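{- Let $q=p^h$ with $p$ prime, and let $f(X,Y)=\sum_{i,j}a_{i,j}X^iY^j\in\mathbb{F}_q[X,Y]$ with $f(0,0)=0$, of degree $d$, and with $a_{0,1}=0$ if $p>2$. Suppose $q>6.3\,(d+1)^{13/3}$. If $$\mathcal{O}_4(f)=\{(1,x,y,f(x,y),-y^2-xf(x,y)) : x,y\in\mathbb{F}_q\}\cup\{(0,0,0,0,1)\}$$ is an ovoid of the parabolic quadric $\mathcal{Q}: X_0X_4+X_1X_3+X_2^2=0$ of $\mathrm{PG}(4,q)$, then one of the following holds: (1) $p=2$ and $f(X,Y)=a_{1,0}X+a_{0,1}Y$; hence $\mathcal{O}_4(f)$ is an elliptic quadric; (2) $p>2$ and $f(X,Y)=a_{p^j,0}X^{p^j}$ for some $j\ge 0$; hence $\mathcal{O}_4(f)$ is either an elliptic quadric or a Kantor ovoid.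
   Context: An ovoid of $\mathcal{Q}$ is a set of points of $\mathcal{Q}$ meeting every line contained in $\mathcal{Q}$ in exactly one point; equivalently, a set of $q^2+1$ points of $\mathcal{Q}$, no two on a common line of $\mathcal{Q}$. For $\mathcal{O}_4(f)$ this is equivalent to $(y_1-y_2)^2+(x_1-x_2)(f(x_1,y_1)-f(x_2,y_2))\neq 0$ for all $(x_1,y_1)\neq(x_2,y_2)$ in $\mathbb{F}_q^2$. An elliptic quadric is an ovoid obtained as the intersection of $\mathcal{Q}$ with a hyperplane of $\mathrm{PG}(4,q)$ meeting $\mathcal{Q}$ in an elliptic quadric $Q^-(3,q)$ (e.g. $\mathcal{O}_4(-nX)$ with $n$ a non-square, $q$ odd, or $\mathcal{O}_4(aX+Y)$ with $\mathrm{tr}(a)=1$, $q$ even). A Kantor ovoid ($q$ odd, $h>1$) is $\mathcal{O}_4(-nX^\sigma)$ with $n$ a non-square in $\mathbb{F}_q$ and $\sigma\neq 1$ a field automorphism of $\mathbb{F}_q$. -}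

module Defs where

open import Level using (0ℓ)
open import Data.Nat as ℕ using (ℕ; zero; suc; _∸_)
open import Data.Fin using (Fin)
open import Data.Product using (Σ; ∃; _×_; _,_)
open import Data.Maybe using (Maybe; just; nothing)
open import Data.Vec using (Vec; []; _∷_; map; zipWith; replicate)
open import Relation.Nullary using (¬_)
open import Relation.Binary.PropositionalEquality using (_≡_)
open import Function.Bundles using (_↔_)
open import Algebra.Bundles using (CommutativeRing)

record FiniteField : Set₁ where
  field
    commRing : CommutativeRing 0ℓ 0ℓ
  open CommutativeRing commRing public
  field
    ≈⇒≡     : ∀ {x y} → x ≈ y → x ≡ y
    0≢1     : ¬ (0# ≡ 1#)
    inverse : ∀ x → ¬ (x ≡ 0#) → ∃ λ y → x * y ≡ 1#
    size    : ℕ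
    enum    : Carrier ↔ Fin size

module _ (F : FiniteField) where
  open FiniteField F

  pow : Carrier → ℕ → Carrier
  pow x zero    = 1#
  pow x (suc n) = x * pow x n

  sumTo : ℕ → (ℕ → Carrier) → Carrier
  sumTo zero    g = g 0
  sumTo (suc n) g = sumTo n g + g (suc n)

  -- A bivariate polynomial is given by its coefficient function
  -- (i , j) ↦ a_{i,j}.  `HasDegree d a` : a has total degree exactly d,
  -- i.e. a_{i,j} = 0 for i + j > d and some a_{i,j} with i + j = d is nonzero.
  HasDegree : ℕ → (ℕ → ℕ → Carrier) → Set
  HasDegree d a =
    (∀ i j → d ℕ.< i ℕ.+ j → a i j ≡ 0#) ×
    (Σ ℕ λ i → Σ ℕ λ j → (i ℕ.+ j ≡ d) × ¬ (a i j ≡ 0#))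

  eval : ℕ → (ℕ → ℕ → Carrier) → Carrier → Carrier → Carrier
  eval d a x y = sumTo d λ i → sumTo (d ∸ i) λ j → a i j * (pow x i * pow y j)

  -- vectors of F^5 (homogeneous coordinates of PG(4,q))
  V5 : Set
  V5 = Vec Carrier 5

  zeroV : V5
  zeroV = replicate 5 0#

  _·_ : Carrier → V5 → V5
  c · v = map (c *_) v

  _⊕_ : V5 → V5 → V5
  u ⊕ v = zipWith _+_ u v

  Qform : V5 → Carrier
  Qform (x0 ∷ x1 ∷ x2 ∷ x3 ∷ x4 ∷ []) = x0 * x4 + x1 * x3 + x2 * x2

  SamePoint : V5 → V5 → Set
  SamePoint u v = ∃ λ c → ¬ (c ≡ 0#) × (v ≡ c · u)

  LineInQ : V5 → V5 → Set
  LineInQ u v = ∀ λ' μ → Qform ((λ' · u) ⊕ (μ · v)) ≡ 0#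

  record IsOvoid {I : Set} (P : I → V5) : Set where
    field
      nonzero  : ∀ i → ¬ (P i ≡ zeroV)
      onQ      : ∀ i → Qform (P i) ≡ 0#
      distinct : ∀ i j → ¬ (i ≡ j) → ¬ SamePoint (P i) (P j)
      count    : I ↔ Fin (size ℕ.* size ℕ.+ 1)
      noLine   : ∀ i j → ¬ (i ≡ j) → ¬ LineInQ (P i) (P j)

  O4 : ℕ → (ℕ → ℕ → Carrier) → Maybe (Carrier × Carrier) → V5
  O4 d a (just (x , y)) =
    1# ∷ x ∷ y ∷ eval d a x y ∷ (- (y * y) + - (x * eval d a x y)) ∷ []
  O4 d a nothing = 0# ∷ 0# ∷ 0# ∷ 0# ∷ 1# ∷ []

{-# OPTIONS --safe #-}
-- Being an ovoid means (y − y′)² + (x − x′)(f(x, y) − f(x′, y′)) ≠ 0 for distinct points.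
--
-- If f has degree e ≥ 3 in Y, fix x′ = x₀ and y′ = 0.  The plane curve
-- v² + u (f(x₀ + u, v) − f(x₀, 0)) = 0 of degree d + 1 then has no affine rational point other
-- than the origin, although for suitable coordinates it has a rational branch on the line at
-- infinity at which it is unramified.  The irreducible component of that branch contradicts a
-- Hasse–Weil type bound, obtained by Stepanov's method with power series on the branch.
--
-- If f = A(X) + B(X) Y + C(X) Y², the condition is quadratic in y for fixed u = x − x′, which
-- forces C = 0 and B constant.
--
-- In characteristic 2 this leaves A(X) + βY, where (A(x + u) − A(x)) / (β² u) has absolute trace 1
-- for all u ≠ 0; comparing coefficients of this trace shows deg A = 1.
--
-- In odd characteristic this leaves A(X), where −(x − x′)(A(x) − A(x′)) is never a square, so that
-- (A(x) − A(x′))^m = ε (x − x′)^m with m = (q − 1)/2.  Following Carlitz and McConnel, power sums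
-- turn this identity into restrictions on the exponents occurring in the powers of A, which leave
-- only monomials X^(p^k).
module Submission where

open import Level using (0ℓ)
open import Algebra.Bundles using (CommutativeRing; CommutativeMonoid; RawRing)
import Algebra.Properties.CommutativeMonoid.Sum as MonoidSum
import Algebra.Properties.CommutativeSemiring.Exp as CommutativeSemiringExp
import Algebra.Properties.Ring as RingProperties
import Algebra.Properties.Semiring.Exp as SemiringExp
import Algebra.Solver.Ring as RingSolver
import Algebra.Solver.Ring.AlmostCommutativeRing as ACR
open import Data.Empty using (⊥; ⊥-elim)
open import Data.Fin as Fin using (Fin)
open import Data.Fin.Permutation using (Permutation; permutation; _⟨$⟩ʳ_)
import Data.Fin.Properties as Finₚ
open import Data.List using (List; []; _∷_; tabulate; length)
open import Data.List.Membership.Propositional using (_∈_)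
open import Data.List.Properties using (length-tabulate)
open import Data.List.Relation.Unary.All as All using (All; []; _∷_)
open import Data.List.Relation.Unary.AllPairs using ([]; _∷_)
open import Data.List.Relation.Unary.Any using (here; there)
open import Data.List.Relation.Unary.Unique.Propositional using (Unique)
open import Data.List.Relation.Unary.Unique.Propositional.Properties using (tabulate⁺)
open import Data.Maybe using (Maybe; just; nothing)
open import Data.Maybe.Properties using (just-injective)
open import Data.Nat as ℕ using (ℕ; zero; suc; _∸_; _⊔_; z≤n; s≤s)
open import Data.Nat.Combinatorics using (nCk+nC[k+1]≡[n+1]C[k+1]; nCn≡1; k>n⇒nCk≡0) renaming (_C_ to _choose_)
open import Data.Nat.Divisibility as ∣ using (_∣_; _∤_; divides)
import Data.Nat.DivMod as DivMod
open import Data.Nat.Primality using (Prime; euclidsLemma; prime⇒irreducible; prime⇒nonTrivial)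
import Data.Nat.Properties as ℕₚ
open import Data.Nat.Solver using (module +-*-Solver)
open import Data.Product using (Σ; _×_; _,_; proj₁; proj₂)
open import Data.Product.Properties using (,-injective)
open import Data.Sum using (_⊎_; inj₁; inj₂)
open import Defs
open import Function using (_∘_; id; _$_)
open import Function.Bundles using (Inverse)
open import Relation.Binary.PropositionalEquality as ≡ using (_≡_; _≢_)
import Relation.Binary.Reasoning.Setoid as SetoidReasoning
open import Relation.Nullary using (¬_; Dec; yes; no)
open import Relation.Nullary.Decidable using (decidable-stable; map′; toWitness)

-- Bounds of Hasse-Weil type are usually proved for absolutely irreducible curves. Here the rational
-- branch takes over that role: it embeds the coordinate ring `k[X, y]` in `k[[X]]`, so that
-- functions become power series whose coefficients are fixed by the `q`-th power map, and every
-- argument stays over `k`. The geometric input shrinks to one fact: a function of small degree that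
-- vanishes to order `q` on the branch is zero. The root has to be simple because the last step
-- cancels a power of the derivative of the equation along the branch. Equality of series is not
-- decidable, so minimal relations and nonzero coefficients are obtained only under double negation;
-- this is enough, the goals being `⊥` or stable equations. The method costs about `4 N^4` for a
-- curve of degree `N = d + 1`. The size hypothesis enters as `q > 10 N^4` when `N ≥ 4`, the
-- situation of `Y`-degree at least 3, and as `q > 7 N^4` in the remaining steps, where `N ≥ 2`.

Ring₀ : Set₁
Ring₀ = CommutativeRing 0ℓ 0ℓ

-- Commutative rings: integer coefficients for the solver, finite sums.

cancel : ℕ → ℕ → ℕ × ℕ
cancel (suc a) (suc b) = cancel a b
cancel a b = a , b

-- Formal differences of naturals, as coefficients for the ring solver; they are kept
-- reduced because the solver compares constant terms syntactically.
differences : RawRing 0ℓ 0ℓ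
differences = record
  { Carrier = ℕ × ℕ
  ; _≈_ = _≡_
  ; _+_ = λ (a , b) (c , d) → cancel (a ℕ.+ c) (b ℕ.+ d)
  ; _*_ = λ (a , b) (c , d) → cancel (a ℕ.* c ℕ.+ b ℕ.* d) (a ℕ.* d ℕ.+ b ℕ.* c)
  ; -_ = λ (a , b) → b , a
  ; 0# = 0 , 0
  ; 1# = 1 , 0
  }

module RingLemmas (R : Ring₀) where
  open CommutativeRing R public using
    ( Carrier; _≈_; _+_; _*_; -_; 0#; 1#; refl; sym; trans; reflexive; setoid; ring; semiring; commutativeSemiring
    ; +-commutativeMonoid; *-commutativeMonoid
    ; +-cong; +-congˡ; +-congʳ; +-assoc; +-comm; +-identityˡ; +-identityʳ; -‿cong; -‿inverseˡ; -‿inverseʳ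
    ; *-cong; *-congˡ; *-congʳ; *-assoc; *-comm; *-identityˡ; *-identityʳ; distribˡ; distribʳ; zeroˡ; zeroʳ)
  open RingProperties ring public using
    ( -‿distribˡ-*; -‿distribʳ-*; -0#≈0#; -‿involutive; -‿anti-homo-+)
  open SemiringExp semiring public using (_^_; ^-congˡ; ^-homo-*; ^-assocʳ)
  open CommutativeSemiringExp commutativeSemiring public using (^-distrib-*)
  open SetoidReasoning setoid public using (begin_; step-≈-⟩; step-≈-⟨; step-≡-⟩; step-≡-⟨; _∎)

  -- The separate case for one makes `ι 1` compute to `1#`, so that the constant `con (1 , 0)` of
  -- the solver matches terms that mention `1#`.
  ι : ℕ → Carrier
  ι zero = 0#
  ι (suc zero) = 1#
  ι (suc (suc n)) = 1# + ι (suc n)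

  ι-suc : ∀ n → ι (suc n) ≈ 1# + ι n
  ι-suc zero = sym (+-identityʳ 1#)
  ι-suc (suc n) = refl

  ι-+ : ∀ m n → ι (m ℕ.+ n) ≈ ι m + ι n
  ι-+ zero n = sym (+-identityˡ _)
  ι-+ (suc m) n = begin
    ι (suc (m ℕ.+ n)) ≈⟨ ι-suc (m ℕ.+ n) ⟩
    1# + ι (m ℕ.+ n) ≈⟨ +-congˡ (ι-+ m n) ⟩
    1# + (ι m + ι n) ≈⟨ +-assoc _ _ _ ⟨
    1# + ι m + ι n ≈⟨ +-congʳ (ι-suc m) ⟨
    ι (suc m) + ι n ∎

  ι-* : ∀ m n → ι (m ℕ.* n) ≈ ι m * ι n
  ι-* zero n = sym (zeroˡ _)
  ι-* (suc m) n = begin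
    ι (n ℕ.+ m ℕ.* n) ≈⟨ ι-+ n (m ℕ.* n) ⟩
    ι n + ι (m ℕ.* n) ≈⟨ +-cong (sym (*-identityˡ _)) (ι-* m n) ⟩
    1# * ι n + ι m * ι n ≈⟨ distribʳ _ _ _ ⟨
    (1# + ι m) * ι n ≈⟨ *-congʳ (ι-suc m) ⟨
    ι (suc m) * ι n ∎

  private
    -- Splitting off a zero subtrahend keeps the constants 0 and 1 free of a spurious `- 0#`.
    ⟦_⟧ : ℕ × ℕ → Carrier
    ⟦ a , zero ⟧ = ι a
    ⟦ a , suc b ⟧ = ι a + - ι (suc b)

    expand : ∀ a b → ⟦ a , b ⟧ ≈ ι a + - ι b
    expand a zero = sym (trans (+-congˡ -0#≈0#) (+-identityʳ _))
    expand a (suc b) = refl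

    interchange : ∀ a b c d → (a + b) + (c + d) ≈ (a + c) + (b + d)
    interchange a b c d = begin
      (a + b) + (c + d) ≈⟨ +-assoc _ _ _ ⟩
      a + (b + (c + d)) ≈⟨ +-congˡ (+-assoc _ _ _) ⟨
      a + ((b + c) + d) ≈⟨ +-congˡ (+-congʳ (+-comm _ _)) ⟩
      a + ((c + b) + d) ≈⟨ +-congˡ (+-assoc _ _ _) ⟩
      a + (c + (b + d)) ≈⟨ +-assoc _ _ _ ⟨
      (a + c) + (b + d) ∎

    neg+ : ∀ a b → - (a + b) ≈ - a + - b
    neg+ a b = trans (-‿anti-homo-+ a b) (+-comm _ _)

    cancel-sound : ∀ a b → ⟦ cancel a b ⟧ ≈ ι a + - ι b
    cancel-sound zero zero = expand 0 0
    cancel-sound zero (suc b) = refl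
    cancel-sound (suc a) zero = expand (suc a) 0
    cancel-sound (suc a) (suc b) = begin
      ⟦ cancel a b ⟧ ≈⟨ cancel-sound a b ⟩
      ι a + - ι b ≈⟨ +-identityˡ _ ⟨
      0# + (ι a + - ι b) ≈⟨ +-congʳ (-‿inverseʳ 1#) ⟨
      (1# + - 1#) + (ι a + - ι b) ≈⟨ interchange _ _ _ _ ⟩
      (1# + ι a) + (- 1# + - ι b) ≈⟨ +-cong (ι-suc a) (trans (-‿cong (ι-suc b)) (neg+ _ _)) ⟨
      ι (suc a) + - ι (suc b) ∎

    add-hom : ∀ p r → ⟦ RawRing._+_ differences p r ⟧ ≈ ⟦ p ⟧ + ⟦ r ⟧
    add-hom (a , b) (c , d) = begin
      ⟦ cancel (a ℕ.+ c) (b ℕ.+ d) ⟧ ≈⟨ cancel-sound (a ℕ.+ c) (b ℕ.+ d) ⟩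
      ι (a ℕ.+ c) + - ι (b ℕ.+ d) ≈⟨ +-cong (ι-+ a c) (-‿cong (ι-+ b d)) ⟩
      (ι a + ι c) + - (ι b + ι d) ≈⟨ +-congˡ (neg+ _ _) ⟩
      (ι a + ι c) + (- ι b + - ι d) ≈⟨ interchange _ _ _ _ ⟩
      (ι a + - ι b) + (ι c + - ι d) ≈⟨ +-cong (expand a b) (expand c d) ⟨
      ⟦ a , b ⟧ + ⟦ c , d ⟧ ∎

    neg-hom : ∀ p → ⟦ RawRing.-_ differences p ⟧ ≈ - ⟦ p ⟧
    neg-hom (a , b) = begin
      ⟦ b , a ⟧ ≈⟨ expand b a ⟩
      ι b + - ι a ≈⟨ +-congʳ (-‿involutive _) ⟨
      - (- ι b) + - ι a ≈⟨ -‿anti-homo-+ _ _ ⟨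
      - (ι a + - ι b) ≈⟨ -‿cong (expand a b) ⟨
      - ⟦ a , b ⟧ ∎

    mul-hom : ∀ p r → ⟦ RawRing._*_ differences p r ⟧ ≈ ⟦ p ⟧ * ⟦ r ⟧
    mul-hom (a , b) (c , d) = begin
      ⟦ cancel (a ℕ.* c ℕ.+ b ℕ.* d) (a ℕ.* d ℕ.+ b ℕ.* c) ⟧ ≈⟨ cancel-sound (a ℕ.* c ℕ.+ b ℕ.* d) (a ℕ.* d ℕ.+ b ℕ.* c) ⟩
      ι (a ℕ.* c ℕ.+ b ℕ.* d) + - ι (a ℕ.* d ℕ.+ b ℕ.* c)
        ≈⟨ +-cong (trans (ι-+ (a ℕ.* c) _) (+-cong (ι-* a c) (ι-* b d)))
                  (-‿cong (trans (ι-+ (a ℕ.* d) _) (+-cong (ι-* a d) (ι-* b c)))) ⟩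
      (ι a * ι c + ι b * ι d) + - (ι a * ι d + ι b * ι c)
        ≈⟨ +-cong (+-congˡ double) (neg+ _ _) ⟩
      (ι a * ι c + - ι b * - ι d) + (- (ι a * ι d) + - (ι b * ι c))
        ≈⟨ +-congˡ (+-cong (-‿distribʳ-* _ _) (-‿distribˡ-* _ _)) ⟩
      (ι a * ι c + - ι b * - ι d) + (ι a * - ι d + - ι b * ι c)
        ≈⟨ trans (interchange _ _ _ _) (+-congˡ (+-comm _ _)) ⟩
      (ι a * ι c + ι a * - ι d) + (- ι b * ι c + - ι b * - ι d)
        ≈⟨ +-cong (distribˡ _ _ _) (distribˡ _ _ _) ⟨
      ι a * (ι c + - ι d) + - ι b * (ι c + - ι d) ≈⟨ distribʳ _ _ _ ⟨
      (ι a + - ι b) * (ι c + - ι d) ≈⟨ *-cong (expand a b) (expand c d) ⟨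
      ⟦ a , b ⟧ * ⟦ c , d ⟧ ∎
      where
      double : ι b * ι d ≈ - ι b * - ι d
      double = begin
        ι b * ι d ≈⟨ -‿involutive _ ⟨
        - (- (ι b * ι d)) ≈⟨ -‿cong (-‿distribˡ-* _ _) ⟩
        - (- ι b * ι d) ≈⟨ -‿distribʳ-* _ _ ⟩
        - ι b * - ι d ∎

    almost : ACR.AlmostCommutativeRing 0ℓ 0ℓ
    almost = ACR.fromCommutativeRing R

    morphism : differences ACR.-Raw-AlmostCommutative⟶ almost
    morphism = record
      { ⟦_⟧ = ⟦_⟧ ; +-homo = add-hom ; *-homo = mul-hom ; -‿homo = neg-hom
      ; 0-homo = refl ; 1-homo = refl }

    decide : ∀ p r → Maybe (⟦ p ⟧ ≈ ⟦ r ⟧)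
    decide (a , b) (c , d) with a ℕ.+ d ℕ.≟ c ℕ.+ b
    ... | no _ = nothing
    ... | yes e = just $ begin
      ⟦ a , b ⟧ ≈⟨ expand a b ⟩
      ι a + - ι b ≈⟨ +-identityʳ _ ⟨
      (ι a + - ι b) + 0# ≈⟨ +-congˡ (-‿inverseʳ (ι d)) ⟨
      (ι a + - ι b) + (ι d + - ι d) ≈⟨ interchange _ _ _ _ ⟩
      (ι a + ι d) + (- ι b + - ι d) ≈⟨ +-congʳ (trans (sym (ι-+ a d)) (trans (reflexive (≡.cong ι e)) (ι-+ c b))) ⟩
      (ι c + ι b) + (- ι b + - ι d) ≈⟨ +-congˡ (+-comm _ _) ⟩
      (ι c + ι b) + (- ι d + - ι b) ≈⟨ interchange _ _ _ _ ⟩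
      (ι c + - ι d) + (ι b + - ι b) ≈⟨ +-congˡ (-‿inverseʳ (ι b)) ⟩
      (ι c + - ι d) + 0# ≈⟨ +-identityʳ _ ⟩
      ι c + - ι d ≈⟨ expand c d ⟨
      ⟦ c , d ⟧ ∎

  open RingSolver differences almost morphism decide public using (solve; _:=_; _:+_; _:*_; _:-_; :-_; con)

  zero-sum : ∀ {x y} → x ≈ 0# → y ≈ 0# → x + y ≈ 0#
  zero-sum p q = trans (+-cong p q) (+-identityˡ _)

  zero-mulˡ : ∀ {x y} → x ≈ 0# → x * y ≈ 0#
  zero-mulˡ p = trans (*-congʳ p) (zeroˡ _)

  zero-mulʳ : ∀ {x y} → y ≈ 0# → x * y ≈ 0#
  zero-mulʳ p = trans (*-congˡ p) (zeroʳ _)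

  1^ : ∀ n → 1# ^ n ≈ 1#
  1^ zero = refl
  1^ (suc n) = trans (*-identityˡ _) (1^ n)

  0^ : ∀ n → 1 ℕ.≤ n → 0# ^ n ≈ 0#
  0^ (suc n) _ = zeroˡ _

  ∑ : ℕ → (ℕ → Carrier) → Carrier
  ∑ zero f = 0#
  ∑ (suc n) f = f 0 + ∑ n (f ∘ suc)

  ∑-cong : ∀ n {f g : ℕ → Carrier} → (∀ i → i ℕ.< n → f i ≈ g i) → ∑ n f ≈ ∑ n g
  ∑-cong zero h = refl
  ∑-cong (suc n) h = +-cong (h 0 (s≤s z≤n)) (∑-cong n (λ i l → h (suc i) (s≤s l)))

  ∑-zero : ∀ n {f : ℕ → Carrier} → (∀ i → i ℕ.< n → f i ≈ 0#) → ∑ n f ≈ 0#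
  ∑-zero zero h = refl
  ∑-zero (suc n) h = zero-sum (h 0 (s≤s z≤n)) (∑-zero n (λ i l → h (suc i) (s≤s l)))

  ∑-+ : ∀ n (f g : ℕ → Carrier) → ∑ n (λ i → f i + g i) ≈ ∑ n f + ∑ n g
  ∑-+ zero f g = sym (+-identityˡ _)
  ∑-+ (suc n) f g = trans (+-congˡ (∑-+ n (f ∘ suc) (g ∘ suc))) (interchange _ _ _ _)

  ∑-*ˡ : ∀ n c (f : ℕ → Carrier) → ∑ n (λ i → c * f i) ≈ c * ∑ n f
  ∑-*ˡ zero c f = sym (zeroʳ _)
  ∑-*ˡ (suc n) c f = trans (+-congˡ (∑-*ˡ n c (f ∘ suc))) (sym (distribˡ _ _ _))

  ∑-*ʳ : ∀ n c (f : ℕ → Carrier) → ∑ n (λ i → f i * c) ≈ ∑ n f * c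
  ∑-*ʳ zero c f = sym (zeroˡ _)
  ∑-*ʳ (suc n) c f = trans (+-congˡ (∑-*ʳ n c (f ∘ suc))) (sym (distribʳ _ _ _))

  ∑-neg : ∀ n (f : ℕ → Carrier) → ∑ n (λ i → - f i) ≈ - ∑ n f
  ∑-neg zero f = sym -0#≈0#
  ∑-neg (suc n) f = trans (+-congˡ (∑-neg n (f ∘ suc))) (sym (neg+ _ _))

  ∑-last : ∀ n (f : ℕ → Carrier) → ∑ (suc n) f ≈ ∑ n f + f n
  ∑-last zero f = +-comm _ _
  ∑-last (suc n) f = trans (+-congˡ (∑-last n (f ∘ suc))) (sym (+-assoc _ _ _))

  ∑-split : ∀ m n (f : ℕ → Carrier) → ∑ (m ℕ.+ n) f ≈ ∑ m f + ∑ n (λ i → f (m ℕ.+ i))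
  ∑-split zero n f = sym (+-identityˡ _)
  ∑-split (suc m) n f = trans (+-congˡ (∑-split m n (f ∘ suc))) (sym (+-assoc _ _ _))

  ∑-single : ∀ n k {f : ℕ → Carrier} → k ℕ.< n → (∀ i → i ℕ.< n → i ≢ k → f i ≈ 0#) → ∑ n f ≈ f k
  ∑-single (suc n) zero _ h =
    trans (+-congˡ (∑-zero n (λ i l → h (suc i) (s≤s l) (λ ())))) (+-identityʳ _)
  ∑-single (suc n) (suc k) (s≤s l) h =
    trans (+-cong (h 0 (s≤s z≤n) (λ ()))
                  (∑-single n k l (λ i m ne → h (suc i) (s≤s m) (ne ∘ ℕₚ.suc-injective))))
          (+-identityˡ _)

  ∑-swap : ∀ m n (f : ℕ → ℕ → Carrier) → ∑ m (λ i → ∑ n (f i)) ≈ ∑ n (λ j → ∑ m (λ i → f i j))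
  ∑-swap zero n f = sym (∑-zero n (λ _ _ → refl))
  ∑-swap (suc m) n f =
    trans (+-congˡ (∑-swap m n (f ∘ suc))) (sym (∑-+ n (f 0) (λ j → ∑ m (λ i → f (suc i) j))))

-- Power series and polynomials in one variable.

-- Formal power series; a polynomial is a series with bounded support.
module Series (R : Ring₀) where
  open RingLemmas R

  PS : Set
  PS = ℕ → Carrier

  -- Cauchy product, peeling the constant term of the left factor; ring laws become inductions on
  -- the index in which that factor is shifted.
  conv : PS → PS → PS
  conv f g zero = f 0 * g 0
  conv f g (suc n) = f 0 * g (suc n) + conv (f ∘ suc) g n

  conv-cong : ∀ {f f' g g'} → (∀ i → f i ≈ f' i) → (∀ i → g i ≈ g' i) → ∀ n → conv f g n ≈ conv f' g' n
  conv-cong p r zero = *-cong (p 0) (r 0)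
  conv-cong p r (suc n) = +-cong (*-cong (p 0) (r (suc n))) (conv-cong (p ∘ suc) r n)

  conv-distribʳ : ∀ f g h n → conv (λ i → f i + g i) h n ≈ conv f h n + conv g h n
  conv-distribʳ f g h zero = distribʳ _ _ _
  conv-distribʳ f g h (suc n) = begin
    (f 0 + g 0) * h (suc n) + conv (λ i → f (suc i) + g (suc i)) h n
      ≈⟨ +-congˡ (conv-distribʳ (f ∘ suc) (g ∘ suc) h n) ⟩
    (f 0 + g 0) * h (suc n) + (conv (f ∘ suc) h n + conv (g ∘ suc) h n)
      ≈⟨ solve 5 (λ a b c d e → (a :+ b) :* c :+ (d :+ e) := (a :* c :+ d) :+ (b :* c :+ e)) refl _ _ _ _ _ ⟩
    conv f h (suc n) + conv g h (suc n) ∎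

  conv-scale : ∀ c g h n → conv (λ i → c * g i) h n ≈ c * conv g h n
  conv-scale c g h zero = *-assoc _ _ _
  conv-scale c g h (suc n) = begin
    c * g 0 * h (suc n) + conv (λ i → c * g (suc i)) h n ≈⟨ +-cong (*-assoc _ _ _) (conv-scale c (g ∘ suc) h n) ⟩
    c * (g 0 * h (suc n)) + c * conv (g ∘ suc) h n ≈⟨ distribˡ _ _ _ ⟨
    c * conv g h (suc n) ∎

  conv-sucʳ : ∀ f g n → conv f g (suc n) ≈ conv f (g ∘ suc) n + f (suc n) * g 0
  conv-sucʳ f g zero = refl
  conv-sucʳ f g (suc n) = trans (+-congˡ (conv-sucʳ (f ∘ suc) g n)) (sym (+-assoc _ _ _))

  conv-comm : ∀ f g n → conv f g n ≈ conv g f n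
  conv-comm f g zero = *-comm _ _
  conv-comm f g (suc n) = begin
    f 0 * g (suc n) + conv (f ∘ suc) g n ≈⟨ +-comm _ _ ⟩
    conv (f ∘ suc) g n + f 0 * g (suc n) ≈⟨ +-cong (conv-comm (f ∘ suc) g n) (*-comm _ _) ⟩
    conv g (f ∘ suc) n + g (suc n) * f 0 ≈⟨ conv-sucʳ g f n ⟨
    conv g f (suc n) ∎

  conv-assoc : ∀ f g h n → conv (conv f g) h n ≈ conv f (conv g h) n
  conv-assoc f g h zero = *-assoc _ _ _
  conv-assoc f g h (suc n) = begin
    f 0 * g 0 * h (suc n) + conv (λ i → f 0 * g (suc i) + conv (f ∘ suc) g i) h n
      ≈⟨ +-congˡ (conv-distribʳ (λ i → f 0 * g (suc i)) (conv (f ∘ suc) g) h n) ⟩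
    f 0 * g 0 * h (suc n) + (conv (λ i → f 0 * g (suc i)) h n + conv (conv (f ∘ suc) g) h n)
      ≈⟨ +-congˡ (+-cong (conv-scale (f 0) (g ∘ suc) h n) (conv-assoc (f ∘ suc) g h n)) ⟩
    f 0 * g 0 * h (suc n) + (f 0 * conv (g ∘ suc) h n + conv (f ∘ suc) (conv g h) n)
      ≈⟨ solve 5 (λ a b c d e → a :* b :* c :+ (a :* d :+ e) := a :* (b :* c :+ d) :+ e) refl _ _ _ _ _ ⟩
    conv f (conv g h) (suc n) ∎

  conv-zeroˡ : ∀ {f} → (∀ i → f i ≈ 0#) → ∀ g n → conv f g n ≈ 0#
  conv-zeroˡ z g zero = zero-mulˡ (z 0)
  conv-zeroˡ z g (suc n) = zero-sum (zero-mulˡ (z 0)) (conv-zeroˡ (z ∘ suc) g n)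

  C : Carrier → PS
  C c zero = c
  C c (suc _) = 0#

  X : PS
  X zero = 0#
  X (suc n) = C 1# n

  C-conv : ∀ c g n → conv (C c) g n ≈ c * g n
  C-conv c g zero = refl
  C-conv c g (suc n) = trans (+-congˡ (conv-zeroˡ (λ _ → refl) g n)) (+-identityʳ _)

  X-conv : ∀ g n → conv X g (suc n) ≈ g n
  X-conv g n = trans (+-cong (zeroˡ _) (C-conv 1# g n)) (trans (+-identityˡ _) (*-identityˡ _))

  infix 4 _≋_
  -- A record rather than a plain function type, so that the two series can be inferred from an
  -- equation.
  record _≋_ (f g : PS) : Set where
    constructor pt
    field at : ∀ n → f n ≈ g n
  open _≋_ public

  series : Ring₀
  series = record
    { Carrier = PS
    ; _≈_ = _≋_
    ; _+_ = λ f g n → f n + g n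
    ; _*_ = conv
    ; -_ = λ f n → - f n
    ; 0# = λ _ → 0#
    ; 1# = C 1#
    ; isCommutativeRing = record
      { isRing = record
        { +-isAbelianGroup = record
          { isGroup = record
            { isMonoid = record
              { isSemigroup = record
                { isMagma = record
                  { isEquivalence = record
                    { refl = pt λ _ → refl ; sym = λ p → pt λ n → sym (at p n) ; trans = λ p r → pt λ n → trans (at p n) (at r n) }
                  ; ∙-cong = λ p r → pt λ n → +-cong (at p n) (at r n) }
                ; assoc = λ f g h → pt λ n → +-assoc _ _ _ }
              ; identity = (λ f → pt λ n → +-identityˡ _) , (λ f → pt λ n → +-identityʳ _) }
            ; inverse = (λ f → pt λ n → -‿inverseˡ _) , (λ f → pt λ n → -‿inverseʳ _)
            ; ⁻¹-cong = λ p → pt λ n → -‿cong (at p n) }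
          ; comm = λ f g → pt λ n → +-comm _ _ }
        ; *-cong = λ p r → pt (conv-cong (at p) (at r))
        ; *-assoc = λ f g h → pt (conv-assoc f g h)
        ; *-identity = (λ f → pt λ n → trans (C-conv 1# f n) (*-identityˡ _))
                     , (λ f → pt λ n → trans (conv-comm f _ n) (trans (C-conv 1# f n) (*-identityˡ _)))
        ; distrib = (λ f g h → pt λ n → trans (conv-comm f _ n)
                       (trans (conv-distribʳ g h f n) (+-cong (conv-comm g f n) (conv-comm h f n))))
                  , (λ f g h → pt (conv-distribʳ g h f)) }
      ; *-comm = λ f g → pt (conv-comm f g) } }

  private module S = RingLemmas series

  C-cong : ∀ {a b} → a ≈ b → C a S.≈ C b
  C-cong {a} {b} p = pt go
    where
    go : ∀ n → C a n ≈ C b n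
    go zero = p
    go (suc n) = refl

  C-* : ∀ a b → C (a * b) S.≈ (C a S.* C b)
  C-* a b = pt go
    where
    go : ∀ n → C (a * b) n ≈ conv (C a) (C b) n
    go zero = refl
    go (suc n) = sym (trans (C-conv a (C b) (suc n)) (zeroʳ _))

  C-+ : ∀ a b → C (a + b) S.≈ (C a S.+ C b)
  C-+ a b = pt λ { zero → refl ; (suc n) → sym (+-identityˡ _) }

  C-0 : C 0# S.≈ S.0#
  C-0 = pt λ { zero → refl ; (suc n) → refl }

  C-neg : ∀ a → C (- a) S.≈ (S.- C a)
  C-neg a = pt λ { zero → refl ; (suc n) → sym -0#≈0# }

  C-^ : ∀ a n → C (a ^ n) S.≈ (C a S.^ n)
  C-^ a zero = S.refl
  C-^ a (suc n) = S.trans (C-* a (a ^ n)) (S.*-congˡ (C-^ a n))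

  head-tail : ∀ f → f S.≈ (C (f 0) S.+ X S.* (f ∘ suc))
  head-tail f = pt λ where
    zero → sym (trans (+-congˡ (zeroˡ _)) (+-identityʳ _))
    (suc n) → sym (trans (+-identityˡ _) (X-conv (f ∘ suc) n))

  X*-zero : ∀ f → (X S.* f) 0 ≈ 0#
  X*-zero f = zeroˡ _

  X^*-low : ∀ m f i → i ℕ.< m → ((X S.^ m) S.* f) i ≈ 0#
  X^*-low (suc m) f zero _ = zero-mulˡ (X*-zero (X S.^ m))
  X^*-low (suc m) f (suc i) (s≤s l) =
    trans (at (S.*-assoc X (X S.^ m) f) (suc i)) (trans (X-conv _ i) (X^*-low m f i l))

  X^*-high : ∀ m f i → ((X S.^ m) S.* f) (m ℕ.+ i) ≈ f i
  X^*-high zero f i = at (S.*-identityˡ f) i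
  X^*-high (suc m) f i =
    trans (at (S.*-assoc X (X S.^ m) f) (suc (m ℕ.+ i))) (trans (X-conv _ (m ℕ.+ i)) (X^*-high m f i))

  X^-top : ∀ m → (X S.^ m) m ≈ 1#
  X^-top m = trans (sym (at (S.*-identityʳ (X S.^ m)) m))
    (trans (reflexive (≡.cong ((X S.^ m) S.* C 1#) (≡.sym (ℕₚ.+-identityʳ m)))) (X^*-high m (C 1#) 0))

  Ord : ℕ → PS → Set
  Ord m f = ∀ i → i ℕ.< m → f i ≈ 0#

  Ord-factor : ∀ m f → Ord m f → f S.≈ ((X S.^ m) S.* (λ i → f (m ℕ.+ i)))
  Ord-factor m f o = pt go
    where
    go : ∀ i → f i ≈ ((X S.^ m) S.* (λ i → f (m ℕ.+ i))) i
    go i with i ℕ.<? m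
    ... | yes l = trans (o i l) (sym (X^*-low m _ i l))
    ... | no nl = trans (reflexive (≡.cong f (≡.sym e)))
        (trans (sym (X^*-high m (λ i → f (m ℕ.+ i)) (i ∸ m)))
               (reflexive (≡.cong ((X S.^ m) S.* (λ i → f (m ℕ.+ i))) e)))
      where e = ℕₚ.m+[n∸m]≡n (ℕₚ.≮⇒≥ nl)

  Deg : ℕ → PS → Set
  Deg m f = ∀ i → m ℕ.< i → f i ≈ 0#

  Deg-mono : ∀ {m n f} → m ℕ.≤ n → Deg m f → Deg n f
  Deg-mono l d i m = d i (ℕₚ.≤-<-trans l m)

  Deg-cong : ∀ {m f g} → f S.≈ g → Deg m f → Deg m g
  Deg-cong e d i l = trans (sym (at e i)) (d i l)

  Deg-+ : ∀ {m f g} → Deg m f → Deg m g → Deg m (f S.+ g)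
  Deg-+ d e i l = zero-sum (d i l) (e i l)

  Deg-neg : ∀ {m f} → Deg m f → Deg m (S.- f)
  Deg-neg d i l = trans (-‿cong (d i l)) -0#≈0#

  Deg-0 : ∀ {m} → Deg m S.0#
  Deg-0 i l = refl

  Deg-C : ∀ {m} c → Deg m (C c)
  Deg-C c (suc i) l = refl

  Deg-X : Deg 1 X
  Deg-X (suc zero) (s≤s ())
  Deg-X (suc (suc i)) l = refl

  Deg-tail : ∀ {m f} → Deg (suc m) f → Deg m (f ∘ suc)
  Deg-tail d i l = d (suc i) (s≤s l)

  Deg-* : ∀ m n {f g} → Deg m f → Deg n g → Deg (m ℕ.+ n) (f S.* g)
  Deg-* zero n {f} {g} d e (suc i) l =
    zero-sum (zero-mulʳ (e (suc i) l)) (conv-zeroˡ (λ j → d (suc j) (s≤s z≤n)) g i)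
  Deg-* (suc m) n {f} d e (suc i) (s≤s l) =
    zero-sum (zero-mulʳ (e (suc i) (ℕₚ.≤-<-trans (ℕₚ.m≤n+m n m) (ℕₚ.<-trans l (ℕₚ.n<1+n i)))))
             (Deg-* m n (Deg-tail {f = f} d) e i l)

  Deg-^ : ∀ m k {f} → Deg m f → Deg (k ℕ.* m) (f S.^ k)
  Deg-^ m zero d (suc i) l = refl
  Deg-^ m (suc k) d = Deg-* m (k ℕ.* m) d (Deg-^ m k d)

  top-* : ∀ m n {f g} → Deg m f → Deg n g → (f S.* g) (m ℕ.+ n) ≈ f m * g n
  top-* zero zero d e = refl
  top-* zero (suc n) {f} {g} d e = trans (+-congˡ (conv-zeroˡ (λ j → d (suc j) (s≤s z≤n)) g n)) (+-identityʳ _)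
  top-* (suc m) n {f} {g} d e =
    trans (+-cong (zero-mulʳ (e (suc (m ℕ.+ n)) (s≤s (ℕₚ.m≤n+m n m)))) (top-* m n (Deg-tail {f = f} d) e)) (+-identityˡ _)

  top-^ : ∀ m k {f} → Deg m f → (f S.^ k) (k ℕ.* m) ≈ f m ^ k
  top-^ m zero d = refl
  top-^ m (suc k) d = trans (top-* m (k ℕ.* m) d (Deg-^ m k d)) (*-congˡ (top-^ m k d))

  Deg-X^ : ∀ n → Deg n (X S.^ n)
  Deg-X^ n = ≡.subst (λ k → Deg k (X S.^ n)) (ℕₚ.*-identityʳ n) (Deg-^ 1 n Deg-X)

  -- Series carry no degree, so Horner's scheme takes a bound; by `ev-mono` any bound above the
  -- degree gives the same value.
  ev : ℕ → PS → Carrier → Carrier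
  ev zero f a = f 0
  ev (suc m) f a = f 0 + a * ev m (f ∘ suc) a

  ev-cong : ∀ m {f g a b} → f S.≈ g → a ≈ b → ev m f a ≈ ev m g b
  ev-cong zero p r = at p 0
  ev-cong (suc m) p r = +-cong (at p 0) (*-cong r (ev-cong m (pt (at p ∘ suc)) r))

  ev-+ : ∀ m f g a → ev m (f S.+ g) a ≈ ev m f a + ev m g a
  ev-+ zero f g a = refl
  ev-+ (suc m) f g a = trans (+-congˡ (*-congˡ (ev-+ m (f ∘ suc) (g ∘ suc) a)))
    (solve 5 (λ p r a s t → p :+ r :+ a :* (s :+ t) := p :+ a :* s :+ (r :+ a :* t)) refl _ _ _ _ _)

  ev-scale : ∀ m c f a → ev m (λ i → c * f i) a ≈ c * ev m f a
  ev-scale zero c f a = refl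
  ev-scale (suc m) c f a = trans (+-congˡ (*-congˡ (ev-scale m c (f ∘ suc) a)))
    (solve 4 (λ p c a s → c :* p :+ a :* (c :* s) := c :* (p :+ a :* s)) refl _ _ _ _)

  ev-neg : ∀ m f a → ev m (S.- f) a ≈ - ev m f a
  ev-neg zero f a = refl
  ev-neg (suc m) f a = trans (+-congˡ (*-congˡ (ev-neg m (f ∘ suc) a)))
    (solve 3 (λ p a s → :- p :+ a :* :- s := :- (p :+ a :* s)) refl _ _ _)

  ev-zero : ∀ m {f} a → f S.≈ S.0# → ev m f a ≈ 0#
  ev-zero zero a z = at z 0
  ev-zero (suc m) a z = zero-sum (at z 0) (zero-mulʳ (ev-zero m a (pt (at z ∘ suc))))

  ev-C : ∀ m c a → ev m (C c) a ≈ c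
  ev-C zero c a = refl
  ev-C (suc m) c a = trans (+-congˡ (zero-mulʳ (ev-zero m a S.refl))) (+-identityʳ _)

  ev-X : ∀ m a → ev (suc m) X a ≈ a
  ev-X m a = trans (+-identityˡ _) (trans (*-congˡ (ev-C m 1# a)) (*-identityʳ _))

  ev-mono : ∀ m n {f} a → m ℕ.≤ n → Deg m f → ev m f a ≈ ev n f a
  ev-mono zero zero a l d = refl
  ev-mono zero (suc n) {f} a l d =
    sym (trans (+-congˡ (zero-mulʳ (ev-zero n a (pt λ i → d (suc i) (s≤s z≤n))))) (+-identityʳ _))
  ev-mono (suc m) (suc n) {f} a (s≤s l) d = +-congˡ (*-congˡ (ev-mono m n a l (Deg-tail {f = f} d)))

  ev-* : ∀ m n {f g} a → Deg m f → Deg n g → ev (m ℕ.+ n) (f S.* g) a ≈ ev m f a * ev n g a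
  ev-* zero n {f} {g} a d e = trans (ev-cong n f*g refl) (ev-scale n (f 0) g a)
    where
    f*g : (f S.* g) S.≈ (λ i → f 0 * g i)
    f*g = pt λ where
      zero → refl
      (suc i) → trans (+-congˡ (conv-zeroˡ (λ j → d (suc j) (s≤s z≤n)) g i)) (+-identityʳ _)
  ev-* (suc m) n {f} {g} a d e = begin
    f 0 * g 0 + a * ev (m ℕ.+ n) (λ i → f 0 * g (suc i) + conv (f ∘ suc) g i) a
      ≈⟨ +-congˡ (*-congˡ (ev-+ (m ℕ.+ n) (λ i → f 0 * g (suc i)) (conv (f ∘ suc) g) a)) ⟩
    f 0 * g 0 + a * (ev (m ℕ.+ n) (λ i → f 0 * g (suc i)) a + ev (m ℕ.+ n) ((f ∘ suc) S.* g) a)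
      ≈⟨ +-congˡ (*-congˡ (+-cong (ev-scale (m ℕ.+ n) (f 0) (g ∘ suc) a) (ev-* m n a (Deg-tail {f = f} d) e))) ⟩
    f 0 * g 0 + a * (f 0 * ev (m ℕ.+ n) (g ∘ suc) a + ev m (f ∘ suc) a * ev n g a)
      ≈⟨ solve 6 (λ f g a x y z → f :* g :+ a :* (f :* x :+ y :* z) := f :* (g :+ a :* x) :+ a :* y :* z) refl _ _ _ _ _ _ ⟩
    f 0 * ev (suc (m ℕ.+ n)) g a + a * ev m (f ∘ suc) a * ev n g a
      ≈⟨ +-congʳ (*-congˡ (sym (ev-mono n (suc (m ℕ.+ n)) a (ℕₚ.m≤n⇒m≤1+n (ℕₚ.m≤n+m n m)) e))) ⟩
    f 0 * ev n g a + a * ev m (f ∘ suc) a * ev n g a ≈⟨ distribʳ _ _ _ ⟨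
    ev (suc m) f a * ev n g a ∎

  ev-^ : ∀ m n f a → Deg m f → ev (n ℕ.* m) (f S.^ n) a ≈ ev m f a ^ n
  ev-^ m zero f a d = refl
  ev-^ m (suc n) f a d = trans (ev-* m (n ℕ.* m) a d (Deg-^ m n d)) (*-congˡ (ev-^ m n f a d))

  ev-X^ : ∀ n a → ev n (X S.^ n) a ≈ a ^ n
  ev-X^ n a = trans (≡.subst (λ j → ev j (X S.^ n) a ≈ ev 1 X a ^ n) (ℕₚ.*-identityʳ n) (ev-^ 1 n X a Deg-X))
                    (^-congˡ n (ev-X 0 a))

  ev-∑ : ∀ m f a → ev m f a ≈ ∑ (suc m) (λ i → f i * a ^ i)
  ev-∑ zero f a = sym (trans (+-identityʳ _) (*-identityʳ _))
  ev-∑ (suc m) f a = +-cong (sym (*-identityʳ _)) (begin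
    a * ev m (f ∘ suc) a ≈⟨ *-congˡ (ev-∑ m (f ∘ suc) a) ⟩
    a * ∑ (suc m) (λ i → f (suc i) * a ^ i) ≈⟨ ∑-*ˡ (suc m) a (λ i → f (suc i) * a ^ i) ⟨
    ∑ (suc m) (λ i → a * (f (suc i) * a ^ i))
      ≈⟨ ∑-cong (suc m) (λ i _ → solve 3 (λ a f p → a :* (f :* p) := f :* (a :* p)) refl a (f (suc i)) (a ^ i)) ⟩
    ∑ (suc m) (λ i → f (suc i) * (a * a ^ i)) ∎)

  -- Horner form of the divided difference (f(z) − f(a)) / (z − a)
  dd : ℕ → PS → Carrier → Carrier → Carrier
  dd zero f a z = 0#
  dd (suc m) f a z = ev m (f ∘ suc) a + z * dd m (f ∘ suc) a z

  dd-spec : ∀ m f a z → (z + - a) * dd m f a z ≈ ev m f z + - ev m f a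
  dd-spec zero f a z = trans (zeroʳ _) (sym (-‿inverseʳ _))
  dd-spec (suc m) f a z = begin
    (z + - a) * (e + z * dd m (f ∘ suc) a z)
      ≈⟨ solve 4 (λ z a e d → (z :- a) :* (e :+ z :* d) := (z :- a) :* e :+ z :* ((z :- a) :* d)) refl z a e _ ⟩
    (z + - a) * e + z * ((z + - a) * dd m (f ∘ suc) a z)
      ≈⟨ +-congˡ (*-congˡ (dd-spec m (f ∘ suc) a z)) ⟩
    (z + - a) * e + z * (ev m (f ∘ suc) z + - e)
      ≈⟨ solve 5 (λ z a e d c → (z :- a) :* e :+ z :* (d :- e) := (c :+ z :* d) :- (c :+ a :* e)) refl z a e _ (f 0) ⟩
    ev (suc m) f z + - ev (suc m) f a ∎
    where e = ev m (f ∘ suc) a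

-- Taylor shifts of polynomials.

module Translation (R : Ring₀) where
  open RingLemmas R
  open Series R
  private module S = RingLemmas series

  -- Horner form of `f (x + X)`: entry `l` is the `l`-th Hasse derivative of `f` at `x`.
  translate : Carrier → ℕ → PS → PS
  translate x zero f = C (f 0)
  translate x (suc m) f = C (f 0) S.+ (C x S.+ X) S.* translate x m (f ∘ suc)

  shift-at-0 : ∀ x (T : PS) → ((C x S.+ X) S.* T) 0 ≈ x * T 0
  shift-at-0 x T = *-congʳ (+-identityʳ x)

  shift-at-suc : ∀ x (T : PS) l → ((C x S.+ X) S.* T) (suc l) ≈ x * T (suc l) + T l
  shift-at-suc x T l = trans (at (S.distribʳ T (C x) X) (suc l)) (+-cong (C-conv x T (suc l)) (X-conv T l))

  Deg-shift : ∀ x → Deg 1 (C x S.+ X)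
  Deg-shift x = Deg-+ {f = C x} {X} (Deg-C x) Deg-X

  ev-shift : ∀ x a → ev 1 (C x S.+ X) a ≈ x + a
  ev-shift x a = trans (ev-+ 1 (C x) X a) (+-cong (ev-C 1 x a) (ev-X 0 a))

  Deg-translate : ∀ x m f → Deg m (translate x m f)
  Deg-translate x zero f = Deg-C _
  Deg-translate x (suc m) f = Deg-+ {f = C (f 0)} (Deg-C _) (Deg-* 1 m (Deg-shift x) (Deg-translate x m (f ∘ suc)))

  ev-translate : ∀ x m f a → ev m (translate x m f) a ≈ ev m f (x + a)
  ev-translate x zero f a = refl
  ev-translate x (suc m) f a = begin
    ev (suc m) (translate x (suc m) f) a ≈⟨ ev-+ (suc m) (C (f 0)) ((C x S.+ X) S.* translate x m (f ∘ suc)) a ⟩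
    ev (suc m) (C (f 0)) a + ev (suc m) ((C x S.+ X) S.* translate x m (f ∘ suc)) a
      ≈⟨ +-cong (ev-C (suc m) (f 0) a) (ev-* 1 m a (Deg-shift x) (Deg-translate x m (f ∘ suc))) ⟩
    f 0 + ev 1 (C x S.+ X) a * ev m (translate x m (f ∘ suc)) a
      ≈⟨ +-congˡ (*-cong (ev-shift x a) (ev-translate x m (f ∘ suc) a)) ⟩
    ev (suc m) f (x + a) ∎

  translate-injective : ∀ x m f → (∀ l → translate x m f l ≈ 0#) → ∀ l → l ℕ.≤ m → f l ≈ 0#
  translate-injective x zero f z zero _ = z 0
  translate-injective x (suc m) f z = λ { zero _ → head ; (suc l) (s≤s le) → translate-injective x m (f ∘ suc) S≈0 l le }
    where
    S = translate x m (f ∘ suc)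
    -- The coefficients of `S` vanish from the top down, since entry `suc l` of the product is
    -- `x * S (suc l) + S l`.
    descend : ∀ j l → m ℕ.< j ℕ.+ l → S l ≈ 0#
    descend zero l lt = Deg-translate x m (f ∘ suc) l lt
    descend (suc j) l lt = begin
      S l ≈⟨ solve 3 (λ s x t → s := (x :* t :+ s) :- x :* t) refl (S l) x (S (suc l)) ⟩
      (x * S (suc l) + S l) + - (x * S (suc l))
        ≈⟨ +-cong (trans (sym (shift-at-suc x S l)) (trans (sym (+-identityˡ _)) (z (suc l))))
                  (trans (-‿cong (zero-mulʳ (descend j (suc l) (≡.subst (m ℕ.<_) (≡.sym (ℕₚ.+-suc j l)) lt)))) -0#≈0#) ⟩
      0# + 0# ≈⟨ +-identityˡ 0# ⟩
      0# ∎
    S≈0 : ∀ l → S l ≈ 0#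
    S≈0 l = descend (suc m) l (s≤s (ℕₚ.m≤m+n m l))
    head : f 0 ≈ 0#
    head = trans (sym (trans (+-congˡ (trans (shift-at-0 x S) (zero-mulʳ (S≈0 0)))) (+-identityʳ _))) (z 0)

-- Finite fields: Fermat's theorem, power sums, roots of polynomials.

module FinSum (M : CommutativeMonoid 0ℓ 0ℓ) where
  open CommutativeMonoid M
  open MonoidSum M public using (sum; sum-permute; ∑-distrib-+; sum-cong-≋)

  sum-ε : ∀ {n} (t : Fin n → Carrier) → (∀ j → t j ≈ ε) → sum t ≈ ε
  sum-ε {zero} t z = refl
  sum-ε {suc n} t z = trans (∙-cong (z Fin.zero) (sum-ε (t ∘ Fin.suc) (z ∘ Fin.suc))) (identityˡ ε)

  sum-single : ∀ {n} (t : Fin n → Carrier) i → (∀ j → j ≢ i → t j ≈ ε) → sum t ≈ t i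
  sum-single {suc n} t Fin.zero z =
    trans (∙-congˡ (sum-ε (t ∘ Fin.suc) (λ j → z (Fin.suc j) λ ()))) (identityʳ _)
  sum-single {suc n} t (Fin.suc i) z =
    trans (∙-cong (z Fin.zero λ ())
                  (sum-single (t ∘ Fin.suc) i (λ j ne → z (Fin.suc j) (ne ∘ Finₚ.suc-injective))))
          (identityˡ _)

module Field (F : FiniteField) where
  k : Ring₀
  k = FiniteField.commRing F
  open FiniteField F public using (≈⇒≡; 0≢1; inverse; size; enum)
  open RingLemmas k public
  open Series k public

  el : Fin size → Carrier
  el = Inverse.from enum

  ix : Carrier → Fin size
  ix = Inverse.to enum

  el-ix : ∀ x → el (ix x) ≡ x
  el-ix x = Inverse.strictlyInverseʳ enum x

  ix-el : ∀ i → ix (el i) ≡ i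
  ix-el i = Inverse.strictlyInverseˡ enum i

  el-injective : ∀ {i j} → el i ≡ el j → i ≡ j
  el-injective {i} {j} e = ≡.trans (≡.sym (ix-el i)) (≡.trans (≡.cong ix e) (ix-el j))

  infix 4 _≟_
  _≟_ : ∀ x y → Dec (x ≈ y)
  x ≟ y = map′ (λ e → reflexive (≡.trans (≡.sym (el-ix x)) (≡.trans (≡.cong el e) (el-ix y))))
               (λ e → ≡.cong ix (≈⇒≡ e)) (ix x Finₚ.≟ ix y)

  ≈-stable : ∀ {x y} → ¬ ¬ (x ≈ y) → x ≈ y
  ≈-stable {x} {y} = decidable-stable (x ≟ y)

  1≉0 : ¬ (1# ≈ 0#)
  1≉0 e = 0≢1 (≡.sym (≈⇒≡ e))

  inv : ∀ x → ¬ (x ≈ 0#) → Σ Carrier λ y → x * y ≈ 1#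
  inv x ne = let (y , e) = inverse x (ne ∘ reflexive) in y , reflexive e

  domain : ∀ {x y} → x * y ≈ 0# → ¬ (x ≈ 0#) → y ≈ 0#
  domain {x} {y} e ne = let (z , xz) = inv x ne in begin
    y ≈⟨ *-identityˡ y ⟨
    1# * y ≈⟨ *-congʳ (trans (sym xz) (*-comm x z)) ⟩
    z * x * y ≈⟨ *-assoc _ _ _ ⟩
    z * (x * y) ≈⟨ zero-mulʳ e ⟩
    0# ∎

  *-≉0 : ∀ {x y} → ¬ (x ≈ 0#) → ¬ (y ≈ 0#) → ¬ (x * y ≈ 0#)
  *-≉0 nx ny e = ny (domain e nx)

  ^-≉0 : ∀ {x} n → ¬ (x ≈ 0#) → ¬ (x ^ n ≈ 0#)
  ^-≉0 zero nx = 1≉0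
  ^-≉0 (suc n) nx = *-≉0 nx (^-≉0 n nx)

  ≈-from-sub : ∀ {x y} → x + - y ≈ 0# → x ≈ y
  ≈-from-sub {x} {y} e = begin
    x ≈⟨ solve 2 (λ x y → x := (x :- y) :+ y) refl x y ⟩
    (x + - y) + y ≈⟨ +-congʳ e ⟩
    0# + y ≈⟨ +-identityˡ y ⟩
    y ∎

  private
    module Prod = FinSum *-commutativeMonoid
    module Sum = FinSum +-commutativeMonoid

    shuffle : (f g : Carrier → Carrier) → (∀ x → f (g x) ≈ x) → (∀ x → g (f x) ≈ x) → Permutation size size
    shuffle f g fg gf = permutation (ix ∘ f ∘ el) (ix ∘ g ∘ el)
      (λ i → ≡.trans (≡.cong (ix ∘ f) (el-ix _)) (≡.trans (≡.cong ix (≈⇒≡ (fg (el i)))) (ix-el i)))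
      (λ i → ≡.trans (≡.cong (ix ∘ g) (el-ix _)) (≡.trans (≡.cong ix (≈⇒≡ (gf (el i)))) (ix-el i)))

    if0 : Carrier → Carrier → Carrier → Carrier
    if0 a u v with a ≟ 0#
    ... | yes _ = u
    ... | no _ = v

    if0-yes : ∀ {a} u v → a ≈ 0# → if0 a u v ≈ u
    if0-yes {a} u v e with a ≟ 0#
    ... | yes _ = refl
    ... | no ne = ⊥-elim (ne e)

    if0-no : ∀ {a} u v → ¬ (a ≈ 0#) → if0 a u v ≈ v
    if0-no {a} u v ne with a ≟ 0#
    ... | yes e = ⊥-elim (ne e)
    ... | no _ = refl

    prod-≉0 : ∀ {n} (t : Fin n → Carrier) → (∀ i → ¬ (t i ≈ 0#)) → ¬ (Prod.sum t ≈ 0#)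
    prod-≉0 {zero} t ne = 1≉0
    prod-≉0 {suc n} t ne = *-≉0 (ne Fin.zero) (prod-≉0 (t ∘ Fin.suc) (ne ∘ Fin.suc))

    prod-const : ∀ n x → Prod.sum {n} (λ _ → x) ≈ x ^ n
    prod-const zero x = refl
    prod-const (suc n) x = *-congˡ (prod-const n x)

    sum-one : ∀ n → Sum.sum {n} (λ _ → 1#) ≈ ι n
    sum-one zero = refl
    sum-one (suc n) = trans (+-congˡ (sum-one n)) (sym (ι-suc n))

    index-≢ : ∀ {i} → i ≢ ix 0# → ¬ (el i ≈ 0#)
    index-≢ {i} ne e = ne (≡.trans (≡.sym (ix-el i)) (≡.cong ix (≈⇒≡ e)))

  -- Multiplication by `x ≠ 0` permutes the field; comparing products over all elements, with 0
  -- replaced by 1, gives 1 for the product of `ψ`. The factor `χ` restores the single `x` that `ψ`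
  -- lacks at 0.
  fermat : ∀ x → x ^ size ≈ x
  fermat x with x ≟ 0#
  ... | yes e = trans (^-congˡ size e) (trans (0^ size (ℕₚ.≤-trans (s≤s z≤n) (Finₚ.toℕ<n (ix 0#)))) (sym e))
  ... | no ne = begin
    x ^ size ≈⟨ prod-const size x ⟨
    Prod.sum {size} (λ _ → x) ≈⟨ Prod.sum-cong-≋ (λ i → sym (split (el i))) ⟩
    Prod.sum (λ i → ψ (el i) * χ (el i)) ≈⟨ Prod.∑-distrib-+ (ψ ∘ el) (χ ∘ el) ⟩
    Prod.sum (ψ ∘ el) * Prod.sum (χ ∘ el) ≈⟨ *-cong Πψ Πχ ⟩
    1# * x ≈⟨ *-identityˡ x ⟩
    x ∎
    where
    y = proj₁ (inv x ne)
    xy = proj₂ (inv x ne)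
    φ ψ χ : Carrier → Carrier
    φ a = if0 a 1# a
    ψ a = if0 a 1# x
    χ a = if0 a x 1#

    split : ∀ a → ψ a * χ a ≈ x
    split a with a ≟ 0#
    ... | yes _ = *-identityˡ x
    ... | no _ = *-identityʳ x

    φ≉0 : ∀ a → ¬ (φ a ≈ 0#)
    φ≉0 a with a ≟ 0#
    ... | yes _ = 1≉0
    ... | no na = na

    φ-x : ∀ a → φ (x * a) ≈ ψ a * φ a
    φ-x a with a ≟ 0#
    ... | yes e = trans (if0-yes 1# _ (zero-mulʳ e)) (sym (*-identityˡ 1#))
    ... | no na = if0-no 1# _ (*-≉0 ne na)

    π : Permutation size size
    π = shuffle (x *_) (y *_)
      (λ a → trans (sym (*-assoc _ _ _)) (trans (*-congʳ xy) (*-identityˡ a)))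
      (λ a → trans (sym (*-assoc _ _ _)) (trans (*-congʳ (trans (*-comm y x) xy)) (*-identityˡ a)))

    Π = Prod.sum (φ ∘ el)

    ψΠ : Prod.sum (ψ ∘ el) * Π ≈ Π
    ψΠ = begin
      Prod.sum (ψ ∘ el) * Π ≈⟨ Prod.∑-distrib-+ (ψ ∘ el) (φ ∘ el) ⟨
      Prod.sum (λ i → ψ (el i) * φ (el i)) ≈⟨ Prod.sum-cong-≋ (λ i → trans (sym (φ-x (el i))) (reflexive (≡.cong φ (≡.sym (el-ix _))))) ⟩
      Prod.sum (λ i → φ (el (π ⟨$⟩ʳ i))) ≈⟨ Prod.sum-permute (φ ∘ el) π ⟨
      Π ∎

    Πψ : Prod.sum (ψ ∘ el) ≈ 1#
    Πψ = ≈-from-sub (domain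
      (trans (solve 2 (λ s p → p :* (s :- con (1 , 0)) := s :* p :- p) refl _ Π)
             (trans (+-congʳ ψΠ) (-‿inverseʳ Π)))
      (prod-≉0 (φ ∘ el) (φ≉0 ∘ el)))

    Πχ : Prod.sum (χ ∘ el) ≈ x
    Πχ = trans (Prod.sum-single (χ ∘ el) (ix 0#) (λ j nj → if0-no x 1# (index-≢ nj)))
               (if0-yes x 1# (reflexive (el-ix 0#)))

  total : (Carrier → Carrier) → Carrier
  total f = Sum.sum (f ∘ el)

  total-cong : ∀ {f g} → (∀ x → f x ≈ g x) → total f ≈ total g
  total-cong h = Sum.sum-cong-≋ (h ∘ el)

  total-+ : ∀ f g → total (λ x → f x + g x) ≈ total f + total g
  total-+ f g = Sum.∑-distrib-+ (f ∘ el) (g ∘ el)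

  total-0 : ∀ {f} → (∀ x → f x ≈ 0#) → total f ≈ 0#
  total-0 {f} z = Sum.sum-ε (f ∘ el) (z ∘ el)

  private
    sum-* : ∀ {n} c (t : Fin n → Carrier) → Sum.sum (λ i → c * t i) ≈ c * Sum.sum t
    sum-* {zero} c t = sym (zeroʳ c)
    sum-* {suc n} c t = trans (+-congˡ (sum-* c (t ∘ Fin.suc))) (sym (distribˡ _ _ _))

  total-* : ∀ c f → total (λ x → c * f x) ≈ c * total f
  total-* c f = sum-* c (f ∘ el)

  total-∑ : ∀ n (f : ℕ → Carrier → Carrier) → total (λ x → ∑ n (λ i → f i x)) ≈ ∑ n (λ i → total (f i))
  total-∑ zero f = total-0 (λ _ → refl)
  total-∑ (suc n) f = trans (total-+ (f 0) (λ x → ∑ n (λ i → f (suc i) x))) (+-congˡ (total-∑ n (f ∘ suc)))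

  total-permute : (f g : Carrier → Carrier) → (∀ x → f (g x) ≈ x) → (∀ x → g (f x) ≈ x) →
    ∀ t → (∀ {x y} → x ≈ y → t x ≈ t y) → total (t ∘ f) ≈ total t
  total-permute f g fg gf t ct = trans
    (Sum.sum-cong-≋ (λ i → ct (reflexive (≡.sym (el-ix (f (el i)))))))
    (sym (Sum.sum-permute (t ∘ el) (shuffle f g fg gf)))

  -- Translation by 1 permutes the field, so the sum of all elements does not change when `size`
  -- ones are added to it.
  ι-size : ι size ≈ 0#
  ι-size = trans (sym (sum-one size)) $ ≈-from-sub $ begin
    total (λ _ → 1#) + - 0# ≈⟨ solve 2 (λ o t → o :- con (0 , 0) := (t :+ o) :- t) refl _ (total id) ⟩
    (total id + total (λ _ → 1#)) + - total id ≈⟨ +-congʳ (sym (total-+ id (λ _ → 1#))) ⟩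
    total (λ x → x + 1#) + - total id
      ≈⟨ +-congʳ (total-permute (_+ 1#) (_+ - 1#)
           (λ x → solve 1 (λ x → (x :- con (1 , 0)) :+ con (1 , 0) := x) refl x)
           (λ x → solve 1 (λ x → (x :+ con (1 , 0)) :- con (1 , 0) := x) refl x) id id) ⟩
    total id + - total id ≈⟨ -‿inverseʳ _ ⟩
    0# ∎

  all : List Carrier
  all = tabulate el

  all-unique : Unique all
  all-unique = tabulate⁺ {f = el} el-injective

  all-length : length all ≡ size
  all-length = length-tabulate el

  module 𝔹 = RingLemmas series

  -- Synthetic division by `X - a`; the remainder is `ev m f a`.
  quot : ℕ → PS → Carrier → PS
  quot zero f a = 𝔹.0#
  quot (suc m) f a = C (ev m (f ∘ suc) a) 𝔹.+ X 𝔹.* quot m (f ∘ suc) a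

  quot-spec : ∀ m f a → Deg m f → f 𝔹.≈ (C (ev m f a) 𝔹.+ (X 𝔹.+ 𝔹.- C a) 𝔹.* quot m f a)
  quot-spec zero f a d = 𝔹.trans f≈C (𝔹.sym (𝔹.trans (𝔹.+-congˡ (𝔹.zeroʳ (X 𝔹.+ 𝔹.- C a))) (𝔹.+-identityʳ (C (f 0)))))
    where
    f≈C : f 𝔹.≈ C (f 0)
    f≈C = pt λ { zero → refl ; (suc i) → d (suc i) (s≤s z≤n) }
  quot-spec (suc m) f a d = 𝔹.begin
    f 𝔹.≈⟨ head-tail f ⟩
    C (f 0) 𝔹.+ X 𝔹.* (f ∘ suc) 𝔹.≈⟨ 𝔹.+-congˡ (𝔹.*-congˡ (quot-spec m (f ∘ suc) a (Deg-tail {f = f} d))) ⟩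
    C (f 0) 𝔹.+ X 𝔹.* (C e 𝔹.+ (X 𝔹.+ 𝔹.- C a) 𝔹.* g)
      𝔹.≈⟨ 𝔹.solve 5 (λ c x e a g → c 𝔹.:+ x 𝔹.:* (e 𝔹.:+ (x 𝔹.:- a) 𝔹.:* g)
             𝔹.:= (c 𝔹.:+ a 𝔹.:* e) 𝔹.:+ (x 𝔹.:- a) 𝔹.:* (e 𝔹.:+ x 𝔹.:* g)) 𝔹.refl (C (f 0)) X (C e) (C a) g ⟩
    (C (f 0) 𝔹.+ C a 𝔹.* C e) 𝔹.+ (X 𝔹.+ 𝔹.- C a) 𝔹.* (C e 𝔹.+ X 𝔹.* g)
      𝔹.≈⟨ 𝔹.+-congʳ (𝔹.trans (𝔹.+-congˡ (𝔹.sym (C-* a e))) (𝔹.sym (C-+ (f 0) (a * e)))) ⟩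
    C (ev (suc m) f a) 𝔹.+ (X 𝔹.+ 𝔹.- C a) 𝔹.* quot (suc m) f a 𝔹.∎
    where
    e = ev m (f ∘ suc) a
    g = quot m (f ∘ suc) a

  Deg-quot : ∀ m f a → Deg m (quot (suc m) f a)
  Deg-quot zero f a = Deg-+ {0} {C (f 1)} {X 𝔹.* 𝔹.0#} (Deg-C (f 1)) (Deg-cong {0} {𝔹.0#} (𝔹.sym (𝔹.zeroʳ X)) (Deg-0 {0}))
  Deg-quot (suc m) f a = Deg-+ {f = C (ev (suc m) (f ∘ suc) a)} (Deg-C _) (Deg-* 1 m Deg-X (Deg-quot m (f ∘ suc) a))

  Deg-X- : ∀ a → Deg 1 (X 𝔹.+ 𝔹.- C a)
  Deg-X- a = Deg-+ {f = X} Deg-X (Deg-neg {f = C a} (Deg-C a))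

  ev-X- : ∀ a b → ev 1 (X 𝔹.+ 𝔹.- C a) b ≈ b + - a
  ev-X- a b = trans (ev-+ 1 X (𝔹.- C a) b) (+-cong (ev-X 0 b) (trans (ev-neg 1 (C a) b) (-‿cong (ev-C 1 a b))))

  root-factor : ∀ m f a → Deg (suc m) f → ev (suc m) f a ≈ 0# →
    f 𝔹.≈ ((X 𝔹.+ 𝔹.- C a) 𝔹.* quot (suc m) f a)
  root-factor m f a d r = 𝔹.trans (quot-spec (suc m) f a d)
    (𝔹.trans (𝔹.+-congʳ (𝔹.trans (C-cong r) C-0)) (𝔹.+-identityˡ _))

  other-root : ∀ m f a b → Deg (suc m) f → ev (suc m) f a ≈ 0# → ev (suc m) f b ≈ 0# → a ≢ b →
    ev m (quot (suc m) f a) b ≈ 0#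
  other-root m f a b d ra rb ne = domain
    (trans (*-congʳ (sym (ev-X- a b)))
      (trans (sym (ev-* 1 m b (Deg-X- a) (Deg-quot m f a)))
        (trans (ev-cong (suc m) (𝔹.sym (root-factor m f a d ra)) refl) rb)))
    (λ e → ne (≡.sym (≈⇒≡ (≈-from-sub e))))

  vanishing-list : ∀ (as : List Carrier) m f → Unique as → m ℕ.< length as → Deg m f →
    (∀ a → a ∈ as → ev m f a ≈ 0#) → f 𝔹.≈ 𝔹.0#
  vanishing-list (a ∷ as) zero f u l d r = pt λ { zero → r a (here ≡.refl) ; (suc i) → d (suc i) (s≤s z≤n) }
  vanishing-list (a ∷ as) (suc m) f (ne ∷ u) (s≤s l) d r =
    𝔹.trans (root-factor m f a d (r a (here ≡.refl))) (𝔹.zero-mulʳ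
      (vanishing-list as m (quot (suc m) f a) u l (Deg-quot m f a)
        (λ b b∈ → other-root m f a b d (r a (here ≡.refl)) (r b (there b∈)) (All.lookup ne b∈))))

  vanishing : ∀ m f → m ℕ.< size → Deg m f → (∀ a → ev m f a ≈ 0#) → f 𝔹.≈ 𝔹.0#
  vanishing m f l d r = vanishing-list all m f all-unique (≡.subst (m ℕ.<_) (≡.sym all-length) l) d (λ a _ → r a)

  roots : List Carrier → PS → PS
  roots [] z = 𝔹.1#
  roots (a ∷ as) z = (z 𝔹.+ 𝔹.- C a) 𝔹.* roots as z

  Deg-roots : ∀ as → Deg (length as) (roots as X)
  Deg-roots [] = Deg-C 1#
  Deg-roots (a ∷ as) = Deg-* 1 (length as) (Deg-X- a) (Deg-roots as)

  top-roots : ∀ as → roots as X (length as) ≈ 1#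
  top-roots [] = refl
  top-roots (a ∷ as) = trans (top-* 1 (length as) (Deg-X- a) (Deg-roots as))
    (trans (*-cong (trans (+-congˡ -0#≈0#) (+-identityʳ 1#)) (top-roots as)) (*-identityˡ 1#))

  factor-list : ∀ as m f → Unique as → Deg (length as ℕ.+ m) f →
    (∀ a → a ∈ as → ev (length as ℕ.+ m) f a ≈ 0#) → Σ PS λ g → Deg m g × (f 𝔹.≈ (roots as X 𝔹.* g))
  factor-list [] m f u d r = f , d , 𝔹.sym (𝔹.*-identityˡ f)
  factor-list (a ∷ as) m f (ne ∷ u) d r =
    let ra = r a (here ≡.refl)
        n = length as ℕ.+ m
        (g , dg , e) = factor-list as m (quot (suc n) f a) u (Deg-quot n f a)
          (λ b b∈ → other-root n f a b d ra (r b (there b∈)) (All.lookup ne b∈))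
    in g , dg , 𝔹.trans (root-factor n f a d ra)
         (𝔹.trans (𝔹.*-congˡ e) (𝔹.sym (𝔹.*-assoc (X 𝔹.+ 𝔹.- C a) (roots as X) g)))

  0<size : 0 ℕ.< size
  0<size = ℕₚ.≤-trans (s≤s z≤n) (Finₚ.toℕ<n (ix 0#))

  1<size : 1 ℕ.< size
  1<size = ℕₚ.≤∧≢⇒< 0<size (λ e → 1≉0 (trans (reflexive (≡.cong ι e)) ι-size))

  Deg-frob : Deg size ((X 𝔹.^ size) 𝔹.+ 𝔹.- X)
  Deg-frob = Deg-+ {f = X 𝔹.^ size} (Deg-X^ size) (Deg-neg {f = X} (Deg-mono {f = X} 0<size Deg-X))

  -- All elements are roots of `X^q - X`, whose degree equals their number; the cofactor is
  -- therefore constant, and the leading coefficients show that it is 1.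
  frob-poly : ((X 𝔹.^ size) 𝔹.+ 𝔹.- X) 𝔹.≈ roots all X
  frob-poly =
    let len+0 = ≡.trans (ℕₚ.+-identityʳ _) all-length
        f = (X 𝔹.^ size) 𝔹.+ 𝔹.- X
        root : ∀ a → ev size f a ≈ 0#
        root a = begin
          ev size f a ≈⟨ ev-+ size (X 𝔹.^ size) (𝔹.- X) a ⟩
          ev size (X 𝔹.^ size) a + ev size (𝔹.- X) a
            ≈⟨ +-cong (trans (ev-X^ size a) (fermat a))
                      (trans (ev-neg size X a) (-‿cong (trans (sym (ev-mono 1 size a 0<size Deg-X)) (ev-X 0 a)))) ⟩
          a + - a ≈⟨ -‿inverseʳ a ⟩
          0# ∎
        (g , dg , e) = factor-list all 0 f all-unique (≡.subst (λ j → Deg j f) (≡.sym len+0) Deg-frob)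
          (λ a _ → ≡.subst (λ j → ev j f a ≈ 0#) (≡.sym len+0) (root a))
        lead : g 0 ≈ 1#
        lead = begin
          g 0 ≈⟨ *-identityˡ (g 0) ⟨
          1# * g 0 ≈⟨ *-congʳ (top-roots all) ⟨
          roots all X (length all) * g 0 ≈⟨ top-* (length all) 0 (Deg-roots all) dg ⟨
          (roots all X 𝔹.* g) (length all ℕ.+ 0) ≡⟨ ≡.cong (roots all X 𝔹.* g) len+0 ⟩
          (roots all X 𝔹.* g) size ≈⟨ at e size ⟨
          (X 𝔹.^ size) size + - X size ≈⟨ +-cong (X^-top size) (trans (-‿cong (Deg-X size 1<size)) -0#≈0#) ⟩
          1# + 0# ≈⟨ +-identityʳ 1# ⟩
          1# ∎
        g≈1 : g 𝔹.≈ 𝔹.1#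
        g≈1 = pt λ { zero → lead ; (suc i) → dg (suc i) (s≤s z≤n) }
    in 𝔹.trans e (𝔹.trans (𝔹.*-congˡ g≈1) (𝔹.*-identityʳ (roots all X)))

  coefficients-unique : ∀ m f g → m ℕ.< size → Deg m f → Deg m g → (∀ a → ev m f a ≈ ev m g a) → f 𝔹.≈ g
  coefficients-unique m f g l df dg h = pt λ i → ≈-from-sub (at
    (vanishing m (f 𝔹.+ 𝔹.- g) l (Deg-+ {f = f} df (Deg-neg {f = g} dg))
      (λ a → trans (ev-+ m f (𝔹.- g) a) (trans (+-cong (h a) (ev-neg m g a)) (-‿inverseʳ _)))) i)

  total-C : ∀ c → total (λ _ → c) ≈ 0#
  total-C c = trans (total-cong (λ _ → sym (*-identityʳ c)))
    (trans (total-* c (λ _ → 1#)) (zero-mulʳ (trans (sum-one size) ι-size)))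

  fermat′ : ∀ x → ¬ (x ≈ 0#) → x ^ (size ∸ 1) ≈ 1#
  fermat′ x ne with size | fermat x | 0<size
  ... | suc n | e | _ = ≈-from-sub (domain
          (trans (solve 2 (λ x y → x :* (y :- con (1 , 0)) := x :* y :- x) refl x (x ^ n))
                 (trans (+-congʳ e) (-‿inverseʳ x))) ne)

  -- Scaling by `x` multiplies the sum by `x^j`. A nonzero sum would force `x^j = 1` for every
  -- `x ≠ 0`, so that `X^(j+1) - X`, of degree below `q`, would vanish everywhere.
  power-sum : ∀ j → j ℕ.< size ∸ 1 → total (_^ j) ≈ 0#
  power-sum zero l = total-C 1#
  power-sum (suc j) l with total (_^ suc j) ≟ 0#
  ... | yes e = e
  ... | no ne = ⊥-elim (1≉0 (trans (sym top) (at coeffs (suc (suc j)))))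
    where
    l′ : suc (suc j) ℕ.< size
    l′ = ℕₚ.≤-trans (s≤s l) (ℕₚ.≤-reflexive (ℕₚ.m+[n∸m]≡n 0<size))
    one : ∀ x → ¬ (x ≈ 0#) → x ^ suc j ≈ 1#
    one x nx =
      let (y , xy) = inv x nx
          scaled : x ^ suc j * total (_^ suc j) ≈ total (_^ suc j)
          scaled = begin
            x ^ suc j * total (_^ suc j) ≈⟨ total-* (x ^ suc j) (_^ suc j) ⟨
            total (λ a → x ^ suc j * a ^ suc j) ≈⟨ total-cong (λ a → sym (^-distrib-* x a (suc j))) ⟩
            total (λ a → (x * a) ^ suc j)
              ≈⟨ total-permute (x *_) (y *_)
                   (λ a → trans (sym (*-assoc _ _ _)) (trans (*-congʳ xy) (*-identityˡ a)))
                   (λ a → trans (sym (*-assoc _ _ _)) (trans (*-congʳ (trans (*-comm y x) xy)) (*-identityˡ a)))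
                   (_^ suc j) (^-congˡ (suc j)) ⟩
            total (_^ suc j) ∎
      in ≈-from-sub (domain
           (trans (solve 2 (λ t p → t :* (p :- con (1 , 0)) := p :* t :- t) refl _ _)
                  (trans (+-congʳ scaled) (-‿inverseʳ _))) ne)
    f = (X 𝔹.^ suc (suc j)) 𝔹.+ 𝔹.- X
    vanish : ∀ a → ev (suc (suc j)) f a ≈ 0#
    vanish a = begin
      ev (suc (suc j)) f a ≈⟨ ev-+ (suc (suc j)) (X 𝔹.^ suc (suc j)) (𝔹.- X) a ⟩
      ev (suc (suc j)) (X 𝔹.^ suc (suc j)) a + ev (suc (suc j)) (𝔹.- X) a
        ≈⟨ +-cong (ev-X^ (suc (suc j)) a) (trans (ev-neg (suc (suc j)) X a) (-‿cong (ev-X (suc j) a))) ⟩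
      a * a ^ suc j + - a ≈⟨ cancels ⟩
      0# ∎
      where
      cancels : a * a ^ suc j + - a ≈ 0#
      cancels with a ≟ 0#
      ... | yes z = zero-sum (zero-mulˡ z) (trans (-‿cong z) -0#≈0#)
      ... | no na = trans (+-congʳ (trans (*-congˡ (one a na)) (*-identityʳ a))) (-‿inverseʳ a)
    coeffs = vanishing (suc (suc j)) f l′
      (Deg-+ {f = X 𝔹.^ suc (suc j)} (Deg-X^ (suc (suc j))) (Deg-neg {f = X} (Deg-mono {f = X} (s≤s z≤n) Deg-X))) vanish
    top : f (suc (suc j)) ≈ 1#
    top = trans (+-cong (X^-top (suc (suc j))) -0#≈0#) (+-identityʳ 1#)

  power-sum-top : total (_^ (size ∸ 1)) ≈ - 1#
  power-sum-top = begin
    total (_^ (size ∸ 1)) ≈⟨ total-cong (λ x → split x) ⟩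
    total (λ x → 1# + - δ x) ≈⟨ total-+ (λ _ → 1#) (λ x → - δ x) ⟩
    total (λ _ → 1#) + total (λ x → - δ x)
      ≈⟨ +-cong (total-C 1#) (Sum.sum-single (λ i → - δ (el i)) (ix 0#)
           (λ j nj → trans (-‿cong (if0-no 1# 0# (index-≢ nj))) -0#≈0#)) ⟩
    0# + - δ (el (ix 0#)) ≈⟨ trans (+-identityˡ _) (-‿cong (if0-yes 1# 0# (reflexive (el-ix 0#)))) ⟩
    - 1# ∎
    where
    δ : Carrier → Carrier
    δ x = if0 x 1# 0#
    split : ∀ x → x ^ (size ∸ 1) ≈ 1# + - δ x
    split x with x ≟ 0#
    ... | yes e = trans (^-congˡ (size ∸ 1) e) (trans (0^ (size ∸ 1) (ℕₚ.m<n⇒0<n∸m 1<size)) (sym (-‿inverseʳ 1#)))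
    ... | no ne = trans (fermat′ x ne) (sym (trans (+-congˡ -0#≈0#) (+-identityʳ 1#)))

  ≋-stable : ∀ {f g} → ¬ ¬ (f ≋ g) → f ≋ g
  ≋-stable nn = pt λ n → ≈-stable λ ne → nn λ e → ne (at e n)

  -- If `f i ≠ 0`, the leading zeros of `f` are dropped one at a time until its constant term is
  -- nonzero; then `g` vanishes term by term. The index `i` is available only under double negation,
  -- which the stable conclusion permits.
  series-domain : ∀ {f g} → f 𝔹.* g ≋ 𝔹.0# → ¬ (f ≋ 𝔹.0#) → g ≋ 𝔹.0#
  series-domain {f} {g} e nf = ≋-stable λ ng → nf (pt λ i → ≈-stable λ fi → ng (pt (cancel-at i f (at e) fi)))
    where
    unit-cancel : ∀ n f g → (∀ i → conv f g i ≈ 0#) → ¬ (f 0 ≈ 0#) → g n ≈ 0#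
    unit-cancel zero f g e f0 = domain (e 0) f0
    unit-cancel (suc n) f g e f0 = unit-cancel n f (g ∘ suc)
      (λ i → trans (sym (+-identityʳ _)) (trans (+-congˡ (sym (zero-mulʳ g0))) (trans (sym (conv-sucʳ f g i)) (e (suc i))))) f0
      where g0 = domain (e 0) f0
    cancel-at : ∀ i f → (∀ j → conv f g j ≈ 0#) → ¬ (f i ≈ 0#) → ∀ n → g n ≈ 0#
    cancel-at zero f e fi n = unit-cancel n f g e fi
    cancel-at (suc i) f e fi with f 0 ≟ 0#
    ... | no f0 = λ n → unit-cancel n f g e f0
    ... | yes f0 = cancel-at i (f ∘ suc)
      (λ j → trans (sym (trans (+-congʳ (zero-mulˡ f0)) (+-identityˡ _))) (e (suc j))) fi

  char : ∀ p h → size ≡ p ℕ.^ h → ι p ≈ 0#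
  char p h e = go h (trans (reflexive (≡.cong ι (≡.sym e))) ι-size)
    where
    go : ∀ h → ι (p ℕ.^ h) ≈ 0# → ι p ≈ 0#
    go zero z = ⊥-elim (1≉0 z)
    go (suc h) z = ≈-stable λ ne → ne (go h (domain (trans (sym (ι-* p (p ℕ.^ h))) z) ne))

-- Binomial coefficients and the Frobenius map.

absorption : ∀ n k → suc k ℕ.* (suc n choose suc k) ≡ suc n ℕ.* (n choose k)
absorption n zero = ≡.trans (ℕₚ.*-identityˡ _) (go n)
  where
  go : ∀ n → suc n choose 1 ≡ suc n ℕ.* (n choose 0)
  go zero = ≡.refl
  go (suc n) = ≡.trans (≡.sym (nCk+nC[k+1]≡[n+1]C[k+1] (suc n) 0)) (≡.cong suc (go n))
absorption zero (suc k) = ≡.trans (≡.cong (suc (suc k) ℕ.*_) (k>n⇒nCk≡0 {1} {suc (suc k)} (s≤s (s≤s z≤n)))) (ℕₚ.*-zeroʳ (suc (suc k)))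
absorption (suc n) (suc k) = begin
  suc (suc k) ℕ.* (suc (suc n) choose suc (suc k)) ≡⟨ ≡.cong (suc (suc k) ℕ.*_) (nCk+nC[k+1]≡[n+1]C[k+1] (suc n) (suc k)) ⟨
  suc (suc k) ℕ.* (A ℕ.+ B) ≡⟨ ℕₚ.*-distribˡ-+ (suc (suc k)) A B ⟩
  (A ℕ.+ suc k ℕ.* A) ℕ.+ suc (suc k) ℕ.* B ≡⟨ ≡.cong₂ (λ u v → (A ℕ.+ u) ℕ.+ v) (absorption n k) (absorption n (suc k)) ⟩
  (A ℕ.+ suc n ℕ.* (n choose k)) ℕ.+ suc n ℕ.* (n choose suc k) ≡⟨ ℕₚ.+-assoc A _ _ ⟩
  A ℕ.+ (suc n ℕ.* (n choose k) ℕ.+ suc n ℕ.* (n choose suc k)) ≡⟨ ≡.cong (A ℕ.+_) (ℕₚ.*-distribˡ-+ (suc n) (n choose k) (n choose suc k)) ⟨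
  A ℕ.+ suc n ℕ.* (n choose k ℕ.+ n choose suc k) ≡⟨ ≡.cong (λ u → A ℕ.+ suc n ℕ.* u) (nCk+nC[k+1]≡[n+1]C[k+1] n k) ⟩
  suc (suc n) ℕ.* A ∎
  where
  open ≡.≡-Reasoning
  A = suc n choose suc k
  B = suc n choose suc (suc k)

1<pr : ∀ {p} → Prime p → 1 ℕ.< p
1<pr {p} pr = ℕ.nonTrivial⇒n>1 p {{prime⇒nonTrivial pr}}

prime∣binomial : ∀ {p} → Prime p → ∀ k → 0 ℕ.< k → k ℕ.< p → p ∣ p choose k
prime∣binomial {suc n} pr (suc k) _ l
  with euclidsLemma (suc k) (suc n choose suc k) pr
         (divides (n choose k) (≡.trans (absorption n k) (ℕₚ.*-comm (suc n) (n choose k))))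
... | inj₂ d = d
... | inj₁ d = ⊥-elim (ℕₚ.<⇒≱ l (∣.∣⇒≤ d))

prime∤binomial : ∀ {p} → Prime p → ∀ c i → c ℕ.< p → i ℕ.≤ c → p ∤ c choose i
prime∤binomial pr c zero l _ d = ℕₚ.<⇒≱ (1<pr pr) (∣.∣⇒≤ d)
prime∤binomial {p} pr (suc c) (suc i) l (s≤s le) d
  with euclidsLemma (suc c) (c choose i) pr (≡.subst (p ∣_) (absorption c i) (∣.∣n⇒∣m*n (suc i) d))
... | inj₁ e = ℕₚ.<⇒≱ l (∣.∣⇒≤ e)
... | inj₂ e = prime∤binomial pr c i (ℕₚ.<-trans (ℕₚ.n<1+n c) l) le e

module Binomial (R : Ring₀) where
  open RingLemmas R

  binomial-theorem : ∀ n a b → (a + b) ^ n ≈ ∑ (suc n) (λ i → ι (n choose i) * (a ^ i * b ^ (n ∸ i)))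
  binomial-theorem zero a b = sym (trans (+-identityʳ _) (trans (*-identityˡ _) (*-identityˡ _)))
  binomial-theorem (suc n) a b = begin
    (a + b) * (a + b) ^ n ≈⟨ *-congˡ (binomial-theorem n a b) ⟩
    (a + b) * ∑ (suc n) t ≈⟨ trans (distribʳ _ _ _) (+-comm _ _) ⟩
    b * ∑ (suc n) t + a * ∑ (suc n) t ≈⟨ +-cong (∑-*ˡ (suc n) b t) (∑-*ˡ (suc n) a t) ⟨
    (b * t 0 + ∑ n (λ i → b * t (suc i))) + ∑ (suc n) (λ i → a * t i)
      ≈⟨ +-cong (+-cong first (∑-cong n lower)) (∑-cong (suc n) (λ i _ → upper i)) ⟩
    (s 0 + ∑ n v) + ∑ (suc n) u ≈⟨ +-congʳ (+-congˡ (trans (sym (+-identityʳ _)) (trans (+-congˡ (sym vn)) (sym (∑-last n v))))) ⟩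
    (s 0 + ∑ (suc n) v) + ∑ (suc n) u ≈⟨ trans (+-assoc _ _ _) (+-congˡ (trans (+-comm _ _) (sym (∑-+ (suc n) u v)))) ⟩
    s 0 + ∑ (suc n) (λ i → u i + v i) ≈⟨ +-congˡ (∑-cong (suc n) (λ i _ → pascal i)) ⟩
    ∑ (suc (suc n)) s ∎
    where
    t s u v : ℕ → Carrier
    t i = ι (n choose i) * (a ^ i * b ^ (n ∸ i))
    s i = ι (suc n choose i) * (a ^ i * b ^ (suc n ∸ i))
    u i = ι (n choose i) * (a ^ suc i * b ^ (n ∸ i))
    v i = ι (n choose suc i) * (a ^ suc i * b ^ (n ∸ i))

    first : b * t 0 ≈ s 0
    first = solve 2 (λ b y → b :* (con (1 , 0) :* (con (1 , 0) :* y)) := con (1 , 0) :* (con (1 , 0) :* (b :* y))) refl b (b ^ n)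

    lower : ∀ i → i ℕ.< n → b * t (suc i) ≈ v i
    lower i l = trans (solve 4 (λ b c x y → b :* (c :* (x :* y)) := c :* (x :* (b :* y))) refl b (ι (n choose suc i)) (a ^ suc i) _)
      (*-congˡ (*-congˡ (reflexive (≡.cong (b ^_) (≡.sym (ℕₚ.+-∸-assoc 1 l))))))

    upper : ∀ i → a * t i ≈ u i
    upper i = solve 4 (λ a c x y → a :* (c :* (x :* y)) := c :* (a :* x :* y)) refl a (ι (n choose i)) (a ^ i) _

    vn : v n ≈ 0#
    vn = zero-mulˡ (reflexive (≡.cong ι (k>n⇒nCk≡0 (ℕₚ.n<1+n n))))

    pascal : ∀ i → u i + v i ≈ s (suc i)
    pascal i = trans (sym (distribʳ _ _ _))
      (*-congʳ (trans (sym (ι-+ (n choose i) (n choose suc i))) (reflexive (≡.cong ι (nCk+nC[k+1]≡[n+1]C[k+1] n i)))))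

module Frobenius (R : Ring₀) {p} (pr : Prime p)
  (char : CommutativeRing._≈_ R (RingLemmas.ι R p) (CommutativeRing.0# R)) where
  open RingLemmas R
  open Binomial R

  ι-∣ : ∀ {n} → p ∣ n → ι n ≈ 0#
  ι-∣ {n} (divides d e) = trans (reflexive (≡.cong ι e)) (trans (ι-* d p) (zero-mulʳ char))

  frobenius : ∀ a b → (a + b) ^ p ≈ a ^ p + b ^ p
  frobenius a b = begin
    (a + b) ^ p ≈⟨ binomial-theorem p a b ⟩
    t 0 + ∑ p (t ∘ suc) ≈⟨ +-cong
       (trans (*-identityˡ _) (*-identityˡ _))
       (∑-single p (p ∸ 1) {t ∘ suc} (≡.subst (p ∸ 1 ℕ.<_) p-1 (ℕₚ.n<1+n (p ∸ 1)))
         (λ i l ne → zero-mulˡ (ι-∣ (prime∣binomial pr (suc i) (s≤s z≤n)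
           (ℕₚ.≤∧≢⇒< l (λ e → ne (≡.trans (≡.cong (_∸ 1) e) ≡.refl))))))) ⟩
    b ^ p + t (suc (p ∸ 1)) ≈⟨ +-congˡ (reflexive (≡.cong t p-1)) ⟩
    b ^ p + t p ≈⟨ +-congˡ (trans (*-cong (reflexive (≡.cong ι (nCn≡1 p)))
                     (*-congˡ (reflexive (≡.cong (b ^_) (ℕₚ.n∸n≡0 p))))) (trans (*-identityˡ _) (*-identityʳ _))) ⟩
    b ^ p + a ^ p ≈⟨ +-comm _ _ ⟩
    a ^ p + b ^ p ∎
    where
    t : ℕ → Carrier
    t i = ι (p choose i) * (a ^ i * b ^ (p ∸ i))
    p-1 : suc (p ∸ 1) ≡ p
    p-1 = ℕₚ.m+[n∸m]≡n (ℕₚ.<⇒≤ (1<pr pr))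

  frobenius^ : ∀ j a b → (a + b) ^ (p ℕ.^ j) ≈ a ^ (p ℕ.^ j) + b ^ (p ℕ.^ j)
  frobenius^ zero a b = trans (*-identityʳ _) (sym (+-cong (*-identityʳ _) (*-identityʳ _)))
  frobenius^ (suc j) a b = begin
    (a + b) ^ (p ℕ.* p ℕ.^ j) ≈⟨ ^-assocʳ (a + b) p (p ℕ.^ j) ⟨
    ((a + b) ^ p) ^ (p ℕ.^ j) ≈⟨ ^-congˡ (p ℕ.^ j) (frobenius a b) ⟩
    (a ^ p + b ^ p) ^ (p ℕ.^ j) ≈⟨ frobenius^ j (a ^ p) (b ^ p) ⟩
    (a ^ p) ^ (p ℕ.^ j) + (b ^ p) ^ (p ℕ.^ j) ≈⟨ +-cong (^-assocʳ a p (p ℕ.^ j)) (^-assocʳ b p (p ℕ.^ j)) ⟩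
    a ^ (p ℕ.^ suc j) + b ^ (p ℕ.^ suc j) ∎

  0<p^ : ∀ j → 0 ℕ.< p ℕ.^ j
  0<p^ zero = s≤s z≤n
  0<p^ (suc j) = ℕₚ.*-mono-< {0} {p} (ℕₚ.<-trans (s≤s z≤n) (1<pr pr)) (0<p^ j)

  frobenius^-∑ : ∀ j n (f : ℕ → Carrier) → ∑ n f ^ (p ℕ.^ j) ≈ ∑ n (λ i → f i ^ (p ℕ.^ j))
  frobenius^-∑ j zero f = 0^ (p ℕ.^ j) (0<p^ j)
  frobenius^-∑ j (suc n) f = trans (frobenius^ j (f 0) (∑ n (f ∘ suc))) (+-congˡ (frobenius^-∑ j n (f ∘ suc)))

  frobenius^-neg : ∀ j a → (- a) ^ (p ℕ.^ j) ≈ - (a ^ (p ℕ.^ j))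
  frobenius^-neg j a = begin
    (- a) ^ P ≈⟨ solve 2 (λ x y → x := (y :+ x) :- y) refl ((- a) ^ P) (a ^ P) ⟩
    (a ^ P + (- a) ^ P) + - a ^ P ≈⟨ +-congʳ (sym (frobenius^ j a (- a))) ⟩
    (a + - a) ^ P + - a ^ P ≈⟨ +-congʳ (trans (^-congˡ P (-‿inverseʳ a)) (0^ P (0<p^ j))) ⟩
    0# + - a ^ P ≈⟨ +-identityˡ _ ⟩
    - a ^ P ∎
    where P = p ℕ.^ j

module FrobeniusSeries (R : Ring₀) {p} (pr : Prime p)
  (char : CommutativeRing._≈_ R (RingLemmas.ι R p) (CommutativeRing.0# R)) where
  open RingLemmas R
  open Series R
  private
    module S = RingLemmas series

  ι-series : ∀ n → S.ι n S.≈ C (ι n)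
  ι-series zero = S.sym C-0
  ι-series (suc zero) = S.refl
  ι-series (suc (suc n)) = S.trans (S.+-congˡ (ι-series (suc n))) (S.sym (C-+ 1# (ι (suc n))))

  char-series : S.ι p S.≈ S.0#
  char-series = S.trans (ι-series p) (S.trans (C-cong char) C-0)

  module FS = Frobenius series pr char-series

  power-head-tail : ∀ j f → (f S.^ (p ℕ.^ j)) S.≈ (C (f 0 ^ (p ℕ.^ j)) S.+ (X S.^ (p ℕ.^ j)) S.* ((f ∘ suc) S.^ (p ℕ.^ j)))
  power-head-tail j f = S.trans (S.^-congˡ P (head-tail f)) (S.trans (FS.frobenius^ j (C (f 0)) (X S.* (f ∘ suc)))
    (S.+-cong (S.sym (C-^ (f 0) P)) (S.^-distrib-* X (f ∘ suc) P)))
    where P = p ℕ.^ j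

  -- The factor `g^(p^j)` is a series in `X^(p^j)` whose coefficients are the powers of those of
  -- `g`, so only the coefficients of `f` at indices congruent to `t` modulo `p^j` meet it.
  mul-power-coefficient : ∀ j f g t s → t ℕ.< p ℕ.^ j →
    (f S.* (g S.^ (p ℕ.^ j))) (t ℕ.+ p ℕ.^ j ℕ.* s) ≈
    ∑ (suc s) (λ i → f (t ℕ.+ p ℕ.^ j ℕ.* (s ∸ i)) * g i ^ (p ℕ.^ j))
  mul-power-coefficient j f g t s t<P = trans (at split (t ℕ.+ P ℕ.* s)) (go s)
    where
    P = p ℕ.^ j
    rest = f S.* ((g ∘ suc) S.^ P)
    split : (f S.* (g S.^ P)) S.≈ ((λ n → f n * g 0 ^ P) S.+ (X S.^ P) S.* rest)
    split = S.trans (S.*-congˡ (power-head-tail j g))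
      (S.trans (S.solve 4 (λ f c x r → f S.:* (c S.:+ x S.:* r) S.:= c S.:* f S.:+ x S.:* (f S.:* r)) S.refl f (C (g 0 ^ P)) (X S.^ P) ((g ∘ suc) S.^ P))
        (S.+-congʳ (pt λ n → trans (C-conv (g 0 ^ P) f n) (*-comm _ _))))
    go : ∀ s → f (t ℕ.+ P ℕ.* s) * g 0 ^ P + ((X S.^ P) S.* rest) (t ℕ.+ P ℕ.* s) ≈
         ∑ (suc s) (λ i → f (t ℕ.+ P ℕ.* (s ∸ i)) * g i ^ P)
    go zero = +-congˡ (X^*-low P rest _ (≡.subst (ℕ._< P) (≡.sym (≡.trans (≡.cong (t ℕ.+_) (ℕₚ.*-zeroʳ P)) (ℕₚ.+-identityʳ t))) t<P))
    go (suc s) = +-congˡ (trans (reflexive (≡.cong ((X S.^ P) S.* rest) index))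
      (trans (X^*-high P rest (t ℕ.+ P ℕ.* s)) (mul-power-coefficient j f (g ∘ suc) t s t<P)))
      where
      index : t ℕ.+ P ℕ.* suc s ≡ P ℕ.+ (t ℕ.+ P ℕ.* s)
      index = ≡.trans (≡.cong (t ℕ.+_) (ℕₚ.*-suc P s)) (≡.trans (≡.sym (ℕₚ.+-assoc t P _))
        (≡.trans (≡.cong (ℕ._+ P ℕ.* s) (ℕₚ.+-comm t P)) (ℕₚ.+-assoc P t _)))

-- Reduction modulo a monic polynomial, and the filtration by total degree.

prepend : {A : Set} → A → (ℕ → A) → ℕ → A
prepend z a zero = z
prepend z a (suc j) = a j

module Companion (R : Ring₀) where
  open RingLemmas R

  -- The left coefficients are the companion matrix applied to `a`: multiplication by `z` with
  -- `z^(n+1)` replaced by lower powers. The correction term is the defect of that replacement and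
  -- vanishes when `z` is a root.
  companion : ∀ n (a g : ℕ → Carrier) z →
    ∑ (suc n) (λ j → (prepend 0# a j + - (a n * g j)) * z ^ j) ≈
    z * ∑ (suc n) (λ j → a j * z ^ j) + - (a n * (z ^ suc n + ∑ (suc n) (λ j → g j * z ^ j)))
  companion n a g z = begin
    ∑ (suc n) (λ j → (prepend 0# a j + - (a n * g j)) * z ^ j)
      ≈⟨ ∑-cong (suc n) (λ j _ → solve 4 (λ p t g w → (p :- t :* g) :* w := p :* w :- t :* (g :* w)) refl (prepend 0# a j) (a n) (g j) (z ^ j)) ⟩
    ∑ (suc n) (λ j → prepend 0# a j * z ^ j + - (a n * (g j * z ^ j)))
      ≈⟨ ∑-+ (suc n) (λ j → prepend 0# a j * z ^ j) (λ j → - (a n * (g j * z ^ j))) ⟩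
    ∑ (suc n) (λ j → prepend 0# a j * z ^ j) + ∑ (suc n) (λ j → - (a n * (g j * z ^ j)))
      ≈⟨ +-cong shifted (trans (∑-neg (suc n) (λ j → a n * (g j * z ^ j))) (-‿cong (∑-*ˡ (suc n) (a n) (λ j → g j * z ^ j)))) ⟩
    z * A + - (a n * G)
      ≈⟨ solve 5 (λ z A t w G → z :* A :- t :* G := z :* (A :+ t :* w) :- t :* (z :* w :+ G)) refl z A (a n) (z ^ n) G ⟩
    z * (A + a n * z ^ n) + - (a n * (z ^ suc n + G)) ≈⟨ +-congʳ (*-congˡ (∑-last n (λ j → a j * z ^ j))) ⟨
    z * ∑ (suc n) (λ j → a j * z ^ j) + - (a n * (z ^ suc n + G)) ∎
    where
    A = ∑ n (λ j → a j * z ^ j)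
    G = ∑ (suc n) (λ j → g j * z ^ j)
    shifted : 0# * 1# + ∑ n (λ j → a j * (z * z ^ j)) ≈ z * A
    shifted = trans (+-congʳ (zeroˡ 1#)) (trans (+-identityˡ _)
      (trans (∑-cong n (λ j _ → solve 3 (λ a z w → a :* (z :* w) := z :* (a :* w)) refl (a j) z (z ^ j)))
             (∑-*ˡ n z (λ j → a j * z ^ j))))

-- Degrees are recorded as pairs (D , s) standing for the possibly negative degree D − s.
module Weights (F : FiniteField) where
  module K = Field F
  open K using (series; _≋_; pt; at)
  open RingLemmas series
  module 𝕃 = Series series
  open Companion series
  open +-*-Solver using () renaming (solve to ℕ-solve; _:=_ to _≐_; _:+_ to _⊞_; con to #)

  W : ℕ → ℕ → K.PS → Set
  W D s f = ∀ a → D ℕ.< a ℕ.+ s → f a K.≈ K.0#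

  W-weaken : ∀ {D s E t f} → D ℕ.+ t ℕ.≤ E ℕ.+ s → W D s f → W E t f
  W-weaken {D} {s} {E} {t} le w a l = w a (ℕₚ.≰⇒> λ a+s≤D → ℕₚ.<⇒≱ l (ℕₚ.+-cancelʳ-≤ s (a ℕ.+ t) E
    (ℕₚ.≤-trans (ℕₚ.≤-reflexive (ℕ-solve 3 (λ a t s → a ⊞ t ⊞ s ≐ a ⊞ s ⊞ t) ≡.refl a t s))
                (ℕₚ.≤-trans (ℕₚ.+-monoˡ-≤ t a+s≤D) le))))

  W-+ : ∀ {D s f g} → W D s f → W D s g → W D s (f + g)
  W-+ v w a l = K.zero-sum (v a l) (w a l)

  W-neg : ∀ {D s f} → W D s f → W D s (- f)
  W-neg w a l = K.trans (K.-‿cong (w a l)) K.-0#≈0#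

  W-0 : ∀ {D s} → W D s 0#
  W-0 a l = K.refl

  W-tail : ∀ {D s f} → W D s f → W D (suc s) (f ∘ suc)
  W-tail {D} {s} w a l = w (suc a) (≡.subst (D ℕ.<_) (ℕₚ.+-suc a s) l)

  W-* : ∀ D s E t {f g} → W D s f → W E t g → W (D ℕ.+ E) (s ℕ.+ t) (f * g)
  W-* D s E t {f} {g} v w = go s v
    where
    split : ∀ {s t} → D ℕ.+ E ℕ.< s ℕ.+ t → D ℕ.< s ⊎ E ℕ.< t
    split {s} {t} l with D ℕ.<? s | E ℕ.<? t
    ... | yes p | _ = inj₁ p
    ... | no _ | yes r = inj₂ r
    ... | no np | no nr = ⊥-elim (ℕₚ.<⇒≱ l (ℕₚ.+-mono-≤ (ℕₚ.≮⇒≥ np) (ℕₚ.≮⇒≥ nr)))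
    head : ∀ {s f} → W D s f → ∀ a → D ℕ.+ E ℕ.< a ℕ.+ (s ℕ.+ t) → f 0 K.* g a K.≈ K.0#
    head {s} v a l with split {s} {a ℕ.+ t} (≡.subst (D ℕ.+ E ℕ.<_)
                          (ℕ-solve 3 (λ a s t → a ⊞ (s ⊞ t) ≐ s ⊞ (a ⊞ t)) ≡.refl a s t) l)
    ... | inj₁ p = K.zero-mulˡ (v 0 p)
    ... | inj₂ r = K.zero-mulʳ (w a r)
    go : ∀ s {f} → W D s f → W (D ℕ.+ E) (s ℕ.+ t) (f * g)
    go s v zero l = head v 0 l
    go s {f} v (suc a) l = K.zero-sum (head v (suc a) l)
      (go (suc s) (W-tail {f = f} v) a (≡.subst (D ℕ.+ E ℕ.<_)
        (ℕ-solve 2 (λ a u → # 1 ⊞ (a ⊞ u) ≐ a ⊞ (# 1 ⊞ u)) ≡.refl a (s ℕ.+ t)) l))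

  Tot : ℕ → ℕ → 𝕃.PS → Set
  Tot D s P = ∀ j → W D (j ℕ.+ s) (P j)

  Tot-tail : ∀ {D s P} → Tot D s P → Tot D (suc s) (P ∘ suc)
  Tot-tail {D} {s} {P} t j = ≡.subst (λ r → W D r (P (suc j))) (≡.sym (ℕₚ.+-suc j s)) (t (suc j))

  Tot-* : ∀ D s E t {P Q} → Tot D s P → Tot E t Q → Tot (D ℕ.+ E) (s ℕ.+ t) (𝕃.conv P Q)
  Tot-* D s E t v w zero = W-* D s E t (v 0) (w 0)
  Tot-* D s E t {P} {Q} v w (suc j) = W-+
    (≡.subst (λ r → W (D ℕ.+ E) r (P 0 * Q (suc j)))
      (ℕ-solve 3 (λ s j t → s ⊞ (# 1 ⊞ j ⊞ t) ≐ # 1 ⊞ j ⊞ (s ⊞ t)) ≡.refl s j t)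
      (W-* D s E (suc j ℕ.+ t) (v 0) (w (suc j))))
    (≡.subst (λ r → W (D ℕ.+ E) r (𝕃.conv (P ∘ suc) Q j))
      (ℕ-solve 3 (λ s j t → j ⊞ (# 1 ⊞ s ⊞ t) ≐ # 1 ⊞ j ⊞ (s ⊞ t)) ≡.refl s j t)
      (Tot-* D (suc s) E t (Tot-tail {P = P} v) w j))

  Tot⇒Deg : ∀ {D s P} → Tot D s P → 𝕃.Deg D P
  Tot⇒Deg {D} {s} t j l = pt λ a → t j a (ℕₚ.<-≤-trans l (ℕₚ.≤-trans (ℕₚ.m≤m+n j s) (ℕₚ.m≤n+m (j ℕ.+ s) a)))

  module Filtration (y : K.PS) where

    -- A representing polynomial is not unique when `y` is algebraic; the degree bound belongs to
    -- the chosen representative, and sums and products are formed on representatives.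
    Fil : ℕ → ℕ → K.PS → Set
    Fil D s b = Σ 𝕃.PS λ P → Σ ℕ λ m → Tot D s P × 𝕃.Deg m P × (b ≈ 𝕃.ev m P y)

    Fil-cong : ∀ {D s b b'} → b ≈ b' → Fil D s b → Fil D s b'
    Fil-cong e (P , m , t , d , e') = P , m , t , d , trans (sym e) e'

    Fil-weaken : ∀ {D s E t b} → D ℕ.+ t ℕ.≤ E ℕ.+ s → Fil D s b → Fil E t b
    Fil-weaken {D} {s} {E} {t} le (P , m , w , d , e) = P , m ,
      (λ j → W-weaken {D} {j ℕ.+ s} {E} {j ℕ.+ t} (ℕₚ.≤-trans (ℕₚ.≤-reflexive (lemma D j t))
        (ℕₚ.≤-trans (ℕₚ.+-monoʳ-≤ j le) (ℕₚ.≤-reflexive (≡.sym (lemma E j s))))) (w j)) , d , e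
      where
      lemma : ∀ D j t → D ℕ.+ (j ℕ.+ t) ≡ j ℕ.+ (D ℕ.+ t)
      lemma = ℕ-solve 3 (λ D j t → D ⊞ (j ⊞ t) ≐ j ⊞ (D ⊞ t)) ≡.refl

    Fil-+ : ∀ {D s a b} → Fil D s a → Fil D s b → Fil D s (a + b)
    Fil-+ (P , m , v , d , e) (Q , n , w , d' , e') = (λ j → P j + Q j) , m ⊔ n , (λ j → W-+ (v j) (w j)) ,
      𝕃.Deg-+ {f = P} {Q} (𝕃.Deg-mono {f = P} (ℕₚ.m≤m⊔n m n) d) (𝕃.Deg-mono {f = Q} (ℕₚ.m≤n⊔m m n) d') ,
      trans (+-cong (trans e (𝕃.ev-mono m (m ⊔ n) y (ℕₚ.m≤m⊔n m n) d))
                    (trans e' (𝕃.ev-mono n (m ⊔ n) y (ℕₚ.m≤n⊔m m n) d')))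
            (sym (𝕃.ev-+ (m ⊔ n) P Q y))

    Fil-neg : ∀ {D s a} → Fil D s a → Fil D s (- a)
    Fil-neg (P , m , v , d , e) = (λ j → - P j) , m , (λ j → W-neg {f = P j} (v j)) , 𝕃.Deg-neg {f = P} d ,
      trans (-‿cong e) (sym (𝕃.ev-neg m P y))

    Fil-* : ∀ {D s E t a b} → Fil D s a → Fil E t b → Fil (D ℕ.+ E) (s ℕ.+ t) (a * b)
    Fil-* {D} {s} {E} {t} (P , m , v , d , e) (Q , n , w , d' , e') =
      𝕃.conv P Q , m ℕ.+ n , Tot-* D s E t v w , 𝕃.Deg-* m n d d' , trans (*-cong e e') (sym (𝕃.ev-* m n y d d'))

    Fil-poly : ∀ {D s f} → W D s f → Fil D s f
    Fil-poly {D} {s} {f} w = 𝕃.C f , 0 , tot , 𝕃.Deg-C f , refl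
      where
      tot : Tot D s (𝕃.C f)
      tot zero = w
      tot (suc j) a l = K.refl

    Fil-0 : ∀ {D s} → Fil D s 0#
    Fil-0 = Fil-poly W-0

    Fil-const : ∀ c → Fil 0 0 (K.C c)
    Fil-const c = Fil-poly λ { zero () ; (suc a) l → K.refl }

    Fil-x : Fil 1 0 K.X
    Fil-x = Fil-poly λ { zero () ; (suc zero) (s≤s ()) ; (suc (suc a)) l → K.refl }

    Fil-y : Fil 1 0 y
    Fil-y = 𝕃.X , 1 , tot , 𝕃.Deg-X , sym (𝕃.ev-X 0 y)
      where
      tot : Tot 1 0 𝕃.X
      tot zero a l = K.refl
      tot (suc zero) zero (s≤s ())
      tot (suc zero) (suc a) l = K.refl
      tot (suc (suc j)) a l = K.refl

    Fil-^ : ∀ {D s b} n → Fil D s b → Fil (n ℕ.* D) (n ℕ.* s) (b ^ n)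
    Fil-^ zero w = Fil-const K.1#
    Fil-^ (suc n) w = Fil-* w (Fil-^ n w)

    Fil-∑ : ∀ {D s} n {f : ℕ → K.PS} → (∀ i → i ℕ.< n → Fil D s (f i)) → Fil D s (∑ n f)
    Fil-∑ zero w = Fil-0
    Fil-∑ (suc n) w = Fil-+ (w 0 (s≤s z≤n)) (Fil-∑ n (λ i l → w (suc i) (s≤s l)))

    -- Division by a monic polynomial of Y-degree suc n and total degree suc n having y as a root.
    reduce : ∀ n (H : 𝕃.PS) → (∀ j → j ℕ.< suc n → W (suc n) j (H j)) →
      y ^ suc n + ∑ (suc n) (λ j → H j * y ^ j) ≈ 0# → ∀ {D s b} → Fil D s b →
      Σ 𝕃.PS λ P → (∀ j → j ℕ.< suc n → W D (j ℕ.+ s) (P j)) × (b ≈ ∑ (suc n) (λ j → P j * y ^ j))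
    reduce n H wH root {D} (P , m , t , _ , e) = let (Q , w , e') = go m P t in Q , w , trans e e'
      where
      constant : ∀ c → ∑ (suc n) (λ j → 𝕃.C c j * y ^ j) ≈ c
      constant c = trans (∑-single (suc n) 0 {λ j → 𝕃.C c j * y ^ j} (s≤s z≤n)
        (λ { zero _ ne → ⊥-elim (ne ≡.refl) ; (suc j) _ _ → zeroˡ _ })) (*-identityʳ c)

      go : ∀ m P {s} → Tot D s P →
        Σ 𝕃.PS λ Q → (∀ j → j ℕ.< suc n → W D (j ℕ.+ s) (Q j)) × (𝕃.ev m P y ≈ ∑ (suc n) (λ j → Q j * y ^ j))
      go zero P t = 𝕃.C (P 0) , (λ { zero l → t 0 ; (suc j) l → W-0 }) ,
        sym (constant (P 0))
      go (suc m) P {s} t =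
        let (Q , w , e) = go m (P ∘ suc) (Tot-tail {P = P} t)
            old j = prepend 0# Q j + - (Q n * H j)
        in (λ j → 𝕃.C (P 0) j + old j) , (λ j l → W-+ (first j) (W-+ (previous Q w j l) (W-neg {f = Q n * H j} (last Q w j l)))) , (begin
          P 0 + y * 𝕃.ev m (P ∘ suc) y ≈⟨ +-congˡ (*-congˡ e) ⟩
          P 0 + y * ∑ (suc n) (λ j → Q j * y ^ j)
            ≈⟨ +-cong (sym (constant (P 0)))
                 (trans (sym (+-identityʳ _)) (+-congˡ (sym (trans (-‿cong (zero-mulʳ root)) -0#≈0#)))) ⟩
          ∑ (suc n) (λ j → 𝕃.C (P 0) j * y ^ j) + (y * ∑ (suc n) (λ j → Q j * y ^ j) + - (Q n * (y ^ suc n + ∑ (suc n) (λ j → H j * y ^ j))))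
            ≈⟨ +-congˡ (companion n Q H y) ⟨
          ∑ (suc n) (λ j → 𝕃.C (P 0) j * y ^ j) + ∑ (suc n) (λ j → old j * y ^ j)
            ≈⟨ ∑-+ (suc n) (λ j → 𝕃.C (P 0) j * y ^ j) (λ j → old j * y ^ j) ⟨
          ∑ (suc n) (λ j → 𝕃.C (P 0) j * y ^ j + old j * y ^ j)
            ≈⟨ ∑-cong (suc n) (λ j _ → sym (distribʳ (y ^ j) (𝕃.C (P 0) j) (old j))) ⟩
          ∑ (suc n) (λ j → (𝕃.C (P 0) j + old j) * y ^ j) ∎)
        where
        first : ∀ j → W D (j ℕ.+ s) (𝕃.C (P 0) j)
        first zero = t 0
        first (suc j) = W-0
        previous : ∀ Q → (∀ j → j ℕ.< suc n → W D (j ℕ.+ suc s) (Q j)) → ∀ j → j ℕ.< suc n → W D (j ℕ.+ s) (prepend 0# Q j)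
        previous Q w zero l = W-0
        previous Q w (suc j) (s≤s l) = ≡.subst (λ r → W D r (Q j)) (ℕₚ.+-suc j s) (w j (ℕₚ.m≤n⇒m≤1+n l))
        -- The degree gained from `H j` is what `Q n` has lost by standing at `y^n`: `(D - (n + 1 +
        -- s)) + (n + 1 - j) = D - (j + s)`.
        last : ∀ Q → (∀ j → j ℕ.< suc n → W D (j ℕ.+ suc s) (Q j)) → ∀ j → j ℕ.< suc n → W D (j ℕ.+ s) (Q n * H j)
        last Q w j l = W-weaken {f = Q n * H j}
          (ℕₚ.≤-reflexive (ℕ-solve 4 (λ D n j s → D ⊞ (# 1 ⊞ n) ⊞ (j ⊞ s) ≐ D ⊞ (n ⊞ (# 1 ⊞ s) ⊞ j)) ≡.refl D n j s))
          (W-* D (n ℕ.+ suc s) (suc n) j (w n (ℕₚ.n<1+n n)) (wH j l))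

-- Coding of index pairs, and the pigeonhole principle for parameter vectors.

module _ (M : ℕ) .{{_ : ℕ.NonZero M}} where

  index-/ : ∀ j {a} → a ℕ.< M → (a ℕ.+ j ℕ.* M) DivMod./ M ≡ j
  index-/ j {a} l = ≡.trans (DivMod.+-distrib-/-∣ʳ a (divides j ≡.refl))
    (≡.cong₂ ℕ._+_ (DivMod.m<n⇒m/n≡0 l) (DivMod.m*n/n≡m j M))

  index-% : ∀ j {a} → a ℕ.< M → (a ℕ.+ j ℕ.* M) DivMod.% M ≡ a
  index-% j {a} l = ≡.trans (DivMod.[m+kn]%n≡m%n a j M) (DivMod.m<n⇒m%n≡m l)

module Pigeonhole (F : FiniteField) where
  open Field F

  extend : ∀ {U} → (Fin U → Fin size) → ℕ → Carrier
  extend {U} g i with i ℕ.<? U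
  ... | yes l = el (g (Fin.fromℕ< l))
  ... | no _ = 0#

  extend-toℕ : ∀ {U} (g : Fin U → Fin size) i → extend g (Fin.toℕ i) ≡ el (g i)
  extend-toℕ {U} g i with Fin.toℕ i ℕ.<? U
  ... | yes l = ≡.cong (el ∘ g) (Finₚ.fromℕ<-toℕ i l)
  ... | no nl = ⊥-elim (nl (Finₚ.toℕ<n i))

  private
    fun-ext : ∀ {m n} (f g : Fin m → Fin n) → (∀ i → f i ≡ g i) → Fin.funToFin f ≡ Fin.funToFin g
    fun-ext {zero} f g e = ≡.refl
    fun-ext {suc m} f g e = ≡.cong₂ Fin.combine (e Fin.zero) (fun-ext (f ∘ Fin.suc) (g ∘ Fin.suc) (e ∘ Fin.suc))

  abstract
    -- Siegel's lemma: two of the q^U parameter vectors have the same q^V-valued image.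
    collision : ∀ U V → V ℕ.< U → (Φ : (ℕ → Carrier) → ℕ → Carrier) →
      Σ (ℕ → Carrier) λ ν → Σ (ℕ → Carrier) λ ν′ →
        (Σ ℕ λ i → i ℕ.< U × ¬ (ν i ≈ ν′ i)) × (∀ c → c ℕ.< V → Φ ν c ≈ Φ ν′ c)
    collision U V V<U Φ =
      let Ψ : Fin (size ℕ.^ U) → Fin (size ℕ.^ V)
          Ψ = λ a → Fin.funToFin {V} {size} (λ c → ix (Φ (extend (Fin.finToFun {size} {U} a)) (Fin.toℕ c)))
          (a , b , a<b , e) = Finₚ.pigeonhole (ℕₚ.^-monoʳ-< size 1<size V<U) Ψ
          f = Fin.finToFun {size} {U} a
          g = Fin.finToFun {size} {U} b
          (i , ne) = Finₚ.¬∀⟶∃¬ U (λ i → f i ≡ g i) (λ i → f i Finₚ.≟ g i)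
            (λ same → Finₚ.<⇒≢ a<b (≡.trans (≡.sym (Finₚ.funToFin-finToFin {U} {size} a))
                        (≡.trans (fun-ext f g same) (Finₚ.funToFin-finToFin {U} {size} b))))
      in extend f , extend g ,
         (Fin.toℕ i , Finₚ.toℕ<n i , λ s → ne (el-injective (≡.trans (≡.sym (extend-toℕ f i))
            (≡.trans (≈⇒≡ s) (extend-toℕ g i))))) ,
         λ c l →
           let d = Fin.fromℕ< l
               same : ix (Φ (extend f) (Fin.toℕ d)) ≡ ix (Φ (extend g) (Fin.toℕ d))
               same = ≡.trans (≡.sym (Finₚ.finToFun-funToFin {V} {size} (λ c → ix (Φ (extend f) (Fin.toℕ c))) d))
                        (≡.trans (≡.cong (λ r → Fin.finToFun {size} {V} r d) e)
                          (Finₚ.finToFun-funToFin {V} {size} (λ c → ix (Φ (extend g) (Fin.toℕ c))) d))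
           in ≡.subst (λ c → Φ (extend f) c ≈ Φ (extend g) c) (Finₚ.toℕ-fromℕ< l)
                (reflexive (≡.trans (≡.sym (el-ix _)) (≡.trans (≡.cong el same) (el-ix _))))

-- Functions on a branch: bound for the order of vanishing, independence over Frobenius.

-- A polynomial H(X, Y), monic of degree suc n in Y and of total degree suc n, with a power
-- series root y of degree suc n over the rational functions of X.
record Branch (F : FiniteField) : Set where
  open Weights F
  open RingLemmas K.series
  field
    p h : ℕ
    pr : Prime p
    size≡ : K.size ≡ p ℕ.^ h
    y : K.PS
    n : ℕ
    H : 𝕃.PS
    wH : Tot (suc n) 0 H
    monic : H (suc n) ≈ 1#
    root : 𝕃.ev (suc n) H y ≈ 0#
    independent : ∀ m (P : 𝕃.PS) → (∀ j → j ℕ.< suc n → K.Deg m (P j)) →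
      ∑ (suc n) (λ j → P j * y ^ j) ≈ 0# → ∀ j → j ℕ.< suc n → P j ≈ 0#

module Curve (F : FiniteField) (B : Branch F) where
  open Branch B
  open Weights F
  open K using (series; _≋_; pt; at; size)
  open RingLemmas series
  open Companion series
  open Filtration y
  open +-*-Solver using () renaming (solve to ℕ-solve; _:=_ to _≐_; _:+_ to _⊞_; _:*_ to _⊠_; con to #)

  ∑-at : ∀ m (f : ℕ → K.PS) i → ∑ m f i ≡ K.∑ m (λ j → f j i)
  ∑-at zero f i = ≡.refl
  ∑-at (suc m) f i = ≡.cong (f 0 i K.+_) (∑-at m (f ∘ suc) i)

  truncate : ℕ → K.PS → K.PS
  truncate E f a with a ℕ.≤? E
  ... | yes _ = f a
  ... | no _ = K.0#

  truncate-≤ : ∀ {E a} f → a ℕ.≤ E → truncate E f a ≡ f a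
  truncate-≤ {E} {a} f l with a ℕ.≤? E
  ... | yes _ = ≡.refl
  ... | no nl = ⊥-elim (nl l)

  truncate-> : ∀ {E a} f → E ℕ.< a → truncate E f a ≡ K.0#
  truncate-> {E} {a} f l with a ℕ.≤? E
  ... | yes le = ⊥-elim (ℕₚ.<⇒≱ l le)
  ... | no _ = ≡.refl

  Deg-truncate : ∀ E f → K.Deg E (truncate E f)
  Deg-truncate E f a l = K.reflexive (truncate-> f l)

  wH₀ : ∀ j → j ℕ.< suc n → W (suc n) j (H j)
  wH₀ j _ = ≡.subst (λ r → W (suc n) r (H j)) (ℕₚ.+-identityʳ j) (wH j)

  root-sum : y ^ suc n + ∑ (suc n) (λ j → H j * y ^ j) ≈ 0#
  root-sum = begin
    y ^ suc n + ∑ (suc n) (λ j → H j * y ^ j) ≈⟨ trans (+-comm _ _) (+-congˡ (sym (trans (*-congʳ monic) (*-identityˡ _)))) ⟩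
    ∑ (suc n) (λ j → H j * y ^ j) + H (suc n) * y ^ suc n ≈⟨ ∑-last (suc n) (λ j → H j * y ^ j) ⟨
    ∑ (suc (suc n)) (λ j → H j * y ^ j) ≈⟨ 𝕃.ev-∑ (suc n) H y ⟨
    𝕃.ev (suc n) H y ≈⟨ root ⟩
    0# ∎

  abstract
    normal-form : ∀ {D s b} → Fil D s b →
      Σ 𝕃.PS λ P → (∀ j → j ℕ.< suc n → W D (j ℕ.+ s) (P j)) × (b ≈ ∑ (suc n) (λ j → P j * y ^ j))
    normal-form = reduce n H wH₀ root-sum

  W⇒Deg : ∀ {D s f} → W D s f → K.Deg D f
  W⇒Deg {D} {s} w a l = w a (ℕₚ.<-≤-trans l (ℕₚ.m≤m+n a s))

  Fil-product : ∀ {D j s} (f : K.PS) → K.Deg D f → j ℕ.≤ s → Fil (D ℕ.+ s) 0 (f * y ^ j)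
  Fil-product {D} {j} {s} f d l = Fil-weaken
    (ℕₚ.≤-trans (ℕₚ.+-monoˡ-≤ _ (ℕₚ.+-monoʳ-≤ D (ℕₚ.≤-trans (ℕₚ.≤-reflexive (ℕₚ.*-identityʳ j)) l)))
      (ℕₚ.≤-trans (ℕₚ.≤-reflexive (ℕₚ.+-identityʳ _)) (ℕₚ.m≤m+n _ _)))
    (Fil-* (Fil-poly {D} {0} {f} (λ a l → d a (≡.subst (D ℕ.<_) (ℕₚ.+-identityʳ a) l))) (Fil-^ j Fil-y))

  -- The combination of the monomials X^a y^b (a ≤ E, b ≤ n) with coefficients ν.
  combination : ℕ → K.PS → K.PS
  combination E ν = ∑ (suc n) (λ b → truncate E (λ a → ν (a ℕ.+ b ℕ.* suc E)) * y ^ b)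

  abstract
   Fil-combination : ∀ E ν → Fil (E ℕ.+ n) 0 (combination E ν)
   Fil-combination E ν = Fil-∑ (suc n) λ { b (s≤s l) → Fil-product (truncate E (λ a → ν (a ℕ.+ b ℕ.* suc E))) (Deg-truncate E _) l }

  combination-injective : ∀ E ν ν′ → combination E ν ≈ combination E ν′ →
    ∀ i → i ℕ.< suc n ℕ.* suc E → ν i K.≈ ν′ i
  combination-injective E ν ν′ e i i<U = K.≈-from-sub (K.trans (K.reflexive (≡.sym (≡.cong₂ (λ u v → u K.+ K.- v)
      (value ν) (value ν′)))) (at (independent E P degP zero-combination b b≤n) a))
    where
    a = i DivMod.% suc E
    b = i DivMod./ suc E
    b≤n : b ℕ.< suc n
    b≤n = DivMod.m<n*o⇒m/o<n i<U
    value : ∀ ν → truncate E (λ a → ν (a ℕ.+ b ℕ.* suc E)) a ≡ ν i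
    value ν = ≡.trans (truncate-≤ (λ a → ν (a ℕ.+ b ℕ.* suc E)) (ℕₚ.≤-pred (DivMod.m%n<n i (suc E))))
      (≡.cong ν (≡.sym (DivMod.m≡m%n+[m/n]*n i (suc E))))
    T T′ P : ℕ → K.PS
    T b = truncate E (λ a → ν (a ℕ.+ b ℕ.* suc E))
    T′ b = truncate E (λ a → ν′ (a ℕ.+ b ℕ.* suc E))
    P b = T b + - T′ b
    degP : ∀ j → j ℕ.< suc n → K.Deg E (P j)
    degP j _ = K.Deg-+ {f = T j} (Deg-truncate E _) (K.Deg-neg {f = T′ j} (Deg-truncate E _))
    zero-combination : ∑ (suc n) (λ b → P b * y ^ b) ≈ 0#
    zero-combination = begin
      ∑ (suc n) (λ b → P b * y ^ b)
        ≈⟨ ∑-cong (suc n) (λ b _ → solve 3 (λ t u w → (t :- u) :* w := t :* w :- u :* w) refl (T b) (T′ b) (y ^ b)) ⟩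
      ∑ (suc n) (λ b → T b * y ^ b + - (T′ b * y ^ b)) ≈⟨ ∑-+ (suc n) (λ b → T b * y ^ b) (λ b → - (T′ b * y ^ b)) ⟩
      combination E ν + ∑ (suc n) (λ b → - (T′ b * y ^ b)) ≈⟨ +-cong e (∑-neg (suc n) (λ b → T′ b * y ^ b)) ⟩
      combination E ν′ + - combination E ν′ ≈⟨ -‿inverseʳ _ ⟩
      0# ∎

  *-Ord : ∀ {m} f g → K.Ord m g → K.Ord m (f * g)
  *-Ord {m} f g o i l = K.trans (at (trans (*-congˡ (K.Ord-factor m g o))
    (solve 3 (λ f x g → f :* (x :* g) := x :* (f :* g)) refl f (K.X ^ m) (λ i → g (m ℕ.+ i)))) i) (K.X^*-low m _ i l)

  -- If u b and v b agree in all coordinates but the constant one, then (u − v) b is a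
  -- polynomial in X alone; it vanishes when its degree is less than the order of b.
  coordinates-agree : ∀ {E b} u v (P Q : 𝕃.PS) → E ℕ.< size → K.Ord size b →
    (∀ j → j ℕ.< suc n → K.Deg E (P j)) → (∀ j → j ℕ.< suc n → K.Deg E (Q j)) →
    u * b ≈ ∑ (suc n) (λ j → P j * y ^ j) → v * b ≈ ∑ (suc n) (λ j → Q j * y ^ j) →
    (∀ j → j ℕ.< n → P (suc j) ≈ Q (suc j)) → (u + - v) * b ≈ 0#
  coordinates-agree {E} {b} u v P Q E<q ord dP dQ uP vQ same = trans ub-vb T≈0
    where
    T = P 0 + - Q 0
    ub-vb : (u + - v) * b ≈ T
    ub-vb = begin
      (u + - v) * b ≈⟨ solve 3 (λ u v b → (u :- v) :* b := u :* b :- v :* b) refl u v b ⟩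
      u * b + - (v * b) ≈⟨ +-cong uP (-‿cong vQ) ⟩
      (P 0 * 1# + ∑ n (λ j → P (suc j) * y ^ suc j)) + - (Q 0 * 1# + ∑ n (λ j → Q (suc j) * y ^ suc j))
        ≈⟨ +-congˡ (-‿cong (+-congˡ (∑-cong n (λ j l → *-congʳ (sym (same j l)))))) ⟩
      (P 0 * 1# + ∑ n (λ j → P (suc j) * y ^ suc j)) + - (Q 0 * 1# + ∑ n (λ j → P (suc j) * y ^ suc j))
        ≈⟨ solve 3 (λ u v w → (u :* con (1 , 0) :+ w) :- (v :* con (1 , 0) :+ w) := u :- v) refl (P 0) (Q 0) _ ⟩
      T ∎
    T≈0 : T ≈ 0#
    T≈0 = pt go
      where
      go : ∀ a → T a K.≈ K.0#
      go a with a ℕ.<? size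
      ... | yes l = K.trans (at (sym ub-vb) a) (*-Ord (u + - v) b ord a l)
      ... | no nl = K.Deg-+ {f = P 0} (dP 0 (s≤s z≤n)) (K.Deg-neg {f = Q 0} (dQ 0 (s≤s z≤n))) a
        (ℕₚ.<-≤-trans E<q (ℕₚ.≮⇒≥ nl))

  decode-agree : ∀ M .{{_ : ℕ.NonZero M}} m (P Q : 𝕃.PS) →
    (∀ c → c ℕ.< m ℕ.* M → P (c DivMod./ M) (c DivMod.% M) K.≈ Q (c DivMod./ M) (c DivMod.% M)) →
    ∀ j a → j ℕ.< m → a ℕ.< M → P j a K.≈ Q j a
  decode-agree M m P Q e j a lj la = ≡.subst₂ (λ u v → P u v K.≈ Q u v) (index-/ M j la) (index-% M j la)
    (e (a ℕ.+ j ℕ.* M) (ℕₚ.<-≤-trans (ℕₚ.+-monoˡ-< (j ℕ.* M) la) (ℕₚ.*-monoˡ-≤ M lj)))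

  difference-zero : ∀ u v → u + - v ≈ 0# → u ≈ v
  difference-zero u v z = trans (solve 2 (λ u v → u := (u :- v) :+ v) refl u v) (trans (+-congʳ z) (+-identityˡ v))

  -- A substitute for the norm of `b` down to `k[X]`: counting parameters yields a nonzero
  -- multiplier `u` for which only the constant coordinate of `u b` is left, a polynomial in `X` of
  -- degree at most `(n + 1)(n + D)`. Order `q` makes it zero, and then `b` is zero because series
  -- form a domain.
  order-bound : ∀ {D b} → suc n ℕ.* (n ℕ.+ D) ℕ.< size → Fil D 0 b → K.Ord size b → b ≈ 0#
  order-bound {D} {b} small fb ord = K.≋-stable λ nb → clash nb (Pigeonhole.collision F (suc n ℕ.* suc E) (n ℕ.* M) fewer Φ)
    where
    -- The least value for which the `(n + 1)(E + 1)` parameters outnumber the `n (E + n + D + 1)`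
    -- coefficients to be matched.
    E = n ℕ.* (n ℕ.+ D)
    N = E ℕ.+ n ℕ.+ D
    M = suc N
    coords : (ℕ → K.Carrier) → 𝕃.PS
    coords ν = proj₁ (normal-form (Fil-* (Fil-combination E ν) fb))
    coords-deg : ∀ ν j → j ℕ.< suc n → K.Deg N (coords ν j)
    coords-deg ν j l = W⇒Deg {N} {j ℕ.+ 0} (proj₁ (proj₂ (normal-form (Fil-* (Fil-combination E ν) fb))) j l)
    coords-eq : ∀ ν → combination E ν * b ≈ ∑ (suc n) (λ j → coords ν j * y ^ j)
    coords-eq ν = proj₂ (proj₂ (normal-form (Fil-* (Fil-combination E ν) fb)))
    Φ : (ℕ → K.Carrier) → ℕ → K.Carrier
    Φ ν c = coords ν (suc (c DivMod./ M)) (c DivMod.% M)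
    fewer : n ℕ.* M ℕ.< suc n ℕ.* suc E
    fewer = s≤s (ℕₚ.≤-reflexive (ℕ-solve 3 (λ n e d → n ⊠ (# 1 ⊞ (e ⊞ n ⊞ d)) ≐ n ⊠ (n ⊞ d) ⊞ n ⊠ (# 1 ⊞ e)) ≡.refl n E D))
    N<q : N ℕ.< size
    N<q = ≡.subst (ℕ._< size) (ℕ-solve 2 (λ n d → (# 1 ⊞ n) ⊠ (n ⊞ d) ≐ n ⊠ (n ⊞ d) ⊞ n ⊞ d) ≡.refl n D) small

    clash : ¬ (b ≈ 0#) →
      (Σ (ℕ → K.Carrier) λ ν → Σ (ℕ → K.Carrier) λ ν′ → (Σ ℕ λ i → i ℕ.< suc n ℕ.* suc E × ¬ (ν i K.≈ ν′ i)) ×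
        (∀ c → c ℕ.< n ℕ.* M → Φ ν c K.≈ Φ ν′ c)) → ⊥
    clash nb (ν , ν′ , (i , i<U , ne) , e) = ne (combination-injective E ν ν′
      (K.≋-stable λ ns → nb (K.series-domain
        (coordinates-agree (combination E ν) (combination E ν′) (coords ν) (coords ν′) N<q ord
          (coords-deg ν) (coords-deg ν′) (coords-eq ν) (coords-eq ν′) same)
        (λ z → ns (difference-zero (combination E ν) (combination E ν′) z)))) i i<U)
      where
      same : ∀ j → j ℕ.< n → coords ν (suc j) ≈ coords ν′ (suc j)
      same j j<n = pt go
        where
        go : ∀ a → coords ν (suc j) a K.≈ coords ν′ (suc j) a
        go a with a ℕ.<? M
        ... | no nl = K.trans (coords-deg ν (suc j) (s≤s j<n) a (ℕₚ.≮⇒≥ nl))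
                              (K.sym (coords-deg ν′ (suc j) (s≤s j<n) a (ℕₚ.≮⇒≥ nl)))
        ... | yes l = decode-agree M n (coords ν ∘ suc) (coords ν′ ∘ suc) e j a j<n l

  module Fr = FrobeniusSeries K.k pr (K.char p h size≡)

  mul-frobenius : ∀ f g t s → t ℕ.< size →
    (f * g ^ size) (t ℕ.+ size ℕ.* s) K.≈ K.∑ (suc s) (λ i → f (t ℕ.+ size ℕ.* (s ∸ i)) K.* g i)
  mul-frobenius f g t s l = K.trans
    (≡.subst (λ q → t ℕ.< q → (f * g ^ q) (t ℕ.+ q ℕ.* s) K.≈ K.∑ (suc s) (λ i → f (t ℕ.+ q ℕ.* (s ∸ i)) K.* (g i K.^ q)))
      (≡.sym size≡) (Fr.mul-power-coefficient h f g t s) l)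
    (K.∑-cong (suc s) (λ i _ → K.*-congˡ {f (t ℕ.+ size ℕ.* (s ∸ i))} (K.fermat (g i))))

  -- The series X^l y^j stay independent over Fil D 0 after applying the Frobenius, because
  -- elements of Fil D 0 are determined by their coefficients below size.
  frobenius-independent : ∀ {D} → suc n ℕ.* (n ℕ.+ D) ℕ.< size → ∀ M (c : ℕ → ℕ → K.PS) →
    (∀ j l → j ℕ.< suc n → l ℕ.< suc M → Fil D 0 (c j l)) →
    ∑ (suc n) (λ j → ∑ (suc M) (λ l → c j l * (K.X ^ l * y ^ j) ^ size)) ≈ 0# →
    ∀ j l → j ℕ.< suc n → l ℕ.< suc M → c j l ≈ 0#
  frobenius-independent {D} small M c fc e j l j≤n l≤M = pt λ t → K.trans (K.sym (poly-coefficient (λ l → c j l t) l l≤M))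
      (at (independent M (λ j → poly (λ l → c j l t)) (λ j _ → Deg-poly (λ l → c j l t)) (pt λ s → K.trans (K.sym (E-at t s)) (vanish (suc s) s (ℕₚ.n<1+n s) t)) j j≤n) l)
    where
    mono : ℕ → ℕ → K.PS
    mono j l = K.X ^ l * y ^ j
    -- For fixed `s` this lists the coefficients of a combination of the `c j l` with constant
    -- multipliers; for fixed `t`, those of a polynomial in `X` and `y`.
    E : ℕ → ℕ → K.Carrier
    E t s = K.∑ (suc n) (λ j → K.∑ (suc M) (λ l → c j l t K.* mono j l s))

    poly : (ℕ → K.Carrier) → K.PS
    poly d = ∑ (suc M) (λ l → K.C (d l) * K.X ^ l)

    Deg-∑ : ∀ {m} N (f : ℕ → K.PS) → (∀ i → i ℕ.< N → K.Deg m (f i)) → K.Deg m (∑ N f)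
    Deg-∑ zero f d a l = K.refl
    Deg-∑ (suc N) f d = K.Deg-+ {f = f 0} (d 0 (s≤s z≤n)) (Deg-∑ N (f ∘ suc) (λ i l → d (suc i) (s≤s l)))

    Deg-poly : ∀ d → K.Deg M (poly d)
    Deg-poly d = Deg-∑ (suc M) (λ l → K.C (d l) * K.X ^ l) (λ { l (s≤s le) →
      K.Deg-mono {f = K.C (d l) * K.X ^ l} le (K.Deg-* 0 l (K.Deg-C (d l)) (K.Deg-X^ l)) })

    poly-coefficient : ∀ d l → l ℕ.< suc M → poly d l K.≈ d l
    poly-coefficient d l l≤M = K.trans (K.reflexive (∑-at (suc M) (λ l → K.C (d l) * K.X ^ l) l))
      (K.trans (K.∑-single (suc M) l l≤M (λ i _ ne → K.trans (K.C-conv (d i) (K.X ^ i) l) (K.zero-mulʳ (off i ne))))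
        (K.trans (K.C-conv (d l) (K.X ^ l) l) (K.trans (K.*-congˡ (K.X^-top l)) (K.*-identityʳ _))))
      where
      off : ∀ i → i ≢ l → (K.X ^ i) l K.≈ K.0#
      off i ne with i ℕ.<? l
      ... | yes i<l = K.Deg-X^ i l i<l
      ... | no nl = K.trans (at (sym (*-identityʳ (K.X ^ i))) l) (K.X^*-low i 1# l (ℕₚ.≤∧≢⇒< (ℕₚ.≮⇒≥ nl) (ne ∘ ≡.sym)))

    E-at : ∀ t s → E t s K.≈ ∑ (suc n) (λ j → poly (λ l → c j l t) * y ^ j) s
    E-at t s = K.sym (K.trans (at (∑-cong (suc n) (λ j _ → expand j)) s)
      (K.trans (K.reflexive (∑-at (suc n) (λ j → ∑ (suc M) (λ l → K.C (c j l t) * mono j l)) s))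
        (K.∑-cong (suc n) (λ j _ → K.trans (K.reflexive (∑-at (suc M) (λ l → K.C (c j l t) * mono j l) s))
          (K.∑-cong (suc M) (λ l _ → K.C-conv (c j l t) (mono j l) s))))))
      where
      expand : ∀ j → poly (λ l → c j l t) * y ^ j ≈ ∑ (suc M) (λ l → K.C (c j l t) * mono j l)
      expand j = trans (sym (∑-*ʳ (suc M) (y ^ j) (λ l → K.C (c j l t) * K.X ^ l)))
        (∑-cong (suc M) (λ l _ → *-assoc (K.C (c j l t)) (K.X ^ l) (y ^ j)))

    -- The coefficient of `X^(t + q s)`: the `q`-th powers are series in `X^q` with unchanged
    -- coefficients.
    convolution : ∀ t s → t ℕ.< size → K.∑ (suc s) (λ i → E (t ℕ.+ size ℕ.* (s ∸ i)) i) K.≈ K.0#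
    convolution t s l = K.begin
      K.∑ (suc s) (λ i → E (t ℕ.+ size ℕ.* (s ∸ i)) i)
        K.≈⟨ K.∑-swap (suc s) (suc n) (λ i j → K.∑ (suc M) (λ l → c j l (t ℕ.+ size ℕ.* (s ∸ i)) K.* mono j l i)) ⟩
      K.∑ (suc n) (λ j → K.∑ (suc s) (λ i → K.∑ (suc M) (λ l → c j l (t ℕ.+ size ℕ.* (s ∸ i)) K.* mono j l i)))
        K.≈⟨ K.∑-cong (suc n) (λ j _ → K.∑-swap (suc s) (suc M) (λ i l → c j l (t ℕ.+ size ℕ.* (s ∸ i)) K.* mono j l i)) ⟩
      K.∑ (suc n) (λ j → K.∑ (suc M) (λ l → K.∑ (suc s) (λ i → c j l (t ℕ.+ size ℕ.* (s ∸ i)) K.* mono j l i)))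
        K.≈⟨ K.∑-cong (suc n) (λ j _ → K.∑-cong (suc M) (λ l′ _ → mul-frobenius (c j l′) (mono j l′) t s l)) ⟨
      K.∑ (suc n) (λ j → K.∑ (suc M) (λ l → (c j l * mono j l ^ size) (t ℕ.+ size ℕ.* s)))
        K.≈⟨ K.∑-cong (suc n) {λ j → ∑ (suc M) (λ l → c j l * mono j l ^ size) (t ℕ.+ size ℕ.* s)}
               (λ j _ → K.reflexive (∑-at (suc M) (λ l → c j l * mono j l ^ size) (t ℕ.+ size ℕ.* s))) ⟨
      K.∑ (suc n) (λ j → ∑ (suc M) (λ l → c j l * mono j l ^ size) (t ℕ.+ size ℕ.* s))
        K.≈⟨ K.reflexive (∑-at (suc n) (λ j → ∑ (suc M) (λ l → c j l * mono j l ^ size)) _) ⟨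
      ∑ (suc n) (λ j → ∑ (suc M) (λ l → c j l * mono j l ^ size)) (t ℕ.+ size ℕ.* s) K.≈⟨ at e _ ⟩
      K.0# K.∎

    -- Once all earlier rows are zero, the coefficient at `t + q s` is `E t s` alone. Row `s`
    -- therefore vanishes to order `q`, and `order-bound` removes it entirely.
    vanish : ∀ s i → i ℕ.< s → ∀ t → E t i K.≈ K.0#
    vanish (suc s) i (s≤s i≤s) with i ℕ.≟ s
    ... | no ne = vanish s i (ℕₚ.≤∧≢⇒< i≤s ne)
    ... | yes ≡.refl = λ t → K.trans (K.sym (row-at t)) (at (order-bound small Fil-row low) t)
      where
      row : K.PS
      row = ∑ (suc n) (λ j → ∑ (suc M) (λ l → K.C (mono j l s) * c j l))
      row-at : ∀ t → row t K.≈ E t s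
      row-at t = K.trans (K.reflexive (∑-at (suc n) (λ j → ∑ (suc M) (λ l → K.C (mono j l s) * c j l)) t))
        (K.∑-cong (suc n) (λ j _ → K.trans (K.reflexive (∑-at (suc M) (λ l → K.C (mono j l s) * c j l) t))
          (K.∑-cong (suc M) (λ l _ → K.trans (K.C-conv (mono j l s) (c j l) t) (K.*-comm _ _)))))
      Fil-row : Fil D 0 row
      Fil-row = Fil-∑ (suc n) (λ j j≤n → Fil-∑ (suc M) (λ l l≤M → Fil-* (Fil-const (mono j l s)) (fc j l j≤n l≤M)))
      low : K.Ord size row
      low t t<q = K.trans (row-at t) (K.begin
        E t s K.≈⟨ K.reflexive (≡.cong (λ r → E r s) (≡.sym (≡.trans (≡.cong (λ u → t ℕ.+ size ℕ.* u) (ℕₚ.n∸n≡0 s))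
                     (≡.trans (≡.cong (t ℕ.+_) (ℕₚ.*-zeroʳ size)) (ℕₚ.+-identityʳ t))))) ⟩
        E (t ℕ.+ size ℕ.* (s ∸ s)) s K.≈⟨ K.+-identityˡ _ ⟨
        K.0# K.+ E (t ℕ.+ size ℕ.* (s ∸ s)) s
          K.≈⟨ K.+-congʳ (K.∑-zero s (λ i l → vanish s i l (t ℕ.+ size ℕ.* (s ∸ i)))) ⟨
        K.∑ s (λ i → E (t ℕ.+ size ℕ.* (s ∸ i)) i) K.+ E (t ℕ.+ size ℕ.* (s ∸ s)) s
          K.≈⟨ K.∑-last s (λ i → E (t ℕ.+ size ℕ.* (s ∸ i)) i) ⟨
        K.∑ (suc s) (λ i → E (t ℕ.+ size ℕ.* (s ∸ i)) i) K.≈⟨ convolution t s t<q ⟩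
        K.0# K.∎)

-- Auxiliary functions of two points of the curve, and their specialisations.

-- Vectors (c₀, …, c_n) of series in L stand for ∑ c_j(L) Z^j modulo H(X + L, Z); ζ is
-- multiplication by Z.
module Operators (F : FiniteField) (B : Branch F) where
  open Branch B
  open Curve F B
  open Weights F
  open K using (series; _≋_; pt; at; size)
  open RingLemmas series
  open Companion series
  open Filtration y
  open Translation series
  module 𝕃R = RingLemmas 𝕃.series
  open +-*-Solver using () renaming (solve to ℕ-solve; _:=_ to _≐_; _:+_ to _⊞_; _:*_ to _⊠_; con to #)

  Vec : Set
  Vec = ℕ → 𝕃.PS

  -- f(X + L) as a polynomial in L
  taylor : ℕ → K.PS → 𝕃.PS
  taylor m f = translate K.X m (K.C ∘ f)

  taylor-0 : ∀ m f → K.Deg m f → taylor m f 0 ≈ f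
  taylor-0 zero f d = pt λ { zero → K.refl ; (suc i) → K.sym (d (suc i) (s≤s z≤n)) }
  taylor-0 (suc m) f d = begin
    K.C (f 0) + ((𝕃.C K.X 𝕃R.+ 𝕃.X) 𝕃R.* taylor m (f ∘ suc)) 0 ≈⟨ +-congˡ (shift-at-0 K.X (taylor m (f ∘ suc))) ⟩
    K.C (f 0) + K.X * taylor m (f ∘ suc) 0 ≈⟨ +-congˡ (*-congˡ (taylor-0 m (f ∘ suc) (K.Deg-tail {f = f} d))) ⟩
    K.C (f 0) + K.X * (f ∘ suc) ≈⟨ K.head-tail f ⟨
    f ∎

  Fil-translate : ∀ {D s} x m f → Fil 1 0 x → (∀ l → Fil D (s ℕ.+ l) (f l)) → ∀ l → Fil D (s ℕ.+ l) (translate x m f l)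
  Fil-translate {D} x m f fx = go m f
    where
    constant : ∀ {s} f → (∀ l → Fil D (s ℕ.+ l) (f l)) → ∀ l → Fil D (s ℕ.+ l) (𝕃.C (f 0) l)
    constant f w zero = w 0
    constant f w (suc l) = Fil-0
    go : ∀ m {s} f → (∀ l → Fil D (s ℕ.+ l) (f l)) → ∀ l → Fil D (s ℕ.+ l) (translate x m f l)
    go zero f w l = constant f w l
    go (suc m) {s} f w l = Fil-+ (constant f w l) (shifted l)
      where
      T = translate x m (f ∘ suc)
      rec : ∀ l → Fil D (suc s ℕ.+ l) (T l)
      rec = go m (f ∘ suc) (λ l → ≡.subst (λ r → Fil D r (f (suc l))) (ℕₚ.+-suc s l) (w (suc l)))
      times-x : ∀ l → Fil D (s ℕ.+ l) (x * T l)
      times-x l = Fil-weaken (ℕₚ.≤-reflexive (ℕ-solve 3 (λ D s l → # 1 ⊞ D ⊞ (s ⊞ l) ≐ D ⊞ (# 1 ⊞ s ⊞ l)) ≡.refl D s l)) (Fil-* fx (rec l))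
      shifted : ∀ l → Fil D (s ℕ.+ l) (((𝕃.C x 𝕃R.+ 𝕃.X) 𝕃R.* T) l)
      shifted zero = Fil-cong (sym (shift-at-0 x T)) (times-x 0)
      shifted (suc l) = Fil-cong (sym (shift-at-suc x T l))
        (Fil-+ (times-x (suc l)) (≡.subst (λ r → Fil D r (T l)) (≡.sym (ℕₚ.+-suc s l)) (rec l)))

  Fil-taylor : ∀ {D s} m f → W D s f → ∀ l → Fil D (s ℕ.+ l) (taylor m f l)
  Fil-taylor {D} {s} m f w = Fil-translate K.X m (K.C ∘ f) Fil-x λ l → Fil-poly λ where
    zero lt → w l (≡.subst (D ℕ.<_) (ℕₚ.+-comm s l) lt)
    (suc a) lt → K.refl

  Fil-conv : ∀ D u E v {f g} → (∀ l → Fil D (u ℕ.+ l) (f l)) → (∀ l → Fil E (v ℕ.+ l) (g l)) →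
    ∀ l → Fil (D ℕ.+ E) (u ℕ.+ v ℕ.+ l) (𝕃.conv f g l)
  Fil-conv D u E v {f} {g} ff fg zero = ≡.subst (λ r → Fil (D ℕ.+ E) r (f 0 * g 0))
    (ℕ-solve 2 (λ u v → u ⊞ # 0 ⊞ (v ⊞ # 0) ≐ u ⊞ v ⊞ # 0) ≡.refl u v) (Fil-* (ff 0) (fg 0))
  Fil-conv D u E v {f} {g} ff fg (suc l) = Fil-+
    (≡.subst (λ r → Fil (D ℕ.+ E) r (f 0 * g (suc l)))
      (ℕ-solve 3 (λ u v l → u ⊞ # 0 ⊞ (v ⊞ (# 1 ⊞ l)) ≐ u ⊞ v ⊞ (# 1 ⊞ l)) ≡.refl u v l) (Fil-* (ff 0) (fg (suc l))))
    (≡.subst (λ r → Fil (D ℕ.+ E) r (𝕃.conv (f ∘ suc) g l))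
      (ℕ-solve 3 (λ u v l → (# 1 ⊞ u) ⊞ v ⊞ l ≐ u ⊞ v ⊞ (# 1 ⊞ l)) ≡.refl u v l)
      (Fil-conv D (suc u) E v (λ l → ≡.subst (λ r → Fil D r (f (suc l))) (ℕₚ.+-suc u l) (ff (suc l))) fg l))

  -- A representative of negative total degree has no terms; through this a grading bounds the
  -- `L`-degree.
  Fil-negative : ∀ {D s b} → D ℕ.< s → Fil D s b → b ≈ 0#
  Fil-negative {D} {s} l (P , m , t , _ , e) = trans e (𝕃.ev-zero m y (𝕃.pt λ j → pt λ a →
    t j a (ℕₚ.<-≤-trans l (ℕₚ.≤-trans (ℕₚ.m≤n+m s j) (ℕₚ.m≤n+m (j ℕ.+ s) a)))))

  -- The coefficients of `H (X + L, Z)` in `Z`, from which `ζ` forms the companion matrix.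
  η : ℕ → 𝕃.PS
  η j = taylor (suc n) (H j)

  ζ : Vec → Vec
  ζ c j = prepend 𝕃R.0# c j 𝕃R.+ 𝕃R.- (c n 𝕃R.* η j)

  -- Total degree in four quantities: `L` and `Z` count as one alongside `X` and `y`, so that
  -- `H (X + L, Z)` has total degree `n + 1`.
  Graded : ℕ → ℕ → Vec → Set
  Graded D s c = ∀ j l → j ℕ.< suc n → Fil D (s ℕ.+ (j ℕ.+ l)) (c j l)

  Graded-weaken : ∀ {D s E t c} → D ℕ.+ t ℕ.≤ E ℕ.+ s → Graded D s c → Graded E t c
  Graded-weaken {D} {s} {E} {t} le gr j l j≤n = Fil-weaken (ℕₚ.≤-trans (ℕₚ.≤-reflexive (≡.sym (ℕₚ.+-assoc D t (j ℕ.+ l))))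
    (ℕₚ.≤-trans (ℕₚ.+-monoˡ-≤ (j ℕ.+ l) le) (ℕₚ.≤-reflexive (ℕₚ.+-assoc E s (j ℕ.+ l))))) (gr j l j≤n)

  Graded⇒Deg : ∀ {D s c} → Graded D s c → ∀ j → j ℕ.< suc n → 𝕃.Deg D (c j)
  Graded⇒Deg {D} {s} gr j j≤n l D<l = Fil-negative (ℕₚ.<-≤-trans D<l (ℕₚ.≤-trans (ℕₚ.m≤n+m l j) (ℕₚ.m≤n+m (j ℕ.+ l) s))) (gr j l j≤n)

  -- Reduction by a monic polynomial of total degree `n + 1` does not raise the degree, so only the
  -- factor `Z` counts.
  Graded-ζ : ∀ {D s c} → Graded D s c → Graded (suc D) s (ζ c)
  Graded-ζ {D} {s} {c} gr j l j≤n = Fil-+ (previous j j≤n) (Fil-neg (Fil-weaken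
      (ℕₚ.≤-reflexive (ℕ-solve 5 (λ D n s j l → D ⊞ (# 1 ⊞ n) ⊞ (s ⊞ (j ⊞ l)) ≐ # 1 ⊞ D ⊞ (s ⊞ n ⊞ j ⊞ l)) ≡.refl D n s j l))
      (Fil-conv D (s ℕ.+ n) (suc n) j
        (λ l → ≡.subst (λ r → Fil D r (c n l)) (≡.sym (ℕₚ.+-assoc s n l)) (gr n l (ℕₚ.n<1+n n)))
        (Fil-taylor (suc n) (H j) (wH₀ j j≤n)) l)))
    where
    previous : ∀ j → j ℕ.< suc n → Fil (suc D) (s ℕ.+ (j ℕ.+ l)) (prepend 𝕃R.0# c j l)
    previous zero _ = Fil-0
    previous (suc j) (s≤s j≤n) = Fil-weaken
      (ℕₚ.≤-reflexive (ℕ-solve 4 (λ D s j l → D ⊞ (s ⊞ (# 1 ⊞ j ⊞ l)) ≐ # 1 ⊞ D ⊞ (s ⊞ (j ⊞ l))) ≡.refl D s j l))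
      (gr j l (ℕₚ.m≤n⇒m≤1+n j≤n))

  infixl 7 _•_
  _•_ : K.PS → Vec → Vec
  (e • c) j l = e * c j l

  _⊹_ : Vec → Vec → Vec
  (c ⊹ d) j = c j 𝕃R.+ d j

  -- (P(Z) − P(y)) / (Z − y) applied to c
  quotient : ℕ → 𝕃.PS → Vec → Vec
  quotient zero P c j = 𝕃R.0#
  quotient (suc m) P c = (𝕃.ev m (P ∘ suc) y • c) ⊹ ζ (quotient m (P ∘ suc) c)

  -- A divided difference has total degree one less than the polynomial, whence `suc t`; each `ζ` in
  -- Horner's scheme is paid for by one dropped coefficient.
  Graded-quotient : ∀ {E t D s c} m P → Tot E t P → 𝕃.Deg m P → Graded D s c →
    Graded (E ℕ.+ D) (suc t ℕ.+ s) (quotient m P c)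
  Graded-quotient zero P tot d gr j l j≤n = Fil-0
  Graded-quotient {E} {t} {D} {s} {c} (suc m) P tot d gr j l j≤n = Fil-+
    (≡.subst (λ r → Fil (E ℕ.+ D) r (e * c j l)) (≡.sym (ℕₚ.+-assoc (suc t) s (j ℕ.+ l)))
      (Fil-* (P ∘ suc , m , Tot-tail {P = P} tot , 𝕃.Deg-tail {f = P} d , refl) (gr j l j≤n)))
    (Graded-weaken {suc (E ℕ.+ D)} {suc (suc t) ℕ.+ s} {E ℕ.+ D} {suc t ℕ.+ s} {ζ (quotient m (P ∘ suc) c)}
      (ℕₚ.≤-reflexive (≡.sym (ℕₚ.+-suc (E ℕ.+ D) (suc t ℕ.+ s))))
      (Graded-ζ {E ℕ.+ D} {suc (suc t) ℕ.+ s} (Graded-quotient {E} {suc t} {D} {s} m (P ∘ suc) (Tot-tail {P = P} tot) (𝕃.Deg-tail {f = P} d) gr)) j l j≤n)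
    where e = 𝕃.ev m (P ∘ suc) y

  -- A functional on vectors turning ζ into multiplication by z turns quotient m P into
  -- multiplication by a divided difference of P.
  quotient-functional : (φ : Vec → K.PS) (z : K.PS) (G : Vec → Set) →
    (∀ c d → φ (c ⊹ d) ≈ φ c + φ d) → (∀ e c → φ (e • c) ≈ e * φ c) → φ (λ _ → 𝕃R.0#) ≈ 0# →
    (∀ c → G c → φ (ζ c) ≈ z * φ c) →
    ∀ m P c → (∀ i → i ℕ.< m → G (quotient (m ∸ suc i) (λ j → P (suc i ℕ.+ j)) c)) →
    φ (quotient m P c) ≈ 𝕃.dd m P y z * φ c
  quotient-functional φ z G add scale φ0 mul zero P c g = trans φ0 (sym (zeroˡ _))
  quotient-functional φ z G add scale φ0 mul (suc m) P c g = begin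
    φ ((e • c) ⊹ ζ (quotient m P′ c)) ≈⟨ add (e • c) (ζ (quotient m P′ c)) ⟩
    φ (e • c) + φ (ζ (quotient m P′ c)) ≈⟨ +-cong (scale e c) (mul (quotient m P′ c) (g 0 (s≤s z≤n))) ⟩
    e * φ c + z * φ (quotient m P′ c)
      ≈⟨ +-congˡ (*-congˡ (quotient-functional φ z G add scale φ0 mul m P′ c (λ i l → g (suc i) (s≤s l)))) ⟩
    e * φ c + z * (𝕃.dd m P′ y z * φ c)
      ≈⟨ solve 4 (λ e f z d → e :* f :+ z :* (d :* f) := (e :+ z :* d) :* f) refl e (φ c) z (𝕃.dd m P′ y z) ⟩
    𝕃.dd (suc m) P y z * φ c ∎
    where
    P′ = P ∘ suc
    e = 𝕃.ev m P′ y

module Functionals (F : FiniteField) (B : Branch F) where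
  open Branch B
  open Curve F B
  open Operators F B
  open Weights F
  open K using (series; _≋_; pt; at; size)
  open RingLemmas series
  open Companion series
  open Filtration y
  open Translation series

  -- The Frobenius point: `L` becomes `X^q - X`, so that `X + L` becomes `X^q`, and `Z` becomes
  -- `y^q`.
  λq zq : K.PS
  λq = K.X ^ size + - K.X
  zq = y ^ size

  -- The coefficients of `f` lie in the field with `q` elements, so the `q`-th power acts on the
  -- variable only.
  frobenius-polynomial : ∀ m f → K.Deg m f → f ^ size ≈ 𝕃.ev m (K.C ∘ f) (K.X ^ size)
  frobenius-polynomial m f d = go m f d
    where
    head-tail-q : ∀ f → f ^ size ≈ K.C (f 0) + K.X ^ size * (f ∘ suc) ^ size
    head-tail-q f = trans
      (≡.subst (λ q → f ^ q ≈ K.C (f 0 K.^ q) + K.X ^ q * (f ∘ suc) ^ q) (≡.sym size≡) (Fr.power-head-tail h f))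
      (+-congʳ (K.C-cong (K.fermat (f 0))))
    go : ∀ m f → K.Deg m f → f ^ size ≈ 𝕃.ev m (K.C ∘ f) (K.X ^ size)
    go zero f d = begin
      f ^ size ≈⟨ ^-congˡ size (pt λ { zero → K.refl ; (suc i) → d (suc i) (s≤s z≤n) }) ⟩
      K.C (f 0) ^ size ≈⟨ K.C-^ (f 0) size ⟨
      K.C (f 0 K.^ size) ≈⟨ K.C-cong (K.fermat (f 0)) ⟩
      K.C (f 0) ∎
    go (suc m) f d = trans (head-tail-q f) (+-congˡ (*-congˡ (go m (f ∘ suc) (K.Deg-tail {f = f} d))))

  frobenius-+ : ∀ a b → (a + b) ^ size ≈ a ^ size + b ^ size
  frobenius-+ a b = ≡.subst (λ q → (a + b) ^ q ≈ a ^ q + b ^ q) (≡.sym size≡) (Fr.FS.frobenius^ h a b)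

  frobenius-∑ : ∀ m (f : ℕ → K.PS) → ∑ m f ^ size ≈ ∑ m (λ i → f i ^ size)
  frobenius-∑ m f = ≡.subst (λ q → ∑ m f ^ q ≈ ∑ m (λ i → f i ^ q)) (≡.sym size≡) (Fr.FS.frobenius^-∑ h m f)

  ^-comm : ∀ a m k → (a ^ m) ^ k ≈ (a ^ k) ^ m
  ^-comm a m k = trans (^-assocʳ a m k) (trans (reflexive (≡.cong (a ^_) (ℕₚ.*-comm m k))) (sym (^-assocʳ a k m)))

  g : ℕ → K.PS
  g j = 𝕃.ev (suc n) (K.C ∘ H j) (K.X ^ size)

  Deg-H : ∀ j → K.Deg (suc n) (H j)
  Deg-H j = W⇒Deg {suc n} {j ℕ.+ 0} (wH j)

  root-frobenius : zq ^ suc n + ∑ (suc n) (λ j → g j * zq ^ j) ≈ 0#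
  root-frobenius = begin
    zq ^ suc n + ∑ (suc n) (λ j → g j * zq ^ j)
      ≈⟨ +-cong (^-comm y size (suc n)) (∑-cong (suc n) (λ j _ → trans
           (*-cong (sym (frobenius-polynomial (suc n) (H j) (Deg-H j))) (^-comm y size j)) (sym (^-distrib-* (H j) (y ^ j) size)))) ⟩
    (y ^ suc n) ^ size + ∑ (suc n) (λ j → (H j * y ^ j) ^ size)
      ≈⟨ trans (frobenius-+ (y ^ suc n) _) (+-congˡ (frobenius-∑ (suc n) (λ j → H j * y ^ j))) ⟨
    (y ^ suc n + ∑ (suc n) (λ j → H j * y ^ j)) ^ size ≈⟨ ^-congˡ size root-sum ⟩
    0# ^ size ≈⟨ 0^ size K.0<size ⟩
    0# ∎

  -- Specialisation at the Frobenius point; `E` has to dominate the `L`-degrees that occur.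
  evS : ℕ → Vec → K.PS
  evS E c = ∑ (suc n) (λ j → 𝕃.ev E (c j) λq * zq ^ j)

  evS-+ : ∀ E c d → evS E (c ⊹ d) ≈ evS E c + evS E d
  evS-+ E c d = trans
    (∑-cong (suc n) {λ j → 𝕃.ev E (c j 𝕃R.+ d j) λq * zq ^ j} (λ j _ → trans (*-congʳ (𝕃.ev-+ E (c j) (d j) λq)) (distribʳ (zq ^ j) (𝕃.ev E (c j) λq) (𝕃.ev E (d j) λq))))
    (∑-+ (suc n) (λ j → 𝕃.ev E (c j) λq * zq ^ j) (λ j → 𝕃.ev E (d j) λq * zq ^ j))

  evS-• : ∀ E e c → evS E (e • c) ≈ e * evS E c
  evS-• E e c = trans
    (∑-cong (suc n) {λ j → 𝕃.ev E (λ i → e * c j i) λq * zq ^ j} (λ j _ → trans (*-congʳ (𝕃.ev-scale E e (c j) λq)) (*-assoc e (𝕃.ev E (c j) λq) (zq ^ j))))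
    (∑-*ˡ (suc n) e (λ j → 𝕃.ev E (c j) λq * zq ^ j))

  evS-0 : ∀ E → evS E (λ _ → 𝕃R.0#) ≈ 0#
  evS-0 E = ∑-zero (suc n) {λ j → 𝕃.ev E 𝕃R.0# λq * zq ^ j} (λ j _ → zero-mulˡ (𝕃.ev-zero E λq 𝕃R.refl))

  X+λq : K.X + λq ≈ K.X ^ size
  X+λq = solve 2 (λ x q → x :+ (q :- x) := q) refl K.X (K.X ^ size)

  -- The specialisation respects reduction modulo `H (X + L, Z)`, which becomes
  -- `H (X^q, y^q) = H (X, y)^q = 0`.
  evS-ζ : ∀ {D} E c → D ℕ.+ suc n ℕ.≤ E → Graded D 0 c → evS E (ζ c) ≈ zq * evS E c
  evS-ζ {D} E c le gr = begin
    evS E (ζ c) ≈⟨ ∑-cong (suc n) {λ j → 𝕃.ev E (ζ c j) λq * zq ^ j} (λ j _ → *-congʳ (coordinate j)) ⟩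
    ∑ (suc n) (λ j → (prepend 0# a j + - (a n * g j)) * zq ^ j) ≈⟨ companion n a g zq ⟩
    zq * evS E c + - (a n * (zq ^ suc n + ∑ (suc n) (λ j → g j * zq ^ j)))
      ≈⟨ trans (+-congˡ (trans (-‿cong (zero-mulʳ root-frobenius)) -0#≈0#)) (+-identityʳ _) ⟩
    zq * evS E c ∎
    where
    a : ℕ → K.PS
    a j = 𝕃.ev E (c j) λq
    deg : 𝕃.Deg D (c n)
    deg = Graded⇒Deg {D} {0} {c} gr n (ℕₚ.n<1+n n)
    product : ∀ j → 𝕃.ev E (c n 𝕃R.* η j) λq ≈ a n * g j
    product j = begin
      𝕃.ev E (c n 𝕃R.* η j) λq ≈⟨ 𝕃.ev-mono (D ℕ.+ suc n) E λq le (𝕃.Deg-* D (suc n) deg (Deg-translate K.X (suc n) (K.C ∘ H j))) ⟨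
      𝕃.ev (D ℕ.+ suc n) (c n 𝕃R.* η j) λq ≈⟨ 𝕃.ev-* D (suc n) λq deg (Deg-translate K.X (suc n) (K.C ∘ H j)) ⟩
      𝕃.ev D (c n) λq * 𝕃.ev (suc n) (η j) λq
        ≈⟨ *-cong (𝕃.ev-mono D E λq (ℕₚ.≤-trans (ℕₚ.m≤m+n D (suc n)) le) deg)
                  (trans (ev-translate K.X (suc n) (K.C ∘ H j) λq) (𝕃.ev-cong (suc n) (𝕃R.refl {K.C ∘ H j}) X+λq)) ⟩
      a n * g j ∎
    before : ∀ j → 𝕃.ev E (prepend 𝕃R.0# c j) λq ≈ prepend 0# a j
    before zero = 𝕃.ev-zero E λq 𝕃R.refl
    before (suc j) = refl
    coordinate : ∀ j → 𝕃.ev E (ζ c j) λq ≈ prepend 0# a j + - (a n * g j)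
    coordinate j = trans (𝕃.ev-+ E (prepend 𝕃R.0# c j) (𝕃R.- (c n 𝕃R.* η j)) λq)
      (+-cong (before j) (trans (𝕃.ev-neg E (c n 𝕃R.* η j) λq) (-‿cong (product j))))

  Low : ℕ → Vec → Set
  Low l₀ c = ∀ j l → j ℕ.< suc n → l ℕ.< l₀ → c j l ≈ 0#

  -- For a vector that is `Low l₀` this is the lowest term of its expansion along the diagonal
  -- `L = 0`, `Z = y`.
  Δ : ℕ → Vec → K.PS
  Δ l₀ c = ∑ (suc n) (λ j → c j l₀ * y ^ j)

  Δ-+ : ∀ l₀ c d → Δ l₀ (c ⊹ d) ≈ Δ l₀ c + Δ l₀ d
  Δ-+ l₀ c d = trans (∑-cong (suc n) (λ j _ → distribʳ (y ^ j) (c j l₀) (d j l₀))) (∑-+ (suc n) (λ j → c j l₀ * y ^ j) (λ j → d j l₀ * y ^ j))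

  Δ-• : ∀ l₀ e c → Δ l₀ (e • c) ≈ e * Δ l₀ c
  Δ-• l₀ e c = trans (∑-cong (suc n) (λ j _ → *-assoc e (c j l₀) (y ^ j))) (∑-*ˡ (suc n) e (λ j → c j l₀ * y ^ j))

  Δ-0 : ∀ l₀ → Δ l₀ (λ _ → 𝕃R.0#) ≈ 0#
  Δ-0 l₀ = ∑-zero (suc n) (λ j _ → zeroˡ (y ^ j))

  Low-ζ : ∀ {l₀} c → Low l₀ c → Low l₀ (ζ c)
  Low-ζ {l₀} c low j l j≤n l<l₀ = zero-sum (previous j j≤n) (trans (-‿cong vanish) -0#≈0#)
    where
    previous : ∀ j → j ℕ.< suc n → prepend 𝕃R.0# c j l ≈ 0#
    previous zero _ = refl
    previous (suc j) (s≤s j≤n) = low j l (ℕₚ.m≤n⇒m≤1+n j≤n) l<l₀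
    vanish : (c n 𝕃R.* η j) l ≈ 0#
    vanish = trans (𝕃.at (𝕃R.trans (𝕃R.*-congʳ (𝕃.Ord-factor l₀ (c n) (λ l → low n l (ℕₚ.n<1+n n)))) (𝕃R.*-assoc (𝕃.X 𝕃R.^ l₀) (λ i → c n (l₀ ℕ.+ i)) (η j))) l)
      (𝕃.X^*-low l₀ ((λ i → c n (l₀ ℕ.+ i)) 𝕃R.* η j) l l<l₀)

  -- In the lowest `L`-degree only the constant term `H j` of `η j` takes part, and `H (X, y) = 0`.
  Δ-ζ : ∀ l₀ c → Low l₀ c → Δ l₀ (ζ c) ≈ y * Δ l₀ c
  Δ-ζ l₀ c low = begin
    Δ l₀ (ζ c) ≈⟨ ∑-cong (suc n) {λ j → ζ c j l₀ * y ^ j} (λ j _ → *-congʳ (+-cong (before j) (-‿cong (leading j)))) ⟩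
    ∑ (suc n) (λ j → (prepend 0# a j + - (a n * H j)) * y ^ j) ≈⟨ companion n a H y ⟩
    y * Δ l₀ c + - (a n * (y ^ suc n + ∑ (suc n) (λ j → H j * y ^ j)))
      ≈⟨ trans (+-congˡ (trans (-‿cong (zero-mulʳ root-sum)) -0#≈0#)) (+-identityʳ _) ⟩
    y * Δ l₀ c ∎
    where
    a : ℕ → K.PS
    a j = c j l₀
    before : ∀ j → prepend 𝕃R.0# c j l₀ ≈ prepend 0# a j
    before zero = refl
    before (suc j) = refl
    rest : 𝕃.PS
    rest i = c n (l₀ ℕ.+ i)
    leading : ∀ j → (c n 𝕃R.* η j) l₀ ≈ a n * H j
    leading j = begin
      (c n 𝕃R.* η j) l₀ ≈⟨ 𝕃.at (𝕃R.trans (𝕃R.*-congʳ (𝕃.Ord-factor l₀ (c n) (λ l → low n l (ℕₚ.n<1+n n)))) (𝕃R.*-assoc (𝕃.X 𝕃R.^ l₀) rest (η j))) l₀ ⟩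
      ((𝕃.X 𝕃R.^ l₀) 𝕃R.* (rest 𝕃R.* η j)) l₀ ≡⟨ ≡.cong ((𝕃.X 𝕃R.^ l₀) 𝕃R.* (rest 𝕃R.* η j)) (ℕₚ.+-identityʳ l₀) ⟨
      ((𝕃.X 𝕃R.^ l₀) 𝕃R.* (rest 𝕃R.* η j)) (l₀ ℕ.+ 0) ≈⟨ 𝕃.X^*-high l₀ (rest 𝕃R.* η j) 0 ⟩
      c n (l₀ ℕ.+ 0) * η j 0 ≈⟨ *-cong (reflexive (≡.cong (c n) (ℕₚ.+-identityʳ l₀))) (taylor-0 (suc n) (H j) (Deg-H j)) ⟩
      a n * H j ∎

  Tot-drop : ∀ {D t P} i → Tot D t P → Tot D (i ℕ.+ t) (λ j → P (i ℕ.+ j))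
  Tot-drop {D} {t} {P} i tot j = ≡.subst (λ r → W D r (P (i ℕ.+ j)))
    (≡.trans (≡.cong (ℕ._+ t) (ℕₚ.+-comm i j)) (ℕₚ.+-assoc j i t)) (tot (i ℕ.+ j))

  Deg-drop : ∀ {m P} i → 𝕃.Deg m P → 𝕃.Deg (m ∸ i) (λ j → P (i ℕ.+ j))
  Deg-drop {m} i d j l = d (i ℕ.+ j) (ℕₚ.≤-<-trans (ℕₚ.m≤n+m∸n m i) (ℕₚ.+-monoʳ-< i l))

  -- Multiplication by `H (X, Z) / (Z - y)` modulo `H (X + L, Z)`: the quotient is formed at `X`,
  -- the reduction at `X + L`.
  W* : Vec → Vec
  W* = quotient (suc n) H

  Deg-H-Y : 𝕃.Deg (suc n) H
  Deg-H-Y = Tot⇒Deg wH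

  Graded-W* : ∀ {D} c → Graded D 0 c → Graded (n ℕ.+ D) 0 (W* c)
  Graded-W* {D} c gr = Graded-weaken {suc n ℕ.+ D} {1} {n ℕ.+ D} {0} {W* c}
    (ℕₚ.≤-reflexive (≡.trans (ℕₚ.+-identityʳ (suc n ℕ.+ D)) (ℕₚ.+-comm 1 (n ℕ.+ D))))
    (Graded-quotient {suc n} {0} {D} {0} (suc n) H wH Deg-H-Y gr)

  evS-W* : ∀ {D} E c → suc n ℕ.+ D ℕ.+ suc n ℕ.≤ E → Graded D 0 c → evS E (W* c) ≈ 𝕃.dd (suc n) H y zq * evS E c
  evS-W* {D} E c le gr = quotient-functional (evS E) zq (Graded (suc n ℕ.+ D) 0) (evS-+ E) (evS-• E) (evS-0 E)
    (λ c → evS-ζ {suc n ℕ.+ D} E c le) (suc n) H c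
    (λ i l → Graded-weaken {suc n ℕ.+ D} {suc (suc i ℕ.+ 0) ℕ.+ 0} {suc n ℕ.+ D} {0} {quotient (suc n ∸ suc i) (λ j → H (suc i ℕ.+ j)) c}
      (ℕₚ.+-monoʳ-≤ (suc n ℕ.+ D) z≤n)
      (Graded-quotient {suc n} {suc i ℕ.+ 0} {D} {0} (suc n ∸ suc i) (λ j → H (suc i ℕ.+ j))
        (Tot-drop {P = H} (suc i) wH) (Deg-drop {P = H} (suc i) Deg-H-Y) gr))

  Low-quotient : ∀ {l₀} m P c → Low l₀ c → Low l₀ (quotient m P c)
  Low-quotient zero P c low j l j≤n l<l₀ = refl
  Low-quotient (suc m) P c low j l j≤n l<l₀ = zero-sum (zero-mulʳ (low j l j≤n l<l₀))
    (Low-ζ (quotient m (P ∘ suc) c) (Low-quotient m (P ∘ suc) c low) j l j≤n l<l₀)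

  -- On the diagonal the divided difference is the `Y`-derivative of `H` at `y`.
  Δ-W* : ∀ l₀ c → Low l₀ c → Δ l₀ (W* c) ≈ 𝕃.dd (suc n) H y y * Δ l₀ c
  Δ-W* l₀ c low = quotient-functional (Δ l₀) y (Low l₀) (Δ-+ l₀) (Δ-• l₀) (Δ-0 l₀) (Δ-ζ l₀) (suc n) H c
    (λ i _ → Low-quotient (suc n ∸ suc i) (λ j → H (suc i ℕ.+ j)) c low)

  iterate : ℕ → Vec → Vec
  iterate zero c = c
  iterate (suc γ) c = W* (iterate γ c)

  Graded-iterate : ∀ {D} γ c → Graded D 0 c → Graded (γ ℕ.* n ℕ.+ D) 0 (iterate γ c)
  Graded-iterate zero c gr = gr
  Graded-iterate {D} (suc γ) c gr = ≡.subst (λ r → Graded r 0 (iterate (suc γ) c)) (≡.sym (ℕₚ.+-assoc n (γ ℕ.* n) D))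
    (Graded-W* (iterate γ c) (Graded-iterate γ c gr))

  evS-iterate : ∀ {D} E γ c → suc n ℕ.+ (γ ℕ.* n ℕ.+ D) ℕ.+ suc n ℕ.≤ E → Graded D 0 c →
    evS E (iterate γ c) ≈ 𝕃.dd (suc n) H y zq ^ γ * evS E c
  evS-iterate E zero c le gr = sym (*-identityˡ _)
  evS-iterate {D} E (suc γ) c le gr =
    let le′ = ℕₚ.≤-trans (ℕₚ.+-monoˡ-≤ (suc n) (ℕₚ.+-monoʳ-≤ (suc n) (ℕₚ.+-monoˡ-≤ D (ℕₚ.m≤n+m (γ ℕ.* n) n)))) le
    in trans (evS-W* {γ ℕ.* n ℕ.+ D} E (iterate γ c) le′ (Graded-iterate γ c gr))
      (trans (*-congˡ (evS-iterate {D} E γ c le′ gr)) (sym (*-assoc _ _ _)))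

  Low-iterate : ∀ {l₀} γ c → Low l₀ c → Low l₀ (iterate γ c)
  Low-iterate zero c low = low
  Low-iterate (suc γ) c low = Low-quotient (suc n) H (iterate γ c) (Low-iterate γ c low)

  Δ-iterate : ∀ l₀ γ c → Low l₀ c → Δ l₀ (iterate γ c) ≈ 𝕃.dd (suc n) H y y ^ γ * Δ l₀ c
  Δ-iterate l₀ zero c low = sym (*-identityˡ _)
  Δ-iterate l₀ (suc γ) c low = trans (Δ-W* l₀ (iterate γ c) (Low-iterate γ c low))
    (trans (*-congˡ (Δ-iterate l₀ γ c low)) (sym (*-assoc _ _ _)))

-- Divisibility that follows from the absence of rational points.

-- The fibre over `X = 0` is exempt because the branch itself gives the rational point `y 0` there.
NoPoint : (F : FiniteField) → Branch F → Set
NoPoint F B = ∀ a w → ¬ (w K.≈ K.0#) → ¬ (K.ev (suc n) (Weights.𝕃.ev F (suc n) H (K.C a)) w K.≈ K.0#)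
  where
  open Branch B
  module K = Field F

module Unramified (F : FiniteField) (B : Branch F) (no-point : NoPoint F B) where
  open Branch B
  open Curve F B
  open Operators F B
  open Functionals F B
  open Weights F
  open K using (series; _≋_; pt; at; size)
  open RingLemmas series
  open Filtration y

  Λ : K.PS
  Λ = K.X ^ (size ∸ 1) + - 1#

  suc-pred-size : suc (size ∸ 1) ≡ size
  suc-pred-size = ℕₚ.m+[n∸m]≡n K.0<size

  X*Λ : K.X * Λ ≈ λq
  X*Λ = trans (solve 2 (λ x p → x :* (p :- con (1 , 0)) := x :* p :- x) refl K.X (K.X ^ (size ∸ 1)))
    (+-congʳ (reflexive (≡.cong (K.X ^_) suc-pred-size)))

  X-cancel : ∀ {f g} → K.X * f ≈ K.X * g → f ≈ g
  X-cancel {f} {g} e = pt λ i → K.trans (K.sym (K.X-conv f i)) (K.trans (at e (suc i)) (K.X-conv g i))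

  -- Membership in the ring `k[X, y]` with no control of the degree.
  InR : K.PS → Set
  InR b = Σ ℕ λ D → Fil D 0 b

  R-+ : ∀ {a b} → InR a → InR b → InR (a + b)
  R-+ (D , fa) (E , fb) = D ⊔ E , Fil-+ (Fil-weaken (ℕₚ.+-monoˡ-≤ 0 (ℕₚ.m≤m⊔n D E)) fa)
                                        (Fil-weaken (ℕₚ.+-monoˡ-≤ 0 (ℕₚ.m≤n⊔m D E)) fb)

  R-neg : ∀ {a} → InR a → InR (- a)
  R-neg (D , fa) = D , Fil-neg fa

  R-* : ∀ {a b} → InR a → InR b → InR (a * b)
  R-* (D , fa) (E , fb) = D ℕ.+ E , Fil-* fa fb

  R-const : ∀ c → InR (K.C c)
  R-const c = 0 , Fil-const c

  R-poly : ∀ {m} f → K.Deg m f → InR f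
  R-poly {m} f d = m , Fil-poly (λ a l → d a (≡.subst (m ℕ.<_) (ℕₚ.+-identityʳ a) l))

  R-y : InR y
  R-y = 1 , Fil-y

  R-^ : ∀ {b} m → InR b → InR (b ^ m)
  R-^ zero r = R-const K.1#
  R-^ (suc m) r = R-* r (R-^ m r)

  R-∑ : ∀ m {f : ℕ → K.PS} → (∀ i → i ℕ.< m → InR (f i)) → InR (∑ m f)
  R-∑ zero r = 0 , Fil-0
  R-∑ (suc m) r = R-+ (r 0 (s≤s z≤n)) (R-∑ m (λ i l → r (suc i) (s≤s l)))

  R-ev : ∀ m P {b} → (∀ j → InR (P j)) → InR b → InR (𝕃.ev m P b)
  R-ev zero P r rb = r 0
  R-ev (suc m) P r rb = R-+ (r 0) (R-* rb (R-ev m (P ∘ suc) (r ∘ suc) rb))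

  R-dd : ∀ m P {a b} → (∀ j → InR (P j)) → InR a → InR b → InR (𝕃.dd m P a b)
  R-dd zero P r ra rb = 0 , Fil-0
  R-dd (suc m) P r ra rb = R-+ (R-ev m (P ∘ suc) (r ∘ suc) ra) (R-* rb (R-dd m (P ∘ suc) (r ∘ suc) ra rb))

  R-H : ∀ j → InR (H j)
  R-H j = R-poly (H j) (Deg-H j)

  R-X^ : ∀ m → InR (K.X ^ m)
  R-X^ m = R-poly (K.X ^ m) (K.Deg-X^ m)

  -- The polynomial `X f` vanishes on the whole field, so it is divisible by `X^q - X = X Λ`.
  Λ-divides : ∀ {m} f → K.Deg m f → (∀ w → ¬ (w K.≈ K.0#) → K.ev m f w K.≈ K.0#) → Σ K.PS λ g → InR g × (f ≈ Λ * g)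
  Λ-divides {m} f d r =
    let N = length K.all ℕ.+ suc m
        dXf = K.Deg-* 1 m K.Deg-X d
        (g , dg , e) = K.factor-list K.all (suc m) (K.X * f) K.all-unique
          (K.Deg-mono {f = K.X * f} (ℕₚ.m≤n+m (suc m) (length K.all)) dXf)
          (λ w _ → K.trans (K.sym (K.ev-mono (suc m) N w (ℕₚ.m≤n+m (suc m) (length K.all)) dXf))
            (K.trans (K.ev-* 1 m w K.Deg-X d) (vanish w)))
    in g , R-poly g dg , X-cancel (begin
      K.X * f ≈⟨ e ⟩
      K.roots K.all K.X * g ≈⟨ *-congʳ (trans (sym K.frob-poly) (sym X*Λ)) ⟩
      (K.X * Λ) * g ≈⟨ *-assoc K.X Λ g ⟩
      K.X * (Λ * g) ∎)
    where
    vanish : ∀ w → K.ev 1 K.X w K.* K.ev m f w K.≈ K.0#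
    vanish w with w K.≟ K.0#
    ... | yes z = K.zero-mulˡ (K.trans (K.ev-X 0 w) z)
    ... | no nz = K.zero-mulʳ (r w nz)

  -- Invertibility modulo `Λ` in `k[X, y]`.
  Unit : K.PS → Set
  Unit b = Σ K.PS λ u → Σ K.PS λ v → InR u × InR v × (u * b ≈ 1# + Λ * v)

  Unit-* : ∀ {a b} → Unit a → Unit b → Unit (a * b)
  Unit-* {a} {b} (u , v , ru , rv , e) (u′ , v′ , ru′ , rv′ , e′) =
    u * u′ , v + v′ + Λ * (v * v′) , R-* ru ru′ , R-+ (R-+ rv rv′) (R-* R-Λ (R-* rv rv′)) , (begin
      u * u′ * (a * b) ≈⟨ solve 4 (λ u u′ a b → u :* u′ :* (a :* b) := (u :* a) :* (u′ :* b)) refl u u′ a b ⟩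
      u * a * (u′ * b) ≈⟨ *-cong e e′ ⟩
      (1# + Λ * v) * (1# + Λ * v′)
        ≈⟨ solve 3 (λ l v w → (con (1 , 0) :+ l :* v) :* (con (1 , 0) :+ l :* w) := con (1 , 0) :+ l :* (v :+ w :+ l :* (v :* w))) refl Λ v v′ ⟩
      1# + Λ * (v + v′ + Λ * (v * v′)) ∎)
    where
    R-Λ : InR Λ
    R-Λ = R-+ (R-X^ (size ∸ 1)) (R-neg (R-const K.1#))

  Unit-roots : (∀ a → Unit (y + - K.C a)) → ∀ as → Unit (K.roots as y)
  Unit-roots u [] = 1# , 0# , R-const K.1# , (0 , Fil-0) , solve 1 (λ l → con (1 , 0) :* con (1 , 0) := con (1 , 0) :+ l :* con (0 , 0)) refl Λ
  Unit-roots u (a ∷ as) = Unit-* (u a) (Unit-roots u as)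

  C-conv-hom : ∀ f g → (K.C ∘ (f * g)) 𝕃.≋ ((K.C ∘ f) 𝕃R.* (K.C ∘ g))
  C-conv-hom f g = 𝕃.pt (go f g)
    where
    go : ∀ f g i → K.C ((f * g) i) ≈ 𝕃.conv (K.C ∘ f) (K.C ∘ g) i
    go f g zero = K.C-* (f 0) (g 0)
    go f g (suc i) = trans (K.C-+ _ _) (+-cong (K.C-* (f 0) (g (suc i))) (go (f ∘ suc) g i))

  Deg-C∘ : ∀ {m f} → K.Deg m f → 𝕃.Deg m (K.C ∘ f)
  Deg-C∘ d i l = trans (K.C-cong (d i l)) K.C-0

  C∘X : (K.C ∘ K.X) 𝕃.≋ 𝕃.X
  C∘X = 𝕃.pt λ { zero → K.C-0 ; (suc zero) → refl ; (suc (suc i)) → K.C-0 }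

  C∘-sub : ∀ f g → (K.C ∘ (f + - g)) 𝕃.≋ ((K.C ∘ f) 𝕃R.+ 𝕃R.- (K.C ∘ g))
  C∘-sub f g = 𝕃.pt λ i → trans (K.C-+ (f i) (K.- g i)) (+-congˡ (K.C-neg (g i)))

  C∘1 : (K.C ∘ 1#) 𝕃.≋ 𝕃R.1#
  C∘1 = 𝕃.pt λ { zero → refl ; (suc i) → K.C-0 }

  C∘X^ : ∀ m → (K.C ∘ (K.X ^ m)) 𝕃.≋ (𝕃.X 𝕃R.^ m)
  C∘X^ zero = C∘1
  C∘X^ (suc m) = 𝕃R.trans (C-conv-hom K.X (K.X ^ m)) (𝕃R.*-cong C∘X (C∘X^ m))

  substitute-roots : ∀ as → 𝕃.ev (length as) (K.C ∘ K.roots as K.X) y ≈ K.roots as y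
  substitute-roots [] = refl
  substitute-roots (a ∷ as) = begin
    𝕃.ev (suc (length as)) (K.C ∘ (l * K.roots as K.X)) y ≈⟨ 𝕃.ev-cong (suc (length as)) (C-conv-hom l (K.roots as K.X)) refl ⟩
    𝕃.ev (suc (length as)) ((K.C ∘ l) 𝕃R.* (K.C ∘ K.roots as K.X)) y
      ≈⟨ 𝕃.ev-* 1 (length as) y (Deg-C∘ {1} {l} (K.Deg-X- a)) (Deg-C∘ {length as} {K.roots as K.X} (K.Deg-roots as)) ⟩
    𝕃.ev 1 (K.C ∘ l) y * 𝕃.ev (length as) (K.C ∘ K.roots as K.X) y ≈⟨ *-cong linear (substitute-roots as) ⟩
    (y + - K.C a) * K.roots as y ∎
    where
    l = K.X + - K.C a
    linear : 𝕃.ev 1 (K.C ∘ l) y ≈ y + - K.C a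
    linear = begin
      𝕃.ev 1 (K.C ∘ l) y ≈⟨ 𝕃.ev-cong 1 (C∘-sub K.X (K.C a)) refl ⟩
      𝕃.ev 1 ((K.C ∘ K.X) 𝕃R.+ 𝕃R.- (K.C ∘ K.C a)) y ≈⟨ 𝕃.ev-+ 1 (K.C ∘ K.X) (𝕃R.- (K.C ∘ K.C a)) y ⟩
      𝕃.ev 1 (K.C ∘ K.X) y + 𝕃.ev 1 (𝕃R.- (K.C ∘ K.C a)) y
        ≈⟨ +-cong (trans (𝕃.ev-cong 1 C∘X refl) (𝕃.ev-X 0 y))
             (trans (𝕃.ev-neg 1 (K.C ∘ K.C a) y) (-‿cong (trans (+-congˡ (zero-mulʳ K.C-0)) (+-identityʳ _)))) ⟩
      y + - K.C a ∎

  zq-y : zq + - y ≈ K.roots K.all y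
  zq-y = begin
    zq + - y ≈⟨ +-cong (𝕃.ev-X^ size y) (trans (𝕃.ev-neg size 𝕃.X y) (-‿cong (trans (sym (𝕃.ev-mono 1 size y K.0<size 𝕃.Deg-X)) (𝕃.ev-X 0 y)))) ⟨
    𝕃.ev size (𝕃.X 𝕃R.^ size) y + 𝕃.ev size (𝕃R.- 𝕃.X) y ≈⟨ 𝕃.ev-+ size (𝕃.X 𝕃R.^ size) (𝕃R.- 𝕃.X) y ⟨
    𝕃.ev size ((𝕃.X 𝕃R.^ size) 𝕃R.+ 𝕃R.- 𝕃.X) y
      ≈⟨ 𝕃.ev-cong size (𝕃R.trans (C∘-sub (K.X ^ size) K.X) (𝕃R.+-cong (C∘X^ size) (𝕃R.-‿cong C∘X))) refl ⟨
    𝕃.ev size (K.C ∘ λq) y ≈⟨ 𝕃.ev-cong size (𝕃.pt λ i → K.C-cong (at K.frob-poly i)) refl ⟩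
    𝕃.ev size (K.C ∘ K.roots K.all K.X) y ≡⟨ ≡.cong (λ m → 𝕃.ev m (K.C ∘ K.roots K.all K.X) y) K.all-length ⟨
    𝕃.ev (length K.all) (K.C ∘ K.roots K.all K.X) y ≈⟨ substitute-roots K.all ⟩
    K.roots K.all y ∎

  -- Since `H (X, y) = 0`, the function `y - a` divides `H (X, a)`. That polynomial has no zero off
  -- `X = 0`, so its power `q - 1` is 1 modulo `Λ`.
  Unit-y-a : ∀ a → Unit (y + - K.C a)
  Unit-y-a a =
    let (g , rg , e) = Λ-divides (π ^ (size ∸ 1) + - 1#) deg vanish
    in - (D * π ^ (size ∸ 2)) , g , R-neg (R-* (R-dd (suc n) H R-H (R-const a) R-y) (R-^ (size ∸ 2) R-π)) , rg , (begin
      - (D * π ^ (size ∸ 2)) * (y + - K.C a)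
        ≈⟨ solve 3 (λ d q z → :- (d :* q) :* z := :- (z :* d) :* q) refl D (π ^ (size ∸ 2)) (y + - K.C a) ⟩
      - ((y + - K.C a) * D) * π ^ (size ∸ 2) ≈⟨ *-congʳ (trans (-‿cong product) (-‿involutive π)) ⟩
      π * π ^ (size ∸ 2) ≡⟨ ≡.cong (π ^_) (ℕₚ.+-∸-assoc 1 K.1<size) ⟨
      π ^ (size ∸ 1) ≈⟨ solve 1 (λ p → p := con (1 , 0) :+ (p :- con (1 , 0))) refl (π ^ (size ∸ 1)) ⟩
      1# + (π ^ (size ∸ 1) + - 1#) ≈⟨ +-congˡ e ⟩
      1# + Λ * g ∎)
    where
    π = 𝕃.ev (suc n) H (K.C a)
    D = 𝕃.dd (suc n) H (K.C a) y
    product : (y + - K.C a) * D ≈ - π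
    product = trans (𝕃.dd-spec (suc n) H (K.C a) y) (trans (+-congʳ root) (+-identityˡ _))
    Deg-ev : ∀ m P → (∀ j → K.Deg (suc n) (P j)) → K.Deg (suc n) (𝕃.ev m P (K.C a))
    Deg-ev zero P d = d 0
    Deg-ev (suc m) P d = K.Deg-+ {f = P 0} (d 0) (K.Deg-* 0 (suc n) (K.Deg-C a) (Deg-ev m (P ∘ suc) (d ∘ suc)))
    Deg-π : K.Deg (suc n) π
    Deg-π = Deg-ev (suc n) H Deg-H
    R-π : InR π
    R-π = R-poly π Deg-π
    m = (size ∸ 1) ℕ.* suc n
    deg : K.Deg m (π ^ (size ∸ 1) + - 1#)
    deg = K.Deg-+ {f = π ^ (size ∸ 1)} (K.Deg-^ (suc n) (size ∸ 1) Deg-π) (K.Deg-neg {f = 1#} (K.Deg-C K.1#))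
    vanish : ∀ w → ¬ (w K.≈ K.0#) → K.ev m (π ^ (size ∸ 1) + - 1#) w K.≈ K.0#
    vanish w nz = K.trans (K.ev-+ m (π ^ (size ∸ 1)) (- 1#) w)
      (K.trans (K.+-cong (K.trans (K.ev-^ (suc n) (size ∸ 1) π w Deg-π) (K.fermat′ _ (no-point a w nz)))
                         (K.trans (K.ev-neg m 1# w) (K.-‿cong (K.ev-C m K.1# w))))
               (K.-‿inverseʳ K.1#))

  ev-self : ∀ m f → K.Deg m f → 𝕃.ev m (K.C ∘ f) K.X ≈ f
  ev-self zero f d = pt λ { zero → K.refl ; (suc i) → K.sym (d (suc i) (s≤s z≤n)) }
  ev-self (suc m) f d = trans (+-congˡ (*-congˡ (ev-self m (f ∘ suc) (K.Deg-tail {f = f} d)))) (sym (K.head-tail f))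

  -- H(X, y^q) ≡ H(X^q, y^q) = H(X, y)^q = 0 modulo Λ, whereas y^q − y is a unit modulo Λ.
  quotient-divisible : Σ K.PS λ G → InR G × (𝕃.dd (suc n) H y zq ≈ Λ * G)
  quotient-divisible =
    let (u , v , ru , rv , e) = Unit-roots Unit-y-a K.all
    in u * S + - (v * Q) , R-+ (R-* ru R-S) (R-neg (R-* rv R-Q)) , (begin
      Q ≈⟨ solve 3 (λ q l v → q := (con (1 , 0) :+ l :* v) :* q :- l :* (v :* q)) refl Q Λ v ⟩
      (1# + Λ * v) * Q + - (Λ * (v * Q)) ≈⟨ +-congʳ (*-congʳ (trans (sym e) (*-congˡ (sym zq-y)))) ⟩
      u * (zq + - y) * Q + - (Λ * (v * Q)) ≈⟨ +-congʳ (trans (*-assoc _ _ _) (*-congˡ zq-y*Q)) ⟩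
      u * (Λ * S) + - (Λ * (v * Q))
        ≈⟨ solve 5 (λ u l s v q → u :* (l :* s) :- l :* (v :* q) := l :* (u :* s :- v :* q)) refl u Λ S v Q ⟩
      Λ * (u * S + - (v * Q)) ∎)
    where
    Q = 𝕃.dd (suc n) H y zq
    d : ℕ → K.PS
    d j = 𝕃.dd (suc n) (K.C ∘ H j) K.X (K.X ^ size)
    S = ∑ (suc n) (λ j → - (K.X * d j) * zq ^ j)
    R-Q : InR Q
    R-Q = R-dd (suc n) H R-H R-y (R-^ size R-y)
    R-S : InR S
    R-S = R-∑ (suc n) (λ j _ → R-* (R-neg (R-* (R-poly K.X K.Deg-X)
      (R-dd (suc n) (K.C ∘ H j) (λ i → R-const (H j i)) (R-poly K.X K.Deg-X) (R-X^ size)))) (R-^ j (R-^ size R-y)))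
    coordinate : ∀ j → H j + - g j ≈ Λ * - (K.X * d j)
    coordinate j = begin
      H j + - g j ≈⟨ +-congʳ (ev-self (suc n) (H j) (Deg-H j)) ⟨
      𝕃.ev (suc n) (K.C ∘ H j) K.X + - g j ≈⟨ solve 2 (λ a b → a :- b := :- (b :- a)) refl _ (g j) ⟩
      - (g j + - 𝕃.ev (suc n) (K.C ∘ H j) K.X) ≈⟨ -‿cong (𝕃.dd-spec (suc n) (K.C ∘ H j) K.X (K.X ^ size)) ⟨
      - (λq * d j) ≈⟨ -‿cong (*-congʳ X*Λ) ⟨
      - (K.X * Λ * d j) ≈⟨ solve 3 (λ x l d → :- (x :* l :* d) := l :* :- (x :* d)) refl K.X Λ (d j) ⟩
      Λ * - (K.X * d j) ∎
    ev-H-zq : 𝕃.ev (suc n) H zq ≈ zq ^ suc n + ∑ (suc n) (λ j → H j * zq ^ j)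
    ev-H-zq = begin
      𝕃.ev (suc n) H zq ≈⟨ 𝕃.ev-∑ (suc n) H zq ⟩
      ∑ (suc (suc n)) (λ j → H j * zq ^ j) ≈⟨ ∑-last (suc n) (λ j → H j * zq ^ j) ⟩
      ∑ (suc n) (λ j → H j * zq ^ j) + H (suc n) * zq ^ suc n ≈⟨ trans (+-comm _ _) (+-congʳ (trans (*-congʳ monic) (*-identityˡ _))) ⟩
      zq ^ suc n + ∑ (suc n) (λ j → H j * zq ^ j) ∎
    zq-y*Q : (zq + - y) * Q ≈ Λ * S
    zq-y*Q = begin
      (zq + - y) * Q ≈⟨ 𝕃.dd-spec (suc n) H y zq ⟩
      𝕃.ev (suc n) H zq + - 𝕃.ev (suc n) H y ≈⟨ +-cong ev-H-zq (-‿cong (trans root (sym root-frobenius))) ⟩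
      (zq ^ suc n + ∑ (suc n) (λ j → H j * zq ^ j)) + - (zq ^ suc n + ∑ (suc n) (λ j → g j * zq ^ j))
        ≈⟨ solve 3 (λ a b c → (a :+ b) :- (a :+ c) := b :- c) refl (zq ^ suc n) _ _ ⟩
      ∑ (suc n) (λ j → H j * zq ^ j) + - ∑ (suc n) (λ j → g j * zq ^ j) ≈⟨ +-congˡ (∑-neg (suc n) (λ j → g j * zq ^ j)) ⟨
      ∑ (suc n) (λ j → H j * zq ^ j) + ∑ (suc n) (λ j → - (g j * zq ^ j))
        ≈⟨ ∑-+ (suc n) (λ j → H j * zq ^ j) (λ j → - (g j * zq ^ j)) ⟨
      ∑ (suc n) (λ j → H j * zq ^ j + - (g j * zq ^ j)) ≈⟨ ∑-cong (suc n) (λ j _ → begin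
        H j * zq ^ j + - (g j * zq ^ j) ≈⟨ solve 3 (λ h g z → h :* z :- g :* z := (h :- g) :* z) refl (H j) (g j) (zq ^ j) ⟩
        (H j + - g j) * zq ^ j ≈⟨ *-congʳ (coordinate j) ⟩
        Λ * - (K.X * d j) * zq ^ j ≈⟨ *-assoc _ _ _ ⟩
        Λ * (- (K.X * d j) * zq ^ j) ∎) ⟩
      ∑ (suc n) (λ j → Λ * (- (K.X * d j) * zq ^ j)) ≈⟨ ∑-*ˡ (suc n) Λ (λ j → - (K.X * d j) * zq ^ j) ⟩
      Λ * S ∎

-- Stepanov's method.

index-< : ∀ {K M a i} → a ℕ.< M → i ℕ.< K → a ℕ.+ i ℕ.* M ℕ.< K ℕ.* M
index-< {K} {M} {a} {i} la li = ℕₚ.<-≤-trans (ℕₚ.+-monoˡ-< (i ℕ.* M) la) (ℕₚ.*-monoˡ-≤ M li)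

module _ (N M : ℕ) .{{_ : ℕ.NonZero N}} .{{_ : ℕ.NonZero M}} where

  decode : {A : Set} → (ℕ → ℕ → ℕ → ℕ → A) → ℕ → A
  decode f c = f (c DivMod./ M DivMod./ N DivMod./ N) (c DivMod./ M DivMod./ N DivMod.% N) (c DivMod./ M DivMod.% N) (c DivMod.% M)

  encode : ℕ → ℕ → ℕ → ℕ → ℕ
  encode l j b a = a ℕ.+ (b ℕ.+ (j ℕ.+ l ℕ.* N) ℕ.* N) ℕ.* M

  encode-< : ∀ {l j b a} → l ℕ.< N → j ℕ.< N → b ℕ.< N → a ℕ.< M → encode l j b a ℕ.< N ℕ.* N ℕ.* N ℕ.* M
  encode-< ll lj lb la = index-< {K = N ℕ.* N ℕ.* N} la (index-< {K = N ℕ.* N} lb (index-< {K = N} lj ll))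

  decode-encode : {A : Set} (f : ℕ → ℕ → ℕ → ℕ → A) → ∀ l {j b a} → j ℕ.< N → b ℕ.< N → a ℕ.< M →
    decode f (encode l j b a) ≡ f l j b a
  decode-encode f l {j} {b} {a} lj lb la
    rewrite index-/ M (b ℕ.+ (j ℕ.+ l ℕ.* N) ℕ.* N) la | index-% M (b ℕ.+ (j ℕ.+ l ℕ.* N) ℕ.* N) la
          | index-/ N (j ℕ.+ l ℕ.* N) lb | index-% N (j ℕ.+ l ℕ.* N) lb | index-/ N l lj | index-% N l lj = ≡.refl

-- Stepanov's method: a curve with a rational branch has a rational point with X ≠ 0.
-- Otherwise the Frobenius moves every point in the fibres over X ≠ 0 to another point of the
-- fibre, so the divided difference W* of H vanishes at (y, y^q) modulo Λ = X^(q−1) − 1.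
-- A multiple r W*^γ with few parameters has a truncation below L^γ (L = X^q − X) of small
-- degree that is divisible by Λ^γ, hence zero; then r W*^γ vanishes to order γ along the
-- diagonal, where W* does not vanish, and so r = 0.
SimpleRoot : (F : FiniteField) → Branch F → Set
SimpleRoot F B = ¬ (Weights.𝕃.dd F (suc n) H y y K.≋ K.𝔹.0#)
  where
  open Branch B
  module K = Field F

module Stepanov (F : FiniteField) (B : Branch F) (no-point : NoPoint F B) (simple : SimpleRoot F B)
  (large : 10 ℕ.* (suc (Branch.n B) ℕ.* suc (Branch.n B) ℕ.* suc (Branch.n B) ℕ.* suc (Branch.n B)) ℕ.≤ FiniteField.size F) where
  open Branch B
  open Curve F B
  open Operators F B
  open Functionals F B
  open Unramified F B no-point
  open Weights F
  open K using (series; _≋_; pt; at; size)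
  open RingLemmas series
  open Filtration y
  open Translation series
  open +-*-Solver using () renaming (solve to ℕ-solve; _:=_ to _≐_; _:+_ to _⊞_; _:*_ to _⊠_; con to #)

  infix 4 _≊_
  _≊_ : Vec → Vec → Set
  c ≊ d = ∀ j l → c j l ≈ d j l

  _⊟_ : Vec → Vec → Vec
  (c ⊟ d) j l = c j l + - d j l

  ζ-cong : ∀ c d → c ≊ d → ζ c ≊ ζ d
  ζ-cong c d e j l = +-cong (previous j) (-‿cong (𝕃.at (𝕃R.*-congʳ {η j} {c n} {d n} (𝕃.pt (e n))) l))
    where
    previous : ∀ j → prepend 𝕃R.0# c j l ≈ prepend 𝕃R.0# d j l
    previous zero = refl
    previous (suc j) = e j l

  ζ-⊟ : ∀ c d → ζ (c ⊟ d) ≊ (ζ c ⊟ ζ d)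
  ζ-⊟ c d j l = begin
    prepend 𝕃R.0# (c ⊟ d) j l + - ((c ⊟ d) n 𝕃R.* η j) l ≈⟨ +-cong (previous j) (-‿cong product) ⟩
    (prepend 𝕃R.0# c j l + - prepend 𝕃R.0# d j l) + - ((c n 𝕃R.* η j) l + - (d n 𝕃R.* η j) l)
      ≈⟨ solve 4 (λ a b x z → (a :- b) :- (x :- z) := (a :- x) :- (b :- z)) refl _ _ _ _ ⟩
    (ζ c ⊟ ζ d) j l ∎
    where
    previous : ∀ j → prepend 𝕃R.0# (c ⊟ d) j l ≈ prepend 𝕃R.0# c j l + - prepend 𝕃R.0# d j l
    previous zero = sym (-‿inverseʳ 0#)
    previous (suc j) = refl
    product : ((c ⊟ d) n 𝕃R.* η j) l ≈ (c n 𝕃R.* η j) l + - (d n 𝕃R.* η j) l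
    product = 𝕃.at (𝕃R.solve 3 (λ a b z → (a 𝕃R.:- b) 𝕃R.:* z 𝕃R.:= a 𝕃R.:* z 𝕃R.:- b 𝕃R.:* z) 𝕃R.refl (c n) (d n) (η j)) l

  quotient-⊟ : ∀ m P c d → quotient m P (c ⊟ d) ≊ (quotient m P c ⊟ quotient m P d)
  quotient-⊟ zero P c d j l = sym (-‿inverseʳ 0#)
  quotient-⊟ (suc m) P c d j l = begin
    e * (c j l + - d j l) + ζ (quotient m P′ (c ⊟ d)) j l
      ≈⟨ +-congˡ (trans (ζ-cong (quotient m P′ (c ⊟ d)) (quotient m P′ c ⊟ quotient m P′ d) (quotient-⊟ m P′ c d) j l)
                        (ζ-⊟ (quotient m P′ c) (quotient m P′ d) j l)) ⟩
    e * (c j l + - d j l) + (ζ (quotient m P′ c) j l + - ζ (quotient m P′ d) j l)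
      ≈⟨ solve 5 (λ e c d x z → e :* (c :- d) :+ (x :- z) := (e :* c :+ x) :- (e :* d :+ z)) refl e (c j l) (d j l) _ _ ⟩
    (quotient (suc m) P c ⊟ quotient (suc m) P d) j l ∎
    where
    P′ = P ∘ suc
    e = 𝕃.ev m P′ y

  quotient-cong : ∀ m P c d → c ≊ d → quotient m P c ≊ quotient m P d
  quotient-cong zero P c d e j l = refl
  quotient-cong (suc m) P c d e j l = +-cong (*-congˡ (e j l))
    (ζ-cong (quotient m (P ∘ suc) c) (quotient m (P ∘ suc) d) (quotient-cong m (P ∘ suc) c d e) j l)

  iterate-⊟ : ∀ γ c d → iterate γ (c ⊟ d) ≊ (iterate γ c ⊟ iterate γ d)
  iterate-⊟ zero c d j l = refl
  iterate-⊟ (suc γ) c d j l = trans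
    (quotient-cong (suc n) H (iterate γ (c ⊟ d)) (iterate γ c ⊟ iterate γ d) (iterate-⊟ γ c d) j l)
    (quotient-⊟ (suc n) H (iterate γ c) (iterate γ d) j l)

  -- With `N = n + 1` these are `γ = 2 N^2`, `E = 2 N^3 + N`, `D = 4 N^3 + 2 N - 1`. The auxiliary
  -- function has `L`-degree below `γ` with `M` parameters for each power of `L`; `D` bounds its
  -- degree after `γ` applications of `W*`, and `Eₑ` leaves room for the reductions inside them. `G`
  -- is the last power of `L` that is kept: the `N` powers from `G + 1` to `γ - 1` are made to
  -- vanish by the pigeonhole principle.
  N G γ E M D Eₑ : ℕ
  N = suc n
  G = 2 ℕ.* n ℕ.* n ℕ.+ 3 ℕ.* n
  γ = suc G ℕ.+ N
  E = N ℕ.+ γ ℕ.* N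
  M = N ℕ.* suc E
  D = γ ℕ.* n ℕ.+ (E ℕ.+ n ℕ.+ γ)
  Eₑ = N ℕ.+ D ℕ.+ N

  -- The right side exceeds the left by `2 N^3`. The conditions are `N` powers of `L`, `N` powers of
  -- `Z`, `N` powers of `y` and `D + 1` powers of `X`.
  fewer : N ℕ.* N ℕ.* N ℕ.* suc D ℕ.< γ ℕ.* M
  fewer = ≡.subst (suc (N ℕ.* N ℕ.* N ℕ.* suc D) ℕ.≤_) (ℕ-solve 1 (λ n →
      let N′ = # 1 ⊞ n
          γ′ = # 1 ⊞ (# 2 ⊠ n ⊠ n ⊞ # 3 ⊠ n) ⊞ N′
          E′ = N′ ⊞ γ′ ⊠ N′
          D′ = γ′ ⊠ n ⊞ (E′ ⊞ n ⊞ γ′)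
      in # 1 ⊞ N′ ⊠ N′ ⊠ N′ ⊠ (# 1 ⊞ D′) ⊞ (# 1 ⊞ # 6 ⊠ n ⊞ # 6 ⊠ n ⊠ n ⊞ # 2 ⊠ n ⊠ n ⊠ n) ≐ γ′ ⊠ (N′ ⊠ (# 1 ⊞ E′))) ≡.refl n)
    (ℕₚ.m≤m+n _ _)

  -- The left side equals `4 N^4 + 3 N^2 - 2 N`.
  small : N ℕ.* (n ℕ.+ D) ℕ.< size
  small = ℕₚ.≤-trans (≡.subst (suc (N ℕ.* (n ℕ.+ D)) ℕ.≤_) (ℕ-solve 1 (λ n →
      let N′ = # 1 ⊞ n
          γ′ = # 1 ⊞ (# 2 ⊠ n ⊠ n ⊞ # 3 ⊠ n) ⊞ N′
          E′ = N′ ⊞ γ′ ⊠ N′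
          D′ = γ′ ⊠ n ⊞ (E′ ⊞ n ⊞ γ′)
      in # 1 ⊞ N′ ⊠ (n ⊞ D′) ⊞ (# 4 ⊞ # 20 ⊠ n ⊞ # 33 ⊠ n ⊠ n ⊞ # 24 ⊠ n ⊠ n ⊠ n ⊞ # 6 ⊠ n ⊠ n ⊠ n ⊠ n) ≐ # 10 ⊠ (N′ ⊠ N′ ⊠ N′ ⊠ N′)) ≡.refl n)
    (ℕₚ.m≤m+n _ _)) large

  degree-small : D ℕ.+ G ℕ.+ n ℕ.< size
  degree-small = ℕₚ.≤-trans (≡.subst (suc (D ℕ.+ G ℕ.+ n) ℕ.≤_) (ℕ-solve 1 (λ n →
      let N′ = # 1 ⊞ n
          G′ = # 2 ⊠ n ⊠ n ⊞ # 3 ⊠ n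
          γ′ = # 1 ⊞ G′ ⊞ N′
          E′ = N′ ⊞ γ′ ⊠ N′
          D′ = γ′ ⊠ n ⊞ (E′ ⊞ n ⊞ γ′)
      in # 1 ⊞ (D′ ⊞ G′ ⊞ n) ⊞ (# 4 ⊞ # 22 ⊠ n ⊞ # 46 ⊠ n ⊠ n ⊞ # 36 ⊠ n ⊠ n ⊠ n ⊞ # 10 ⊠ n ⊠ n ⊠ n ⊠ n) ≐ # 10 ⊠ (N′ ⊠ N′ ⊠ N′ ⊠ N′)) ≡.refl n)
    (ℕₚ.m≤m+n _ _)) large

  monic-multiple-zero : ∀ {T Kd m f g} → K.Deg T f → f T K.≈ K.1# → K.Deg m g → Kd ℕ.< T → K.Deg Kd (f * g) → g ≈ 0#
  monic-multiple-zero {T} {Kd} {m} {f} {g} df lead = go m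
    where
    top-zero : ∀ m {g} → K.Deg m g → Kd ℕ.< T → K.Deg Kd (f * g) → g m K.≈ K.0#
    top-zero m {g} dg lt dfg = K.trans (K.sym (K.*-identityˡ (g m))) (K.trans (K.*-congʳ (K.sym lead))
      (K.trans (K.sym (K.top-* T m df dg)) (dfg (T ℕ.+ m) (ℕₚ.<-≤-trans lt (ℕₚ.m≤m+n T m)))))
    go : ∀ m {g} → K.Deg m g → Kd ℕ.< T → K.Deg Kd (f * g) → g ≈ 0#
    go zero {g} dg lt dfg = pt λ { zero → top-zero 0 dg lt dfg ; (suc i) → dg (suc i) (s≤s z≤n) }
    go (suc m) {g} dg lt dfg = go m lower lt dfg
      where
      lower : K.Deg m g
      lower i l with i ℕ.≟ suc m
      ... | yes ≡.refl = top-zero (suc m) dg lt dfg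
      ... | no ne = dg i (ℕₚ.≤∧≢⇒< l (ne ∘ ≡.sym))

  Deg-Λ : K.Deg (size ∸ 1) Λ
  Deg-Λ = K.Deg-+ {f = K.X ^ (size ∸ 1)} (K.Deg-X^ (size ∸ 1)) (K.Deg-neg {f = 1#} (K.Deg-C K.1#))

  top-Λ : Λ (size ∸ 1) K.≈ K.1#
  top-Λ = K.trans (K.+-cong (K.X^-top (size ∸ 1)) (K.Deg-neg {f = 1#} (K.Deg-C {0} K.1#) (size ∸ 1) (ℕₚ.m<n⇒0<n∸m K.1<size))) (K.+-identityʳ K.1#)

  -- In the basis `1, y, ..., y^n` the equation holds coordinatewise, and a nonzero multiple of the
  -- monic `Λ^k` has too large a degree.
  Λ-multiple-zero : ∀ {Kd b g} k → Fil Kd 0 b → InR g → b ≈ Λ ^ k * g → Kd ℕ.< k ℕ.* (size ∸ 1) → b ≈ 0#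
  Λ-multiple-zero {Kd} {b} {g} k fb (m , fg) e lt =
    let (P , wP , eP) = normal-form fb
        (Q , wQ , eQ) = normal-form fg
        dP : ∀ j → j ℕ.< suc n → K.Deg Kd (P j)
        dP j l = W⇒Deg {Kd} {j ℕ.+ 0} (wP j l)
        dQ : ∀ j → j ℕ.< suc n → K.Deg m (Q j)
        dQ j l = W⇒Deg {m} {j ℕ.+ 0} (wQ j l)
        dΛ = K.Deg-^ (size ∸ 1) k Deg-Λ
        T = k ℕ.* (size ∸ 1)
        same : ∀ j → j ℕ.< suc n → P j + - (Λ ^ k * Q j) ≈ 0#
        same = independent (Kd ⊔ (T ℕ.+ m)) (λ j → P j + - (Λ ^ k * Q j))
          (λ j l → K.Deg-+ {f = P j} (K.Deg-mono {f = P j} (ℕₚ.m≤m⊔n Kd (T ℕ.+ m)) (dP j l))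
             (K.Deg-neg {f = Λ ^ k * Q j} (K.Deg-mono {f = Λ ^ k * Q j} (ℕₚ.m≤n⊔m Kd (T ℕ.+ m)) (K.Deg-* T m dΛ (dQ j l)))))
          (begin
            ∑ (suc n) (λ j → (P j + - (Λ ^ k * Q j)) * y ^ j)
              ≈⟨ ∑-cong (suc n) (λ j _ → solve 4 (λ p l q z → (p :- l :* q) :* z := p :* z :- l :* (q :* z)) refl (P j) (Λ ^ k) (Q j) (y ^ j)) ⟩
            ∑ (suc n) (λ j → P j * y ^ j + - (Λ ^ k * (Q j * y ^ j)))
              ≈⟨ ∑-+ (suc n) (λ j → P j * y ^ j) (λ j → - (Λ ^ k * (Q j * y ^ j))) ⟩
            ∑ (suc n) (λ j → P j * y ^ j) + ∑ (suc n) (λ j → - (Λ ^ k * (Q j * y ^ j)))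
              ≈⟨ +-congˡ (trans (∑-neg (suc n) (λ j → Λ ^ k * (Q j * y ^ j))) (-‿cong (∑-*ˡ (suc n) (Λ ^ k) (λ j → Q j * y ^ j)))) ⟩
            ∑ (suc n) (λ j → P j * y ^ j) + - (Λ ^ k * ∑ (suc n) (λ j → Q j * y ^ j))
              ≈⟨ +-cong (sym eP) (-‿cong (*-congˡ (sym eQ))) ⟩
            b + - (Λ ^ k * g) ≈⟨ trans (+-congʳ e) (-‿inverseʳ _) ⟩
            0# ∎)
        Q≈0 : ∀ j → j ℕ.< suc n → Q j ≈ 0#
        Q≈0 j l = monic-multiple-zero dΛ (K.trans (K.top-^ (size ∸ 1) k Deg-Λ) (K.trans (K.^-congˡ k top-Λ) (K.1^ k))) (dQ j l) lt
          (K.Deg-cong (difference-zero (P j) (Λ ^ k * Q j) (same j l)) (dP j l))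
    in trans e (zero-mulʳ (trans eQ (∑-zero (suc n) {λ j → Q j * y ^ j} (λ j l → zero-mulˡ (Q≈0 j l)))))

  -- The auxiliary function `∑ r_l L^l` over `l < γ`, free of `Z`; the block `l` of the parameters
  -- gives `r_l`.
  initial : (ℕ → K.Carrier) → Vec
  initial ν zero l with l ℕ.<? γ
  ... | yes _ = combination E (λ i → ν (i ℕ.+ l ℕ.* M))
  ... | no _ = 0#
  initial ν (suc j) l = 0#

  initial-at : ∀ ν {l} → l ℕ.< γ → initial ν 0 l ≡ combination E (λ i → ν (i ℕ.+ l ℕ.* M))
  initial-at ν {l} lt with l ℕ.<? γ
  ... | yes _ = ≡.refl
  ... | no nl = ⊥-elim (nl lt)

  Graded-initial : ∀ ν → Graded (E ℕ.+ n ℕ.+ γ) 0 (initial ν)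
  Graded-initial ν (suc j) l _ = Fil-0
  Graded-initial ν zero l _ with l ℕ.<? γ
  ... | yes lt = Fil-weaken (ℕₚ.≤-trans (ℕₚ.+-monoʳ-≤ (E ℕ.+ n) (ℕₚ.<⇒≤ lt)) (ℕₚ.m≤m+n (E ℕ.+ n ℕ.+ γ) 0)) (Fil-combination E (λ i → ν (i ℕ.+ l ℕ.* M)))
  ... | no _ = Fil-0

  power : (ℕ → K.Carrier) → Vec
  power ν = iterate γ (initial ν)

  abstract
    Graded-power : ∀ ν → Graded D 0 (power ν)
    Graded-power ν = Graded-iterate γ (initial ν) (Graded-initial ν)

  coordinates : (ℕ → K.Carrier) → ℕ → ℕ → 𝕃.PS
  coordinates ν j l with j ℕ.<? suc n
  ... | yes j≤n = proj₁ (normal-form (Graded-power ν j l j≤n))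
  ... | no _ = λ _ → 0#

  coordinates-spec : ∀ ν j l → j ℕ.< suc n →
    (∀ b → b ℕ.< suc n → K.Deg D (coordinates ν j l b)) × (power ν j l ≈ ∑ (suc n) (λ b → coordinates ν j l b * y ^ b))
  coordinates-spec ν j l lt with j ℕ.<? suc n
  ... | no nl = ⊥-elim (nl lt)
  ... | yes j≤n = (λ b b≤n → W⇒Deg {D} {b ℕ.+ (j ℕ.+ l)} (proj₁ (proj₂ (normal-form (Graded-power ν j l j≤n))) b b≤n)) ,
                  proj₂ (proj₂ (normal-form (Graded-power ν j l j≤n)))

  parameters : (ℕ → K.Carrier) → ℕ → ℕ → ℕ → ℕ → K.Carrier
  parameters ν l j b a = coordinates ν j (suc G ℕ.+ l) b a

  Agree : (ℕ → K.Carrier) → (ℕ → K.Carrier) → Set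
  Agree ν ν′ = ∀ c → c ℕ.< N ℕ.* N ℕ.* N ℕ.* suc D → decode N (suc D) (parameters ν) c K.≈ decode N (suc D) (parameters ν′) c

  top-coefficients : ∀ ν ν′ → Agree ν ν′ → ∀ j l → j ℕ.< suc n → l ℕ.< N → power ν j (suc G ℕ.+ l) ≈ power ν′ j (suc G ℕ.+ l)
  top-coefficients ν ν′ agree j l j≤n l≤n = trans (proj₂ s) (trans (∑-cong (suc n) (λ b b≤n → *-congʳ {y ^ b} (pt (same b b≤n)))) (sym (proj₂ s′)))
    where
    s = coordinates-spec ν j (suc G ℕ.+ l) j≤n
    s′ = coordinates-spec ν′ j (suc G ℕ.+ l) j≤n
    same : ∀ b → b ℕ.< suc n → ∀ a → coordinates ν j (suc G ℕ.+ l) b a K.≈ coordinates ν′ j (suc G ℕ.+ l) b a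
    same b b≤n a with a ℕ.<? suc D
    ... | no nl = K.trans (proj₁ s b b≤n a (ℕₚ.≮⇒≥ nl)) (K.sym (proj₁ s′ b b≤n a (ℕₚ.≮⇒≥ nl)))
    ... | yes lt = ≡.subst₂ K._≈_ (decode-encode N (suc D) (parameters ν) l j≤n b≤n lt) (decode-encode N (suc D) (parameters ν′) l j≤n b≤n lt)
      (agree (encode N (suc D) l j b a) (encode-< N (suc D) l≤n j≤n b≤n lt))

  Graded-⊟ : ∀ {D c d} → Graded D 0 c → Graded D 0 d → Graded D 0 (c ⊟ d)
  Graded-⊟ gc gd j l j≤n = Fil-+ (gc j l j≤n) (Fil-neg (gd j l j≤n))

  R-X^size : InR (K.X ^ size)
  R-X^size = R-X^ size

  R-λq : InR λq
  R-λq = R-+ R-X^size (R-neg (R-poly K.X K.Deg-X))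

  R-zq : InR zq
  R-zq = R-^ size R-y

  -- At the Frobenius point each application of `W*` contributes one factor `Λ`, by
  -- `quotient-divisible`.
  evS-divisible : ∀ c → Graded (E ℕ.+ n ℕ.+ γ) 0 c → Σ K.PS λ g → InR g × (evS Eₑ (iterate γ c) ≈ Λ ^ γ * g)
  evS-divisible c gr =
    let (g , rg , e) = quotient-divisible
    in g ^ γ * evS Eₑ c , R-* (R-^ γ rg) (R-∑ (suc n) λ j j≤n →
         R-* (R-ev Eₑ′ (λ l → c j l) (λ l → E ℕ.+ n ℕ.+ γ , Fil-weaken (ℕₚ.+-monoʳ-≤ (E ℕ.+ n ℕ.+ γ) z≤n) (gr j l j≤n)) R-λq) (R-^ j R-zq)) , (begin
      evS Eₑ (iterate γ c) ≈⟨ evS-iterate {E ℕ.+ n ℕ.+ γ} Eₑ γ c ℕₚ.≤-refl gr ⟩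
      𝕃.dd (suc n) H y zq ^ γ * evS Eₑ c ≈⟨ *-congʳ (trans (^-congˡ γ e) (^-distrib-* Λ g γ)) ⟩
      Λ ^ γ * g ^ γ * evS Eₑ c ≈⟨ *-assoc _ _ _ ⟩
      Λ ^ γ * (g ^ γ * evS Eₑ c) ∎)
    where Eₑ′ = Eₑ

  γ≤Eₑ : γ ℕ.≤ suc Eₑ
  γ≤Eₑ = ℕₚ.m≤n⇒m≤1+n (ℕₚ.≤-trans (ℕₚ.m≤n+m γ (γ ℕ.* n ℕ.+ (E ℕ.+ n))) (ℕₚ.≤-trans
    (ℕₚ.≤-reflexive (ℕₚ.+-assoc (γ ℕ.* n) (E ℕ.+ n) γ)) (ℕₚ.≤-trans (ℕₚ.m≤n+m D N) (ℕₚ.m≤m+n (N ℕ.+ D) N))))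

  module Truncation (c : Vec) (gr : Graded D 0 c) (g : K.PS) (rg : InR g) (divides : evS Eₑ c ≈ Λ ^ γ * g)
    (killed : ∀ j l → j ℕ.< suc n → l ℕ.< N → c j (suc G ℕ.+ l) ≈ 0#) where

    kept : K.PS
    kept = ∑ (suc n) (λ j → 𝕃.ev G (c j) λq * zq ^ j)

    tail : ℕ → K.PS
    tail j = ∑ (suc Eₑ ∸ γ) (λ i → c j (γ ℕ.+ i) * (K.X ^ γ * λq ^ i))

    -- From `L^γ` on, every term carries `(X^q - X)^γ = X^γ Λ^γ`; the terms strictly between `G` and
    -- `γ` are killed.
    split : ∀ j → j ℕ.< suc n → 𝕃.ev Eₑ (c j) λq ≈ 𝕃.ev G (c j) λq + Λ ^ γ * tail j
    split j j≤n = begin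
      𝕃.ev Eₑ (c j) λq ≈⟨ 𝕃.ev-∑ Eₑ (c j) λq ⟩
      ∑ (suc Eₑ) t ≡⟨ ≡.cong (λ m → ∑ m t) (ℕₚ.m+[n∸m]≡n γ≤Eₑ) ⟨
      ∑ (γ ℕ.+ (suc Eₑ ∸ γ)) t ≈⟨ ∑-split γ (suc Eₑ ∸ γ) t ⟩
      ∑ γ t + ∑ (suc Eₑ ∸ γ) (λ i → t (γ ℕ.+ i)) ≈⟨ +-cong (∑-split (suc G) N t) (∑-cong (suc Eₑ ∸ γ) (λ i _ → high i)) ⟩
      (∑ (suc G) t + ∑ N (λ i → t (suc G ℕ.+ i))) + ∑ (suc Eₑ ∸ γ) (λ i → Λ ^ γ * (c j (γ ℕ.+ i) * (K.X ^ γ * λq ^ i)))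
        ≈⟨ +-cong (trans (+-congˡ (∑-zero N {λ i → t (suc G ℕ.+ i)} (λ i i≤n → zero-mulˡ (killed j i j≤n i≤n)))) (+-identityʳ _))
                  (∑-*ˡ (suc Eₑ ∸ γ) (Λ ^ γ) (λ i → c j (γ ℕ.+ i) * (K.X ^ γ * λq ^ i))) ⟩
      ∑ (suc G) t + Λ ^ γ * tail j ≈⟨ +-congʳ (𝕃.ev-∑ G (c j) λq) ⟨
      𝕃.ev G (c j) λq + Λ ^ γ * tail j ∎
      where
      t : ℕ → K.PS
      t l = c j l * λq ^ l
      high : ∀ i → t (γ ℕ.+ i) ≈ Λ ^ γ * (c j (γ ℕ.+ i) * (K.X ^ γ * λq ^ i))
      high i = begin
        c j (γ ℕ.+ i) * λq ^ (γ ℕ.+ i)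
          ≈⟨ *-congˡ (trans (^-homo-* λq γ i) (*-congʳ (trans (^-congˡ γ (sym X*Λ)) (^-distrib-* K.X Λ γ)))) ⟩
        c j (γ ℕ.+ i) * (K.X ^ γ * Λ ^ γ * λq ^ i)
          ≈⟨ solve 4 (λ c x l q → c :* (x :* l :* q) := l :* (c :* (x :* q))) refl (c j (γ ℕ.+ i)) (K.X ^ γ) (Λ ^ γ) (λq ^ i) ⟩
        Λ ^ γ * (c j (γ ℕ.+ i) * (K.X ^ γ * λq ^ i)) ∎

    Fil-c : ∀ j l → j ℕ.< suc n → Fil D 0 (c j l)
    Fil-c j l j≤n = Fil-weaken (ℕₚ.+-monoʳ-≤ D z≤n) (gr j l j≤n)

    R-c : ∀ j l → j ℕ.< suc n → InR (c j l)
    R-c j l j≤n = D , Fil-c j l j≤n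

    tails : K.PS
    tails = ∑ (suc n) (λ j → tail j * zq ^ j)

    R-tails : InR tails
    R-tails = R-∑ (suc n) (λ j j≤n → R-* (R-∑ (suc Eₑ ∸ γ) (λ i _ →
      R-* (R-c j (γ ℕ.+ i) j≤n) (R-* (R-X^ γ) (R-^ i R-λq)))) (R-^ j R-zq))

    kept-divisible : kept ≈ Λ ^ γ * (g + - tails)
    kept-divisible = begin
      kept ≈⟨ solve 3 (λ k l t → k := (k :+ l :* t) :- l :* t) refl kept (Λ ^ γ) tails ⟩
      (kept + Λ ^ γ * tails) + - (Λ ^ γ * tails) ≈⟨ +-congʳ (+-congˡ (sym (∑-*ˡ (suc n) (Λ ^ γ) (λ j → tail j * zq ^ j)))) ⟩
      (kept + ∑ (suc n) (λ j → Λ ^ γ * (tail j * zq ^ j))) + - (Λ ^ γ * tails)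
        ≈⟨ +-congʳ (sym (∑-+ (suc n) (λ j → 𝕃.ev G (c j) λq * zq ^ j) (λ j → Λ ^ γ * (tail j * zq ^ j)))) ⟩
      ∑ (suc n) (λ j → 𝕃.ev G (c j) λq * zq ^ j + Λ ^ γ * (tail j * zq ^ j)) + - (Λ ^ γ * tails)
        ≈⟨ +-congʳ (∑-cong (suc n) (λ j j≤n → trans
             (solve 4 (λ e l t z → e :* z :+ l :* (t :* z) := (e :+ l :* t) :* z) refl (𝕃.ev G (c j) λq) (Λ ^ γ) (tail j) (zq ^ j))
             (*-congʳ (sym (split j j≤n))))) ⟩
      evS Eₑ c + - (Λ ^ γ * tails) ≈⟨ +-congʳ divides ⟩
      Λ ^ γ * g + - (Λ ^ γ * tails) ≈⟨ solve 3 (λ l g t → l :* g :- l :* t := l :* (g :- t)) refl (Λ ^ γ) g tails ⟩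
      Λ ^ γ * (g + - tails) ∎

    Fil-kept : Fil (D ℕ.+ (G ℕ.+ n) ℕ.* size) 0 kept
    Fil-kept = Fil-∑ (suc n) λ { j (s≤s j≤n) → Fil-cong (*-congʳ (sym (𝕃.ev-∑ G (c j) λq)))
      (Fil-cong (∑-*ʳ (suc G) (zq ^ j) (λ l → c j l * λq ^ l)) (Fil-∑ (suc G) λ { l (s≤s l≤G) → term j l j≤n l≤G })) }
      where
      Fil-λq : Fil size 0 λq
      Fil-λq = Fil-+ (Fil-poly (λ a lt → K.Deg-X^ size a (≡.subst (size ℕ.<_) (ℕₚ.+-identityʳ a) lt)))
                     (Fil-neg (Fil-weaken (ℕₚ.+-monoˡ-≤ 0 K.0<size) Fil-x))
      term : ∀ j l → j ℕ.≤ n → l ℕ.≤ G → Fil (D ℕ.+ (G ℕ.+ n) ℕ.* size) 0 (c j l * λq ^ l * zq ^ j)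
      term j l j≤n l≤G = Fil-weaken
        (ℕₚ.+-mono-≤ (ℕₚ.≤-trans (ℕₚ.≤-reflexive (ℕ-solve 4 (λ D l s j → D ⊞ l ⊠ s ⊞ j ⊠ (s ⊠ # 1) ≐ D ⊞ (l ⊞ j) ⊠ s) ≡.refl D l size j))
           (ℕₚ.+-monoʳ-≤ D (ℕₚ.*-monoˡ-≤ size (ℕₚ.+-mono-≤ l≤G j≤n)))) z≤n)
        (Fil-* (Fil-* (Fil-c j l (s≤s j≤n)) (Fil-^ l Fil-λq)) (Fil-^ j (Fil-^ size Fil-y)))

    -- The degree `D + (G + n) q` lies below `γ (q - 1) = (G + n + 2)(q - 1)`. Removing the powers
    -- of `L` above `G` makes up for the `n q` that `y^(q n)` contributes.
    kept≈0 : kept ≈ 0#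
    kept≈0 = Λ-multiple-zero γ Fil-kept (R-+ rg (R-neg R-tails)) kept-divisible bound
      where
      s = size ∸ 1
      bound : D ℕ.+ (G ℕ.+ n) ℕ.* size ℕ.< γ ℕ.* s
      bound = ≡.subst (λ q → D ℕ.+ (G ℕ.+ n) ℕ.* q ℕ.< γ ℕ.* s) suc-pred-size
        (≡.subst₂ ℕ._<_ (ℕ-solve 4 (λ D G n s → D ⊞ G ⊞ n ⊞ (G ⊞ n) ⊠ s ≐ D ⊞ (G ⊞ n) ⊠ (# 1 ⊞ s)) ≡.refl D G n s)
                        (ℕ-solve 3 (λ G n s → s ⊞ s ⊞ (G ⊞ n) ⊠ s ≐ (# 1 ⊞ G ⊞ (# 1 ⊞ n)) ⊠ s) ≡.refl G n s)
          (ℕₚ.+-monoˡ-< ((G ℕ.+ n) ℕ.* s) (ℕₚ.<-≤-trans degree-small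
            (≡.subst (ℕ._≤ s ℕ.+ s) (≡.trans (ℕₚ.+-comm s 1) suc-pred-size) (ℕₚ.+-monoʳ-≤ s (ℕₚ.m<n⇒0<n∸m K.1<size))))))

    x^-1 : Fil 1 0 (- K.X)
    x^-1 = Fil-neg Fil-x

    -- The part of `c j` up to `L^G`, rewritten in powers of `X + L`; as this becomes `X^q`, `kept`
    -- turns into a combination of `q`-th powers.
    shifted : ℕ → 𝕃.PS
    shifted j = translate (- K.X) G (c j)

    shifted≈0 : ∀ j l → j ℕ.< suc n → l ℕ.< suc G → shifted j l ≈ 0#
    shifted≈0 = frobenius-independent {D} small G shifted
      (λ j l j≤n _ → Fil-weaken (ℕₚ.+-monoʳ-≤ D z≤n) (Fil-translate {D} {0} (- K.X) G (c j) x^-1 (λ l → Fil-weaken (ℕₚ.+-monoʳ-≤ D (ℕₚ.m≤n+m l j)) (gr j l j≤n)) l))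
      (begin
        ∑ (suc n) (λ j → ∑ (suc G) (λ l → shifted j l * (K.X ^ l * y ^ j) ^ size))
          ≈⟨ ∑-cong (suc n) (λ j _ → trans (∑-cong (suc G) (λ l _ → separate j l)) (∑-*ʳ (suc G) (zq ^ j) (λ l → shifted j l * (K.X ^ size) ^ l))) ⟩
        ∑ (suc n) (λ j → ∑ (suc G) (λ l → shifted j l * (K.X ^ size) ^ l) * zq ^ j)
          ≈⟨ ∑-cong (suc n) (λ j _ → *-congʳ {zq ^ j} (sym (𝕃.ev-∑ G (shifted j) (K.X ^ size)))) ⟩
        ∑ (suc n) (λ j → 𝕃.ev G (shifted j) (K.X ^ size) * zq ^ j)
          ≈⟨ ∑-cong (suc n) (λ j _ → *-congʳ {zq ^ j} (trans (ev-translate (- K.X) G (c j) (K.X ^ size)) (𝕃.ev-cong G (𝕃R.refl {c j}) (+-comm (- K.X) (K.X ^ size))))) ⟩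
        kept ≈⟨ kept≈0 ⟩
        0# ∎)
      where
      separate : ∀ j l → shifted j l * (K.X ^ l * y ^ j) ^ size ≈ shifted j l * (K.X ^ size) ^ l * zq ^ j
      separate j l = trans (*-congˡ (trans (^-distrib-* (K.X ^ l) (y ^ j) size) (*-cong (^-comm K.X l size) (^-comm y j size)))) (sym (*-assoc _ _ _))

    vanish : ∀ j l → j ℕ.< suc n → l ℕ.< γ → c j l ≈ 0#
    vanish j l j≤n l<γ with l ℕ.<? suc G
    ... | yes (s≤s l≤G) = translate-injective (- K.X) G (c j) below l l≤G
      where
      below : ∀ l → shifted j l ≈ 0#
      below l with l ℕ.<? suc G
      ... | yes lt = shifted≈0 j l j≤n lt
      ... | no nl = Deg-translate (- K.X) G (c j) l (ℕₚ.≮⇒≥ nl)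
    ... | no nl = ≡.subst (λ l → c j l ≈ 0#) (ℕₚ.m+[n∸m]≡n (ℕₚ.≮⇒≥ nl))
      (killed j (l ∸ suc G) j≤n (ℕₚ.+-cancelˡ-< (suc G) (l ∸ suc G) N (≡.subst (ℕ._< γ) (≡.sym (ℕₚ.m+[n∸m]≡n (ℕₚ.≮⇒≥ nl))) l<γ)))

  series-^-≉0 : ∀ {f} m → ¬ (f ≈ 0#) → ¬ (f ^ m ≈ 0#)
  series-^-≉0 zero nf e = K.1≉0 (at e 0)
  series-^-≉0 (suc m) nf e = series-^-≉0 m nf (K.series-domain e nf)

  -- Induction on `l`, with `m` as fuel: once the coefficients below `l` vanish, the lowest term
  -- after `γ` applications of `W*` is `c 0 l` times a power of the derivative, and the latter
  -- cancels.
  diagonal : ∀ c → (∀ j l → c (suc j) l ≈ 0#) → (∀ j l → j ℕ.< suc n → l ℕ.< γ → iterate γ c j l ≈ 0#) →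
    ∀ m l → l ℕ.< m → l ℕ.< γ → c 0 l ≈ 0#
  diagonal c others zero-below (suc m) l (s≤s l≤m) l<γ = K.series-domain (begin
      𝕃.dd (suc n) H y y ^ γ * c 0 l ≈⟨ *-congˡ (sym first) ⟩
      𝕃.dd (suc n) H y y ^ γ * Δ l c ≈⟨ Δ-iterate l γ c low ⟨
      Δ l (iterate γ c) ≈⟨ ∑-zero (suc n) {λ j → iterate γ c j l * y ^ j} (λ j j≤n → zero-mulˡ (zero-below j l j≤n l<γ)) ⟩
      0# ∎) (series-^-≉0 γ simple)
    where
    low : Low l c
    low zero i _ i<l = diagonal c others zero-below m i (ℕₚ.<-≤-trans i<l l≤m) (ℕₚ.<-trans i<l l<γ)
    low (suc j) i _ _ = others j i
    first : Δ l c ≈ c 0 l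
    first = trans (+-congˡ (∑-zero n {λ j → c (suc j) l * y ^ suc j} (λ j _ → zero-mulˡ (others j l)))) (trans (+-identityʳ _) (*-identityʳ _))

  contradiction : ⊥
  contradiction = clash (Pigeonhole.collision F (γ ℕ.* M) (N ℕ.* N ℕ.* N ℕ.* suc D) fewer (λ ν → decode N (suc D) (parameters ν)))
    where
    clash : (Σ (ℕ → K.Carrier) λ ν → Σ (ℕ → K.Carrier) λ ν′ → (Σ ℕ λ i → i ℕ.< γ ℕ.* M × ¬ (ν i K.≈ ν′ i)) × Agree ν ν′) → ⊥
    clash (ν , ν′ , (i , i<U , ne) , agree) = ne (K.trans (K.reflexive (≡.cong ν i≡))
        (K.trans (combination-injective E (λ i → ν (i ℕ.+ l ℕ.* M)) (λ i → ν′ (i ℕ.+ l ℕ.* M)) equal (i DivMod.% M) (DivMod.m%n<n i M))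
          (K.reflexive (≡.cong ν′ (≡.sym i≡)))))
      where
      l = i DivMod./ M
      i≡ : i ≡ i DivMod.% M ℕ.+ l ℕ.* M
      i≡ = DivMod.m≡m%n+[m/n]*n i M
      l<γ : l ℕ.< γ
      l<γ = DivMod.m<n*o⇒m/o<n i<U
      c₀ = initial ν ⊟ initial ν′
      gr₀ : Graded (E ℕ.+ n ℕ.+ γ) 0 c₀
      gr₀ = Graded-⊟ {c = initial ν} {initial ν′} (Graded-initial ν) (Graded-initial ν′)
      killed : ∀ j l → j ℕ.< suc n → l ℕ.< N → iterate γ c₀ j (suc G ℕ.+ l) ≈ 0#
      killed j l j≤n l<N = trans (iterate-⊟ γ (initial ν) (initial ν′) j (suc G ℕ.+ l))
        (trans (+-congʳ (top-coefficients ν ν′ agree j l j≤n l<N)) (-‿inverseʳ _))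
      div = evS-divisible c₀ gr₀
      zero-below : ∀ j l → j ℕ.< suc n → l ℕ.< γ → iterate γ c₀ j l ≈ 0#
      zero-below = Truncation.vanish (iterate γ c₀) (Graded-iterate {E ℕ.+ n ℕ.+ γ} γ c₀ gr₀)
        (proj₁ div) (proj₁ (proj₂ div)) (proj₂ (proj₂ div)) killed
      c₀≈0 : c₀ 0 l ≈ 0#
      c₀≈0 = diagonal c₀ (λ j l → -‿inverseʳ 0#) zero-below (suc l) l (ℕₚ.n<1+n l) l<γ
      equal : combination E (λ i → ν (i ℕ.+ l ℕ.* M)) ≈ combination E (λ i → ν′ (i ℕ.+ l ℕ.* M))
      equal = difference-zero (combination E (λ i → ν (i ℕ.+ l ℕ.* M))) (combination E (λ i → ν′ (i ℕ.+ l ℕ.* M))) (trans (reflexive (≡.sym (≡.cong₂ (λ u v → u + - v) (initial-at ν l<γ) (initial-at ν′ l<γ)))) c₀≈0)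

-- The minimal polynomial of a power series.

module _ (R : Ring₀) where
  open RingLemmas R
  open Series R
  private module S = RingLemmas series

  -- Descent on the degree of `g`, whose top coefficient would show up in the product at an index of
  -- at least `T`. Regularity of the leading coefficient covers both uses, over `k` and over the
  -- ring of series.
  regular-multiple : ∀ T m {f g} → Deg T f → (∀ z → f T * z ≈ 0# → z ≈ 0#) → Deg m g →
    (∀ i → T ℕ.≤ i → (f S.* g) i ≈ 0#) → g S.≈ S.0#
  regular-multiple T m {f} df reg = go m
    where
    top-zero : ∀ m {g} → Deg m g → (∀ i → T ℕ.≤ i → (f S.* g) i ≈ 0#) → g m ≈ 0#
    top-zero m {g} dg z = reg (g m) (trans (sym (top-* T m df dg)) (z (T ℕ.+ m) (ℕₚ.m≤m+n T m)))
    go : ∀ m {g} → Deg m g → (∀ i → T ℕ.≤ i → (f S.* g) i ≈ 0#) → g S.≈ S.0#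
    go zero dg z = pt λ { zero → top-zero 0 dg z ; (suc i) → dg (suc i) (s≤s z≤n) }
    go (suc m) {g} dg z = go m lower z
      where
      lower : Deg m g
      lower i l with i ℕ.≟ suc m
      ... | yes ≡.refl = top-zero (suc m) dg z
      ... | no ne = dg i (ℕₚ.≤∧≢⇒< l (ne ∘ ≡.sym))

-- The predicate is not decidable, so its minimum exists only under double negation.
least : (P : ℕ → Set) → ∀ n → P n → ¬ ¬ (Σ ℕ λ m → P m × (∀ i → i ℕ.< m → ¬ P i))
least P n pn none = go (suc n) n (ℕₚ.n<1+n n) pn
  where
  go : ∀ b i → i ℕ.< b → ¬ P i
  go (suc b) i (s≤s i≤b) pi = none (i , pi , λ j j<i → go b j (ℕₚ.<-≤-trans j<i i≤b))

module Polynomials (F : FiniteField) where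
  open Weights F
  open K using (series; _≋_; pt; at)
  open RingLemmas series
  module 𝕃R = RingLemmas 𝕃.series

  -- Coefficients in `k[X]` with a common degree bound; `𝕃.PS` by itself admits power series in `X`.
  Pol : 𝕃.PS → Set
  Pol P = Σ ℕ λ D → ∀ j → K.Deg D (P j)

  Pol-+ : ∀ {P Q} → Pol P → Pol Q → Pol (P 𝕃R.+ Q)
  Pol-+ {P} {Q} (D , d) (E , e) = D ⊔ E , λ j → K.Deg-+ {f = P j} (K.Deg-mono {f = P j} (ℕₚ.m≤m⊔n D E) (d j))
                                                       (K.Deg-mono {f = Q j} (ℕₚ.m≤n⊔m D E) (e j))

  Pol-neg : ∀ {P} → Pol P → Pol (𝕃R.- P)
  Pol-neg {P} (D , d) = D , λ j → K.Deg-neg {f = P j} (d j)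

  Pol-* : ∀ {P Q} → Pol P → Pol Q → Pol (P 𝕃R.* Q)
  Pol-* {P} {Q} (D , d) (E , e) = D ℕ.+ E , go P d
    where
    go : ∀ P → (∀ j → K.Deg D (P j)) → ∀ j → K.Deg (D ℕ.+ E) (𝕃.conv P Q j)
    go P d zero = K.Deg-* D E (d 0) (e 0)
    go P d (suc j) = K.Deg-+ {f = P 0 * Q (suc j)} (K.Deg-* D E (d 0) (e (suc j))) (go (P ∘ suc) (d ∘ suc) j)

  Pol-C : ∀ {D} f → K.Deg D f → Pol (𝕃.C f)
  Pol-C {D} f d = D , λ { zero → d ; (suc j) i l → K.refl }

  Pol-0 : Pol 𝕃R.0#
  Pol-0 = 0 , λ j i l → K.refl

  Pol-X : Pol 𝕃.X
  Pol-X = 0 , λ { zero i l → K.refl ; (suc zero) → K.Deg-C K.1# ; (suc (suc j)) i l → K.refl }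

  Pol-X^ : ∀ k → Pol (𝕃.X 𝕃R.^ k)
  Pol-X^ zero = Pol-C 1# (K.Deg-C {0} K.1#)
  Pol-X^ (suc k) = Pol-* Pol-X (Pol-X^ k)

  monomial-at-top : ∀ t k {U j} → 𝕃.Deg j U → (𝕃.C t 𝕃R.* ((𝕃.X 𝕃R.^ k) 𝕃R.* U)) (k ℕ.+ j) ≈ t * U j
  monomial-at-top t k {U} {j} d = trans (𝕃.C-conv t ((𝕃.X 𝕃R.^ k) 𝕃R.* U) (k ℕ.+ j)) (*-congˡ (𝕃.X^*-high k U j))

  Deg-monomial : ∀ t k {U j} → 𝕃.Deg j U → 𝕃.Deg (k ℕ.+ j) (𝕃.C t 𝕃R.* ((𝕃.X 𝕃R.^ k) 𝕃R.* U))
  Deg-monomial t k {U} {j} d = 𝕃.Deg-* 0 (k ℕ.+ j) (𝕃.Deg-C t) (𝕃.Deg-* k j (𝕃.Deg-X^ k) d)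

  divide-monic : ∀ j {U} → 𝕃.Deg j U → U j ≈ 1# → Pol U → ∀ m C → (∀ i → m ℕ.≤ i → C i ≈ 0#) → Pol C →
    Σ 𝕃.PS λ Q → Σ 𝕃.PS λ R → (C 𝕃.≋ (U 𝕃R.* Q 𝕃R.+ R)) × (∀ i → j ℕ.≤ i → R i ≈ 0#) × Pol Q × Σ ℕ (λ e → 𝕃.Deg e Q)
  divide-monic j {U} dU lead pU m C dC pC with m ℕ.≤? j
  ... | yes m≤j = 𝕃R.0# , C , 𝕃R.sym (𝕃R.trans (𝕃R.+-congʳ (𝕃R.zeroʳ U)) (𝕃R.+-identityˡ C)) ,
                  (λ i l → dC i (ℕₚ.≤-trans m≤j l)) , Pol-0 , 0 , 𝕃.Deg-0 {0}
  divide-monic j {U} dU lead pU zero C dC pC | no nm = ⊥-elim (nm z≤n)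
  divide-monic j {U} dU lead pU (suc m) C dC pC | no nm =
    let (Q , R , e , r , pQ , (d , dQ)) = divide-monic j dU lead pU m C′ lower pC′
    in T 𝕃R.+ Q , R , (𝕃R.begin
         C 𝕃R.≈⟨ 𝕃R.solve 2 (λ c m → c 𝕃R.:= m 𝕃R.:+ (c 𝕃R.:- m)) 𝕃R.refl C (mono) ⟩
         mono 𝕃R.+ C′ 𝕃R.≈⟨ 𝕃R.+-congˡ e ⟩
         mono 𝕃R.+ (U 𝕃R.* Q 𝕃R.+ R)
           𝕃R.≈⟨ 𝕃R.solve 5 (λ t x u q r → t 𝕃R.:* (x 𝕃R.:* u) 𝕃R.:+ (u 𝕃R.:* q 𝕃R.:+ r) 𝕃R.:= u 𝕃R.:* (t 𝕃R.:* x 𝕃R.:+ q) 𝕃R.:+ r)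
                  𝕃R.refl (𝕃.C (C m)) (𝕃.X 𝕃R.^ (m ∸ j)) U Q R ⟩
         U 𝕃R.* (T 𝕃R.+ Q) 𝕃R.+ R 𝕃R.∎) , r ,
       Pol-+ (Pol-* pCm (Pol-X^ (m ∸ j))) pQ ,
       (m ∸ j) ⊔ d , 𝕃.Deg-+ {f = T} {Q} (𝕃.Deg-mono {f = T} (ℕₚ.m≤m⊔n (m ∸ j) d) (𝕃.Deg-* 0 (m ∸ j) (𝕃.Deg-C (C m)) (𝕃.Deg-X^ (m ∸ j))))
                                       (𝕃.Deg-mono {f = Q} (ℕₚ.m≤n⊔m (m ∸ j) d) dQ)
    where
    j≤m : j ℕ.≤ m
    j≤m = ℕₚ.≤-pred (ℕₚ.≰⇒> nm)
    k+j = ℕₚ.m∸n+n≡m j≤m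
    T = 𝕃.C (C m) 𝕃R.* (𝕃.X 𝕃R.^ (m ∸ j))
    mono = 𝕃.C (C m) 𝕃R.* ((𝕃.X 𝕃R.^ (m ∸ j)) 𝕃R.* U)
    C′ = C 𝕃R.+ 𝕃R.- mono
    pCm : Pol (𝕃.C (C m))
    pCm = Pol-C (C m) (proj₂ pC m)
    pC′ : Pol C′
    pC′ = Pol-+ pC (Pol-neg {mono} (Pol-* pCm (Pol-* (Pol-X^ (m ∸ j)) pU)))
    mono-deg : 𝕃.Deg m mono
    mono-deg = ≡.subst (λ r → 𝕃.Deg r mono) k+j (Deg-monomial (C m) (m ∸ j) dU)
    mono-top : mono m ≈ C m
    mono-top = trans (≡.subst (λ r → mono r ≈ C m * U j) k+j (monomial-at-top (C m) (m ∸ j) dU)) (trans (*-congˡ lead) (*-identityʳ _))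
    lower : ∀ i → m ℕ.≤ i → C′ i ≈ 0#
    lower i m≤i with i ℕ.≟ m
    ... | yes ≡.refl = trans (+-congˡ (-‿cong mono-top)) (-‿inverseʳ _)
    ... | no ne = let m<i = ℕₚ.≤∧≢⇒< m≤i (ne ∘ ≡.sym) in
      zero-sum (dC i m<i) (trans (-‿cong (mono-deg i m<i)) -0#≈0#)

  -- Euclidean division in k[X] by a polynomial c with c e ≠ 0.
  divide : ∀ e {c} → K.Deg e c → ¬ (c e K.≈ K.0#) → ∀ m l → (∀ i → m ℕ.≤ i → l i K.≈ K.0#) →
    Σ K.PS λ g → Σ ℕ (λ d → K.Deg d g) × (∀ i → e ℕ.≤ i → (l + - (g * c)) i K.≈ K.0#)
  divide e {c} dc ne m l z with m ℕ.≤? e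
  ... | yes m≤e = 0# , (0 , K.Deg-0 {0}) , λ i le → K.zero-sum (z i (ℕₚ.≤-trans m≤e le))
                    (K.trans (K.-‿cong (at (zeroˡ c) i)) K.-0#≈0#)
  divide e {c} dc ne zero l z | no nm = ⊥-elim (nm z≤n)
  divide e {c} dc ne (suc m) l z | no nm =
    let (g , (d , dg) , r) = divide e dc ne m l′ lower
    in T + g , ((m ∸ e) ⊔ d , K.Deg-+ {f = T} {g} (K.Deg-mono {f = T} (ℕₚ.m≤m⊔n (m ∸ e) d) dT) (K.Deg-mono {f = g} (ℕₚ.m≤n⊔m (m ∸ e) d) dg)) ,
       λ i le → K.trans (at (solve 4 (λ l t g c → l :- (t :+ g) :* c := (l :- t :* c) :- g :* c) refl l T g c) i) (r i le)
    where
    e≤m : e ℕ.≤ m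
    e≤m = ℕₚ.≤-pred (ℕₚ.≰⇒> nm)
    cinv = K.inv (c e) ne
    t = l m K.* proj₁ cinv
    T = K.C t * K.X ^ (m ∸ e)
    dT : K.Deg (m ∸ e) T
    dT = K.Deg-* 0 (m ∸ e) (K.Deg-C t) (K.Deg-X^ (m ∸ e))
    l′ = l + - (T * c)
    top : (T * c) m K.≈ l m
    top = K.begin
      (T * c) m K.≡⟨ ≡.cong (T * c) (ℕₚ.m∸n+n≡m e≤m) ⟨
      (T * c) (m ∸ e ℕ.+ e) K.≈⟨ K.top-* (m ∸ e) e dT dc ⟩
      T (m ∸ e) K.* c e K.≈⟨ K.*-congʳ (K.trans (K.C-conv t (K.X ^ (m ∸ e)) (m ∸ e)) (K.trans (K.*-congˡ (K.X^-top (m ∸ e))) (K.*-identityʳ t))) ⟩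
      l m K.* proj₁ cinv K.* c e K.≈⟨ K.trans (K.*-assoc _ _ _) (K.*-congˡ (K.trans (K.*-comm _ _) (proj₂ cinv))) ⟩
      l m K.* K.1# K.≈⟨ K.*-identityʳ _ ⟩
      l m K.∎
    lower : ∀ i → m ℕ.≤ i → l′ i K.≈ K.0#
    lower i m≤i with i ℕ.≟ m
    ... | yes ≡.refl = K.trans (K.+-congˡ (K.-‿cong top)) (K.-‿inverseʳ _)
    ... | no n≢ = let m<i = ℕₚ.≤∧≢⇒< m≤i (n≢ ∘ ≡.sym) in
      K.zero-sum (z i m<i) (K.trans (K.-‿cong (K.Deg-* (m ∸ e) e dT dc i (≡.subst (ℕ._< i) (≡.sym (ℕₚ.m∸n+n≡m e≤m)) m<i))) K.-0#≈0#)

  -- A primitive polynomial relation satisfied by a series y: n is the degree of y over k(X) and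
  -- δ the least degree of a leading coefficient.
  module Primitive (y : K.PS) where

    Killer : ℕ → 𝕃.PS → Set
    Killer m P = Pol P × 𝕃.Deg m P × (𝕃.ev m P y ≈ 0#)

    Killer-lower : ∀ {m P} → P (suc m) ≈ 0# → Killer (suc m) P → Killer m P
    Killer-lower {m} {P} z (pP , dP , e) = pP , lower , trans (𝕃.ev-mono m (suc m) y (ℕₚ.n≤1+n m) lower) e
      where
      lower : 𝕃.Deg m P
      lower i l with i ℕ.≟ suc m
      ... | yes ≡.refl = z
      ... | no ne = dP i (ℕₚ.≤∧≢⇒< l (ne ∘ ≡.sym))

    Killer-sub : ∀ {m P Q} → Killer m P → Killer m Q → Killer m (P 𝕃R.+ 𝕃R.- Q)
    Killer-sub {m} {P} {Q} (pP , dP , eP) (pQ , dQ , eQ) = Pol-+ pP (Pol-neg {Q} pQ) ,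
      𝕃.Deg-+ {f = P} {𝕃R.- Q} dP (𝕃.Deg-neg {f = Q} dQ) ,
      trans (𝕃.ev-+ m P (𝕃R.- Q) y) (zero-sum eP (trans (𝕃.ev-neg m Q y) (trans (-‿cong eQ) -0#≈0#)))

    Killer-mul : ∀ k {A m P} → Pol A → 𝕃.Deg k A → Killer m P → Killer (k ℕ.+ m) (A 𝕃R.* P)
    Killer-mul k {A} {m} {P} pA dA (pP , dP , eP) = Pol-* pA pP , 𝕃.Deg-* k m dA dP , trans (𝕃.ev-* k m y dA dP) (zero-mulʳ eP)

    small-killer : ∀ n → (∀ m → m ℕ.< n → ∀ P → Killer m P → P m ≈ 0#) → ∀ m → m ℕ.< n → ∀ P → Killer m P → P 𝕃.≋ 𝕃R.0#
    small-killer n smaller zero lt P kP = 𝕃.pt λ { zero → smaller 0 lt P kP ; (suc i) → proj₁ (proj₂ kP) (suc i) (s≤s z≤n) }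
    small-killer n smaller (suc m) lt P kP =
      small-killer n smaller m (ℕₚ.<-trans (ℕₚ.n<1+n m) lt) P (Killer-lower (smaller (suc m) lt P kP) kP)

    drop-lead : ∀ n → (∀ m → m ℕ.< n → ∀ P → Killer m P → P 𝕃.≋ 𝕃R.0#) → ∀ C → Killer n C → C n ≈ 0# → C 𝕃.≋ 𝕃R.0#
    drop-lead zero small C kC z = 𝕃.pt λ { zero → z ; (suc i) → proj₁ (proj₂ kC) (suc i) (s≤s z≤n) }
    drop-lead (suc m) small C kC z = small m (ℕₚ.n<1+n m) C (Killer-lower z kC)

    module Minimal (n : ℕ) (smaller : ∀ m → m ℕ.< n → ∀ P → Killer m P → P m ≈ 0#)
      (δ : ℕ) (s : 𝕃.PS) (ks : Killer n s) (dδ : K.Deg δ (s n)) (lead : ¬ (s n δ K.≈ K.0#))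
      (least-δ : ∀ P e → e ℕ.< δ → Killer n P → K.Deg e (P n) → P n ≈ 0#) where

      Multiple : ℕ → 𝕃.PS → Set
      Multiple j C = Σ 𝕃.PS λ T → Pol T × 𝕃.Deg j T × (C 𝕃.≋ (s 𝕃R.* T))

      zero-lead : ∀ C → Killer n C → C n ≈ 0# → C 𝕃.≋ 𝕃R.0#
      zero-lead = drop-lead n (small-killer n smaller)

      raised : ℕ → 𝕃.PS
      raised j = (𝕃.X 𝕃R.^ j) 𝕃R.* s

      raised-killer : ∀ j → Killer (j ℕ.+ n) (raised j)
      raised-killer j = Killer-mul j (Pol-X^ j) (𝕃.Deg-X^ j) ks

      regular-lead : ∀ z → s n δ K.* z K.≈ K.0# → z K.≈ K.0#
      regular-lead z e = K.domain e lead

      -- A form of Gauss's lemma that avoids contents, by induction on the excess `j` of the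
      -- `Y`-degree and on the bound `e` for the leading coefficient. If its degree is at least `δ`,
      -- a multiple of `s` lowers it. If it were smaller, `s` would be a `k[X]`-multiple of a
      -- relation with a leading coefficient of degree below `δ`.
      multiple : ∀ j e C → Killer (j ℕ.+ n) C → (∀ i → e ℕ.≤ i → C (j ℕ.+ n) i K.≈ K.0#) → Multiple j C
      multiple zero zero C kC z = 𝕃R.0# , Pol-0 , 𝕃.Deg-0 {0} , 𝕃R.trans (zero-lead C kC (pt λ i → z i z≤n)) (𝕃R.sym (𝕃R.zeroʳ s))
      multiple (suc j) zero C kC z =
        let kC′ = Killer-lower (pt λ i → z i z≤n) kC
            (D , d) = proj₁ kC
            (T , pT , dT , e) = multiple j (suc D) C kC′ (λ i l → d (j ℕ.+ n) i l)
        in T , pT , 𝕃.Deg-mono {f = T} (ℕₚ.n≤1+n j) dT , e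
      multiple j (suc e) C kC z with C (j ℕ.+ n) e K.≟ K.0#
      ... | yes ze = multiple j e C kC λ i l → lower i l
        where
        lower : ∀ i → e ℕ.≤ i → C (j ℕ.+ n) i K.≈ K.0#
        lower i l with i ℕ.≟ e
        ... | yes ≡.refl = ze
        ... | no ne = z i (ℕₚ.≤∧≢⇒< l (ne ∘ ≡.sym))
      ... | no nz with δ ℕ.≤? e
      ...   | yes δ≤e =
        let (T , pT , dT , eq) = multiple j e C′ kC′ lower
        in T 𝕃R.+ A , Pol-+ pT pA , 𝕃.Deg-+ {f = T} {A} dT dA , (𝕃R.begin
             C 𝕃R.≈⟨ 𝕃R.solve 3 (λ c a s → c 𝕃R.:= (c 𝕃R.:- a 𝕃R.:* s) 𝕃R.:+ a 𝕃R.:* s) 𝕃R.refl C A s ⟩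
             C′ 𝕃R.+ A 𝕃R.* s 𝕃R.≈⟨ 𝕃R.+-congʳ eq ⟩
             s 𝕃R.* T 𝕃R.+ A 𝕃R.* s 𝕃R.≈⟨ 𝕃R.solve 3 (λ s t a → s 𝕃R.:* t 𝕃R.:+ a 𝕃R.:* s 𝕃R.:= s 𝕃R.:* (t 𝕃R.:+ a)) 𝕃R.refl s T A ⟩
             s 𝕃R.* (T 𝕃R.+ A) 𝕃R.∎)
        where
        c = C (j ℕ.+ n)
        li = K.inv (s n δ) lead
        t = c e K.* proj₁ li
        a = K.C t * K.X ^ (e ∸ δ)
        A = 𝕃.C a 𝕃R.* (𝕃.X 𝕃R.^ j)
        da : K.Deg (e ∸ δ) a
        da = K.Deg-* 0 (e ∸ δ) (K.Deg-C t) (K.Deg-X^ (e ∸ δ))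
        pA : Pol A
        pA = Pol-* (Pol-C a da) (Pol-X^ j)
        dA : 𝕃.Deg j A
        dA = 𝕃.Deg-* 0 j (𝕃.Deg-C a) (𝕃.Deg-X^ j)
        C′ = C 𝕃R.+ 𝕃R.- (A 𝕃R.* s)
        kC′ : Killer (j ℕ.+ n) C′
        kC′ = Killer-sub kC (Killer-mul j pA dA ks)
        A-top : (A 𝕃R.* s) (j ℕ.+ n) ≈ a * s n
        A-top = trans (𝕃.top-* j n dA (proj₁ (proj₂ ks))) (*-congʳ (trans (𝕃.C-conv a (𝕃.X 𝕃R.^ j) j) (trans (*-congˡ (𝕃.X^-top j)) (*-identityʳ a))))
        e≡ = ℕₚ.m∸n+n≡m δ≤e
        top : (a * s n) e K.≈ c e
        top = K.begin
          (a * s n) e K.≡⟨ ≡.cong (a * s n) e≡ ⟨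
          (a * s n) (e ∸ δ ℕ.+ δ) K.≈⟨ K.top-* (e ∸ δ) δ da dδ ⟩
          a (e ∸ δ) K.* s n δ K.≈⟨ K.*-congʳ (K.trans (K.C-conv t (K.X ^ (e ∸ δ)) (e ∸ δ)) (K.trans (K.*-congˡ (K.X^-top (e ∸ δ))) (K.*-identityʳ t))) ⟩
          c e K.* proj₁ li K.* s n δ K.≈⟨ K.trans (K.*-assoc _ _ _) (K.*-congˡ (K.trans (K.*-comm _ _) (proj₂ li))) ⟩
          c e K.* K.1# K.≈⟨ K.*-identityʳ _ ⟩
          c e K.∎
        lower : ∀ i → e ℕ.≤ i → C′ (j ℕ.+ n) i K.≈ K.0#
        lower i l with i ℕ.≟ e
        ... | yes ≡.refl = K.trans (K.+-congˡ (K.-‿cong (K.trans (at A-top e) top))) (K.-‿inverseʳ _)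
        ... | no ne = let e<i = ℕₚ.≤∧≢⇒< l (ne ∘ ≡.sym) in K.zero-sum (z i e<i)
          (K.trans (K.-‿cong (K.trans (at A-top i) (K.Deg-* (e ∸ δ) δ da dδ i (≡.subst (ℕ._< i) (≡.sym e≡) e<i)))) K.-0#≈0#)
      ...   | no e<δ′ = ⊥-elim (lead (at sn≈0 δ))
        where
        e<δ = ℕₚ.≰⇒> e<δ′
        c = C (j ℕ.+ n)
        dc : K.Deg e c
        dc i l = z i l
        -- The remainder `s n - g c` has degree below `e`, so the induction hypothesis applies to
        -- `V`.
        div = divide e dc nz (suc δ) (s n) dδ
        g = proj₁ div
        dg = proj₂ (proj₁ (proj₂ div))
        pg : Pol (𝕃.C g)
        pg = Pol-C g dg
        V = raised j 𝕃R.+ 𝕃R.- (𝕃.C g 𝕃R.* C)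
        kV : Killer (j ℕ.+ n) V
        kV = Killer-sub (raised-killer j) (Killer-mul 0 pg (𝕃.Deg-C g) kC)
        V-lead : V (j ℕ.+ n) ≈ s n + - (g * c)
        V-lead = +-cong (𝕃.X^*-high j s n) (-‿cong (𝕃.C-conv g C (j ℕ.+ n)))
        small-lead : ∀ i → e ℕ.≤ i → V (j ℕ.+ n) i K.≈ K.0#
        small-lead i l = K.trans (at V-lead i) (proj₂ (proj₂ div) i l)
        rec = multiple j e V kV small-lead
        T = proj₁ rec
        pT = proj₁ (proj₂ rec)
        dT = proj₁ (proj₂ (proj₂ rec))
        -- The leading coefficient of `V` has degree below `δ`, too small for a nonzero multiple of
        -- `s n`.
        T-top : T j ≈ 0#
        T-top = regular-multiple K.k δ (proj₁ pT) dδ regular-lead (proj₂ pT j) λ i l → K.trans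
          (at (trans (sym (𝕃.top-* n j (proj₁ (proj₂ ks)) dT)) (trans (reflexive (≡.cong (s 𝕃R.* T) (ℕₚ.+-comm n j)))
            (sym (𝕃.at (proj₂ (proj₂ (proj₂ rec))) (j ℕ.+ n))))) i) (small-lead i (ℕₚ.≤-trans (ℕₚ.<⇒≤ e<δ) l))
        U = (𝕃.X 𝕃R.^ j) 𝕃R.+ 𝕃R.- T
        dU : 𝕃.Deg j U
        dU = 𝕃.Deg-+ {f = 𝕃.X 𝕃R.^ j} {𝕃R.- T} (𝕃.Deg-X^ j) (𝕃.Deg-neg {f = T} dT)
        U-top : U j ≈ 1#
        U-top = trans (+-cong (𝕃.X^-top j) (trans (-‿cong T-top) -0#≈0#)) (+-identityʳ 1#)
        pU : Pol U
        pU = Pol-+ (Pol-X^ j) (Pol-neg {T} pT)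
        gC : (𝕃.C g 𝕃R.* C) 𝕃.≋ (s 𝕃R.* U)
        gC = 𝕃R.begin
          𝕃.C g 𝕃R.* C 𝕃R.≈⟨ 𝕃R.solve 2 (λ r gc → gc 𝕃R.:= r 𝕃R.:- (r 𝕃R.:- gc)) 𝕃R.refl (raised j) (𝕃.C g 𝕃R.* C) ⟩
          raised j 𝕃R.+ 𝕃R.- V 𝕃R.≈⟨ 𝕃R.+-congˡ (𝕃R.-‿cong (proj₂ (proj₂ (proj₂ rec)))) ⟩
          raised j 𝕃R.+ 𝕃R.- (s 𝕃R.* T)
            𝕃R.≈⟨ 𝕃R.solve 3 (λ x s t → x 𝕃R.:* s 𝕃R.:- s 𝕃R.:* t 𝕃R.:= s 𝕃R.:* (x 𝕃R.:- t)) 𝕃R.refl (𝕃.X 𝕃R.^ j) s T ⟩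
          s 𝕃R.* U 𝕃R.∎
        -- Here `g C = s U` with `U` monic in `Y`. Dividing `C` by `U` gives `U (s - g Q) = g R`,
        -- and the `Y`-degree of `R` forces `s = g Q`.
        qr = divide-monic j dU U-top pU (suc (j ℕ.+ n)) C (proj₁ (proj₂ kC)) (proj₁ kC)
        Q = proj₁ qr
        R = proj₁ (proj₂ qr)
        pQ = proj₁ (proj₂ (proj₂ (proj₂ (proj₂ qr))))
        eQ = proj₁ (proj₂ (proj₂ (proj₂ (proj₂ (proj₂ qr)))))
        dQ = proj₂ (proj₂ (proj₂ (proj₂ (proj₂ (proj₂ qr)))))
        Z = s 𝕃R.+ 𝕃R.- (𝕃.C g 𝕃R.* Q)
        UZ : (U 𝕃R.* Z) 𝕃.≋ (𝕃.C g 𝕃R.* R)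
        UZ = 𝕃R.begin
          U 𝕃R.* Z 𝕃R.≈⟨ 𝕃R.solve 4 (λ u s g q → u 𝕃R.:* (s 𝕃R.:- g 𝕃R.:* q) 𝕃R.:= s 𝕃R.:* u 𝕃R.:- g 𝕃R.:* (u 𝕃R.:* q)) 𝕃R.refl U s (𝕃.C g) Q ⟩
          s 𝕃R.* U 𝕃R.+ 𝕃R.- (𝕃.C g 𝕃R.* (U 𝕃R.* Q)) 𝕃R.≈⟨ 𝕃R.+-congʳ (𝕃R.sym gC) ⟩
          𝕃.C g 𝕃R.* C 𝕃R.+ 𝕃R.- (𝕃.C g 𝕃R.* (U 𝕃R.* Q)) 𝕃R.≈⟨ 𝕃R.+-congʳ (𝕃R.*-congˡ (proj₁ (proj₂ (proj₂ qr)))) ⟩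
          𝕃.C g 𝕃R.* (U 𝕃R.* Q 𝕃R.+ R) 𝕃R.+ 𝕃R.- (𝕃.C g 𝕃R.* (U 𝕃R.* Q))
            𝕃R.≈⟨ 𝕃R.solve 3 (λ g w r → g 𝕃R.:* (w 𝕃R.:+ r) 𝕃R.:- g 𝕃R.:* w 𝕃R.:= g 𝕃R.:* r) 𝕃R.refl (𝕃.C g) (U 𝕃R.* Q) R ⟩
          𝕃.C g 𝕃R.* R 𝕃R.∎
        Z≈0 : Z 𝕃.≋ 𝕃R.0#
        Z≈0 = regular-multiple series j (n ⊔ eQ) dU (λ z e → trans (sym (trans (*-congʳ U-top) (*-identityˡ z))) e)
          (𝕃.Deg-+ {f = s} {𝕃R.- (𝕃.C g 𝕃R.* Q)} (𝕃.Deg-mono {f = s} (ℕₚ.m≤m⊔n n eQ) (proj₁ (proj₂ ks)))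
            (𝕃.Deg-neg {f = 𝕃.C g 𝕃R.* Q} (𝕃.Deg-mono {f = 𝕃.C g 𝕃R.* Q} (ℕₚ.m≤n⊔m n eQ) (𝕃.Deg-* 0 eQ (𝕃.Deg-C g) dQ))))
          (λ i l → trans (𝕃.at UZ i) (trans (𝕃.C-conv g R i) (zero-mulʳ (proj₁ (proj₂ (proj₂ (proj₂ qr))) i l))))
        s≈gQ : ∀ i → s i ≈ g * Q i
        s≈gQ i = trans (solve 2 (λ a b → a := (a :- b) :+ b) refl (s i) (g * Q i))
          (trans (+-congʳ (trans (+-congˡ (-‿cong (sym (𝕃.C-conv g Q i)))) (𝕃.at Z≈0 i))) (+-identityˡ _))
        g≉0 : ¬ (g ≈ 0#)
        g≉0 e = lead (K.trans (at (s≈gQ n) δ) (at (zero-mulˡ {g} {Q n} e) δ))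
        dQn : 𝕃.Deg n Q
        dQn i l = K.series-domain (trans (sym (s≈gQ i)) (proj₁ (proj₂ ks) i l)) g≉0
        kQ : Killer n Q
        kQ = pQ , dQn , K.series-domain (trans (sym (𝕃.ev-scale n g Q y)) (trans (𝕃.ev-cong n (𝕃.pt λ i → sym (s≈gQ i)) refl) (proj₂ (proj₂ ks)))) g≉0
        -- The leading coefficient of `Q` is that of `C`, of degree `e < δ`, against the choice of
        -- `δ`.
        Qn≈0 : Q n ≈ 0#
        Qn≈0 = least-δ Q e e<δ kQ dQn-deg
          where
          cQ : c ≈ Q n
          cQ = begin
            c ≈⟨ 𝕃.at (proj₁ (proj₂ (proj₂ qr))) (j ℕ.+ n) ⟩
            (U 𝕃R.* Q) (j ℕ.+ n) + R (j ℕ.+ n) ≈⟨ +-cong (𝕃.top-* j n dU dQn) (proj₁ (proj₂ (proj₂ (proj₂ qr))) (j ℕ.+ n) (ℕₚ.m≤m+n j n)) ⟩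
            U j * Q n + 0# ≈⟨ trans (+-identityʳ _) (trans (*-congʳ U-top) (*-identityˡ _)) ⟩
            Q n ∎
          dQn-deg : K.Deg e (Q n)
          dQn-deg = K.Deg-cong cQ dc
        sn≈0 : s n ≈ 0#
        sn≈0 = trans (s≈gQ n) (zero-mulʳ Qn≈0)

-- Total degree of monic factors.

-- A monic factor of a filtered monic polynomial is filtered: the forms of top weight of the
-- two factors multiply to that of the product.
module Filtered (F : FiniteField) where
  open Weights F
  open Polynomials F
  open K using (series; _≋_; pt; at)
  open RingLemmas series
  open +-*-Solver using () renaming (solve to ℕ-solve; _:=_ to _≐_; _:+_ to _⊞_; con to #)

  top-weight : ℕ → ℕ → K.PS → K.Carrier
  top-weight D s f with s ℕ.≤? D
  ... | yes _ = f (D ∸ s)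
  ... | no _ = K.0#

  W-zero : ∀ {D s f} → D ℕ.< s → W D s f → ∀ a → f a K.≈ K.0#
  W-zero {D} {s} l w a = w a (ℕₚ.<-≤-trans l (ℕₚ.m≤n+m s a))

  W⇒Deg∸ : ∀ {D s f} → s ℕ.≤ D → W D s f → K.Deg (D ∸ s) f
  W⇒Deg∸ {D} {s} s≤D w a l = w a (≡.subst (ℕ._< a ℕ.+ s) (ℕₚ.m∸n+n≡m s≤D) (ℕₚ.+-monoˡ-< s l))

  top-weight-product : ∀ D s E t {f g} e → W D s f → W E t g → e ℕ.+ (s ℕ.+ t) ≡ D ℕ.+ E →
    (f * g) e K.≈ top-weight D s f K.* top-weight E t g
  top-weight-product D s E t {f} {g} e wf wg eq with s ℕ.≤? D | t ℕ.≤? E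
  ... | no ns | _ = K.trans (K.conv-zeroˡ (W-zero {f = f} (ℕₚ.≰⇒> ns) wf) g e) (K.sym (K.zeroˡ _))
  ... | yes _ | no nt = K.trans (at (*-comm f g) e) (K.trans (K.conv-zeroˡ (W-zero {f = g} (ℕₚ.≰⇒> nt) wg) f e) (K.sym (K.zeroʳ _)))
  ... | yes s≤D | yes t≤E = K.trans (K.reflexive (≡.cong (f * g) e≡)) (K.top-* (D ∸ s) (E ∸ t) (W⇒Deg∸ {f = f} s≤D wf) (W⇒Deg∸ {f = g} t≤E wg))
    where
    e≡ : e ≡ (D ∸ s) ℕ.+ (E ∸ t)
    e≡ = ℕₚ.+-cancelʳ-≡ (s ℕ.+ t) e ((D ∸ s) ℕ.+ (E ∸ t)) (≡.trans eq (≡.trans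
      (≡.sym (≡.cong₂ ℕ._+_ (ℕₚ.m∸n+n≡m s≤D) (ℕₚ.m∸n+n≡m t≤E)))
      (ℕ-solve 4 (λ a s b t → a ⊞ s ⊞ (b ⊞ t) ≐ a ⊞ b ⊞ (s ⊞ t)) ≡.refl (D ∸ s) s (E ∸ t) t)))

  -- The part of weight exactly `D - s`, dehomogenised to one variable so that `series-domain`
  -- applies to it.
  form : ℕ → ℕ → 𝕃.PS → K.PS
  form D s P b = top-weight D (b ℕ.+ s) (P b)

  form-product : ∀ D s E t {P Q} c e → Tot D s P → Tot E t Q → e ℕ.+ (c ℕ.+ (s ℕ.+ t)) ≡ D ℕ.+ E →
    𝕃.conv P Q c e K.≈ K.conv (form D s P) (form E t Q) c
  form-product D s E t zero e wP wQ eq = top-weight-product D s E t e (wP 0) (wQ 0) eq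
  form-product D s E t {P} {Q} (suc c) e wP wQ eq = K.+-cong
    (top-weight-product D s E (suc c ℕ.+ t) e (wP 0) (wQ (suc c))
      (≡.trans (ℕ-solve 4 (λ e s c t → e ⊞ (s ⊞ (# 1 ⊞ c ⊞ t)) ≐ e ⊞ (# 1 ⊞ c ⊞ (s ⊞ t))) ≡.refl e s c t) eq))
    (K.trans (form-product D (suc s) E t {P ∘ suc} {Q} c e (Tot-tail {P = P} wP) wQ
       (≡.trans (ℕ-solve 4 (λ e s c t → e ⊞ (c ⊞ (# 1 ⊞ s ⊞ t)) ≐ e ⊞ (# 1 ⊞ c ⊞ (s ⊞ t))) ≡.refl e s c t) eq))
      (K.conv-cong (λ b → K.reflexive (≡.cong (λ r → top-weight D r (P (suc b))) (ℕₚ.+-suc b s))) (λ _ → K.refl) c))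

  form-Deg : ∀ D P → K.Deg D (form D 0 P)
  form-Deg D P b l with b ℕ.+ 0 ℕ.≤? D
  ... | yes le = ⊥-elim (ℕₚ.<⇒≱ l (ℕₚ.≤-trans (ℕₚ.m≤m+n b 0) le))
  ... | no _ = K.refl

  form-zero⇒Tot : ∀ {D P} → Tot (suc D) 0 P → form (suc D) 0 P ≈ 0# → Tot D 0 P
  form-zero⇒Tot {D} {P} tot z j a l with suc D ℕ.≟ a ℕ.+ (j ℕ.+ 0)
  ... | no ne = tot j a (ℕₚ.≤∧≢⇒< l ne)
  ... | yes e with j ℕ.+ 0 ℕ.≤? suc D | at z j
  ...   | no nl | _ = ⊥-elim (nl (≡.subst (j ℕ.+ 0 ℕ.≤_) (≡.sym e) (ℕₚ.m≤n+m (j ℕ.+ 0) a)))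
  ...   | yes _ | zj = K.trans (K.reflexive (≡.cong (P j) (≡.sym (≡.trans (≡.cong (_∸ (j ℕ.+ 0)) e) (ℕₚ.m+n∸n≡m a (j ℕ.+ 0)))))) zj

  form-lead : ∀ {n P} → P n ≈ 1# → form n 0 P n K.≈ K.1#
  form-lead {n} {P} e with n ℕ.+ 0 ℕ.≤? n
  ... | no nl = ⊥-elim (nl (ℕₚ.≤-reflexive (ℕₚ.+-identityʳ n)))
  ... | yes _ = K.trans (K.reflexive (≡.cong (P n) (≡.trans (≡.cong (n ∸_) (ℕₚ.+-identityʳ n)) (ℕₚ.n∸n≡0 n)))) (at e 0)

  factor-filtered : ∀ {n j H T V} → H n ≈ 1# → T j ≈ 1# → (H 𝕃R.* T) 𝕃.≋ V → Tot (n ℕ.+ j) 0 V →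
    ∀ α β → Tot (α ℕ.+ n) 0 H → Tot (β ℕ.+ j) 0 T → Tot n 0 H
  factor-filtered hn tj e tV zero β wH wT = wH
  factor-filtered {n} {j} {H} {T} {V} hn tj e tV (suc α) β wH wT i a l = K.≈-stable λ ne →
    let D = suc α ℕ.+ n
        E = β ℕ.+ j
        u = form D 0 H
        v = form E 0 T
        -- The two top forms multiply to the part of `V` of weight `n + j + α + 1 + β`, above its
        -- total degree.
        uv : u * v ≈ 0#
        uv = pt λ c → product c (c ℕ.≤? D ℕ.+ E)
        u≉0 : ¬ (u ≈ 0#)
        u≉0 z = ne (factor-filtered {n} {j} {H} {T} {V} hn tj e tV α β (form-zero⇒Tot {P = H} wH z) wT i a l)
    in lower-T β wT ne (K.series-domain uv u≉0)
    where
    product : ∀ c → Dec (c ℕ.≤ (suc α ℕ.+ n) ℕ.+ (β ℕ.+ j)) → (form (suc α ℕ.+ n) 0 H * form (β ℕ.+ j) 0 T) c K.≈ K.0#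
    product c (no nl) = K.Deg-* (suc α ℕ.+ n) (β ℕ.+ j) (form-Deg (suc α ℕ.+ n) H) (form-Deg (β ℕ.+ j) T) c (ℕₚ.≰⇒> nl)
    product c (yes le) =
      let S = (suc α ℕ.+ n) ℕ.+ (β ℕ.+ j)
          e+c : S ∸ c ℕ.+ (c ℕ.+ 0) ≡ S
          e+c = ≡.trans (≡.cong (S ∸ c ℕ.+_) (ℕₚ.+-identityʳ c)) (ℕₚ.m∸n+n≡m le)
      in K.trans (K.sym (form-product (suc α ℕ.+ n) 0 (β ℕ.+ j) 0 {H} {T} c (S ∸ c) wH wT e+c))
           (K.trans (at (𝕃.at e c) (S ∸ c)) (tV c (S ∸ c) (≡.subst (n ℕ.+ j ℕ.<_) (≡.sym e+c)
             (s≤s (ℕₚ.+-mono-≤ (ℕₚ.m≤n+m n α) (ℕₚ.m≤n+m j β))))))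
    -- The excess `β` goes down until the top form of `T` contains the leading coefficient 1 and
    -- cannot vanish.
    lower-T : ∀ β → Tot (β ℕ.+ j) 0 T → ¬ (H i a K.≈ K.0#) → form (β ℕ.+ j) 0 T ≈ 0# → ⊥
    lower-T zero wT ne z = K.1≉0 (K.trans (K.sym (form-lead {P = T} tj)) (at z j))
    lower-T (suc β) wT ne z = ne (factor-filtered {n} {j} {H} {T} {V} hn tj e tV (suc α) β wH (form-zero⇒Tot {P = T} wT z) i a l)

-- From a curve to the component of a simple branch.

dd-difference : (R : Ring₀) → let open RingLemmas R; open Series R in
  ∀ m f a z z′ → Σ Carrier λ r → dd m f a z + - dd m f a z′ ≈ (z + - z′) * r
dd-difference R = go
  where
  open RingLemmas R
  open Series R
  go : ∀ m f a z z′ → Σ Carrier λ r → dd m f a z + - dd m f a z′ ≈ (z + - z′) * r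
  go zero f a z z′ = 0# , trans (-‿inverseʳ 0#) (sym (zeroʳ _))
  go (suc m) f a z z′ =
    let (r , e) = go m (f ∘ suc) a z z′
        d = dd m (f ∘ suc) a z
        d′ = dd m (f ∘ suc) a z′
    in d + z′ * r , (begin
      (ev m (f ∘ suc) a + z * d) + - (ev m (f ∘ suc) a + z′ * d′)
        ≈⟨ solve 5 (λ e z d z′ d′ → (e :+ z :* d) :- (e :+ z′ :* d′) := (z :- z′) :* d :+ z′ :* (d :- d′)) refl _ z d z′ d′ ⟩
      (z + - z′) * d + z′ * (d + - d′) ≈⟨ +-congˡ (*-congˡ e) ⟩
      (z + - z′) * d + z′ * ((z + - z′) * r)
        ≈⟨ solve 4 (λ y d z′ r → y :* d :+ z′ :* (y :* r) := y :* (d :+ z′ :* r)) refl (z + - z′) d z′ r ⟩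
      (z + - z′) * (d + z′ * r) ∎)

-- A filtered monic polynomial V with a simple power series root and no zero (w, a), w ≠ 0, does
-- not exist over a large field: pass to the irreducible factor H that has the root.
module Component (F : FiniteField) {p} (pr : Prime p) (h : ℕ) (size≡ : FiniteField.size F ≡ p ℕ.^ h)
  (N : ℕ) (V : Weights.𝕃.PS F) (tV : Weights.Tot F N 0 V) (y : Field.PS F)
  (lead-V : Field._≋_ F (V N) (Field.C F (Field.1# F)))
  (root-V : Field._≋_ F (Weights.𝕃.ev F N V y) (Field.𝔹.0# F))
  (z : Field.PS F)
  (simple-V : ∀ r → ¬ (Field._≋_ F (Weights.𝕃.ev F N V (Field.𝔹._+_ F y z)) (Field.𝔹._*_ F (Field.𝔹._*_ F z z) r)))
  (no-zero : ∀ a w → ¬ (Field._≈_ F w (Field.0# F)) → ¬ (Field._≈_ F (Field.ev F N (Weights.𝕃.ev F N V (Field.C F a)) w) (Field.0# F)))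
  (large : 10 ℕ.* (N ℕ.* N ℕ.* N ℕ.* N) ℕ.≤ FiniteField.size F) where
  open Weights F
  open Polynomials F
  open Filtered F
  open Primitive y
  open K using (series; _≋_; pt; at; size)
  open RingLemmas series

  Pol-V : Pol V
  Pol-V = N , λ j a l → tV j a (ℕₚ.<-≤-trans l (ℕₚ.m≤m+n a (j ℕ.+ 0)))

  killer-V : Killer N V
  killer-V = Pol-V , Tot⇒Deg tV , root-V

  1≉0 : ¬ (1# ≈ 0#)
  1≉0 e = K.1≉0 (at e 0)

  Deg-ev : ∀ {D} m P a → (∀ j → K.Deg D (P j)) → K.Deg D (𝕃.ev m P (K.C a))
  Deg-ev zero P a d = d 0
  Deg-ev {D} (suc m) P a d = K.Deg-+ {f = P 0} (d 0) (K.Deg-* 0 D (K.Deg-C a) (Deg-ev m (P ∘ suc) a (d ∘ suc)))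

  module Factor (n j : ℕ) (N≡ : suc n ℕ.+ j ≡ N) (smaller : ∀ m → m ℕ.< suc n → ∀ P → Killer m P → P m ≈ 0#)
    (s T : 𝕃.PS) (ks : Killer (suc n) s) (pT : Pol T) (dT : 𝕃.Deg j T) (V≈sT : V 𝕃.≋ (s 𝕃R.* T))
    (c : K.Carrier) (c≉0 : ¬ (c K.≈ K.0#)) (sc : s (suc n) ≈ K.C c) where

    ci : K.Carrier
    ci = proj₁ (K.inv c c≉0)

    H T′ : 𝕃.PS
    H = 𝕃.C (K.C ci) 𝕃R.* s
    T′ = 𝕃.C (K.C c) 𝕃R.* T

    ci*c : K.C ci * K.C c ≈ 1#
    ci*c = trans (sym (K.C-* ci c)) (K.C-cong (K.trans (K.*-comm ci c) (proj₂ (K.inv c c≉0))))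

    H*T′ : (H 𝕃R.* T′) 𝕃.≋ V
    H*T′ = 𝕃R.begin
      H 𝕃R.* T′ 𝕃R.≈⟨ 𝕃R.solve 4 (λ a s b t → a 𝕃R.:* s 𝕃R.:* (b 𝕃R.:* t) 𝕃R.:= a 𝕃R.:* b 𝕃R.:* (s 𝕃R.:* t)) 𝕃R.refl (𝕃.C (K.C ci)) s (𝕃.C (K.C c)) T ⟩
      𝕃.C (K.C ci) 𝕃R.* 𝕃.C (K.C c) 𝕃R.* (s 𝕃R.* T)
        𝕃R.≈⟨ 𝕃R.*-cong (𝕃R.trans (𝕃R.sym (𝕃.C-* (K.C ci) (K.C c))) (𝕃.C-cong ci*c)) (𝕃R.sym V≈sT) ⟩
      𝕃R.1# 𝕃R.* V 𝕃R.≈⟨ 𝕃R.*-identityˡ V ⟩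
      V 𝕃R.∎

    killer-H : Killer (suc n) H
    killer-H = Killer-mul 0 (Pol-C (K.C ci) (K.Deg-C {0} ci)) (𝕃.Deg-C (K.C ci)) ks

    Deg-T′ : 𝕃.Deg j T′
    Deg-T′ = 𝕃.Deg-* 0 j (𝕃.Deg-C (K.C c)) dT

    Pol-T′ : Pol T′
    Pol-T′ = Pol-* (Pol-C (K.C c) (K.Deg-C {0} c)) pT

    H-lead : H (suc n) ≈ 1#
    H-lead = trans (𝕃.C-conv (K.C ci) s (suc n)) (trans (*-congˡ sc) ci*c)

    T′-lead : T′ j ≈ 1#
    T′-lead = begin
      T′ j ≈⟨ trans (sym (*-identityˡ _)) (*-congʳ (sym H-lead)) ⟩
      H (suc n) * T′ j ≈⟨ 𝕃.top-* (suc n) j (proj₁ (proj₂ killer-H)) Deg-T′ ⟨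
      (H 𝕃R.* T′) (suc n ℕ.+ j) ≈⟨ trans (reflexive (≡.cong (H 𝕃R.* T′) N≡)) (𝕃.at H*T′ N) ⟩
      V N ≈⟨ lead-V ⟩
      1# ∎

    Pol⇒Tot : ∀ {m P} (pP : Pol P) → 𝕃.Deg m P → Tot (proj₁ pP ℕ.+ m) 0 P
    Pol⇒Tot {m} {P} (D , d) dP j a l with j ℕ.≤? m
    ... | no nl = at (dP j (ℕₚ.≰⇒> nl)) a
    ... | yes le = d j a (ℕₚ.+-cancelʳ-< m D a (ℕₚ.<-≤-trans l (ℕₚ.+-monoʳ-≤ a (ℕₚ.≤-trans (ℕₚ.≤-reflexive (ℕₚ.+-identityʳ j)) le))))

    filtered : Tot (suc n) 0 H
    filtered = factor-filtered {suc n} {j} {H} {T′} {V} H-lead T′-lead H*T′ (≡.subst (λ r → Tot r 0 V) (≡.sym N≡) tV)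
      (proj₁ (proj₁ killer-H)) (proj₁ Pol-T′) (Pol⇒Tot {P = H} (proj₁ killer-H) (proj₁ (proj₂ killer-H))) (Pol⇒Tot {P = T′} Pol-T′ Deg-T′)

    cut : 𝕃.PS → 𝕃.PS
    cut P i with i ℕ.≤? n
    ... | yes _ = P i
    ... | no _ = 0#

    cut-≤ : ∀ P {i} → i ℕ.≤ n → cut P i ≡ P i
    cut-≤ P {i} l with i ℕ.≤? n
    ... | yes _ = ≡.refl
    ... | no nl = ⊥-elim (nl l)

    cut-> : ∀ P {i} → n ℕ.< i → cut P i ≈ 0#
    cut-> P {i} l with i ℕ.≤? n
    ... | yes le = ⊥-elim (ℕₚ.<⇒≱ l le)
    ... | no _ = refl

    independent : ∀ m (P : 𝕃.PS) → (∀ j → j ℕ.< suc n → K.Deg m (P j)) →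
      ∑ (suc n) (λ j → P j * y ^ j) ≈ 0# → ∀ j → j ℕ.< suc n → P j ≈ 0#
    independent m P dP e i (s≤s i≤n) = trans (reflexive (≡.sym (cut-≤ P i≤n)))
      (𝕃.at (small-killer (suc n) smaller n (ℕₚ.n<1+n n) (cut P) (pol , (λ i → cut-> P) , vanish)) i)
      where
      pol : Pol (cut P)
      pol = m , deg
        where
        deg : ∀ j → K.Deg m (cut P j)
        deg j with j ℕ.≤? n
        ... | yes le = dP j (s≤s le)
        ... | no _ = K.Deg-0 {m}
      vanish : 𝕃.ev n (cut P) y ≈ 0#
      vanish = trans (𝕃.ev-∑ n (cut P) y) (trans (∑-cong (suc n) {λ j → cut P j * y ^ j} λ { j (s≤s l) → *-congʳ (reflexive (cut-≤ P l)) }) e)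

    branch : Branch F
    branch = record
      { p = p ; h = h ; pr = pr ; size≡ = size≡ ; y = y ; n = n ; H = H ; wH = filtered
      ; monic = H-lead ; root = proj₂ (proj₂ killer-H) ; independent = independent }

    ev-V : ∀ Z → 𝕃.ev N V Z ≈ 𝕃.ev (suc n) H Z * 𝕃.ev j T′ Z
    ev-V Z = begin
      𝕃.ev N V Z ≈⟨ 𝕃.ev-cong N H*T′ refl ⟨
      𝕃.ev N (H 𝕃R.* T′) Z ≡⟨ ≡.cong (λ m → 𝕃.ev m (H 𝕃R.* T′) Z) N≡ ⟨
      𝕃.ev (suc n ℕ.+ j) (H 𝕃R.* T′) Z ≈⟨ 𝕃.ev-* (suc n) j Z (proj₁ (proj₂ killer-H)) Deg-T′ ⟩
      𝕃.ev (suc n) H Z * 𝕃.ev j T′ Z ∎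

    no-point : ∀ a w → ¬ (w K.≈ K.0#) → ¬ (K.ev (suc n) (𝕃.ev (suc n) H (K.C a)) w K.≈ K.0#)
    no-point a w w≉0 e = no-zero a w w≉0 (K.begin
      K.ev N X w K.≈⟨ K.ev-mono N (N ⊔ M) w (ℕₚ.m≤m⊔n N M) (Deg-ev N V a (proj₂ Pol-V)) ⟩
      K.ev (N ⊔ M) X w K.≈⟨ K.ev-cong (N ⊔ M) (ev-V (K.C a)) K.refl ⟩
      K.ev (N ⊔ M) (A * A′) w K.≈⟨ K.ev-mono M (N ⊔ M) w (ℕₚ.m≤n⊔m N M) (K.Deg-* (suc n) d dA dA′) ⟨
      K.ev M (A * A′) w K.≈⟨ K.ev-* (suc n) d w dA dA′ ⟩
      K.ev (suc n) A w K.* K.ev d A′ w K.≈⟨ K.zero-mulˡ e ⟩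
      K.0# K.∎)
      where
      X = 𝕃.ev N V (K.C a)
      A = 𝕃.ev (suc n) H (K.C a)
      A′ = 𝕃.ev j T′ (K.C a)
      d = proj₁ Pol-T′
      M = suc n ℕ.+ d
      dA : K.Deg (suc n) A
      dA = Deg-ev (suc n) H a (λ j i l → filtered j i (ℕₚ.<-≤-trans l (ℕₚ.m≤m+n i (j ℕ.+ 0))))
      dA′ : K.Deg d A′
      dA′ = Deg-ev j T′ a (proj₂ Pol-T′)

    -- If the derivative of `H` vanished at `y`, then `H (y + z)`, and with it the multiple
    -- `V (y + z)`, would be divisible by `z^2`.
    simple : ¬ (𝕃.dd (suc n) H y y ≈ 0#)
    simple dd≈0 =
      let (r , e) = dd-difference series (suc n) H y (y + z) y
          z≈ = solve 2 (λ y z → (y :+ z) :- y := z) refl y z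
      in simple-V (r * 𝕃.ev j T′ (y + z)) (begin
        𝕃.ev N V (y + z) ≈⟨ ev-V (y + z) ⟩
        𝕃.ev (suc n) H (y + z) * 𝕃.ev j T′ (y + z) ≈⟨ *-congʳ (begin
          𝕃.ev (suc n) H (y + z) ≈⟨ trans (+-congˡ (trans (-‿cong (proj₂ (proj₂ killer-H))) -0#≈0#)) (+-identityʳ _) ⟨
          𝕃.ev (suc n) H (y + z) + - 𝕃.ev (suc n) H y ≈⟨ 𝕃.dd-spec (suc n) H y (y + z) ⟨
          ((y + z) + - y) * 𝕃.dd (suc n) H y (y + z)
            ≈⟨ *-cong z≈ (trans (sym (trans (+-congˡ (trans (-‿cong dd≈0) -0#≈0#)) (+-identityʳ _))) (trans e (*-congʳ z≈))) ⟩
          z * (z * r) ∎) ⟩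
        z * (z * r) * 𝕃.ev j T′ (y + z) ≈⟨ solve 3 (λ z r t → z :* (z :* r) :* t := z :* z :* (r :* t)) refl z r (𝕃.ev j T′ (y + z)) ⟩
        z * z * (r * 𝕃.ev j T′ (y + z)) ∎)

    impossible : ⊥
    impossible = Stepanov.contradiction F branch no-point simple
      (ℕₚ.≤-trans (ℕₚ.*-monoʳ-≤ 10 (ℕₚ.*-mono-≤ (ℕₚ.*-mono-≤ (ℕₚ.*-mono-≤ n≤N n≤N) n≤N) n≤N)) large)
      where
      n≤N : suc n ℕ.≤ N
      n≤N = ≡.subst (suc n ℕ.≤_) N≡ (ℕₚ.m≤m+n (suc n) j)

  Relation : ℕ → Set
  Relation m = Σ 𝕃.PS λ P → Killer m P × ¬ (P m ≈ 0#)

  LeadDegree : ℕ → ℕ → Set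
  LeadDegree n δ = Σ 𝕃.PS λ P → Killer n P × K.Deg δ (P n) × ¬ (P n ≈ 0#)

  no-relation : ∀ {n} → (∀ m → m ℕ.< n → ¬ Relation m) → ∀ m → m ℕ.< n → ∀ P → Killer m P → P m ≈ 0#
  no-relation none m l P kP = K.≋-stable λ ne → none m l (P , kP , ne)

  relation-V : Relation N
  relation-V = V , killer-V , λ e → 1≉0 (trans (sym lead-V) e)

  contradiction : ⊥
  contradiction = least Relation N relation-V step
    where
    step : ¬ (Σ ℕ λ m → Relation m × (∀ i → i ℕ.< m → ¬ Relation i))
    finish : ∀ n → (∀ m → m ℕ.< suc n → ¬ Relation m) → ∀ s → Killer (suc n) s → ∀ δ → K.Deg δ (s (suc n)) → ¬ (s (suc n) ≈ 0#) →
      (∀ e → e ℕ.< δ → ¬ LeadDegree (suc n) e) → ⊥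
    finish n none s ks δ dδ ns least-δ = by-degree δ dδ lead M.regular-lead
      where
      smaller = no-relation none
      exact : ∀ δ → K.Deg δ (s (suc n)) → (∀ e → e ℕ.< δ → ¬ LeadDegree (suc n) e) → ¬ (s (suc n) δ K.≈ K.0#)
      exact zero d least-δ z₀ = ns (pt λ { zero → z₀ ; (suc i) → d (suc i) (s≤s z≤n) })
      exact (suc δ) d least-δ z₀ = least-δ δ (ℕₚ.n<1+n δ) (s , ks , lower , ns)
        where
        lower : K.Deg δ (s (suc n))
        lower i l with i ℕ.≟ suc δ
        ... | yes ≡.refl = z₀
        ... | no ne = d i (ℕₚ.≤∧≢⇒< l (ne ∘ ≡.sym))
      lead = exact δ dδ least-δ
      module M = Minimal (suc n) smaller δ s ks dδ lead (λ P e l kP dP → K.≋-stable λ ne → least-δ e l (P , kP , dP , ne))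
      n≤N : suc n ℕ.≤ N
      n≤N with suc n ℕ.≤? N
      ... | yes l = l
      ... | no nl = ⊥-elim (none N (ℕₚ.≰⇒> nl) relation-V)
      j = N ∸ suc n
      j+n : j ℕ.+ suc n ≡ N
      j+n = ℕₚ.m∸n+n≡m n≤N
      mult = M.multiple j (suc N) V (≡.subst (λ m → Killer m V) (≡.sym j+n) killer-V)
        (λ i l → proj₂ Pol-V (j ℕ.+ suc n) i l)
      T = proj₁ mult
      dT = proj₁ (proj₂ (proj₂ mult))
      N≡ : suc n ℕ.+ j ≡ N
      N≡ = ≡.trans (ℕₚ.+-comm (suc n) j) j+n
      top : s (suc n) * T j ≈ 1#
      top = begin
        s (suc n) * T j ≈⟨ 𝕃.top-* (suc n) j (proj₁ (proj₂ ks)) dT ⟨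
        (s 𝕃R.* T) (suc n ℕ.+ j) ≈⟨ 𝕃.at (proj₂ (proj₂ (proj₂ mult))) (suc n ℕ.+ j) ⟨
        V (suc n ℕ.+ j) ≈⟨ trans (reflexive (≡.cong V N≡)) lead-V ⟩
        1# ∎
      -- Since `V` is monic, the leading coefficient of its factor `s` is a unit of `k[X]`, so its
      -- degree is zero.
      by-degree : ∀ δ → K.Deg δ (s (suc n)) → ¬ (s (suc n) δ K.≈ K.0#) → (∀ z → s (suc n) δ K.* z K.≈ K.0# → z K.≈ K.0#) → ⊥
      by-degree zero d nz reg = Factor.impossible n j N≡ smaller s T ks (proj₁ (proj₂ mult)) dT (proj₂ (proj₂ (proj₂ mult)))
        (s (suc n) 0) nz (pt λ { zero → K.refl ; (suc i) → d (suc i) (s≤s z≤n) })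
      by-degree (suc δ) d nz reg = 1≉0 (trans (sym top) (zero-mulʳ (regular-multiple K.k (suc δ) (proj₁ (proj₁ (proj₂ mult))) d reg
        (proj₂ (proj₁ (proj₂ mult)) j) (λ { (suc i) (s≤s l) → at top (suc i) }))))
    step (zero , (P , (pP , dP , e) , ne) , _) = ne e
    step (suc n , (P , kP , ne) , none) = least (LeadDegree (suc n)) (proj₁ (proj₁ kP)) (P , kP , proj₂ (proj₁ kP) (suc n) , ne)
      λ { (δ , (s , ks , dδ , ns) , least-δ) → finish n none s ks δ dδ ns least-δ }

-- Polynomial expressions with degree bounds.

-- Polynomial expressions in X and Y over the field, indexed by a bound for the total degree.
module Expressions (F : FiniteField) where
  module W = Weights F
  module K = Field F
  open K using (at; pt)
  module 𝕃 = W.𝕃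
  module 𝔹 = RingLemmas K.series
  module 𝕃R = RingLemmas 𝕃.series

  -- A deep embedding: total degree, leading coefficient, and values in polynomials, series and the
  -- field are all read off a single description of the curve.
  data Form : ℕ → Set where
    con : K.Carrier → Form 0
    X Y : Form 1
    nil : ∀ {D} → Form D
    up : ∀ {D} → Form D → Form (suc D)
    cast : ∀ {D E} → D ≡ E → Form D → Form E
    _⟨+⟩_ : ∀ {D} → Form D → Form D → Form D
    _⟨*⟩_ : ∀ {D E} → Form D → Form E → Form (D ℕ.+ E)
    _⟨^⟩_ : Form 1 → ∀ m → Form m
    sum : ∀ {D} → ℕ → (ℕ → Form D) → Form D

  infixl 6 _⟨+⟩_
  infixl 7 _⟨*⟩_
  infixr 8 _⟨^⟩_

  module Interpretation (R : Ring₀) (embed : K.Carrier → CommutativeRing.Carrier R) (x y : CommutativeRing.Carrier R) where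
    open RingLemmas R

    ⟦_⟧ : ∀ {D} → Form D → Carrier
    ⟦ con c ⟧ = embed c
    ⟦ X ⟧ = x
    ⟦ Y ⟧ = y
    ⟦ nil ⟧ = 0#
    ⟦ up e ⟧ = ⟦ e ⟧
    ⟦ cast _ e ⟧ = ⟦ e ⟧
    ⟦ e ⟨+⟩ f ⟧ = ⟦ e ⟧ + ⟦ f ⟧
    ⟦ e ⟨*⟩ f ⟧ = ⟦ e ⟧ * ⟦ f ⟧
    ⟦ e ⟨^⟩ m ⟧ = ⟦ e ⟧ ^ m
    ⟦ sum m f ⟧ = ∑ m (λ i → ⟦ f i ⟧)

  -- The coefficient of Y^D.
  top : ∀ {D} → Form D → K.Carrier
  top (con c) = c
  top X = K.0#
  top Y = K.1#
  top nil = K.0#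
  top (up e) = K.0#
  top (cast _ e) = top e
  top (e ⟨+⟩ f) = top e K.+ top f
  top (e ⟨*⟩ f) = top e K.* top f
  top (e ⟨^⟩ m) = top e K.^ m
  top (sum m f) = K.∑ m (λ i → top (f i))

  module AsPolynomial = Interpretation 𝕃.series (λ c → 𝕃.C (K.C c)) (𝕃.C K.X) 𝕃.X
  module OnSeries (z : K.PS) = Interpretation K.series K.C K.X z
  module OnField = Interpretation K.k id

  poly : ∀ {D} → Form D → 𝕃.PS
  poly = AsPolynomial.⟦_⟧

  Tot-const : ∀ {D s} {c : K.PS} → W.W D s c → W.Tot D s (𝕃.C c)
  Tot-const w zero = w
  Tot-const w (suc j) a l = K.refl

  Tot-C : ∀ c → W.Tot 0 0 (𝕃.C (K.C c))
  Tot-C c = Tot-const λ { zero () ; (suc a) l → K.refl }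

  Tot-weaken : ∀ {D E P} → D ℕ.≤ E → W.Tot D 0 P → W.Tot E 0 P
  Tot-weaken le t j a l = t j a (ℕₚ.≤-<-trans le l)

  Tot-+ : ∀ {D P Q} → W.Tot D 0 P → W.Tot D 0 Q → W.Tot D 0 (P 𝕃R.+ Q)
  Tot-+ v w j a l = K.zero-sum (v j a l) (w j a l)

  Tot-0 : ∀ {D} → W.Tot D 0 𝕃R.0#
  Tot-0 j a l = K.refl

  Tot-^ : ∀ m {P} → W.Tot 1 0 P → W.Tot m 0 (P 𝕃R.^ m)
  Tot-^ zero t = Tot-C K.1#
  Tot-^ (suc m) t = W.Tot-* 1 0 m 0 t (Tot-^ m t)

  Tot-∑ : ∀ {D} m (f : ℕ → 𝕃.PS) → (∀ i → W.Tot D 0 (f i)) → W.Tot D 0 (𝕃R.∑ m f)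
  Tot-∑ zero f t = Tot-0
  Tot-∑ (suc m) f t = Tot-+ {P = f 0} (t 0) (Tot-∑ m (f ∘ suc) (t ∘ suc))

  total-degree : ∀ {D} (e : Form D) → W.Tot D 0 (poly e)
  total-degree (con c) = Tot-C c
  total-degree X = Tot-const λ { zero () ; (suc zero) (s≤s ()) ; (suc (suc a)) l → K.refl }
  total-degree Y zero a l = K.refl
  total-degree Y (suc zero) zero (s≤s ())
  total-degree Y (suc zero) (suc a) l = K.refl
  total-degree Y (suc (suc j)) a l = K.refl
  total-degree nil = Tot-0
  total-degree (up e) = Tot-weaken {P = poly e} (ℕₚ.n≤1+n _) (total-degree e)
  total-degree (cast ≡.refl e) = total-degree e
  total-degree (e ⟨+⟩ f) = Tot-+ {P = poly e} (total-degree e) (total-degree f)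
  total-degree (_⟨*⟩_ {D} {E} e f) = W.Tot-* D 0 E 0 (total-degree e) (total-degree f)
  total-degree (e ⟨^⟩ m) = Tot-^ m (total-degree e)
  total-degree (sum m f) = Tot-∑ m (λ i → poly (f i)) (λ i → total-degree (f i))

  Y-degree : ∀ {D} (e : Form D) → 𝕃.Deg D (poly e)
  Y-degree e = W.Tot⇒Deg (total-degree e)

  ∑-at : ∀ m (f : ℕ → 𝕃.PS) i → 𝕃R.∑ m f i ≡ 𝔹.∑ m (λ j → f j i)
  ∑-at zero f i = ≡.refl
  ∑-at (suc m) f i = ≡.cong (f 0 i 𝔹.+_) (∑-at m (f ∘ suc) i)

  C-∑ : ∀ m (f : ℕ → K.Carrier) → K.C (K.∑ m f) 𝔹.≈ 𝔹.∑ m (λ i → K.C (f i))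
  C-∑ zero f = K.C-0
  C-∑ (suc m) f = 𝔹.trans (K.C-+ (f 0) _) (𝔹.+-congˡ (C-∑ m (f ∘ suc)))

  leading : ∀ {D} (e : Form D) → poly e D 𝔹.≈ K.C (top e)
  leading (con c) = 𝔹.refl
  leading X = 𝔹.sym K.C-0
  leading Y = 𝔹.refl
  leading nil = 𝔹.sym K.C-0
  leading (up e) = 𝔹.trans (Y-degree e _ (ℕₚ.n<1+n _)) (𝔹.sym K.C-0)
  leading (cast ≡.refl e) = leading e
  leading (e ⟨+⟩ f) = 𝔹.trans (𝔹.+-cong (leading e) (leading f)) (𝔹.sym (K.C-+ _ _))
  leading (_⟨*⟩_ {D} {E} e f) = 𝔹.trans (𝕃.top-* D E (Y-degree e) (Y-degree f))
    (𝔹.trans (𝔹.*-cong (leading e) (leading f)) (𝔹.sym (K.C-* _ _)))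
  leading (e ⟨^⟩ m) = 𝔹.trans (≡.subst (λ r → (poly e 𝕃R.^ m) r 𝔹.≈ poly e 1 𝔹.^ m) (ℕₚ.*-identityʳ m) (𝕃.top-^ 1 m (Y-degree e)))
    (𝔹.trans (𝔹.^-congˡ m (leading e)) (𝔹.sym (K.C-^ (top e) m)))
  leading {D} (sum m f) = 𝔹.trans (𝔹.reflexive (∑-at m (λ i → poly (f i)) D))
    (𝔹.trans (𝔹.∑-cong m (λ i _ → leading (f i))) (𝔹.sym (C-∑ m (λ i → top (f i)))))

  module _ (z : K.PS) where
    open OnSeries z using (⟦_⟧)

    ev-poly : ∀ {D} (e : Form D) → 𝕃.ev D (poly e) z 𝔹.≈ ⟦ e ⟧
    ev-poly (con c) = 𝔹.refl
    ev-poly X = 𝕃.ev-C 1 K.X z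
    ev-poly Y = 𝕃.ev-X 0 z
    ev-poly {D} nil = 𝕃.ev-zero D z 𝕃R.refl
    ev-poly (up {D} e) = 𝔹.trans (𝔹.sym (𝕃.ev-mono D (suc D) z (ℕₚ.n≤1+n D) (Y-degree e))) (ev-poly e)
    ev-poly (cast ≡.refl e) = ev-poly e
    ev-poly {D} (e ⟨+⟩ f) = 𝔹.trans (𝕃.ev-+ D (poly e) (poly f) z) (𝔹.+-cong (ev-poly e) (ev-poly f))
    ev-poly (_⟨*⟩_ {D} {E} e f) = 𝔹.trans (𝕃.ev-* D E z (Y-degree e) (Y-degree f)) (𝔹.*-cong (ev-poly e) (ev-poly f))
    ev-poly (e ⟨^⟩ m) = 𝔹.trans (≡.subst (λ r → 𝕃.ev r (poly e 𝕃R.^ m) z 𝔹.≈ 𝕃.ev 1 (poly e) z 𝔹.^ m) (ℕₚ.*-identityʳ m) (𝕃.ev-^ 1 m (poly e) z (Y-degree e)))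
      (𝔹.^-congˡ m (ev-poly e))
    ev-poly {D} (sum m f) = go m f (λ i → ev-poly (f i))
      where
      go : ∀ m (f : ℕ → Form D) → (∀ i → 𝕃.ev D (poly (f i)) z 𝔹.≈ ⟦ f i ⟧) → 𝕃.ev D (𝕃R.∑ m (λ i → poly (f i))) z 𝔹.≈ 𝔹.∑ m (λ i → ⟦ f i ⟧)
      go zero f h = 𝕃.ev-zero D z 𝕃R.refl
      go (suc m) f h = 𝔹.trans (𝕃.ev-+ D (poly (f 0)) (𝕃R.∑ m (λ i → poly (f (suc i)))) z) (𝔹.+-cong (h 0) (go m (f ∘ suc) (h ∘ suc)))

  module _ (a w : K.Carrier) where
    open OnSeries (K.C a) using (⟦_⟧)
    module P = OnField w a

    ev-constant : ∀ {D} (e : Form D) → K.Deg D ⟦ e ⟧ × (K.ev D ⟦ e ⟧ w K.≈ P.⟦ e ⟧)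
    ev-constant (con c) = K.Deg-C c , K.refl
    ev-constant X = K.Deg-X , K.ev-X 0 w
    ev-constant Y = K.Deg-C a , K.ev-C 1 a w
    ev-constant {D} nil = K.Deg-0 {D} , K.ev-zero D w 𝔹.refl
    ev-constant (up {D} e) = let (d , h) = ev-constant e in
      K.Deg-mono {f = ⟦ e ⟧} (ℕₚ.n≤1+n D) d , K.trans (K.sym (K.ev-mono D (suc D) w (ℕₚ.n≤1+n D) d)) h
    ev-constant (cast ≡.refl e) = ev-constant e
    ev-constant {D} (e ⟨+⟩ f) = let (d , h) = ev-constant e ; (d′ , h′) = ev-constant f in
      K.Deg-+ {f = ⟦ e ⟧} d d′ , K.trans (K.ev-+ D ⟦ e ⟧ ⟦ f ⟧ w) (K.+-cong h h′)
    ev-constant (_⟨*⟩_ {D} {E} e f) = let (d , h) = ev-constant e ; (d′ , h′) = ev-constant f in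
      K.Deg-* D E d d′ , K.trans (K.ev-* D E w d d′) (K.*-cong h h′)
    ev-constant (e ⟨^⟩ m) = let (d , h) = ev-constant e in
      ≡.subst (λ r → K.Deg r (⟦ e ⟧ 𝔹.^ m)) (ℕₚ.*-identityʳ m) (K.Deg-^ 1 m d) ,
      K.trans (≡.subst (λ r → K.ev r (⟦ e ⟧ 𝔹.^ m) w K.≈ K.ev 1 ⟦ e ⟧ w K.^ m) (ℕₚ.*-identityʳ m) (K.ev-^ 1 m ⟦ e ⟧ w d)) (K.^-congˡ m h)
    ev-constant {D} (sum m f) = go m f (λ i → ev-constant (f i))
      where
      go : ∀ m (f : ℕ → Form D) → (∀ i → K.Deg D ⟦ f i ⟧ × (K.ev D ⟦ f i ⟧ w K.≈ P.⟦ f i ⟧)) →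
        K.Deg D (𝔹.∑ m (λ i → ⟦ f i ⟧)) × (K.ev D (𝔹.∑ m (λ i → ⟦ f i ⟧)) w K.≈ K.∑ m (λ i → P.⟦ f i ⟧))
      go zero f h = K.Deg-0 {D} , K.ev-zero D w 𝔹.refl
      go (suc m) f h = let (d , e) = h 0 ; (d′ , e′) = go m (f ∘ suc) (h ∘ suc) in
        K.Deg-+ {f = ⟦ f 0 ⟧} d d′ , K.trans (K.ev-+ D ⟦ f 0 ⟧ (𝔹.∑ m (λ i → ⟦ f (suc i) ⟧)) w) (K.+-cong e e′)

-- Fixed points of contractions of power series.

-- Solving t = Ψ(t) by successive approximation.
module Contraction (R : Ring₀) where
  open RingLemmas R
  open Series R
  private module S = RingLemmas series

  Ord-mono : ∀ {m n f} → m ℕ.≤ n → Ord n f → Ord m f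
  Ord-mono l o i lt = o i (ℕₚ.<-≤-trans lt l)

  Ord-+ : ∀ {m f g} → Ord m f → Ord m g → Ord m (f S.+ g)
  Ord-+ o o′ i l = zero-sum (o i l) (o′ i l)

  Ord-neg : ∀ {m f} → Ord m f → Ord m (S.- f)
  Ord-neg o i l = trans (-‿cong (o i l)) -0#≈0#

  Ord-cong : ∀ {m f g} → f ≋ g → Ord m f → Ord m g
  Ord-cong e o i l = trans (sym (at e i)) (o i l)

  Ord-* : ∀ {m n f g} → Ord m f → Ord n g → Ord (m ℕ.+ n) (f S.* g)
  Ord-* {m} {n} {f} {g} o o′ = Ord-cong
    (S.trans (S.*-congʳ (S.^-homo-* X m n)) (S.trans (S.solve 4 (λ x y f g → x S.:* y S.:* (f S.:* g) S.:= x S.:* f S.:* (y S.:* g)) S.refl (X S.^ m) (X S.^ n) f′ g′)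
      (S.sym (S.*-cong (Ord-factor m f o) (Ord-factor n g o′)))))
    (X^*-low (m ℕ.+ n) (f′ S.* g′))
    where
    f′ g′ : PS
    f′ i = f (m ℕ.+ i)
    g′ i = g (n ℕ.+ i)

  Ord-*ʳ : ∀ {m f} g → Ord m f → Ord m (f S.* g)
  Ord-*ʳ {m} {f} g o = ≡.subst (λ r → Ord r (f S.* g)) (ℕₚ.+-identityʳ m) (Ord-* {m} {0} {f} {g} o (λ _ ()))

  module _ (Ψ : PS → PS) (contract : ∀ m t t′ → Ord m (t S.+ S.- t′) → Ord (suc m) (Ψ t S.+ S.- Ψ t′)) where

    private
      approx : ℕ → PS
      approx zero = S.0#
      approx (suc i) = Ψ (approx i)

      difference : ∀ {m} t u v → Ord m (t S.+ S.- u) → Ord m (u S.+ S.- v) → Ord m (t S.+ S.- v)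
      difference t u v o o′ = Ord-cong (S.solve 3 (λ t u v → (t S.:- u) S.:+ (u S.:- v) S.:= t S.:- v) S.refl t u v)
        (Ord-+ {f = t S.+ S.- u} o o′)

      step : ∀ i → Ord i (approx (suc i) S.+ S.- approx i)
      step zero _ ()
      step (suc i) = contract i (approx (suc i)) (approx i) (step i)

    -- The diagonal of the approximations: `approx (suc i)` already agrees with all later ones up to
    -- degree `i`.
    fixpoint : PS
    fixpoint i = approx (suc i) i

    private
      chain : ∀ i j → Ord i (approx (j ℕ.+ i) S.+ S.- approx i)
      chain i zero j l = -‿inverseʳ _
      chain i (suc j) = difference (approx (suc (j ℕ.+ i))) (approx (j ℕ.+ i)) (approx i)
        (Ord-mono {f = approx (suc (j ℕ.+ i)) S.+ S.- approx (j ℕ.+ i)} (ℕₚ.m≤n+m i j) (step (j ℕ.+ i))) (chain i j)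

      close : ∀ m → Ord m (fixpoint S.+ S.- approx m)
      close m i l = trans (solve 2 (λ f g → f :- g := :- (g :- f)) refl (approx (suc i) i) (approx m i))
        (trans (-‿cong (≡.subst (λ r → approx r i + - approx (suc i) i ≈ 0#) (ℕₚ.m∸n+n≡m l)
          (chain (suc i) (m ∸ suc i) i (ℕₚ.n<1+n i)))) -0#≈0#)

    is-fixpoint : Ψ fixpoint ≋ fixpoint
    is-fixpoint = pt λ i → trans (solve 2 (λ f g → f := (f :- g) :+ g) refl (Ψ fixpoint i) (fixpoint i))
      (trans (+-congʳ (difference (Ψ fixpoint) (approx (suc i)) fixpoint
          (Ord-mono {f = Ψ fixpoint S.+ S.- approx (suc i)} (ℕₚ.≤-refl) (contract i fixpoint (approx i) (close i)))
          (Ord-cong (S.solve 2 (λ f g → S.:- (f S.:- g) S.:= g S.:- f) S.refl fixpoint (approx (suc i)))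
            (Ord-neg {f = fixpoint S.+ S.- approx (suc i)} (close (suc i)))) i (ℕₚ.n<1+n i)))
        (+-identityˡ _))

-- Degree at least three in `Y`.

^-collect : (R : Ring₀) → let open RingLemmas R in ∀ w s v c i j r →
  c * ((w * s) ^ i * ((w * v) ^ j * w ^ r)) ≈ w ^ (i ℕ.+ (j ℕ.+ r)) * (c * (s ^ i * v ^ j))
^-collect R w s v c i j r = begin
  c * ((w * s) ^ i * ((w * v) ^ j * w ^ r)) ≈⟨ *-congˡ (*-cong (^-distrib-* w s i) (*-congʳ (^-distrib-* w v j))) ⟩
  c * (w ^ i * s ^ i * (w ^ j * v ^ j * w ^ r))
    ≈⟨ solve 6 (λ c p s q v r → c :* (p :* s :* (q :* v :* r)) := p :* (q :* r) :* (c :* (s :* v))) refl c (w ^ i) (s ^ i) (w ^ j) (v ^ j) (w ^ r) ⟩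
  w ^ i * (w ^ j * w ^ r) * (c * (s ^ i * v ^ j)) ≈⟨ *-congʳ (trans (^-homo-* w i (j ℕ.+ r)) (*-congˡ (^-homo-* w j r))) ⟨
  w ^ (i ℕ.+ (j ℕ.+ r)) * (c * (s ^ i * v ^ j)) ∎
  where open RingLemmas R

module _ (R : Ring₀) where
  open RingLemmas R

  ∑-reverse : ∀ d (f : ℕ → Carrier) → ∑ (suc d) f ≈ ∑ (suc d) (λ i → f (d ∸ i))
  ∑-reverse zero f = refl
  ∑-reverse (suc d) f = begin
    ∑ (suc (suc d)) f ≈⟨ ∑-last (suc d) f ⟩
    ∑ (suc d) f + f (suc d) ≈⟨ trans (+-comm _ _) (+-congˡ (∑-reverse d f)) ⟩
    f (suc d) + ∑ (suc d) (λ i → f (d ∸ i)) ∎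

module HighDegree (F : FiniteField) {p} (pr : Prime p) (h : ℕ) (size≡ : FiniteField.size F ≡ p ℕ.^ h)
  (d e : ℕ) (a : ℕ → ℕ → FiniteField.Carrier F) where
  open Expressions F
  open K using (_≋_)

  f : K.Carrier → K.Carrier → K.Carrier
  f x y = K.∑ (suc d) (λ i → K.∑ (suc (d ∸ i)) (λ j → a i j K.* (x K.^ i K.* y K.^ j)))

  module _
    (a-degree : ∀ i j → d ℕ.< i ℕ.+ j → a i j K.≈ K.0#)
    (3≤e : 3 ℕ.≤ e) (e≤d : e ℕ.≤ d) (a-Y : ∀ i j → e ℕ.< j → a i j K.≈ K.0#)
    (large : 10 ℕ.* (suc d ℕ.* suc d ℕ.* suc d ℕ.* suc d) ℕ.≤ K.size)
    (ovoid : ∀ x₀ u v → ¬ (u K.≈ K.0# × v K.≈ K.0#) → ¬ (v K.* v K.+ u K.* (f (x₀ K.+ u) v K.+ K.- f x₀ K.0#) K.≈ K.0#)) where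

    in-range : ∀ i j → i ℕ.≤ d → j ℕ.≤ d ∸ i → i ℕ.+ (j ℕ.+ (d ∸ i ∸ j)) ≡ d
    in-range i j i≤d j≤ = ≡.trans (≡.cong (i ℕ.+_) (ℕₚ.m+[n∸m]≡n j≤)) (ℕₚ.m+[n∸m]≡n i≤d)

    -- The curve v² + u (f(x₀ + u, v) − f(x₀, 0)) = 0 in the coordinates u = Y/X, v = (1 + κY)/X,
    -- with κ chosen so that it becomes monic in Y and x₀ so that it has a rational branch at X = 0.
    module Slice (κ x₀ : K.Carrier)
      (λ≉0 : ¬ (K.∑ (suc d) (λ i → a i (d ∸ i) K.* κ K.^ (d ∸ i)) K.≈ K.0#))
      (α≉0 : ¬ (K.∑ (suc d) (λ i → a i e K.* x₀ K.^ i) K.≈ K.0#)) where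

      lead α c₀ : K.Carrier
      lead = K.∑ (suc d) (λ i → a i (d ∸ i) K.* κ K.^ (d ∸ i))
      α = K.∑ (suc d) (λ i → a i e K.* x₀ K.^ i)
      c₀ = f x₀ K.0#

      -- These are `X v` and `X (x₀ + u)` in the new coordinates.
      line abscissa : Form 1
      line = up (con K.1#) ⟨+⟩ con κ ⟨*⟩ Y
      abscissa = con x₀ ⟨*⟩ X ⟨+⟩ Y

      monomial : ∀ i j → Form (i ℕ.+ (j ℕ.+ (d ∸ i ∸ j)))
      monomial i j = con (a i j) ⟨*⟩ (abscissa ⟨^⟩ i ⟨*⟩ (line ⟨^⟩ j ⟨*⟩ X ⟨^⟩ (d ∸ i ∸ j)))

      -- The exponents of `monomial` add up to `d` only for `i + j ≤ d`, so the index equation is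
      -- decided before casting; pairs outside this range do not occur in the sum.
      term : ℕ → ℕ → Form d
      term i j with i ℕ.+ (j ℕ.+ (d ∸ i ∸ j)) ℕ.≟ d
      ... | yes q = cast q (monomial i j)
      ... | no _ = nil

      1≤d : 1 ℕ.≤ d
      1≤d = ℕₚ.≤-trans (s≤s z≤n) (ℕₚ.≤-trans 3≤e e≤d)

      -- `body` is `X^(d + 1)` times the equation in `u` and `v`; `curve` makes it monic in `Y`.
      body curve : Form (suc d)
      body = cast (≡.cong suc (ℕₚ.m+[n∸m]≡n 1≤d)) (line ⟨^⟩ 2 ⟨*⟩ X ⟨^⟩ (d ∸ 1)) ⟨+⟩
             Y ⟨*⟩ (sum (suc d) (λ i → sum (suc (d ∸ i)) (term i)) ⟨+⟩ con (K.- c₀) ⟨*⟩ X ⟨^⟩ d)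
      curve = con (proj₁ (K.inv lead λ≉0)) ⟨*⟩ body

      top-term : ∀ i j → i ℕ.≤ d → j ℕ.≤ d ∸ i → top (term i j) ≡ top (monomial i j)
      top-term i j i≤d j≤ with i ℕ.+ (j ℕ.+ (d ∸ i ∸ j)) ℕ.≟ d
      ... | yes _ = ≡.refl
      ... | no ne = ⊥-elim (ne (in-range i j i≤d j≤))

      top-line : top line K.≈ κ
      top-line = K.trans (K.+-identityˡ _) (K.*-identityʳ κ)

      top-abscissa : top abscissa K.≈ K.1#
      top-abscissa = K.trans (K.+-congʳ (K.zeroʳ x₀)) (K.+-identityˡ _)

      top-row : ∀ i → i ℕ.≤ d → K.∑ (suc (d ∸ i)) (λ j → top (term i j)) K.≈ a i (d ∸ i) K.* κ K.^ (d ∸ i)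
      top-row i i≤d = K.trans (K.∑-cong (suc (d ∸ i)) (λ { j (s≤s l) → K.reflexive (top-term i j i≤d l) }))
        (K.trans (K.∑-single (suc (d ∸ i)) (d ∸ i) {λ j → top (monomial i j)} (ℕₚ.n<1+n _) off) (K.*-congˡ (K.begin
          top abscissa K.^ i K.* (top line K.^ (d ∸ i) K.* K.0# K.^ (d ∸ i ∸ (d ∸ i)))
            K.≈⟨ K.*-cong (K.trans (K.^-congˡ i top-abscissa) (K.1^ i)) (K.*-cong (K.^-congˡ (d ∸ i) top-line) (K.reflexive (≡.cong (K.0# K.^_) (ℕₚ.n∸n≡0 (d ∸ i))))) ⟩
          K.1# K.* (κ K.^ (d ∸ i) K.* K.1#) K.≈⟨ K.trans (K.*-identityˡ _) (K.*-identityʳ _) ⟩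
          κ K.^ (d ∸ i) K.∎)))
        where
        off : ∀ j → j ℕ.< suc (d ∸ i) → j ≢ d ∸ i → top (monomial i j) K.≈ K.0#
        off j (s≤s l) ne = K.zero-mulʳ (K.zero-mulʳ (K.zero-mulʳ (K.0^ (d ∸ i ∸ j) (ℕₚ.m<n⇒0<n∸m (ℕₚ.≤∧≢⇒< l ne)))))

      -- Terms of `f` of degree below `d` carry a power of `X`; what remains is the top form of `f`
      -- at `(1, κ)`.
      top-curve : top curve K.≈ K.1#
      top-curve = K.trans (K.*-congˡ (K.begin
          top line K.^ 2 K.* K.0# K.^ (d ∸ 1) K.+ K.1# K.* (K.∑ (suc d) (λ i → K.∑ (suc (d ∸ i)) (λ j → top (term i j))) K.+ K.- c₀ K.* K.0# K.^ d)
            K.≈⟨ K.+-cong (K.zero-mulʳ (K.0^ (d ∸ 1) (ℕₚ.m<n⇒0<n∸m (ℕₚ.≤-trans (s≤s (s≤s z≤n)) (ℕₚ.≤-trans 3≤e e≤d)))))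
                 (K.trans (K.*-identityˡ _) (K.+-cong (K.∑-cong (suc d) (λ { i (s≤s l) → top-row i l })) (K.zero-mulʳ (K.0^ d 1≤d)))) ⟩
          K.0# K.+ (lead K.+ K.0#) K.≈⟨ K.trans (K.+-identityˡ _) (K.+-identityʳ _) ⟩
          lead K.∎))
        (K.trans (K.*-comm _ _) (proj₂ (K.inv lead λ≉0)))

      module Value (R : Ring₀) (embed : K.Carrier → CommutativeRing.Carrier R) (x y : CommutativeRing.Carrier R) where
        open RingLemmas R
        open Interpretation R embed x y

        value-term : ∀ i j → i ℕ.≤ d → j ℕ.≤ d ∸ i → ⟦ term i j ⟧ ≡ ⟦ monomial i j ⟧
        value-term i j i≤d j≤ with i ℕ.+ (j ℕ.+ (d ∸ i ∸ j)) ℕ.≟ d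
        ... | yes _ = ≡.refl
        ... | no ne = ⊥-elim (ne (in-range i j i≤d j≤))

        value-sum : ∀ (g : ℕ → ℕ → Carrier) → (∀ i j → i ℕ.≤ d → j ℕ.≤ d ∸ i → ⟦ monomial i j ⟧ ≈ g i j) →
          ⟦ sum (suc d) (λ i → sum (suc (d ∸ i)) (term i)) ⟧ ≈ ∑ (suc d) (λ i → ∑ (suc (d ∸ i)) (g i))
        value-sum g eq = ∑-cong (suc d) λ { i (s≤s i≤d) → ∑-cong (suc (d ∸ i)) λ { j (s≤s j≤) →
          trans (reflexive (value-term i j i≤d j≤)) (eq i j i≤d j≤) } }

        pull : ∀ c (g : ℕ → ℕ → Carrier) → ∑ (suc d) (λ i → ∑ (suc (d ∸ i)) (λ j → c * g i j)) ≈ c * ∑ (suc d) (λ i → ∑ (suc (d ∸ i)) (g i))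
        pull c g = trans (∑-cong (suc d) (λ i _ → ∑-*ˡ (suc (d ∸ i)) c (g i))) (∑-*ˡ (suc d) c (λ i → ∑ (suc (d ∸ i)) (g i)))

      no-zero : ∀ b w → ¬ (w K.≈ K.0#) → ¬ (K.ev (suc d) (𝕃.ev (suc d) (poly curve) (K.C b)) w K.≈ K.0#)
      no-zero b w w≉0 z = ovoid x₀ u v nonzero (K.domain (K.trans (K.sym scaled) body≈0) (K.*-≉0 w≉0 (K.^-≉0 d w≉0)))
        where
        open OnField w b using (⟦_⟧)
        open Value K.k id w b
        wi = K.inv w w≉0
        u = b K.* proj₁ wi
        v = (K.1# K.+ κ K.* b) K.* proj₁ wi
        undo : ∀ x → x K.≈ w K.* (x K.* proj₁ wi)
        undo x = K.sym (K.trans (K.solve 3 (λ w x i → w K.:* (x K.:* i) K.:= x K.:* (w K.:* i)) K.refl w x (proj₁ wi)) (K.trans (K.*-congˡ (proj₂ wi)) (K.*-identityʳ x)))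
        body≈0 : ⟦ body ⟧ K.≈ K.0#
        body≈0 = K.domain (K.trans (K.sym (K.trans (K.ev-cong (suc d) (ev-poly (K.C b) curve) K.refl) (proj₂ (ev-constant b w curve)))) z)
          (λ e → K.1≉0 (K.trans (K.sym (proj₂ (K.inv lead λ≉0))) (K.zero-mulʳ e)))
        -- The identity `w v - κ w u = 1` keeps `u` and `v` from vanishing together.
        nonzero : ¬ (u K.≈ K.0# × v K.≈ K.0#)
        nonzero (u0 , v0) = K.1≉0 (K.begin
          K.1# K.≈⟨ K.solve 2 (λ k b → K.con (1 , 0) K.:= (K.con (1 , 0) K.:+ k K.:* b) K.:- k K.:* b) K.refl κ b ⟩
          (K.1# K.+ κ K.* b) K.+ K.- (κ K.* b)
            K.≈⟨ K.+-cong (K.trans (undo _) (K.zero-mulʳ v0)) (K.trans (K.-‿cong (K.zero-mulʳ (K.trans (undo b) (K.zero-mulʳ u0)))) K.-0#≈0#) ⟩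
          K.0# K.+ K.0# K.≈⟨ K.+-identityˡ _ ⟩
          K.0# K.∎)
        s = x₀ K.+ u
        abscissa-value : ⟦ abscissa ⟧ K.≈ w K.* s
        abscissa-value = K.trans (K.+-congˡ (undo b)) (K.solve 3 (λ x w u → x K.:* w K.:+ w K.:* u K.:= w K.:* (x K.:+ u)) K.refl x₀ w u)
        monomial-value : ∀ i j → i ℕ.≤ d → j ℕ.≤ d ∸ i → ⟦ monomial i j ⟧ K.≈ w K.^ d K.* (a i j K.* (s K.^ i K.* v K.^ j))
        monomial-value i j i≤d j≤ = K.trans (K.*-congˡ (K.*-cong (K.^-congˡ i abscissa-value) (K.*-congʳ (K.^-congˡ j (undo _)))))
          (K.trans (^-collect K.k w s v (a i j) i j (d ∸ i ∸ j)) (K.*-congʳ (K.reflexive (≡.cong (w K.^_) (in-range i j i≤d j≤)))))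
        scaled : ⟦ body ⟧ K.≈ w K.* w K.^ d K.* (v K.* v K.+ u K.* (f s v K.+ K.- c₀))
        scaled = K.begin
          ⟦ body ⟧ K.≈⟨ K.+-cong (K.*-congʳ (K.^-congˡ 2 (undo _))) (K.*-cong (undo b) (K.+-congʳ (K.trans (value-sum _ monomial-value) (pull (w K.^ d) (λ i j → a i j K.* (s K.^ i K.* v K.^ j)))))) ⟩
          (w K.* v) K.^ 2 K.* w K.^ (d ∸ 1) K.+ w K.* u K.* (w K.^ d K.* f s v K.+ K.- c₀ K.* w K.^ d)
            K.≈⟨ K.solve 7 (λ w v q u p F c → w K.:* v K.:* (w K.:* v K.:* K.con (1 , 0)) K.:* q K.:+ w K.:* u K.:* (p K.:* F K.:+ (K.:- c) K.:* p)
                   K.:= w K.:* (w K.:* q) K.:* (v K.:* v) K.:+ w K.:* p K.:* (u K.:* (F K.:- c))) K.refl w v (w K.^ (d ∸ 1)) u (w K.^ d) (f s v) c₀ ⟩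
          w K.* (w K.* w K.^ (d ∸ 1)) K.* (v K.* v) K.+ w K.* w K.^ d K.* (u K.* (f s v K.+ K.- c₀))
            K.≈⟨ K.+-congʳ (K.*-congʳ (K.*-congˡ (K.reflexive (≡.cong (w K.^_) (ℕₚ.m+[n∸m]≡n 1≤d))))) ⟩
          w K.* w K.^ d K.* (v K.* v) K.+ w K.* w K.^ d K.* (u K.* (f s v K.+ K.- c₀)) K.≈⟨ K.distribˡ _ _ _ ⟨
          w K.* w K.^ d K.* (v K.* v K.+ u K.* (f s v K.+ K.- c₀)) K.∎

      open K using (at; pt)
      open Contraction K.k
      open 𝔹 using (_+_; _*_; -_; _^_; ∑; 0#; 1#)

      -- With Y = X² t the curve equation becomes X^(2 + d − e) φ(t) = 0.
      L S g : K.PS → K.PS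
      L s = 1# + K.C κ * (K.X * s)
      S s = K.C x₀ + s
      g s = ∑ (suc d) (λ i → ∑ (suc (d ∸ i)) (λ j → K.C (a i j) * (K.X ^ (e ∸ j) * (S s ^ i * L s ^ j)))) + K.C (K.- c₀) * K.X ^ e

      φ : K.PS → K.PS
      φ t = K.X ^ (e ∸ 3) * L (K.X * t) ^ 2 + t * g (K.X * t)

      -- Here `u = X t` and `v` has a simple pole, so `v^2` has order `-2` and `u v^e` has order at
      -- least `1 - e`. After multiplication by `X^(d + 1)` the factor `X^(2 + d - e)` is common to
      -- both precisely because `e ≥ 3`.
      curve-value : ∀ t → OnSeries.⟦_⟧ (K.X * (K.X * t)) body 𝔹.≈ K.X ^ (2 ℕ.+ (d ∸ e)) * φ t
      curve-value t = 𝔹.begin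
        ⟦ body ⟧ 𝔹.≈⟨ 𝔹.+-congˡ (𝔹.trans (𝔹.solve 3 (λ x t z → x 𝔹.:* (x 𝔹.:* t) 𝔹.:* z 𝔹.:= t 𝔹.:* ((x 𝔹.:* x) 𝔹.:* z)) 𝔹.refl x t _) (𝔹.*-congˡ inner)) ⟩
        L s ^ 2 * x ^ (d ∸ 1) + t * (x ^ (2 ℕ.+ (d ∸ e)) * g s)
          𝔹.≈⟨ 𝔹.+-congʳ (𝔹.trans (𝔹.*-comm _ _) (𝔹.*-congʳ (𝔹.trans (𝔹.reflexive (≡.cong (x ^_) (≡.sym first-exponent))) (𝔹.^-homo-* x (2 ℕ.+ (d ∸ e)) (e ∸ 3))))) ⟩
        x ^ (2 ℕ.+ (d ∸ e)) * x ^ (e ∸ 3) * L s ^ 2 + t * (x ^ (2 ℕ.+ (d ∸ e)) * g s)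
          𝔹.≈⟨ 𝔹.solve 5 (λ p q l t g → p 𝔹.:* q 𝔹.:* l 𝔹.:+ t 𝔹.:* (p 𝔹.:* g) 𝔹.:= p 𝔹.:* (q 𝔹.:* l 𝔹.:+ t 𝔹.:* g)) 𝔹.refl (x ^ (2 ℕ.+ (d ∸ e))) (x ^ (e ∸ 3)) (L s ^ 2) t (g s) ⟩
        x ^ (2 ℕ.+ (d ∸ e)) * φ t 𝔹.∎
        where
        x = K.X
        s = x * t
        open OnSeries (x * (x * t)) using (⟦_⟧)
        open Value K.series K.C x (x * (x * t))
        first-exponent : 2 ℕ.+ (d ∸ e) ℕ.+ (e ∸ 3) ≡ d ∸ 1
        first-exponent = ℕₚ.suc-injective (≡.trans (ℕ-solve 2 (λ u v → # 1 ⊞ (# 2 ⊞ u ⊞ v) ≐ u ⊞ (# 3 ⊞ v)) ≡.refl (d ∸ e) (e ∸ 3))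
          (≡.trans (≡.cong (d ∸ e ℕ.+_) (ℕₚ.m+[n∸m]≡n 3≤e)) (≡.trans (ℕₚ.m∸n+n≡m e≤d) (≡.sym (ℕₚ.m+[n∸m]≡n 1≤d)))))
          where open +-*-Solver using () renaming (solve to ℕ-solve; _:=_ to _≐_; _:+_ to _⊞_; con to #)
        abscissa-value : ⟦ abscissa ⟧ 𝔹.≈ x * S s
        abscissa-value = 𝔹.solve 3 (λ c x s → c 𝔹.:* x 𝔹.:+ x 𝔹.:* s 𝔹.:= x 𝔹.:* (c 𝔹.:+ s)) 𝔹.refl (K.C x₀) x s
        exponent : ∀ i j → i ℕ.≤ d → j ℕ.≤ d ∸ i → j ℕ.≤ e → 2 ℕ.+ (i ℕ.+ (d ∸ i ∸ j)) ≡ 2 ℕ.+ (d ∸ e) ℕ.+ (e ∸ j)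
        exponent i j i≤d j≤ j≤e = ℕₚ.+-cancelʳ-≡ j _ _ (≡.trans
          (ℕ-solve 3 (λ i r j → # 2 ⊞ (i ⊞ r) ⊞ j ≐ # 2 ⊞ (i ⊞ (j ⊞ r))) ≡.refl i (d ∸ i ∸ j) j)
          (≡.trans (≡.cong (2 ℕ.+_) (in-range i j i≤d j≤)) (≡.sym (≡.trans (ℕₚ.+-assoc (2 ℕ.+ (d ∸ e)) (e ∸ j) j)
            (≡.trans (≡.cong (2 ℕ.+ (d ∸ e) ℕ.+_) (ℕₚ.m∸n+n≡m j≤e)) (≡.cong (2 ℕ.+_) (ℕₚ.m∸n+n≡m e≤d)))))))
          where open +-*-Solver using () renaming (solve to ℕ-solve; _:=_ to _≐_; _:+_ to _⊞_; con to #)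
        monomial-value : ∀ i j → i ℕ.≤ d → j ℕ.≤ d ∸ i →
          (x * x) * ⟦ monomial i j ⟧ 𝔹.≈ x ^ (2 ℕ.+ (d ∸ e)) * (K.C (a i j) * (x ^ (e ∸ j) * (S s ^ i * L s ^ j)))
        monomial-value i j i≤d j≤ with j ℕ.≤? e
        ... | no nl = let z = 𝔹.trans (K.C-cong (a-Y i j (ℕₚ.≰⇒> nl))) K.C-0 in
          𝔹.trans (𝔹.zero-mulʳ (𝔹.zero-mulˡ z)) (𝔹.sym (𝔹.zero-mulʳ (𝔹.zero-mulˡ z)))
        ... | yes j≤e = 𝔹.begin
          (x * x) * (K.C (a i j) * (⟦ abscissa ⟧ ^ i * (L s ^ j * x ^ r)))
            𝔹.≈⟨ 𝔹.*-congˡ (𝔹.*-congˡ (𝔹.*-congʳ (𝔹.trans (𝔹.^-congˡ i abscissa-value) (𝔹.^-distrib-* x (S s) i)))) ⟩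
          (x * x) * (K.C (a i j) * (x ^ i * S s ^ i * (L s ^ j * x ^ r)))
            𝔹.≈⟨ 𝔹.solve 6 (λ x c p s l q → (x 𝔹.:* x) 𝔹.:* (c 𝔹.:* (p 𝔹.:* s 𝔹.:* (l 𝔹.:* q))) 𝔹.:= x 𝔹.:* (x 𝔹.:* (p 𝔹.:* q)) 𝔹.:* (c 𝔹.:* (s 𝔹.:* l))) 𝔹.refl x (K.C (a i j)) (x ^ i) (S s ^ i) (L s ^ j) (x ^ r) ⟩
          x * (x * (x ^ i * x ^ r)) * (K.C (a i j) * (S s ^ i * L s ^ j))
            𝔹.≈⟨ 𝔹.*-congʳ (𝔹.trans (𝔹.*-congˡ (𝔹.*-congˡ (𝔹.sym (𝔹.^-homo-* x i r)))) (𝔹.trans (𝔹.reflexive (≡.cong (x ^_) (exponent i j i≤d j≤ j≤e))) (𝔹.^-homo-* x (2 ℕ.+ (d ∸ e)) (e ∸ j)))) ⟩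
          x ^ (2 ℕ.+ (d ∸ e)) * x ^ (e ∸ j) * (K.C (a i j) * (S s ^ i * L s ^ j))
            𝔹.≈⟨ 𝔹.solve 5 (λ p q c s l → p 𝔹.:* q 𝔹.:* (c 𝔹.:* (s 𝔹.:* l)) 𝔹.:= p 𝔹.:* (c 𝔹.:* (q 𝔹.:* (s 𝔹.:* l)))) 𝔹.refl (x ^ (2 ℕ.+ (d ∸ e))) (x ^ (e ∸ j)) (K.C (a i j)) (S s ^ i) (L s ^ j) ⟩
          x ^ (2 ℕ.+ (d ∸ e)) * (K.C (a i j) * (x ^ (e ∸ j) * (S s ^ i * L s ^ j))) 𝔹.∎
          where r = d ∸ i ∸ j
        constant-exponent : 2 ℕ.+ (d ∸ e) ℕ.+ e ≡ 2 ℕ.+ d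
        constant-exponent = ≡.cong (2 ℕ.+_) (ℕₚ.m∸n+n≡m e≤d)
        inner : (x * x) * ⟦ sum (suc d) (λ i → sum (suc (d ∸ i)) (term i)) ⟨+⟩ con (K.- c₀) ⟨*⟩ X ⟨^⟩ d ⟧ 𝔹.≈ x ^ (2 ℕ.+ (d ∸ e)) * g s
        inner = 𝔹.begin
          (x * x) * (⟦ sum (suc d) (λ i → sum (suc (d ∸ i)) (term i)) ⟧ + K.C (K.- c₀) * x ^ d)
            𝔹.≈⟨ 𝔹.trans (𝔹.distribˡ _ _ _) (𝔹.+-cong (𝔹.trans (𝔹.*-congˡ (value-sum (λ i j → ⟦ monomial i j ⟧) (λ i j _ _ → 𝔹.refl))) (𝔹.sym (pull (x * x) (λ i j → ⟦ monomial i j ⟧)))) tail) ⟩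
          ∑ (suc d) (λ i → ∑ (suc (d ∸ i)) (λ j → (x * x) * ⟦ monomial i j ⟧)) + x ^ (2 ℕ.+ (d ∸ e)) * (K.C (K.- c₀) * x ^ e)
            𝔹.≈⟨ 𝔹.+-congʳ (𝔹.trans (𝔹.∑-cong (suc d) (λ { i (s≤s i≤d) → 𝔹.∑-cong (suc (d ∸ i)) (λ { j (s≤s j≤) → monomial-value i j i≤d j≤ }) })) (pull (x ^ (2 ℕ.+ (d ∸ e))) G)) ⟩
          x ^ (2 ℕ.+ (d ∸ e)) * ∑ (suc d) (λ i → ∑ (suc (d ∸ i)) (G i)) + x ^ (2 ℕ.+ (d ∸ e)) * (K.C (K.- c₀) * x ^ e) 𝔹.≈⟨ 𝔹.distribˡ _ _ _ ⟨
          x ^ (2 ℕ.+ (d ∸ e)) * g s 𝔹.∎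
          where
          G : ℕ → ℕ → K.PS
          G i j = K.C (a i j) * (x ^ (e ∸ j) * (S s ^ i * L s ^ j))
          tail : (x * x) * (K.C (K.- c₀) * x ^ d) 𝔹.≈ x ^ (2 ℕ.+ (d ∸ e)) * (K.C (K.- c₀) * x ^ e)
          tail = 𝔹.begin
            (x * x) * (K.C (K.- c₀) * x ^ d) 𝔹.≈⟨ 𝔹.solve 3 (λ x c p → (x 𝔹.:* x) 𝔹.:* (c 𝔹.:* p) 𝔹.:= c 𝔹.:* (x 𝔹.:* (x 𝔹.:* p))) 𝔹.refl x (K.C (K.- c₀)) (x ^ d) ⟩
            K.C (K.- c₀) * x ^ (2 ℕ.+ d) 𝔹.≈⟨ 𝔹.*-congˡ (𝔹.trans (𝔹.reflexive (≡.cong (x ^_) (≡.sym constant-exponent))) (𝔹.^-homo-* x (2 ℕ.+ (d ∸ e)) e)) ⟩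
            K.C (K.- c₀) * (x ^ (2 ℕ.+ (d ∸ e)) * x ^ e) 𝔹.≈⟨ 𝔹.solve 3 (λ c p q → c 𝔹.:* (p 𝔹.:* q) 𝔹.:= p 𝔹.:* (c 𝔹.:* q)) 𝔹.refl (K.C (K.- c₀)) (x ^ (2 ℕ.+ (d ∸ e))) (x ^ e) ⟩
            x ^ (2 ℕ.+ (d ∸ e)) * (K.C (K.- c₀) * x ^ e) 𝔹.∎

      ^-at-0 : ∀ (u : K.PS) m → (u ^ m) 0 K.≈ u 0 K.^ m
      ^-at-0 u zero = K.refl
      ^-at-0 u (suc m) = K.*-congˡ (^-at-0 u m)

      ∑-at-0 : ∀ m (u : ℕ → K.PS) → ∑ m u 0 ≡ K.∑ m (λ i → u i 0)
      ∑-at-0 zero u = ≡.refl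
      ∑-at-0 (suc m) u = ≡.cong (u 0 0 K.+_) (∑-at-0 m (u ∘ suc))

      -- Terms with `j < e` carry a positive power of `X`; what is left is the coefficient of `Y^e`
      -- in `f`, taken at `x₀`.
      g-at-0 : ∀ s → s 0 K.≈ K.0# → g s 0 K.≈ α
      g-at-0 s s0 = K.trans (K.+-cong sums (K.zero-mulʳ (K.trans (^-at-0 K.X e) (K.0^ e (ℕₚ.≤-trans (s≤s z≤n) 3≤e))))) (K.+-identityʳ _)
        where
        unit : ∀ j i → j ℕ.≤ e → (K.X ^ (e ∸ j) * (S s ^ i * L s ^ j)) 0 K.≈ K.0# K.^ (e ∸ j) K.* x₀ K.^ i
        unit j i j≤e = K.*-cong (^-at-0 K.X (e ∸ j)) (K.trans (K.*-cong
          (K.trans (^-at-0 (S s) i) (K.^-congˡ i (K.trans (K.+-congˡ s0) (K.+-identityʳ x₀))))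
          (K.trans (^-at-0 (L s) j) (K.trans (K.^-congˡ j (K.trans (K.+-congˡ (K.zero-mulʳ (K.zeroˡ (s 0)))) (K.+-identityʳ K.1#))) (K.1^ j)))) (K.*-identityʳ _))
        value : ∀ i j → K.C (a i j) 0 K.* (K.X ^ (e ∸ j) * (S s ^ i * L s ^ j)) 0 K.≈ a i j K.* (K.0# K.^ (e ∸ j) K.* x₀ K.^ i)
        value i j with j ℕ.≤? e
        ... | yes j≤e = K.*-congˡ (unit j i j≤e)
        ... | no nl = let z = a-Y i j (ℕₚ.≰⇒> nl) in K.trans (K.zero-mulˡ z) (K.sym (K.zero-mulˡ z))
        off : ∀ i j → j ≢ e → a i j K.* (K.0# K.^ (e ∸ j) K.* x₀ K.^ i) K.≈ K.0#
        off i j ne with j ℕ.≤? e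
        ... | yes j≤e = K.zero-mulʳ (K.zero-mulˡ (K.0^ (e ∸ j) (ℕₚ.m<n⇒0<n∸m (ℕₚ.≤∧≢⇒< j≤e ne))))
        ... | no nl = K.zero-mulˡ (a-Y i j (ℕₚ.≰⇒> nl))
        row : ∀ i → i ℕ.≤ d → K.∑ (suc (d ∸ i)) (λ j → a i j K.* (K.0# K.^ (e ∸ j) K.* x₀ K.^ i)) K.≈ a i e K.* x₀ K.^ i
        row i i≤d with e ℕ.≤? d ∸ i
        ... | yes le = K.trans (K.∑-single (suc (d ∸ i)) e {λ j → a i j K.* (K.0# K.^ (e ∸ j) K.* x₀ K.^ i)} (s≤s le) (λ j _ → off i j))
          (K.*-congˡ (K.trans (K.*-congʳ (K.reflexive (≡.cong (K.0# K.^_) (ℕₚ.n∸n≡0 e)))) (K.*-identityˡ _)))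
        ... | no nl = K.trans (K.∑-zero (suc (d ∸ i)) {λ j → a i j K.* (K.0# K.^ (e ∸ j) K.* x₀ K.^ i)}
            (λ { j (s≤s l) → off i j (λ eq → nl (≡.subst (ℕ._≤ d ∸ i) eq l)) }))
          (K.sym (K.zero-mulˡ (a-degree i e (≡.subst (ℕ._< i ℕ.+ e) (ℕₚ.m+[n∸m]≡n i≤d) (ℕₚ.+-monoʳ-< i (ℕₚ.≰⇒> nl))))))
        sums : ∑ (suc d) (λ i → ∑ (suc (d ∸ i)) (λ j → K.C (a i j) * (K.X ^ (e ∸ j) * (S s ^ i * L s ^ j)))) 0 K.≈ α
        sums = K.trans (K.reflexive (∑-at-0 (suc d) (λ i → ∑ (suc (d ∸ i)) (λ j → K.C (a i j) * (K.X ^ (e ∸ j) * (S s ^ i * L s ^ j)))))) (K.∑-cong (suc d) (λ { i (s≤s i≤d) →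
          K.trans (K.reflexive (∑-at-0 (suc (d ∸ i)) (λ j → K.C (a i j) * (K.X ^ (e ∸ j) * (S s ^ i * L s ^ j)))))
            (K.trans (K.∑-cong (suc (d ∸ i)) (λ j _ → value i j)) (row i i≤d)) }))

      -- congruence modulo X^m
      module _ (m : ℕ) where
        infix 4 _∼_
        _∼_ : K.PS → K.PS → Set
        u ∼ v = K.Ord m (u + - v)

        ∼-refl : ∀ {u} → u ∼ u
        ∼-refl {u} i _ = K.-‿inverseʳ (u i)

        ∼-+ : ∀ {u u′ v v′} → u ∼ u′ → v ∼ v′ → (u + v) ∼ (u′ + v′)
        ∼-+ {u} {u′} {v} {v′} p r = Ord-cong (𝔹.solve 4 (λ u u′ v v′ → (u 𝔹.:- u′) 𝔹.:+ (v 𝔹.:- v′) 𝔹.:= (u 𝔹.:+ v) 𝔹.:- (u′ 𝔹.:+ v′)) 𝔹.refl u u′ v v′)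
          (Ord-+ {f = u + - u′} p r)

        ∼-* : ∀ {u u′ v v′} → u ∼ u′ → v ∼ v′ → (u * v) ∼ (u′ * v′)
        ∼-* {u} {u′} {v} {v′} p r = Ord-cong (𝔹.solve 4 (λ u u′ v v′ → (u 𝔹.:- u′) 𝔹.:* v 𝔹.:+ (v 𝔹.:- v′) 𝔹.:* u′ 𝔹.:= u 𝔹.:* v 𝔹.:- u′ 𝔹.:* v′) 𝔹.refl u u′ v v′)
          (Ord-+ {f = (u + - u′) * v} (Ord-*ʳ {f = u + - u′} v p) (Ord-*ʳ {f = v + - v′} u′ r))

        ∼-^ : ∀ i {u u′} → u ∼ u′ → (u ^ i) ∼ (u′ ^ i)
        ∼-^ zero p = ∼-refl {1#}
        ∼-^ (suc i) {u} {u′} p = ∼-* {u} {u′} {u ^ i} {u′ ^ i} p (∼-^ i {u} {u′} p)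

        ∼-∑ : ∀ N {u u′ : ℕ → K.PS} → (∀ i → u i ∼ u′ i) → ∑ N u ∼ ∑ N u′
        ∼-∑ zero p = ∼-refl {0#}
        ∼-∑ (suc N) {u} {u′} p = ∼-+ {u 0} {u′ 0} {∑ N (u ∘ suc)} {∑ N (u′ ∘ suc)} (p 0) (∼-∑ N (p ∘ suc))

        ∼-L : ∀ {s s′} → s ∼ s′ → L s ∼ L s′
        ∼-L {s} {s′} p = ∼-+ {1#} {1#} {K.C κ * (K.X * s)} {K.C κ * (K.X * s′)} (∼-refl {1#})
          (∼-* {K.C κ} {K.C κ} {K.X * s} {K.X * s′} (∼-refl {K.C κ}) (∼-* {K.X} {K.X} {s} {s′} (∼-refl {K.X}) p))

        ∼-g : ∀ {s s′} → s ∼ s′ → g s ∼ g s′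
        ∼-g {s} {s′} p = ∼-+ {double s} {double s′} {c} {c} (∼-∑ (suc d) {row s} {row s′} λ i → ∼-∑ (suc (d ∸ i)) {entry s i} {entry s′ i} λ j →
            ∼-* {K.C (a i j)} {K.C (a i j)} {K.X ^ (e ∸ j) * (S s ^ i * L s ^ j)} {K.X ^ (e ∸ j) * (S s′ ^ i * L s′ ^ j)} (∼-refl {K.C (a i j)})
              (∼-* {K.X ^ (e ∸ j)} {K.X ^ (e ∸ j)} {S s ^ i * L s ^ j} {S s′ ^ i * L s′ ^ j} (∼-refl {K.X ^ (e ∸ j)})
                (∼-* {S s ^ i} {S s′ ^ i} {L s ^ j} {L s′ ^ j} (∼-^ i {S s} {S s′} (∼-+ {K.C x₀} {K.C x₀} {s} {s′} (∼-refl {K.C x₀}) p)) (∼-^ j {L s} {L s′} (∼-L {s} {s′} p)))))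
          (∼-refl {c})
          where
          c = K.C (K.- c₀) * K.X ^ e
          entry : K.PS → ℕ → ℕ → K.PS
          entry s i j = K.C (a i j) * (K.X ^ (e ∸ j) * (S s ^ i * L s ^ j))
          row : K.PS → ℕ → K.PS
          row s i = ∑ (suc (d ∸ i)) (entry s i)
          double : K.PS → K.PS
          double s = ∑ (suc d) (row s)

      αi : K.Carrier
      αi = proj₁ (K.inv α α≉0)

      -- A Newton step with fixed slope: modulo `X` the map `φ` is affine in `t` with slope `α`.
      Ψ : K.PS → K.PS
      Ψ t = t + - (K.C αi * φ t)

      Ord-X : K.Ord 1 K.X
      Ord-X zero _ = K.refl
      Ord-X (suc i) (s≤s ())

      -- The unknown enters `L` and `g` only through `X t`, which gains one order; the explicit
      -- factor `t` is corrected by `1 - g / α`, which has order at least one.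
      contract : ∀ m t t′ → K.Ord m (t + - t′) → K.Ord (suc m) (Ψ t + - Ψ t′)
      contract m t t′ o = Ord-cong (𝔹.sym decomposition)
        (Ord-+ {f = (t + - t′) * (1# + - (K.C αi * g s′))}
          (≡.subst (λ r → K.Ord r ((t + - t′) * (1# + - (K.C αi * g s′)))) (ℕₚ.+-comm m 1) (Ord-* {m} {1} {t + - t′} o unit))
          (Ord-neg {f = (q * (ℓ + - ℓ′) + (g s + - g s′) * t) * K.C αi}
            (Ord-*ʳ {f = q * (ℓ + - ℓ′) + (g s + - g s′) * t} (K.C αi)
              (Ord-+ {f = q * (ℓ + - ℓ′)} (Ord-cong (𝔹.*-comm (ℓ + - ℓ′) q) (Ord-*ʳ {f = ℓ + - ℓ′} q (∼-^ (suc m) 2 {L s} {L s′} (∼-L (suc m) {s} {s′} close))))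
                (Ord-*ʳ {f = g s + - g s′} t (∼-g (suc m) {s} {s′} close))))))
        where
        s = K.X * t
        s′ = K.X * t′
        q = K.X ^ (e ∸ 3)
        ℓ = L s ^ 2
        ℓ′ = L s′ ^ 2
        close : K.Ord (suc m) (s + - s′)
        close = Ord-cong (𝔹.solve 3 (λ x t u → x 𝔹.:* (t 𝔹.:- u) 𝔹.:= x 𝔹.:* t 𝔹.:- x 𝔹.:* u) 𝔹.refl K.X t t′) (Ord-* {1} {m} {K.X} {t + - t′} Ord-X o)
        unit : K.Ord 1 (1# + - (K.C αi * g s′))
        unit zero _ = K.trans (K.+-congˡ (K.-‿cong (K.trans (K.*-congˡ (g-at-0 s′ (K.zeroˡ (t′ 0)))) (K.trans (K.*-comm _ _) (proj₂ (K.inv α α≉0)))))) (K.-‿inverseʳ K.1#)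
        unit (suc i) (s≤s ())
        decomposition : (Ψ t + - Ψ t′) 𝔹.≈ ((t + - t′) * (1# + - (K.C αi * g s′)) + - ((q * (ℓ + - ℓ′) + (g s + - g s′) * t) * K.C αi))
        decomposition = 𝔹.solve 8 (λ t t′ c q ℓ ℓ′ G G′ →
          (t 𝔹.:- c 𝔹.:* (q 𝔹.:* ℓ 𝔹.:+ t 𝔹.:* G)) 𝔹.:- (t′ 𝔹.:- c 𝔹.:* (q 𝔹.:* ℓ′ 𝔹.:+ t′ 𝔹.:* G′))
          𝔹.:= (t 𝔹.:- t′) 𝔹.:* (𝔹.con (1 , 0) 𝔹.:- c 𝔹.:* G′) 𝔹.:- (q 𝔹.:* (ℓ 𝔹.:- ℓ′) 𝔹.:+ (G 𝔹.:- G′) 𝔹.:* t) 𝔹.:* c)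
          𝔹.refl t t′ (K.C αi) q ℓ ℓ′ (g s) (g s′)

      t* : K.PS
      t* = fixpoint Ψ contract

      Ψt*≈t* : Ψ t* 𝔹.≈ t*
      Ψt*≈t* = is-fixpoint Ψ contract

      φ-from-Ψ : ∀ t → φ t 𝔹.≈ K.C α * (t + - Ψ t)
      φ-from-Ψ t = 𝔹.sym (𝔹.begin
        K.C α * (t + - (t + - (K.C αi * φ t))) 𝔹.≈⟨ 𝔹.solve 4 (λ a t i p → a 𝔹.:* (t 𝔹.:- (t 𝔹.:- i 𝔹.:* p)) 𝔹.:= (a 𝔹.:* i) 𝔹.:* p) 𝔹.refl (K.C α) t (K.C αi) (φ t) ⟩
        K.C α * K.C αi * φ t 𝔹.≈⟨ 𝔹.*-congʳ (𝔹.trans (𝔹.sym (K.C-* α αi)) (K.C-cong (proj₂ (K.inv α α≉0)))) ⟩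
        1# * φ t 𝔹.≈⟨ 𝔹.*-identityˡ _ ⟩
        φ t 𝔹.∎)

      branch : K.PS
      branch = K.X * (K.X * t*)

      curve-on : ∀ t → 𝕃.ev (suc d) (poly curve) (K.X * (K.X * t)) 𝔹.≈ K.C (proj₁ (K.inv lead λ≉0)) * (K.X ^ (2 ℕ.+ (d ∸ e)) * φ t)
      curve-on t = 𝔹.trans (ev-poly (K.X * (K.X * t)) curve) (𝔹.*-congˡ (curve-value t))

      branch-root : 𝕃.ev (suc d) (poly curve) branch 𝔹.≈ 0#
      branch-root = 𝔹.trans (curve-on t*) (𝔹.zero-mulʳ (𝔹.zero-mulʳ (𝔹.trans (φ-from-Ψ t*)
        (𝔹.zero-mulʳ (𝔹.trans (𝔹.+-congˡ (𝔹.-‿cong Ψt*≈t*)) (𝔹.-‿inverseʳ t*))))))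

      -- Perturbing the root by `z` gives the curve a value of order exactly `2 + (d - e) + d`,
      -- which is below the order `2 (d + 2)` of `z^2`.
      z t⁺ : K.PS
      z = K.X ^ (2 ℕ.+ d)
      t⁺ = t* + K.X ^ d

      shifted : branch + z 𝔹.≈ K.X * (K.X * t⁺)
      shifted = 𝔹.solve 3 (λ x t p → x 𝔹.:* (x 𝔹.:* t) 𝔹.:+ x 𝔹.:* (x 𝔹.:* p) 𝔹.:= x 𝔹.:* (x 𝔹.:* (t 𝔹.:+ p))) 𝔹.refl K.X t* (K.X ^ d)

      φ-order : φ t⁺ d K.≈ α
      φ-order = K.begin
        φ t⁺ d K.≈⟨ at (φ-from-Ψ t⁺) d ⟩
        (K.C α * (t⁺ + - Ψ t⁺)) d K.≈⟨ K.C-conv α (t⁺ + - Ψ t⁺) d ⟩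
        α K.* (t⁺ + - Ψ t⁺) d K.≈⟨ K.*-congˡ (at split d) ⟩
        α K.* ((K.X ^ d) d K.+ K.- (Ψ t⁺ + - Ψ t*) d)
          K.≈⟨ K.*-congˡ (K.+-cong (K.X^-top d) (K.trans (K.-‿cong (contract d t⁺ t* near d (ℕₚ.n<1+n d))) K.-0#≈0#)) ⟩
        α K.* (K.1# K.+ K.0#) K.≈⟨ K.trans (K.*-congˡ (K.+-identityʳ K.1#)) (K.*-identityʳ α) ⟩
        α K.∎
        where
        near : K.Ord d (t⁺ + - t*)
        near = Ord-cong (𝔹.solve 2 (λ t p → p 𝔹.:= (t 𝔹.:+ p) 𝔹.:- t) 𝔹.refl t* (K.X ^ d))
          (λ i l → K.trans (at (𝔹.sym (𝔹.*-identityʳ (K.X ^ d))) i) (K.X^*-low d 1# i l))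
        split : (t⁺ + - Ψ t⁺) 𝔹.≈ (K.X ^ d + - (Ψ t⁺ + - Ψ t*))
        split = 𝔹.trans (𝔹.solve 3 (λ t p u → (t 𝔹.:+ p) 𝔹.:- u 𝔹.:= p 𝔹.:- (u 𝔹.:- t)) 𝔹.refl t* (K.X ^ d) (Ψ t⁺))
          (𝔹.+-congˡ (𝔹.-‿cong (𝔹.+-congˡ (𝔹.-‿cong (𝔹.sym Ψt*≈t*)))))

      simple-root : ∀ r → ¬ (𝕃.ev (suc d) (poly curve) (branch + z) 𝔹.≈ z * z * r)
      simple-root r eq = K.*-≉0 (λ i0 → K.1≉0 (K.trans (K.sym (proj₂ (K.inv lead λ≉0))) (K.zero-mulʳ i0))) α≉0 (K.begin
        ci K.* α K.≈⟨ K.*-congˡ (K.trans (K.X^*-high (2 ℕ.+ (d ∸ e)) (φ t⁺) d) φ-order) ⟨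
        ci K.* (K.X ^ (2 ℕ.+ (d ∸ e)) * φ t⁺) N K.≈⟨ K.C-conv ci (K.X ^ (2 ℕ.+ (d ∸ e)) * φ t⁺) N ⟨
        (K.C ci * (K.X ^ (2 ℕ.+ (d ∸ e)) * φ t⁺)) N K.≈⟨ at (𝔹.trans (𝕃.ev-cong (suc d) (𝕃R.refl {poly curve}) shifted) (curve-on t⁺)) N ⟨
        𝕃.ev (suc d) (poly curve) (branch + z) N K.≈⟨ at eq N ⟩
        (z * z * r) N K.≈⟨ at (𝔹.trans (𝔹.*-congʳ (𝔹.sym (𝔹.^-homo-* K.X (2 ℕ.+ d) (2 ℕ.+ d)))) 𝔹.refl) N ⟩
        (K.X ^ (2 ℕ.+ d ℕ.+ (2 ℕ.+ d)) * r) N K.≈⟨ K.X^*-low (2 ℕ.+ d ℕ.+ (2 ℕ.+ d)) r N N< ⟩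
        K.0# K.∎)
        where
        ci = proj₁ (K.inv lead λ≉0)
        N = 2 ℕ.+ (d ∸ e) ℕ.+ d
        N< : N ℕ.< 2 ℕ.+ d ℕ.+ (2 ℕ.+ d)
        N< = ℕₚ.+-mono-≤-< (ℕₚ.+-monoʳ-≤ 2 (ℕₚ.m∸n≤m d e)) (ℕₚ.m<n+m d {2} (s≤s z≤n))

      contradiction : ⊥
      contradiction = Component.contradiction F pr h size≡ (suc d) (poly curve) (total-degree curve) branch
        (𝔹.trans (leading curve) (K.C-cong top-curve)) branch-root z simple-root no-zero large

    -- Suitable `κ` and `x₀` exist because each only has to avoid the zeros of a nonzero polynomial
    -- of degree at most `d < q`.
    impossible : (Σ ℕ λ i → Σ ℕ λ j → i ℕ.+ j ≡ d × ¬ (a i j K.≈ K.0#)) → (Σ ℕ λ i → ¬ (a i e K.≈ K.0#)) → ⊥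
    impossible (i₁ , j₁ , i+j≡d , top≉0) (i₂ , e≉0) = top≉0 (K.trans (K.reflexive (≡.cong (λ r → a r j₁) i₁≡))
        (K.at (K.vanishing d P d<size degP (λ κ → K.≈-stable λ κ≉0 → e≉0 (K.at (K.vanishing d Q d<size degQ
          (λ x₀ → K.≈-stable λ x₀≉0 → Slice.contradiction κ x₀ (λ z → κ≉0 (K.trans (top-sum κ) z)) (λ z → x₀≉0 (K.trans (K.ev-∑ d Q x₀) z)))) i₂))) j₁))
      where
      d<size : d ℕ.< K.size
      d<size = ℕₚ.≤-trans (ℕₚ.≤-trans (ℕₚ.≤-reflexive (≡.sym (ℕₚ.*-identityˡ (suc d))))
        (ℕₚ.≤-trans (ℕₚ.*-monoˡ-≤ (suc d) {1} {10 ℕ.* (suc d ℕ.* suc d ℕ.* suc d)} (s≤s z≤n)) (ℕₚ.≤-reflexive (ℕₚ.*-assoc 10 (suc d ℕ.* suc d ℕ.* suc d) (suc d))))) large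
      P Q : K.PS
      P j = a (d ∸ j) j
      Q i = a i e
      i₁≡ : i₁ ≡ d ∸ j₁
      i₁≡ = ≡.trans (≡.sym (ℕₚ.m+n∸n≡m i₁ j₁)) (≡.cong (_∸ j₁) i+j≡d)
      degP : K.Deg d P
      degP j l = a-degree (d ∸ j) j (ℕₚ.<-≤-trans l (ℕₚ.m≤n+m j (d ∸ j)))
      degQ : K.Deg d Q
      degQ i l = a-degree i e (ℕₚ.<-≤-trans l (ℕₚ.m≤m+n i e))
      top-sum : ∀ κ → K.ev d P κ K.≈ K.∑ (suc d) (λ i → a i (d ∸ i) K.* κ K.^ (d ∸ i))
      top-sum κ = K.trans (K.ev-∑ d P κ) (K.trans (∑-reverse K.k d (λ j → P j K.* κ K.^ j))
        (K.∑-cong (suc d) {λ i → P (d ∸ i) K.* κ K.^ (d ∸ i)} (λ { i (s≤s i≤d) → K.*-congʳ {κ K.^ (d ∸ i)} (K.reflexive (≡.cong (λ r → a r (d ∸ i)) (ℕₚ.m∸[m∸n]≡n i≤d))) })))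

-- Degree at most two in `Y`.

module Quadratic (F : FiniteField) (2<size : 2 ℕ.< FiniteField.size F) (A B C : FiniteField.Carrier F → FiniteField.Carrier F) where
  open Field F hiding (C)

  two : Carrier
  two = 1# + 1#

  module _ (sqrt : two ≈ 0# → ∀ w → Σ Carrier λ y → y * y ≈ w)
    (ovoid : ∀ x y u v → ¬ (u ≈ 0# × v ≈ 0#) →
      ¬ (v * v + u * ((A (x + u) + B (x + u) * (y + v) + C (x + u) * ((y + v) * (y + v))) + - (A x + B x * y + C x * (y * y))) ≈ 0#)) where

    -- The condition for the points (x , y) and (x + u , b), as a quadratic equation for y.
    no-root : ∀ x u b y → ¬ (u ≈ 0#) →
      ¬ ((1# + - (u * C x)) * (y * y) + - (two * b + u * B x) * y + (b * b + u * (A (x + u) + B (x + u) * b + C (x + u) * (b * b) + - A x)) ≈ 0#)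
    no-root x u b y u≉0 e = ovoid x y u (b + - y) (u≉0 ∘ proj₁) (trans
      (+-congˡ (*-congˡ (+-congʳ (+-cong (+-congˡ (*-congˡ back)) (*-congˡ (*-cong back back))))))
      (trans (solve 9 (λ u b y a′ b′ c′ a β γ →
        (b :- y) :* (b :- y) :+ u :* ((a′ :+ b′ :* b :+ c′ :* (b :* b)) :- (a :+ β :* y :+ γ :* (y :* y)))
        := (con (1 , 0) :- u :* γ) :* (y :* y) :+ (:- ((con (1 , 0) :+ con (1 , 0)) :* b :+ u :* β)) :* y
           :+ (b :* b :+ u :* (a′ :+ b′ :* b :+ c′ :* (b :* b) :- a))) refl u b y (A (x + u)) (B (x + u)) (C (x + u)) (A x) (B x) (C x)) e))
      where
      back : y + (b + - y) ≈ b
      back = solve 2 (λ y b → y :+ (b :- y) := b) refl y b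

    -- For `u = 1 / C x` the quadratic term disappears, and a linear equation with nonzero slope has
    -- a root.
    linear : ∀ x b (nC : ¬ (C x ≈ 0#)) → ¬ (two * b + proj₁ (inv (C x) nC) * B x ≈ 0#) → ⊥
    linear x b nC nm = no-root x u b y u≉0 (trans (+-congʳ (zero-sumˡ (*-congʳ (trans (+-congˡ (-‿cong (trans (*-comm u (C x)) (proj₂ (inv (C x) nC))))) (-‿inverseʳ 1#)))))
        (trans (solve 3 (λ m κ i → con (0 , 0) :* con (0 , 0) :+ (:- m) :* (κ :* i) :+ κ := κ :- (m :* i) :* κ) refl m κ (proj₁ mi))
          (trans (+-congˡ (-‿cong (trans (*-congʳ (proj₂ mi)) (*-identityˡ κ)))) (-‿inverseʳ κ))))
      where
      u = proj₁ (inv (C x) nC)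
      m = two * b + u * B x
      mi = inv m nm
      κ = b * b + u * (A (x + u) + B (x + u) * b + C (x + u) * (b * b) + - A x)
      y = κ * proj₁ mi
      u≉0 : ¬ (u ≈ 0#)
      u≉0 z = 1≉0 (trans (sym (proj₂ (inv (C x) nC))) (zero-mulʳ z))
      zero-sumˡ : ∀ {s t} → s * (y * y) ≈ 0# * t → s * (y * y) + - m * y ≈ 0# * 0# + - m * y
      zero-sumˡ e = +-congʳ (trans e (trans (zeroˡ _) (sym (zeroˡ 0#))))

    -- With `b = 0` and `B x = 0` the linear term is gone, and square roots exist in characteristic
    -- two.
    purely-quadratic : ∀ x u → two ≈ 0# → B x ≈ 0# → ¬ (u ≈ 0#) → ¬ (1# + - (u * C x) ≈ 0#) → ⊥
    purely-quadratic x u two≈0 B≈0 u≉0 n≉0 =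
      let ni = inv (1# + - (u * C x)) n≉0
          κ = 0# * 0# + u * (A (x + u) + B (x + u) * 0# + C (x + u) * (0# * 0#) + - A x)
          (y , yy) = sqrt two≈0 (- (κ * proj₁ ni))
      in no-root x u 0# y u≉0 (begin
        (1# + - (u * C x)) * (y * y) + - (two * 0# + u * B x) * y + κ
          ≈⟨ +-congʳ (+-cong (*-congˡ yy) (*-congʳ (-‿cong (zero-sum (zeroʳ two) (zero-mulʳ B≈0))))) ⟩
        (1# + - (u * C x)) * - (κ * proj₁ ni) + - 0# * y + κ
          ≈⟨ solve 4 (λ n κ i y → n :* (:- (κ :* i)) :+ (:- con (0 , 0)) :* y :+ κ := κ :- (n :* i) :* κ) refl (1# + - (u * C x)) κ (proj₁ ni) y ⟩
        κ + - ((1# + - (u * C x)) * proj₁ ni * κ) ≈⟨ +-congˡ (-‿cong (trans (*-congʳ (proj₂ ni)) (*-identityˡ κ))) ⟩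
        κ + - κ ≈⟨ -‿inverseʳ κ ⟩
        0# ∎)

    -- Supplies an element `g` other than 0 and 1, so that `u = g / C x` avoids both 0 and
    -- `1 / C x`.
    three-elements : ¬ (∀ g → g * g + - g ≈ 0#)
    three-elements all-idempotent = 1≉0 (trans (sym (trans (+-cong (X^-top 2) -0#≈0#) (+-identityʳ 1#))) (at (vanishing 2 P 2<size degP vanish) 2))
      where
      P = (X 𝔹.^ 2) 𝔹.+ 𝔹.- X
      degP : Deg 2 P
      degP = Deg-+ {f = X 𝔹.^ 2} (Deg-X^ 2) (Deg-neg {f = X} (Deg-mono {f = X} (s≤s z≤n) Deg-X))
      vanish : ∀ g → ev 2 P g ≈ 0#
      vanish g = trans (ev-+ 2 (X 𝔹.^ 2) (𝔹.- X) g) (trans (+-cong (trans (ev-X^ 2 g) (*-congˡ (*-identityʳ g)))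
        (trans (ev-neg 2 X g) (-‿cong (ev-X 1 g)))) (all-idempotent g))

    C≈0 : ∀ x → C x ≈ 0#
    C≈0 x = ≈-stable λ nC → cases nC (B x ≟ 0#) (two ≟ 0#)
      where
      cases : ¬ (C x ≈ 0#) → Dec (B x ≈ 0#) → Dec (two ≈ 0#) → ⊥
      cases nC (no nB) _ = linear x 0# nC (λ e → *-≉0 (λ z → 1≉0 (trans (sym (proj₂ (inv (C x) nC))) (zero-mulʳ z))) nB
        (trans (sym (trans (+-congʳ (zeroʳ two)) (+-identityˡ _))) e))
      cases nC (yes B≈0) (no n2) = linear x 1# nC (λ e → n2 (trans (sym (*-identityʳ two)) (trans (sym (+-identityʳ _)) (trans (+-congˡ (sym (zero-mulʳ B≈0))) e))))
      cases nC (yes B≈0) (yes two≈0) = three-elements λ g → ≈-stable λ ng →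
        let ci = inv (C x) nC
            c≉0 : ¬ (proj₁ ci ≈ 0#)
            c≉0 z = 1≉0 (trans (sym (proj₂ ci)) (zero-mulʳ z))
        in purely-quadratic x (g * proj₁ ci) two≈0 B≈0
             (*-≉0 (λ z → ng (zero-sum (zero-mulˡ z) (trans (-‿cong z) -0#≈0#))) c≉0)
             (λ z → ng (trans (solve 3 (λ g i c → g :* g :- g := (:- g) :* (con (1 , 0) :- g :* i :* c) :+ g :* g :* (con (1 , 0) :- c :* i)) refl g (proj₁ ci) (C x))
               (zero-sum (zero-mulʳ z) (zero-mulʳ (trans (+-congˡ (-‿cong (proj₂ ci))) (-‿inverseʳ 1#))))))

    ovoid′ : ∀ x y u v → ¬ (u ≈ 0# × v ≈ 0#) → ¬ (v * v + u * ((A (x + u) + B (x + u) * (y + v)) + - (A x + B x * y)) ≈ 0#)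
    ovoid′ x y u v ne e = ovoid x y u v ne (trans (+-congˡ (*-congˡ (+-cong
      (trans (+-congˡ (zero-mulˡ (C≈0 (x + u)))) (+-identityʳ _)) (-‿cong (trans (+-congˡ (zero-mulˡ (C≈0 x))) (+-identityʳ _)))))) e)

    -- For `v = 0` the condition is linear in `y` with slope `B x - B 0`, and a nonzero slope would
    -- give a root.
    B-constant : ∀ x → B x ≈ B 0#
    B-constant x = ≈-stable λ ne →
      let x≉0 : ¬ (x ≈ 0#)
          x≉0 z = ne (reflexive (≡.cong B (≈⇒≡ z)))
          b≉0 : ¬ (B x + - B 0# ≈ 0#)
          b≉0 z = ne (≈-from-sub z)
          bi = inv (B x + - B 0#) b≉0
          y = - ((A x + - A 0#) * proj₁ bi)
          0+x = ≈⇒≡ (+-identityˡ x)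
      in ovoid′ 0# y x 0# (x≉0 ∘ proj₁) (begin
        0# * 0# + x * ((A (0# + x) + B (0# + x) * (y + 0#)) + - (A 0# + B 0# * y))
          ≈⟨ +-congˡ (*-congˡ (+-congʳ (+-cong (reflexive (≡.cong A 0+x)) (*-congʳ (reflexive (≡.cong B 0+x)))))) ⟩
        0# * 0# + x * ((A x + B x * (y + 0#)) + - (A 0# + B 0# * y))
          ≈⟨ solve 6 (λ x a b c d i → con (0 , 0) :* con (0 , 0) :+ x :* ((a :+ b :* ((:- ((a :- c) :* i)) :+ con (0 , 0))) :- (c :+ d :* (:- ((a :- c) :* i))))
               := x :* (a :- c) :* (con (1 , 0) :- (b :- d) :* i)) refl x (A x) (B x) (A 0#) (B 0#) (proj₁ bi) ⟩
        x * (A x + - A 0#) * (1# + - ((B x + - B 0#) * proj₁ bi)) ≈⟨ zero-mulʳ (trans (+-congˡ (-‿cong (proj₂ bi))) (-‿inverseʳ 1#)) ⟩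
        0# ∎)

    additive-ovoid : ∀ x u v → ¬ (u ≈ 0# × v ≈ 0#) → ¬ (v * v + u * ((A (x + u) + - A x) + B 0# * v) ≈ 0#)
    additive-ovoid x u v ne e = ovoid′ x 0# u v ne (trans
      (+-congˡ (*-congˡ (trans (+-cong (+-congˡ (*-cong (B-constant (x + u)) (+-identityˡ v))) (-‿cong (trans (+-congˡ (zeroʳ (B x))) (+-identityʳ _))))
        (solve 3 (λ a b c → (a :+ b) :- c := (a :- c) :+ b) refl (A (x + u)) (B 0# * v) (A x))))) e)

    B≉0 : two ≈ 0# → ¬ (B 0# ≈ 0#)
    B≉0 two≈0 b≈0 = let (v , vv) = sqrt two≈0 (- (A (0# + 1#) + - A 0#)) in additive-ovoid 0# 1# v (1≉0 ∘ proj₁)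
      (trans (+-cong vv (trans (*-identityˡ _) (trans (+-congˡ (zero-mulˡ b≈0)) (+-identityʳ _)))) (-‿inverseˡ _))

-- Leading Taylor coefficients, and power sums for all exponents.

module TopOfTranslate (R : Ring₀) where
  open RingLemmas R
  open Series R
  open Translation R

  translate-top : ∀ x m f → translate x m f m ≈ f m
  translate-top x zero f = refl
  translate-top x (suc m) f = trans (+-identityˡ _) (trans (shift-at-suc x (translate x m (f ∘ suc)) m)
    (trans (+-cong (zero-mulʳ (Deg-translate x m (f ∘ suc) (suc m) (ℕₚ.n<1+n m))) (translate-top x m (f ∘ suc))) (+-identityˡ _)))

  translate-second : ∀ x m f → translate x (suc m) f m ≈ f m + ι (suc m) * x * f (suc m)
  translate-second x zero f = +-congˡ (trans (shift-at-0 x (translate x 0 (f ∘ suc))) (*-congʳ (sym (*-identityˡ x))))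
  translate-second x (suc m) f = begin
    0# + ((C x 𝕊.+ X) 𝕊.* T) (suc m) ≈⟨ trans (+-identityˡ _) (shift-at-suc x T m) ⟩
    x * T (suc m) + T m ≈⟨ +-cong (*-congˡ (translate-top x (suc m) (f ∘ suc))) (translate-second x m (f ∘ suc)) ⟩
    x * f (suc (suc m)) + (f (suc m) + ι (suc m) * x * f (suc (suc m)))
      ≈⟨ solve 4 (λ x f g i → x :* f :+ (g :+ i :* x :* f) := g :+ (con (1 , 0) :+ i) :* x :* f) refl x (f (suc (suc m))) (f (suc m)) (ι (suc m)) ⟩
    f (suc m) + ι (suc (suc m)) * x * f (suc (suc m)) ∎
    where
    module 𝕊 = RingLemmas series
    T = translate x (suc m) (f ∘ suc)

module PowerSums (F : FiniteField) (2<size : 2 ℕ.< FiniteField.size F) where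
  open Field F

  instance
    nonZero : ℕ.NonZero (size ∸ 1)
    nonZero = ℕ.>-nonZero (ℕₚ.m<n⇒0<n∸m 1<size)

  ^-period : ∀ x n r → ¬ (x ≈ 0#) → x ^ (r ℕ.+ n ℕ.* (size ∸ 1)) ≈ x ^ r
  ^-period x n r ne = trans (^-homo-* x r (n ℕ.* (size ∸ 1))) (trans (*-congˡ (trans (reflexive (≡.cong (x ^_) (ℕₚ.*-comm n (size ∸ 1))))
    (trans (sym (^-assocʳ x (size ∸ 1) n)) (trans (^-congˡ n (fermat′ x ne)) (1^ n))))) (*-identityʳ _))

  total-reduce : ∀ r n → 0 ℕ.< r → total (_^ (r ℕ.+ n ℕ.* (size ∸ 1))) ≈ total (_^ r)
  total-reduce r n 0<r = total-cong λ x → go x (x ≟ 0#)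
    where
    go : ∀ x → Dec (x ≈ 0#) → x ^ (r ℕ.+ n ℕ.* (size ∸ 1)) ≈ x ^ r
    go x (no ne) = ^-period x n r ne
    go x (yes e) = trans (trans (^-congˡ (r ℕ.+ n ℕ.* (size ∸ 1)) e) (0^ (r ℕ.+ n ℕ.* (size ∸ 1)) (ℕₚ.<-≤-trans 0<r (ℕₚ.m≤m+n r (n ℕ.* (size ∸ 1)))))) (sym (trans (^-congˡ r e) (0^ r 0<r)))

  total-multiple : ∀ n → total (_^ (suc n ℕ.* (size ∸ 1))) ≈ - 1#
  total-multiple n = trans (total-reduce (size ∸ 1) n (ℕₚ.m<n⇒0<n∸m 1<size)) power-sum-top

  total-power : ∀ E → 0 ℕ.< E → (∀ n → E ≢ suc n ℕ.* (size ∸ 1)) → total (_^ E) ≈ 0#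
  total-power E 0<E ne = by-cases (E DivMod.% (size ∸ 1)) (E DivMod./ (size ∸ 1)) (DivMod.m≡m%n+[m/n]*n E (size ∸ 1)) (DivMod.m%n<n E (size ∸ 1))
    where
    by-cases : ∀ r n → E ≡ r ℕ.+ n ℕ.* (size ∸ 1) → r ℕ.< size ∸ 1 → total (_^ E) ≈ 0#
    by-cases zero zero ≡.refl l = ⊥-elim (ℕₚ.<-irrefl ≡.refl 0<E)
    by-cases zero (suc n) e l = ⊥-elim (ne n e)
    by-cases (suc r) n ≡.refl l = trans (total-reduce (suc r) n (s≤s z≤n)) (power-sum (suc r) l)

-- Characteristic two.

module Even (F : FiniteField) (h′ : ℕ) (size≡ : FiniteField.size F ≡ 2 ℕ.^ suc (suc h′)) (pr : Prime 2) where
  open Field F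
  open Translation k
  open TopOfTranslate k
  open Frobenius k pr (char 2 (suc (suc h′)) size≡)

  h : ℕ
  h = suc (suc h′)

  2<size : 2 ℕ.< size
  2<size = ≡.subst (2 ℕ.<_) (≡.sym size≡) (ℕₚ.≤-trans (s≤s (s≤s (s≤s z≤n))) (ℕₚ.^-monoʳ-≤ 2 {2} {h} (s≤s (s≤s z≤n))))

  open PowerSums F 2<size

  1+1≈0 : 1# + 1# ≈ 0#
  1+1≈0 = char 2 h size≡

  x+x≈0 : ∀ x → x + x ≈ 0#
  x+x≈0 x = trans (solve 1 (λ x → x :+ x := (con (1 , 0) :+ con (1 , 0)) :* x) refl x) (zero-mulˡ 1+1≈0)

  ^2 : ∀ x i → (x ^ (2 ℕ.^ i)) ^ 2 ≈ x ^ (2 ℕ.^ suc i)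
  ^2 x i = trans (^-assocʳ x (2 ℕ.^ i) 2) (reflexive (≡.cong (x ^_) (ℕₚ.*-comm (2 ℕ.^ i) 2)))

  sqrt : ∀ w → Σ Carrier λ y → y * y ≈ w
  sqrt w = w ^ (2 ℕ.^ suc h′) , (begin
    w ^ (2 ℕ.^ suc h′) * w ^ (2 ℕ.^ suc h′) ≈⟨ *-congˡ (*-identityʳ _) ⟨
    (w ^ (2 ℕ.^ suc h′)) ^ 2 ≈⟨ ^2 w (suc h′) ⟩
    w ^ (2 ℕ.^ h) ≈⟨ trans (reflexive (≡.cong (w ^_) (≡.sym size≡))) (fermat w) ⟩
    w ∎)

  Tr : Carrier → Carrier
  Tr x = ∑ h (λ i → x ^ (2 ℕ.^ i))

  Tr-shift : ∀ x → ∑ h (λ i → x ^ (2 ℕ.^ suc i)) ≈ Tr x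
  Tr-shift x = begin
    ∑ h (λ i → x ^ (2 ℕ.^ suc i)) ≈⟨ ∑-last (suc h′) (λ i → x ^ (2 ℕ.^ suc i)) ⟩
    ∑ (suc h′) (λ i → x ^ (2 ℕ.^ suc i)) + x ^ (2 ℕ.^ h) ≈⟨ +-comm _ _ ⟩
    x ^ (2 ℕ.^ h) + ∑ (suc h′) (λ i → x ^ (2 ℕ.^ suc i))
      ≈⟨ +-congʳ (trans (reflexive (≡.cong (x ^_) (≡.sym size≡))) (trans (fermat x) (sym (*-identityʳ x)))) ⟩
    Tr x ∎

  Tr-square : ∀ x → Tr x * Tr x ≈ Tr x
  Tr-square x = begin
    Tr x * Tr x ≈⟨ *-congˡ (*-identityʳ _) ⟨
    Tr x ^ 2 ≈⟨ frobenius^-∑ 1 h (λ i → x ^ (2 ℕ.^ i)) ⟩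
    ∑ h (λ i → (x ^ (2 ℕ.^ i)) ^ 2) ≈⟨ ∑-cong h (λ i _ → ^2 x i) ⟩
    ∑ h (λ i → x ^ (2 ℕ.^ suc i)) ≈⟨ Tr-shift x ⟩
    Tr x ∎

  Tr-0-or-1 : ∀ x → ¬ (Tr x ≈ 0#) → Tr x ≈ 1#
  Tr-0-or-1 x ne = ≈-from-sub (domain (trans (solve 1 (λ t → t :* (t :- con (1 , 0)) := t :* t :- t) refl (Tr x))
    (trans (+-congʳ (Tr-square x)) (-‿inverseʳ _))) ne)

  -- Additive Hilbert 90, with an element θ of nonzero trace.
  hilbert90 : ∀ η θ → Tr η ≈ 0# → ¬ (Tr θ ≈ 0#) → Σ Carrier λ z → z * z + z ≈ η
  hilbert90 η θ trη≈0 trθ≉0 = z , (begin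
    z * z + z ≈⟨ +-congʳ square ⟩
    (z + η) + z ≈⟨ solve 2 (λ z e → (z :+ e) :+ z := e :+ (z :+ z)) refl z η ⟩
    η + (z + z) ≈⟨ trans (+-congˡ (x+x≈0 z)) (+-identityʳ η) ⟩
    η ∎)
    where
    s t : ℕ → Carrier
    s i = ∑ i (λ j → η ^ (2 ℕ.^ j))
    t i = s i * θ ^ (2 ℕ.^ i)
    z = ∑ h t
    s-square : ∀ i → s i ^ 2 ≈ s (suc i) + η
    s-square i = begin
      s i ^ 2 ≈⟨ frobenius^-∑ 1 i (λ j → η ^ (2 ℕ.^ j)) ⟩
      ∑ i (λ j → (η ^ (2 ℕ.^ j)) ^ 2) ≈⟨ ∑-cong i (λ j _ → ^2 η j) ⟩
      ∑ i (λ j → η ^ (2 ℕ.^ suc j)) ≈⟨ solve 2 (λ e r → r := (e :+ r) :- e) refl η _ ⟩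
      (η + ∑ i (λ j → η ^ (2 ℕ.^ suc j))) + - η
        ≈⟨ +-cong (+-congʳ (sym (*-identityʳ η))) (≈-from-sub (trans (solve 1 (λ e → (:- e) :- e := :- (e :+ e)) refl η) (trans (-‿cong (x+x≈0 η)) -0#≈0#))) ⟩
      s (suc i) + η ∎
    square : z * z ≈ z + η
    square = begin
      z * z ≈⟨ *-congˡ (*-identityʳ z) ⟨
      z ^ 2 ≈⟨ frobenius^-∑ 1 h t ⟩
      ∑ h (λ i → t i ^ 2) ≈⟨ ∑-cong h (λ i _ → trans (^-distrib-* (s i) _ 2) (trans (*-cong (s-square i) (^2 θ i)) (distribʳ _ _ _))) ⟩
      ∑ h (λ i → t (suc i) + η * θ ^ (2 ℕ.^ suc i)) ≈⟨ ∑-+ h (t ∘ suc) (λ i → η * θ ^ (2 ℕ.^ suc i)) ⟩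
      ∑ h (t ∘ suc) + ∑ h (λ i → η * θ ^ (2 ℕ.^ suc i))
        ≈⟨ +-cong (trans (sym (trans (+-congʳ (zeroˡ _)) (+-identityˡ _))) (trans (∑-last h t) (trans (+-congˡ (zero-mulˡ trη≈0)) (+-identityʳ z))))
                  (trans (∑-*ˡ h η (λ i → θ ^ (2 ℕ.^ suc i))) (trans (*-congˡ (trans (Tr-shift θ) (Tr-0-or-1 θ trθ≉0))) (*-identityʳ η))) ⟩
      z + η ∎

  -- If the polynomial b has constant trace 1 off 0, then comparing the coefficients of u^J in
  -- the trace gives b_J = b_{2J}^(q/2).
  module TraceConstant (J j′ : ℕ) (J-odd : J ≡ suc (2 ℕ.* j′)) (b : ℕ → Carrier)
    (large : 4 ℕ.* J ℕ.* (4 ℕ.* J) ℕ.≤ size) (trace : ∀ u → ¬ (u ≈ 0#) → Tr (∑ (4 ℕ.* J) (λ j → b j * u ^ j)) ≈ 1#) where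

    M : ℕ
    M = size ∸ 1

    suc-M : suc M ≡ size
    suc-M = ℕₚ.m+[n∸m]≡n 0<size

    1≤J : 1 ℕ.≤ J
    1≤J = ≡.subst (1 ℕ.≤_) (≡.sym J-odd) (s≤s z≤n)

    J<4J : J ℕ.< 4 ℕ.* J
    J<4J = ℕₚ.<-≤-trans (ℕₚ.m<m+n J 1≤J) (ℕₚ.+-monoʳ-≤ J (ℕₚ.m≤m+n J (2 ℕ.* J)))

    J<M : J ℕ.< M
    J<M = ℕₚ.<-≤-trans J<4J (ℕₚ.≤-pred (≡.subst (suc (4 ℕ.* J) ℕ.≤_) (≡.sym suc-M)
      (ℕₚ.≤-trans (ℕₚ.m<m*n (4 ℕ.* J) (4 ℕ.* J) {{ℕ.>-nonZero (ℕₚ.<-≤-trans 1≤J (ℕₚ.<⇒≤ J<4J))}} (ℕₚ.≤-trans (s≤s 1≤J) J<4J)) large)))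

    -- The exponent of `u` once the `i`-th conjugate of `b j * u ^ j` is multiplied by `u^(M - J)`;
    -- its power sum survives only at multiples of `M`.
    weight : ℕ → ℕ → ℕ
    weight i j = (M ∸ J) ℕ.+ j ℕ.* 2 ℕ.^ i

    0<weight : ∀ i j → 0 ℕ.< weight i j
    0<weight i j = ℕₚ.<-≤-trans (ℕₚ.m<n⇒0<n∸m J<M) (ℕₚ.m≤m+n (M ∸ J) _)

    split-size : ∀ i → i ℕ.< h → size ≡ 2 ℕ.^ (h ∸ i) ℕ.* 2 ℕ.^ i
    split-size i l = ≡.trans size≡ (≡.trans (≡.cong (2 ℕ.^_) (≡.sym (ℕₚ.m∸n+n≡m (ℕₚ.<⇒≤ l)))) (ℕₚ.^-distribˡ-+-* 2 (h ∸ i) i))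

    -- The condition reads `j 2^i = J + n M`. For `n = 0` the oddness of `J` gives `i = 0`.
    -- Otherwise `j 2^i + n = J + n q`; modulo `2^i`, which divides `q` and exceeds both `n` and
    -- `J`, this yields `n = J`. Then `j = J 2^(h - i)`, and `j < 4 J` leaves `h - i = 1`.
    resonance : ∀ i j n → i ℕ.< h → j ℕ.< 4 ℕ.* J → weight i j ≡ suc n ℕ.* M → (i ≡ 0 × j ≡ J) ⊎ (i ≡ suc h′ × j ≡ 2 ℕ.* J)
    resonance i j m i<h j<4J e = by-cases m shifted
      where
      P = 2 ℕ.^ i
      shifted : j ℕ.* P ≡ J ℕ.+ m ℕ.* M
      shifted = ℕₚ.+-cancelˡ-≡ (M ∸ J) _ _ (≡.trans e (≡.trans (≡.cong (ℕ._+ m ℕ.* M) (≡.sym (ℕₚ.m∸n+n≡m (ℕₚ.<⇒≤ J<M)))) (ℕₚ.+-assoc (M ∸ J) J (m ℕ.* M))))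
      odd≢even : ∀ x → suc (2 ℕ.* j′) ≢ 2 ℕ.* x
      odd≢even x eq = ℕₚ.even≢odd x j′ (≡.sym eq)
      by-cases : ∀ n → j ℕ.* P ≡ J ℕ.+ n ℕ.* M → (i ≡ 0 × j ≡ J) ⊎ (i ≡ suc h′ × j ≡ 2 ℕ.* J)
      by-cases zero eq = inj₁ (first i (≡.trans eq (ℕₚ.+-identityʳ J)))
        where
        first : ∀ i → j ℕ.* 2 ℕ.^ i ≡ J → i ≡ 0 × j ≡ J
        first zero q = ≡.refl , ≡.trans (≡.sym (ℕₚ.*-identityʳ j)) q
        first (suc i) q = ⊥-elim (odd≢even (j ℕ.* 2 ℕ.^ i) (≡.trans (≡.sym J-odd) (≡.trans (≡.sym q)
          (+-*-Solver.solve 2 (λ j p → j +-*-Solver.:* (+-*-Solver.con 2 +-*-Solver.:* p) +-*-Solver.:= +-*-Solver.con 2 +-*-Solver.:* (j +-*-Solver.:* p)) ≡.refl j (2 ℕ.^ i)))))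
      by-cases (suc n′) eq = inj₂ (last-index , double)
        where
        n = suc n′
        instance
          P≢0 : ℕ.NonZero P
          P≢0 = ℕₚ.m^n≢0 2 i
        with-q : j ℕ.* P ℕ.+ n ≡ J ℕ.+ n ℕ.* size
        with-q = ≡.trans (≡.cong (ℕ._+ n) eq) (≡.trans (ℕₚ.+-assoc J (n ℕ.* M) n) (≡.cong (J ℕ.+_)
          (≡.trans (ℕₚ.+-comm (n ℕ.* M) n) (≡.trans (≡.sym (ℕₚ.*-suc n M)) (≡.cong (n ℕ.*_) suc-M)))))
        size≤jP : size ℕ.≤ j ℕ.* P
        size≤jP = ≡.subst (size ℕ.≤_) (≡.sym eq) (≡.subst (ℕ._≤ J ℕ.+ n ℕ.* M) suc-M (ℕₚ.+-mono-≤ 1≤J (ℕₚ.m≤m+n M (n′ ℕ.* M))))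
        -- Otherwise `j 2^i` would be below `(4 J)^2 ≤ q`, whereas it is at least `q`.
        4J≤P : 4 ℕ.* J ℕ.≤ P
        4J≤P = ℕₚ.≮⇒≥ λ P<4J → ℕₚ.<⇒≱ (ℕₚ.*-mono-< j<4J P<4J) (ℕₚ.≤-trans large size≤jP)
        J<P : J ℕ.< P
        J<P = ℕₚ.<-≤-trans J<4J 4J≤P
        2P≤size : 2 ℕ.* P ℕ.≤ size
        2P≤size = ≡.subst (2 ℕ.* P ℕ.≤_) (≡.sym size≡) (ℕₚ.^-monoʳ-≤ 2 i<h)
        n<P : n ℕ.< P
        n<P = ℕₚ.<-≤-trans (ℕₚ.≤-<-trans (ℕₚ.≮⇒≥ (λ j<n → ℕₚ.<⇒≱ (too-big j<n) (ℕₚ.≤-reflexive (≡.sym eq)))) j<4J) 4J≤P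
          where
          too-big : j ℕ.< n → j ℕ.* P ℕ.< J ℕ.+ n ℕ.* M
          too-big j<n = ℕₚ.<-≤-trans (ℕₚ.*-monoˡ-< P j<n) (ℕₚ.≤-trans (ℕₚ.*-monoʳ-≤ n P≤M) (ℕₚ.m≤n+m (n ℕ.* M) J))
            where
            P≤M : P ℕ.≤ M
            P≤M = ℕₚ.≤-pred (≡.subst (suc P ℕ.≤_) (≡.sym suc-M) (ℕₚ.<-≤-trans (ℕₚ.m<m+n P (ℕₚ.≤-trans (ℕₚ.≤-<-trans z≤n J<P) (ℕₚ.m≤m+n P 0))) 2P≤size))
        n≡J : n ≡ J
        n≡J = ≡.trans (≡.sym (DivMod.m<n⇒m%n≡m n<P)) (≡.trans (≡.sym (DivMod.[m+kn]%n≡m%n n j P))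
          (≡.trans (≡.cong (DivMod._% P) (≡.trans (ℕₚ.+-comm n (j ℕ.* P)) (≡.trans with-q (≡.cong (J ℕ.+_)
            (≡.trans (≡.cong (n ℕ.*_) (split-size i i<h)) (≡.sym (ℕₚ.*-assoc n (2 ℕ.^ (h ∸ i)) P)))))))
            (≡.trans (DivMod.[m+kn]%n≡m%n J (n ℕ.* 2 ℕ.^ (h ∸ i)) P) (DivMod.m<n⇒m%n≡m J<P))))
        j≡ : j ≡ J ℕ.* 2 ℕ.^ (h ∸ i)
        j≡ = ℕₚ.*-cancelʳ-≡ j (J ℕ.* 2 ℕ.^ (h ∸ i)) P (ℕₚ.+-cancelʳ-≡ n (j ℕ.* P) _ (≡.trans with-q (≡.trans (ℕₚ.+-comm J (n ℕ.* size))
          (≡.cong₂ ℕ._+_ (≡.trans (≡.cong₂ ℕ._*_ n≡J (split-size i i<h)) (≡.sym (ℕₚ.*-assoc J (2 ℕ.^ (h ∸ i)) P))) (≡.sym n≡J)))))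
        small : ∀ e → h ∸ i ≡ e → e ≡ 1
        small zero eq′ = ⊥-elim (ℕₚ.<⇒≢ (ℕₚ.m<n⇒0<n∸m i<h) (≡.sym eq′))
        small (suc zero) eq′ = ≡.refl
        small (suc (suc e)) eq′ = ⊥-elim (ℕₚ.<⇒≱ j<4J (≡.subst (4 ℕ.* J ℕ.≤_) (≡.sym j≡)
          (≡.subst (4 ℕ.* J ℕ.≤_) (ℕₚ.*-comm (2 ℕ.^ (h ∸ i)) J) (ℕₚ.*-monoˡ-≤ J (≡.subst (λ r → 4 ℕ.≤ 2 ℕ.^ r) (≡.sym eq′) (ℕₚ.^-monoʳ-≤ 2 {2} {suc (suc e)} (s≤s (s≤s z≤n))))))))
        h-i : h ∸ i ≡ 1
        h-i = small (h ∸ i) ≡.refl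
        last-index : i ≡ suc h′
        last-index = ≡.trans (≡.sym (ℕₚ.m∸[m∸n]≡n (ℕₚ.<⇒≤ i<h))) (≡.cong (h ∸_) h-i)
        double : j ≡ 2 ℕ.* J
        double = ≡.trans j≡ (≡.trans (≡.cong (λ r → J ℕ.* 2 ℕ.^ r) h-i) (ℕₚ.*-comm J 2))

    contribution : ℕ → ℕ → Carrier
    contribution i j = b j ^ (2 ℕ.^ i) * total (_^ weight i j)

    off : ∀ i j → i ℕ.< h → j ℕ.< 4 ℕ.* J → ¬ (i ≡ 0 × j ≡ J) → ¬ (i ≡ suc h′ × j ≡ 2 ℕ.* J) → contribution i j ≈ 0#
    off i j i<h j<4J n1 n2 = zero-mulʳ (total-power (weight i j) (0<weight i j) λ n e → neither (resonance i j n i<h j<4J e))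
      where
      neither : (i ≡ 0 × j ≡ J) ⊎ (i ≡ suc h′ × j ≡ 2 ℕ.* J) → ⊥
      neither (inj₁ p) = n1 p
      neither (inj₂ p) = n2 p

    on : ∀ i j n → weight i j ≡ suc n ℕ.* M → contribution i j ≈ - (b j ^ (2 ℕ.^ i))
    on i j n e = trans (*-congˡ (trans (reflexive (≡.cong (λ r → total (_^ r)) e)) (total-multiple n)))
      (solve 1 (λ x → x :* (:- con (1 , 0)) := :- x) refl _)

    weight-first : weight 0 J ≡ 1 ℕ.* M
    weight-first = ≡.trans (≡.cong ((M ∸ J) ℕ.+_) (ℕₚ.*-identityʳ J)) (≡.trans (ℕₚ.m∸n+n≡m (ℕₚ.<⇒≤ J<M)) (≡.sym (ℕₚ.*-identityˡ M)))

    weight-last : weight (suc h′) (2 ℕ.* J) ≡ suc J ℕ.* M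
    weight-last = ≡.trans (≡.cong ((M ∸ J) ℕ.+_) doubled) (≡.trans (≡.sym (ℕₚ.+-assoc (M ∸ J) J (J ℕ.* M))) (≡.cong (ℕ._+ J ℕ.* M) (ℕₚ.m∸n+n≡m (ℕₚ.<⇒≤ J<M))))
      where
      doubled : 2 ℕ.* J ℕ.* 2 ℕ.^ suc h′ ≡ J ℕ.+ J ℕ.* M
      doubled = ≡.trans (+-*-Solver.solve 2 (λ j p → +-*-Solver.con 2 +-*-Solver.:* j +-*-Solver.:* p +-*-Solver.:= j +-*-Solver.:* (+-*-Solver.con 2 +-*-Solver.:* p)) ≡.refl J (2 ℕ.^ suc h′))
        (≡.trans (≡.cong (J ℕ.*_) (≡.trans (≡.sym size≡) (≡.sym suc-M))) (ℕₚ.*-suc J M))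

    -- This is the sum over the field of `u^(M - J)` times the trace. The trace is 1 off zero, the
    -- factor vanishes at zero, and the power sum of exponent `M - J < M` is zero.
    grand-total : ∑ h (λ i → ∑ (4 ℕ.* J) (contribution i)) ≈ 0#
    grand-total = begin
      ∑ h (λ i → ∑ (4 ℕ.* J) (contribution i))
        ≈⟨ ∑-cong h (λ i _ → trans (∑-cong (4 ℕ.* J) (λ j _ → sym (total-* (b j ^ (2 ℕ.^ i)) (_^ weight i j)))) (sym (total-∑ (4 ℕ.* J) (λ j u → b j ^ (2 ℕ.^ i) * u ^ weight i j)))) ⟩
      ∑ h (λ i → total (λ u → ∑ (4 ℕ.* J) (λ j → b j ^ (2 ℕ.^ i) * u ^ weight i j))) ≈⟨ total-∑ h (λ i u → ∑ (4 ℕ.* J) (λ j → b j ^ (2 ℕ.^ i) * u ^ weight i j)) ⟨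
      total (λ u → ∑ h (λ i → ∑ (4 ℕ.* J) (λ j → b j ^ (2 ℕ.^ i) * u ^ weight i j))) ≈⟨ total-cong (λ u → trans (factored u) (off-zero u (u ≟ 0#))) ⟩
      total (_^ (M ∸ J)) ≈⟨ power-sum (M ∸ J) (ℕₚ.∸-monoʳ-< {M} {J} {0} 1≤J (ℕₚ.<⇒≤ J<M)) ⟩
      0# ∎
      where
      value : Carrier → Carrier
      value u = ∑ (4 ℕ.* J) (λ j → b j * u ^ j)
      factored : ∀ u → ∑ h (λ i → ∑ (4 ℕ.* J) (λ j → b j ^ (2 ℕ.^ i) * u ^ weight i j)) ≈ u ^ (M ∸ J) * Tr (value u)
      factored u = trans (∑-cong h (λ i _ → begin
          ∑ (4 ℕ.* J) (λ j → b j ^ (2 ℕ.^ i) * u ^ weight i j)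
            ≈⟨ ∑-cong (4 ℕ.* J) (λ j _ → trans (*-congˡ (trans (^-homo-* u (M ∸ J) (j ℕ.* 2 ℕ.^ i)) (*-congˡ (sym (^-assocʳ u j (2 ℕ.^ i))))))
                 (trans (solve 3 (λ b w v → b :* (w :* v) := w :* (b :* v)) refl _ (u ^ (M ∸ J)) _) (*-congˡ (sym (^-distrib-* (b j) (u ^ j) (2 ℕ.^ i)))))) ⟩
          ∑ (4 ℕ.* J) (λ j → u ^ (M ∸ J) * (b j * u ^ j) ^ (2 ℕ.^ i)) ≈⟨ ∑-*ˡ (4 ℕ.* J) (u ^ (M ∸ J)) (λ j → (b j * u ^ j) ^ (2 ℕ.^ i)) ⟩
          u ^ (M ∸ J) * ∑ (4 ℕ.* J) (λ j → (b j * u ^ j) ^ (2 ℕ.^ i)) ≈⟨ *-congˡ (frobenius^-∑ i (4 ℕ.* J) (λ j → b j * u ^ j)) ⟨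
          u ^ (M ∸ J) * value u ^ (2 ℕ.^ i) ∎))
        (∑-*ˡ h (u ^ (M ∸ J)) (λ i → value u ^ (2 ℕ.^ i)))
      off-zero : ∀ u → Dec (u ≈ 0#) → u ^ (M ∸ J) * Tr (value u) ≈ u ^ (M ∸ J)
      off-zero u (no nu) = trans (*-congˡ (trace u nu)) (*-identityʳ _)
      off-zero u (yes u0) = let z = trans (^-congˡ (M ∸ J) u0) (0^ (M ∸ J) (ℕₚ.m<n⇒0<n∸m J<M)) in trans (zero-mulˡ z) (sym z)

    relation : b J + b (2 ℕ.* J) ^ (2 ℕ.^ suc h′) ≈ 0#
    relation = begin
      b J + b (2 ℕ.* J) ^ (2 ℕ.^ suc h′)
        ≈⟨ solve 2 (λ x y → x :+ y := :- ((:- x) :+ (:- y))) refl (b J) _ ⟩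
      - (- b J + - (b (2 ℕ.* J) ^ (2 ℕ.^ suc h′))) ≈⟨ -‿cong (+-cong row-first row-last) ⟨
      - (∑ (4 ℕ.* J) (contribution 0) + ∑ (suc h′) (λ i → ∑ (4 ℕ.* J) (contribution (suc i)))) ≈⟨ trans (-‿cong grand-total) -0#≈0# ⟩
      0# ∎
      where
      2J<4J : 2 ℕ.* J ℕ.< 4 ℕ.* J
      2J<4J = ℕₚ.*-monoˡ-< J {{ℕ.>-nonZero 1≤J}} {2} {4} (s≤s (s≤s (s≤s z≤n)))
      row-first : ∑ (4 ℕ.* J) (contribution 0) ≈ - b J
      row-first = trans (∑-single (4 ℕ.* J) J {contribution 0} J<4J (λ j l ne → off 0 j (s≤s z≤n) l (ne ∘ proj₂) (λ { (() , _) })))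
        (trans (on 0 J 0 weight-first) (-‿cong (*-identityʳ (b J))))
      row-last : ∑ (suc h′) (λ i → ∑ (4 ℕ.* J) (contribution (suc i))) ≈ - (b (2 ℕ.* J) ^ (2 ℕ.^ suc h′))
      row-last = trans (∑-single (suc h′) h′ {λ i → ∑ (4 ℕ.* J) (contribution (suc i))} (ℕₚ.n<1+n h′)
          (λ i l ne → ∑-zero (4 ℕ.* J) (λ j m → off (suc i) j (s≤s l) m (λ { (() , _) }) (ne ∘ ℕₚ.suc-injective ∘ proj₁))))
        (trans (∑-single (4 ℕ.* J) (2 ℕ.* J) {contribution (suc h′)} 2J<4J (λ j l ne → off (suc h′) j (ℕₚ.n<1+n (suc h′)) l (λ { (() , _) }) (ne ∘ proj₂)))
          (on (suc h′) (2 ℕ.* J) J weight-last))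

  -- z² + z = (A(x + u) − A(x)) / (β² u) has no solution z, so that the right hand side, a
  -- polynomial in u with coefficients depending on x, has trace 1.
  module Conclusion (δ : ℕ) (A : PS) (degA : Deg δ A) (2≤δ : 2 ℕ.≤ δ) (β : Carrier) (β≉0 : ¬ (β ≈ 0#))
    (large : 4 ℕ.* δ ℕ.* (4 ℕ.* δ) ℕ.≤ size)
    (ovoid : ∀ x u v → ¬ (u ≈ 0# × v ≈ 0#) → ¬ (v * v + u * ((ev δ A (x + u) + - ev δ A x) + β * v) ≈ 0#)) where

    βi : Carrier
    βi = proj₁ (inv β β≉0)

    coefficient : Carrier → ℕ → Carrier
    coefficient x j = βi * βi * translate x δ A (suc j)

    coefficient-high : ∀ x j → δ ℕ.≤ j → coefficient x j ≈ 0#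
    coefficient-high x j l = zero-mulʳ (Deg-translate x δ A (suc j) (s≤s l))

    value : ∀ x u N → δ ℕ.≤ N → u * (β * β * ∑ N (λ j → coefficient x j * u ^ j)) ≈ ev δ A (x + u) + - ev δ A x
    value x u N δ≤N = begin
      u * (β * β * ∑ N (λ j → coefficient x j * u ^ j)) ≈⟨ *-congˡ (*-congˡ (begin
        ∑ N (λ j → coefficient x j * u ^ j) ≈⟨ ∑-cong N (λ j _ → *-assoc (βi * βi) (T (suc j)) (u ^ j)) ⟩
        ∑ N (λ j → βi * βi * (T (suc j) * u ^ j)) ≈⟨ ∑-*ˡ N (βi * βi) (λ j → T (suc j) * u ^ j) ⟩
        βi * βi * ∑ N (λ j → T (suc j) * u ^ j) ∎)) ⟩
      u * (β * β * (βi * βi * S)) ≈⟨ solve 4 (λ u b i s → u :* (b :* b :* (i :* i :* s)) := (b :* i) :* (b :* i) :* (u :* s)) refl u β βi S ⟩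
      (β * βi) * (β * βi) * (u * S) ≈⟨ trans (*-congʳ (trans (*-cong (proj₂ (inv β β≉0)) (proj₂ (inv β β≉0))) (*-identityˡ 1#))) (*-identityˡ _) ⟩
      u * S ≈⟨ trans (sym (∑-*ˡ N u (λ j → T (suc j) * u ^ j))) (∑-cong N (λ j _ → solve 3 (λ u t p → u :* (t :* p) := t :* (u :* p)) refl u (T (suc j)) (u ^ j))) ⟩
      ∑ N (λ j → T (suc j) * u ^ suc j) ≈⟨ solve 2 (λ s t → s := (t :* con (1 , 0) :+ s) :- t) refl _ (T 0) ⟩
      ∑ (suc N) (λ j → T j * u ^ j) + - T 0 ≈⟨ +-cong whole (-‿cong at-0) ⟩
      ev δ A (x + u) + - ev δ A x ∎
      where
      T = translate x δ A
      S = ∑ N (λ j → T (suc j) * u ^ j)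
      whole : ∑ (suc N) (λ j → T j * u ^ j) ≈ ev δ A (x + u)
      whole = trans (sym (ev-∑ N T u)) (trans (sym (ev-mono δ N u δ≤N (Deg-translate x δ A))) (ev-translate x δ A u))
      at-0 : T 0 ≈ ev δ A x
      at-0 = trans (sym (trans (ev-cong δ 𝔹.refl refl) (ev-at-0 δ T))) (trans (ev-translate x δ A 0#) (ev-cong δ (𝔹.refl {A}) (+-identityʳ x)))
        where
        ev-at-0 : ∀ m f → ev m f 0# ≈ f 0
        ev-at-0 zero f = refl
        ev-at-0 (suc m) f = trans (+-congˡ (zeroˡ _)) (+-identityʳ _)

    -- The trace is a polynomial of degree q/2, so it is not identically zero.
    some-trace : ¬ (∀ θ → Tr θ ≈ 0#)
    some-trace all-zero = 1≉0 (trans (sym top) (at (vanishing D P D<size degP (λ θ → trans (value-P θ) (all-zero θ))) D))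
      where
      D = 2 ℕ.^ suc h′
      D<size : D ℕ.< size
      D<size = ≡.subst (D ℕ.<_) (≡.sym size≡) (ℕₚ.^-monoʳ-< 2 (s≤s (s≤s z≤n)) (ℕₚ.n<1+n (suc h′)))
      P : PS
      P = 𝔹.∑ h (λ i → X 𝔹.^ (2 ℕ.^ i))
      deg-sum : ∀ m (f : ℕ → ℕ) → (∀ i → i ℕ.< m → f i ℕ.≤ D) → Deg D (𝔹.∑ m (λ i → X 𝔹.^ f i))
      deg-sum zero f le = Deg-0 {D}
      deg-sum (suc m) f le = Deg-+ {f = X 𝔹.^ f 0} (Deg-mono {f = X 𝔹.^ f 0} (le 0 (s≤s z≤n)) (Deg-X^ (f 0))) (deg-sum m (f ∘ suc) (λ i l → le (suc i) (s≤s l)))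
      degP : Deg D P
      degP = deg-sum h (2 ℕ.^_) (λ { i (s≤s l) → ℕₚ.^-monoʳ-≤ 2 l })
      value-sum : ∀ θ m (f : ℕ → ℕ) → (∀ i → i ℕ.< m → f i ℕ.≤ D) → ev D (𝔹.∑ m (λ i → X 𝔹.^ f i)) θ ≈ ∑ m (λ i → θ ^ f i)
      value-sum θ zero f le = ev-zero D θ 𝔹.refl
      value-sum θ (suc m) f le = trans (ev-+ D (X 𝔹.^ f 0) (𝔹.∑ m (λ i → X 𝔹.^ f (suc i))) θ)
        (+-cong (trans (sym (ev-mono (f 0) D θ (le 0 (s≤s z≤n)) (Deg-X^ (f 0)))) (ev-X^ (f 0) θ)) (value-sum θ m (f ∘ suc) (λ i l → le (suc i) (s≤s l))))
      value-P : ∀ θ → ev D P θ ≈ Tr θ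
      value-P θ = value-sum θ h (2 ℕ.^_) (λ { i (s≤s l) → ℕₚ.^-monoʳ-≤ 2 l })
      top : P D ≈ 1#
      top = begin
        P D ≈⟨ at (𝔹.∑-last (suc h′) (λ i → X 𝔹.^ (2 ℕ.^ i))) D ⟩
        𝔹.∑ (suc h′) (λ i → X 𝔹.^ (2 ℕ.^ i)) D + (X 𝔹.^ D) D ≈⟨ +-cong (lower (suc h′) (2 ℕ.^_) (λ i l → ℕₚ.^-monoʳ-< 2 (s≤s (s≤s z≤n)) l)) (X^-top D) ⟩
        0# + 1# ≈⟨ +-identityˡ 1# ⟩
        1# ∎
        where
        lower : ∀ m (f : ℕ → ℕ) → (∀ i → i ℕ.< m → f i ℕ.< D) → 𝔹.∑ m (λ i → X 𝔹.^ f i) D ≈ 0#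
        lower zero f lt = refl
        lower (suc m) f lt = zero-sum (Deg-X^ (f 0) D (lt 0 (s≤s z≤n))) (lower m (f ∘ suc) (λ i l → lt (suc i) (s≤s l)))

    trace-one : ∀ x u N → δ ℕ.≤ N → ¬ (u ≈ 0#) → Tr (∑ N (λ j → coefficient x j * u ^ j)) ≈ 1#
    trace-one x u N δ≤N u≉0 = Tr-0-or-1 η λ tr0 → some-trace λ θ → ≈-stable λ trθ →
      let (z , zz) = hilbert90 η θ tr0 trθ
      in ovoid x u (β * u * z) (u≉0 ∘ proj₁) (begin
        (β * u * z) * (β * u * z) + u * ((ev δ A (x + u) + - ev δ A x) + β * (β * u * z)) ≈⟨ +-congˡ (*-congˡ (+-congʳ (sym (value x u N δ≤N)))) ⟩
        (β * u * z) * (β * u * z) + u * (u * (β * β * η) + β * (β * u * z))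
          ≈⟨ solve 4 (λ b u z e → (b :* u :* z) :* (b :* u :* z) :+ u :* (u :* (b :* b :* e) :+ b :* (b :* u :* z)) := b :* b :* (u :* u) :* ((z :* z :+ z) :+ e)) refl β u z η ⟩
        β * β * (u * u) * ((z * z + z) + η) ≈⟨ zero-mulʳ (trans (+-congʳ zz) (x+x≈0 η)) ⟩
        0# ∎)
      where η = ∑ N (λ j → coefficient x j * u ^ j)

    relation : ∀ x J j′ → J ≡ suc (2 ℕ.* j′) → J ℕ.≤ δ → δ ℕ.≤ 4 ℕ.* J → coefficient x J + coefficient x (2 ℕ.* J) ^ (2 ℕ.^ suc h′) ≈ 0#
    relation x J j′ odd J≤δ δ≤4J = TraceConstant.relation J j′ odd (coefficient x)
      (ℕₚ.≤-trans (ℕₚ.*-mono-≤ (ℕₚ.*-monoʳ-≤ 4 J≤δ) (ℕₚ.*-monoʳ-≤ 4 J≤δ)) large) (λ u u≉0 → trace-one x u (4 ℕ.* J) δ≤4J u≉0)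

    scale-cancel : ∀ y → βi * βi * y ≈ 0# → y ≈ 0#
    scale-cancel y e = domain e (*-≉0 βi≉0 βi≉0)
      where
      βi≉0 : ¬ (βi ≈ 0#)
      βi≉0 z = 1≉0 (trans (sym (proj₂ (inv β β≉0))) (zero-mulʳ z))

    -- With `J = δ - 1` odd, `2 J` lies beyond the degree, and the relation kills the top
    -- coefficient itself.
    even-case : ∀ m → δ ≡ suc (suc (2 ℕ.* m)) → A δ ≈ 0#
    even-case m e = trans (sym (translate-top 0# δ A)) (trans (reflexive (≡.cong (translate 0# δ A) e)) (scale-cancel _ (begin
        coefficient 0# J ≈⟨ +-identityʳ _ ⟨
        coefficient 0# J + 0# ≈⟨ +-congˡ (trans (^-congˡ (2 ℕ.^ suc h′) (coefficient-high 0# (2 ℕ.* J) high)) (0^ (2 ℕ.^ suc h′) (0<p^ (suc h′)))) ⟨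
        coefficient 0# J + coefficient 0# (2 ℕ.* J) ^ (2 ℕ.^ suc h′) ≈⟨ relation 0# J m ≡.refl J≤δ δ≤4J ⟩
        0# ∎)))
      where
      J = suc (2 ℕ.* m)
      J≤δ : J ℕ.≤ δ
      J≤δ = ≡.subst (J ℕ.≤_) (≡.sym e) (ℕₚ.n≤1+n J)
      high : δ ℕ.≤ 2 ℕ.* J
      high = ≡.subst (ℕ._≤ 2 ℕ.* J) (≡.sym e) (ℕₚ.+-mono-≤ {1} {J} {J} {J ℕ.+ 0} (s≤s z≤n) (ℕₚ.m≤m+n J 0))
      δ≤4J : δ ℕ.≤ 4 ℕ.* J
      δ≤4J = ℕₚ.≤-trans high (ℕₚ.*-monoˡ-≤ J {2} {4} (s≤s (s≤s z≤n)))

    -- Now `J = δ - 2`. The coefficient at `2 J` does not depend on `x`, while up to scaling the one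
    -- at `J` is `A (δ - 1) + δ x A δ` with `δ` odd; subtracting the relations at `x = 1` and
    -- `x = 0` isolates `A δ`.
    odd-case : ∀ m → δ ≡ suc (suc (suc (2 ℕ.* m))) → A δ ≈ 0#
    odd-case m e = trans (sym top-difference) (scale-cancel _ (begin
        βi * βi * (second 1# + - second 0#) ≈⟨ solve 3 (λ b s t → b :* (s :- t) := b :* s :- b :* t) refl (βi * βi) (second 1#) (second 0#) ⟩
        coefficient 1# J + - coefficient 0# J
          ≈⟨ solve 3 (λ c d e → c :- d := (c :+ e) :- (d :+ e)) refl (coefficient 1# J) (coefficient 0# J) (coefficient 1# (2 ℕ.* J) ^ (2 ℕ.^ suc h′)) ⟩
        (coefficient 1# J + coefficient 1# (2 ℕ.* J) ^ (2 ℕ.^ suc h′)) + - (coefficient 0# J + coefficient 1# (2 ℕ.* J) ^ (2 ℕ.^ suc h′))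
          ≈⟨ +-cong (relation 1# J m ≡.refl J≤δ δ≤4J) (-‿cong (trans (+-congˡ (^-congˡ (2 ℕ.^ suc h′) same)) (relation 0# J m ≡.refl J≤δ δ≤4J))) ⟩
        0# + - 0# ≈⟨ -‿inverseʳ 0# ⟩
        0# ∎))
      where
      J = suc (2 ℕ.* m)
      second : Carrier → Carrier
      second x = translate x δ A (suc J)
      J≤δ : J ℕ.≤ δ
      J≤δ = ≡.subst (J ℕ.≤_) (≡.sym e) (ℕₚ.≤-trans (ℕₚ.n≤1+n J) (ℕₚ.n≤1+n (suc J)))
      δ≤2J+1 : δ ℕ.≤ suc (2 ℕ.* J)
      δ≤2J+1 = ≡.subst (ℕ._≤ suc (2 ℕ.* J)) (≡.sym e) (s≤s (ℕₚ.+-mono-≤ {1} {J} {J} {J ℕ.+ 0} (s≤s z≤n) (ℕₚ.m≤m+n J 0)))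
      δ≤4J : δ ℕ.≤ 4 ℕ.* J
      δ≤4J = ℕₚ.≤-trans δ≤2J+1 (ℕₚ.*-monoˡ-< J {2} {4} (s≤s (s≤s (s≤s z≤n))))
      same : coefficient 1# (2 ℕ.* J) ≈ coefficient 0# (2 ℕ.* J)
      same = *-congˡ (top-independent δ≤2J+1)
        where
        top-independent : δ ℕ.≤ suc (2 ℕ.* J) → translate 1# δ A (suc (2 ℕ.* J)) ≈ translate 0# δ A (suc (2 ℕ.* J))
        top-independent l with δ ℕ.≟ suc (2 ℕ.* J)
        ... | yes eq = ≡.subst (λ r → translate 1# δ A r ≈ translate 0# δ A r) eq (trans (translate-top 1# δ A) (sym (translate-top 0# δ A)))
        ... | no ne = trans (Deg-translate 1# δ A (suc (2 ℕ.* J)) (ℕₚ.≤∧≢⇒< l ne)) (sym (Deg-translate 0# δ A (suc (2 ℕ.* J)) (ℕₚ.≤∧≢⇒< l ne)))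
      ι-odd : ∀ m → ι (suc (2 ℕ.* m)) ≈ 1#
      ι-odd m = trans (ι-suc (2 ℕ.* m)) (trans (+-congˡ (ι-∣ (∣.m∣m*n m))) (+-identityʳ 1#))
      second-value : ∀ x → second x ≈ A (suc J) + x * A δ
      second-value x = ≡.subst (λ r → translate x r A (suc J) ≈ A (suc J) + x * A r) (≡.sym e)
        (trans (translate-second x (suc J) A) (+-congˡ (*-congʳ (trans (*-congʳ (trans (reflexive (≡.cong (ι ∘ suc) (≡.sym double))) (ι-odd (suc m)))) (*-identityˡ x)))))
        where
        double : 2 ℕ.* suc m ≡ suc J
        double = ℕₚ.*-suc 2 m
      top-difference : second 1# + - second 0# ≈ A δ
      top-difference = trans (+-cong (second-value 1#) (-‿cong (second-value 0#)))
        (solve 2 (λ a b → (a :+ con (1 , 0) :* b) :- (a :+ con (0 , 0) :* b) := b) refl (A (suc J)) (A δ))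

    leading-zero : A δ ≈ 0#
    leading-zero = by-parity (δ DivMod.% 2) (δ DivMod./ 2) (DivMod.m≡m%n+[m/n]*n δ 2) (DivMod.m%n<n δ 2)
      where
      by-parity : ∀ r m → δ ≡ r ℕ.+ m ℕ.* 2 → r ℕ.< 2 → A δ ≈ 0#
      by-parity zero zero e l = ⊥-elim (ℕₚ.<⇒≱ (s≤s z≤n) (≡.subst (2 ℕ.≤_) e 2≤δ))
      by-parity zero (suc m) e l = even-case m (≡.trans e (≡.cong (λ r → suc (suc r)) (ℕₚ.*-comm m 2)))
      by-parity (suc zero) zero e l = ⊥-elim (ℕₚ.<⇒≱ (s≤s (s≤s z≤n)) (≡.subst (2 ℕ.≤_) e 2≤δ))
      by-parity (suc zero) (suc m) e l = odd-case m (≡.trans e (≡.cong (λ r → suc (suc (suc r))) (ℕₚ.*-comm m 2)))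
      by-parity (suc (suc r)) m e (s≤s (s≤s ()))

-- Odd characteristic: restrictions on the exponents in powers of `A`.

endo-surjective : ∀ {n} (φ : Fin n → Fin n) → (∀ {i j} → φ i ≡ φ j → i ≡ j) → ∀ b → Σ (Fin n) λ i → φ i ≡ b
endo-surjective {suc n} φ injective b with Finₚ.any? (λ i → φ i Finₚ.≟ b)
... | yes hit = hit
... | no miss = ⊥-elim (ℕₚ.<⇒≱ (ℕₚ.n<1+n n) (Finₚ.injective⇒≤ {f = λ i → Fin.punchOut (avoid i)}
        (λ {i} {j} e → injective (Finₚ.punchOut-injective (avoid i) (avoid j) e))))
  where
  avoid : ∀ i → b ≢ φ i
  avoid i e = miss (i , ≡.sym e)

module Odd (F : FiniteField) (c : ℕ) (1≤c : 1 ℕ.≤ c) (pr : Prime (suc (2 ℕ.* c))) (h : ℕ) (1≤h : 1 ℕ.≤ h)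
  (size≡ : FiniteField.size F ≡ suc (2 ℕ.* c) ℕ.^ h) where
  open Field F
  open Binomial k
  open Translation k
  open TopOfTranslate k
  open +-*-Solver using () renaming (solve to ℕ-solve; _:=_ to _≐_; _:+_ to _⊞_; _:*_ to _⊠_; con to #)

  p : ℕ
  p = suc (2 ℕ.* c)

  open Frobenius k pr (char p h size≡)
  open FrobeniusSeries k pr (char p h size≡) using (mul-power-coefficient)

  -- (p^r − 1) / 2
  half : ℕ → ℕ
  half zero = 0
  half (suc r) = c ℕ.+ p ℕ.* half r

  half-spec : ∀ r → suc (2 ℕ.* half r) ≡ p ℕ.^ r
  half-spec zero = ≡.refl
  half-spec (suc r) = ≡.trans (ℕ-solve 2 (λ c m → # 1 ⊞ # 2 ⊠ (c ⊞ (# 1 ⊞ # 2 ⊠ c) ⊠ m) ≐ (# 1 ⊞ # 2 ⊠ c) ⊠ (# 1 ⊞ # 2 ⊠ m)) ≡.refl c (half r))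
    (≡.cong (p ℕ.*_) (half-spec r))

  -- In base `p` all digits of `half r` equal `c`; this concatenates two blocks of digits.
  half-+ : ∀ r s → half (r ℕ.+ s) ≡ half r ℕ.+ half s ℕ.* p ℕ.^ r
  half-+ zero s = ≡.sym (ℕₚ.*-identityʳ (half s))
  half-+ (suc r) s = ≡.trans (≡.cong (λ x → c ℕ.+ p ℕ.* x) (half-+ r s))
    (ℕ-solve 5 (λ c p a b q → c ⊞ p ⊠ (a ⊞ b ⊠ q) ≐ c ⊞ p ⊠ a ⊞ b ⊠ (p ⊠ q)) ≡.refl c p (half r) (half s) (p ℕ.^ r))

  half< : ∀ r → half r ℕ.< p ℕ.^ r
  half< r = ≡.subst (half r ℕ.<_) (half-spec r) (s≤s (ℕₚ.m≤m+n (half r) (half r ℕ.+ 0)))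

  1≤half : ∀ r → 1 ℕ.≤ r → c ℕ.≤ half r
  1≤half (suc r) _ = ℕₚ.m≤m+n c (p ℕ.* half r)

  m : ℕ
  m = half h

  1≤m : 1 ℕ.≤ m
  1≤m = ℕₚ.≤-trans 1≤c (1≤half h 1≤h)

  size-m : size ≡ suc (2 ℕ.* m)
  size-m = ≡.trans size≡ (≡.sym (half-spec h))

  2<size : 2 ℕ.< size
  2<size = ≡.subst (2 ℕ.<_) (≡.sym size-m) (s≤s (ℕₚ.*-monoʳ-≤ 2 1≤m))

  open PowerSums F 2<size

  pred-size : size ∸ 1 ≡ 2 ℕ.* m
  pred-size = ≡.cong (_∸ 1) size-m

  m<2m : m ℕ.< 2 ℕ.* m
  m<2m = ℕₚ.m<m+n m (ℕₚ.≤-trans 1≤m (ℕₚ.m≤m+n m 0))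

  total-2m : total (_^ (2 ℕ.* m)) ≈ - 1#
  total-2m = ≡.subst (λ r → total (_^ r) ≈ - 1#) pred-size power-sum-top

  total-other : ∀ E → 0 ℕ.< E → (∀ n → E ≢ suc n ℕ.* (2 ℕ.* m)) → total (_^ E) ≈ 0#
  total-other E 0<E ne = total-power E 0<E (λ n e → ne n (≡.trans e (≡.cong (suc n ℕ.*_) pred-size)))

  fermat-2m : ∀ x → ¬ (x ≈ 0#) → x ^ (2 ℕ.* m) ≈ 1#
  fermat-2m x ne = ≡.subst (λ r → x ^ r ≈ 1#) pred-size (fermat′ x ne)

  square-^m : ∀ x → ¬ (x ≈ 0#) → x ^ m * x ^ m ≈ 1#
  square-^m x ne = trans (sym (^-homo-* x m m)) (trans (reflexive (≡.cong (λ r → x ^ (m ℕ.+ r)) (≡.sym (ℕₚ.+-identityʳ m)))) (fermat-2m x ne))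

  -- The value of this central binomial coefficient is left open; the equation in `nonsquare` shows
  -- that it is nonzero as soon as one such `s` exists.
  middle : Carrier
  middle = ι ((2 ℕ.* m) choose m)

  -- Summing (v² + s)^(q−1) = 1 over v; only the powers v^(q−1) and v^(2(q−1)) contribute.
  nonsquare : ∀ s → (∀ v → ¬ (v * v + s ≈ 0#)) → middle * s ^ m ≈ - 1#
  nonsquare s ns = begin
    middle * s ^ m ≈⟨ solve 1 (λ x → x := :- ((:- x) :+ (:- con (1 , 0))) :- con (1 , 0)) refl (middle * s ^ m) ⟩
    - (- (middle * s ^ m) + - 1#) + - 1# ≈⟨ +-congʳ (trans (-‿cong (trans (sym expanded) (trans (total-cong (λ v → fermat-2m (v * v + s) (ns v))) (total-C 1#)))) -0#≈0#) ⟩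
    0# + - 1# ≈⟨ +-identityˡ _ ⟩
    - 1# ∎
    where
    t : ℕ → Carrier
    t i = ι ((2 ℕ.* m) choose i) * s ^ (2 ℕ.* m ∸ i) * total (_^ (2 ℕ.* i))
    summand : ∀ v i → ι ((2 ℕ.* m) choose i) * ((v * v) ^ i * s ^ (2 ℕ.* m ∸ i)) ≈ ι ((2 ℕ.* m) choose i) * s ^ (2 ℕ.* m ∸ i) * v ^ (2 ℕ.* i)
    summand v i = trans (*-congˡ (*-congʳ (trans (^-congˡ i (*-congˡ (sym (*-identityʳ v)))) (^-assocʳ v 2 i))))
      (solve 3 (λ a b c → a :* (b :* c) := a :* c :* b) refl _ _ _)
    off : ∀ i → i ℕ.< 2 ℕ.* m → i ≢ m → t i ≈ 0#
    off zero l ne = zero-mulʳ (total-C 1#)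
    off (suc i) l ne = zero-mulʳ (total-other (2 ℕ.* suc i) (s≤s z≤n) λ n e →
      resonant n (ℕₚ.*-cancelˡ-≡ (suc i) (suc n ℕ.* m) 2 (≡.trans e (ℕ-solve 2 (λ n m → n ⊠ (# 2 ⊠ m) ≐ # 2 ⊠ (n ⊠ m)) ≡.refl (suc n) m))))
      where
      resonant : ∀ n → suc i ≡ suc n ℕ.* m → ⊥
      resonant zero e = ne (≡.trans e (ℕₚ.*-identityˡ m))
      resonant (suc n) e = ℕₚ.<⇒≱ l (≡.subst (2 ℕ.* m ℕ.≤_) (≡.sym e) (ℕₚ.*-monoˡ-≤ m {2} {suc (suc n)} (s≤s (s≤s z≤n))))
    expanded : total (λ v → (v * v + s) ^ (2 ℕ.* m)) ≈ - (middle * s ^ m) + - 1#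
    expanded = begin
      total (λ v → (v * v + s) ^ (2 ℕ.* m))
        ≈⟨ total-cong (λ v → trans (binomial-theorem (2 ℕ.* m) (v * v) s) (∑-cong (suc (2 ℕ.* m)) (λ i _ → summand v i))) ⟩
      total (λ v → ∑ (suc (2 ℕ.* m)) (λ i → ι ((2 ℕ.* m) choose i) * s ^ (2 ℕ.* m ∸ i) * v ^ (2 ℕ.* i)))
        ≈⟨ trans (total-∑ (suc (2 ℕ.* m)) (λ i v → ι ((2 ℕ.* m) choose i) * s ^ (2 ℕ.* m ∸ i) * v ^ (2 ℕ.* i)))
             (∑-cong (suc (2 ℕ.* m)) (λ i _ → total-* (ι ((2 ℕ.* m) choose i) * s ^ (2 ℕ.* m ∸ i)) (_^ (2 ℕ.* i)))) ⟩
      ∑ (suc (2 ℕ.* m)) t ≈⟨ ∑-last (2 ℕ.* m) t ⟩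
      ∑ (2 ℕ.* m) t + t (2 ℕ.* m) ≈⟨ +-cong (trans (∑-single (2 ℕ.* m) m {t} m<2m off) at-m) at-2m ⟩
      - (middle * s ^ m) + - 1# ∎
      where
      at-m : t m ≈ - (middle * s ^ m)
      at-m = trans (*-cong (*-congˡ (reflexive (≡.cong (s ^_) (≡.trans (ℕₚ.m+n∸m≡n m (m ℕ.+ 0)) (ℕₚ.+-identityʳ m))))) total-2m)
        (solve 1 (λ x → x :* (:- con (1 , 0)) := :- x) refl (middle * s ^ m))
      at-2m : t (2 ℕ.* m) ≈ - 1#
      at-2m = trans (*-cong (*-cong (reflexive (≡.cong ι (nCn≡1 (2 ℕ.* m)))) (reflexive (≡.cong (s ^_) (ℕₚ.n∸n≡0 (2 ℕ.* m)))))
          (≡.subst (λ r → total (_^ (2 ℕ.* r)) ≈ - 1#) pred-size (total-multiple 1)))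
        (trans (*-congʳ (*-identityˡ 1#)) (*-identityˡ _))

  -- For the residue `x` of `n` modulo `p`, passing from `x` to the remainder of `p` by `x` keeps
  -- `ι x` zero, until `x` divides the prime `p`.
  ι-nonzero : ∀ {n} → ¬ (p ∣ n) → ¬ (ι n ≈ 0#)
  ι-nonzero {n} p∤n z = small (suc r) r (ℕₚ.n<1+n r) 0<r (DivMod.m%n<n n p) (trans (reduce n p (char p h size≡)) z)
    where
    r = n DivMod.% p
    0<r : 0 ℕ.< r
    0<r = ℕₚ.n≢0⇒n>0 (λ e → p∤n (∣.m%n≡0⇒n∣m n p e))
    reduce : ∀ n p′ .{{_ : ℕ.NonZero p′}} → ι p′ ≈ 0# → ι (n DivMod.% p′) ≈ ι n
    reduce n p′ z = sym (trans (reflexive (≡.cong ι (DivMod.m≡m%n+[m/n]*n n p′)))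
      (trans (ι-+ (n DivMod.% p′) _) (trans (+-congˡ (trans (ι-* (n DivMod./ p′) p′) (zero-mulʳ z))) (+-identityʳ _))))
    small : ∀ b x → x ℕ.< b → 0 ℕ.< x → x ℕ.< p → ¬ (ι x ≈ 0#)
    small (suc b) (suc x) (s≤s l) _ x<p z with p DivMod.% suc x in eq
    ... | zero = divisor (prime⇒irreducible pr (∣.m%n≡0⇒n∣m p (suc x) eq))
      where
      divisor : suc x ≡ 1 ⊎ suc x ≡ p → ⊥
      divisor (inj₁ e) = 1≉0 (trans (reflexive (≡.cong ι (≡.sym e))) z)
      divisor (inj₂ e) = ℕₚ.<⇒≢ x<p e
    ... | suc y = small b (suc y) (ℕₚ.<-≤-trans y<x l) (s≤s z≤n) (ℕₚ.<-trans y<x x<p)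
        (trans (reflexive (≡.cong ι (≡.sym eq))) (trans (reduce p (suc x) z) (char p h size≡)))
      where
      y<x : suc y ℕ.< suc x
      y<x = ≡.subst (ℕ._< suc x) eq (DivMod.m%n<n p (suc x))

  binomial-coefficient : ∀ n N → ((C 1# 𝔹.+ X) 𝔹.^ n) N ≈ ι (n choose N)
  binomial-coefficient zero zero = refl
  binomial-coefficient zero (suc N) = refl
  binomial-coefficient (suc n) zero = trans (shift-at-0 1# ((C 1# 𝔹.+ X) 𝔹.^ n)) (trans (*-identityˡ _) (binomial-coefficient n 0))
  binomial-coefficient (suc n) (suc N) = trans (shift-at-suc 1# ((C 1# 𝔹.+ X) 𝔹.^ n) N)
    (trans (+-cong (trans (*-identityˡ _) (binomial-coefficient n (suc N))) (binomial-coefficient n N))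
      (trans (+-comm _ _) (trans (sym (ι-+ (n choose N) (n choose suc N))) (reflexive (≡.cong ι (nCk+nC[k+1]≡[n+1]C[k+1] n N))))))

  -- Lucas's congruence, from `(1 + X)^(a + b P) = (1 + X)^a * ((1 + X)^b)^P` with `P = p^r`; as `a
  -- = half r < P`, the first factor only reaches the low block of digits.
  lucas : ∀ r s t s′ → t ℕ.< p ℕ.^ r →
    ι (half (r ℕ.+ s) choose (t ℕ.+ p ℕ.^ r ℕ.* s′)) ≈ ι (half r choose t) * ι (half s choose s′) ^ (p ℕ.^ r)
  lucas r s t s′ t<P = begin
    ι (half (r ℕ.+ s) choose N) ≈⟨ binomial-coefficient (half (r ℕ.+ s)) N ⟨
    (B 𝔹.^ half (r ℕ.+ s)) N ≈⟨ at split N ⟩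
    ((B 𝔹.^ half r) 𝔹.* ((B 𝔹.^ half s) 𝔹.^ P)) N ≈⟨ mul-power-coefficient r (B 𝔹.^ half r) (B 𝔹.^ half s) t s′ t<P ⟩
    ∑ (suc s′) u ≈⟨ trans (∑-last s′ u) (trans (+-congʳ (∑-zero s′ vanish)) (+-identityˡ _)) ⟩
    u s′ ≈⟨ *-cong (trans (reflexive (≡.cong (B 𝔹.^ half r) (≡.trans (≡.cong (λ x → t ℕ.+ P ℕ.* x) (ℕₚ.n∸n≡0 s′)) (≡.trans (≡.cong (t ℕ.+_) (ℕₚ.*-zeroʳ P)) (ℕₚ.+-identityʳ t))))) (binomial-coefficient (half r) t))
                  (^-congˡ P (binomial-coefficient (half s) s′)) ⟩
    ι (half r choose t) * ι (half s choose s′) ^ P ∎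
    where
    P = p ℕ.^ r
    N = t ℕ.+ P ℕ.* s′
    B = C 1# 𝔹.+ X
    u : ℕ → Carrier
    u i = (B 𝔹.^ half r) (t ℕ.+ P ℕ.* (s′ ∸ i)) * (B 𝔹.^ half s) i ^ P
    split : (B 𝔹.^ half (r ℕ.+ s)) 𝔹.≈ ((B 𝔹.^ half r) 𝔹.* ((B 𝔹.^ half s) 𝔹.^ P))
    split = 𝔹.trans (𝔹.reflexive (≡.cong (B 𝔹.^_) (half-+ r s))) (𝔹.trans (𝔹.^-homo-* B (half r) (half s ℕ.* P)) (𝔹.*-congˡ (𝔹.sym (𝔹.^-assocʳ B (half s) P))))
    vanish : ∀ i → i ℕ.< s′ → u i ≈ 0#
    vanish i l = zero-mulˡ (trans (binomial-coefficient (half r) (t ℕ.+ P ℕ.* (s′ ∸ i))) (reflexive (≡.cong ι (k>n⇒nCk≡0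
      (ℕₚ.<-≤-trans (half< r) (ℕₚ.≤-trans (ℕₚ.≤-trans (ℕₚ.≤-reflexive (≡.sym (ℕₚ.*-identityʳ P))) (ℕₚ.*-monoʳ-≤ P (ℕₚ.m<n⇒0<n∸m l))) (ℕₚ.m≤n+m (P ℕ.* (s′ ∸ i)) t)))))))

  low-digits : ∀ {r} H t → r ℕ.≤ H → t ℕ.< p ℕ.^ r → ι (half H choose t) ≈ ι (half r choose t)
  low-digits {r} H t r≤H t<P = begin
    ι (half H choose t) ≡⟨ ≡.cong₂ (λ x y → ι (half x choose y)) (≡.sym (ℕₚ.m+[n∸m]≡n r≤H)) (≡.sym (≡.trans (≡.cong (t ℕ.+_) (ℕₚ.*-zeroʳ (p ℕ.^ r))) (ℕₚ.+-identityʳ t))) ⟩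
    ι (half (r ℕ.+ (H ∸ r)) choose (t ℕ.+ p ℕ.^ r ℕ.* 0)) ≈⟨ lucas r (H ∸ r) t 0 t<P ⟩
    ι (half r choose t) * ι (half (H ∸ r) choose 0) ^ (p ℕ.^ r) ≈⟨ trans (*-congˡ (1^ (p ℕ.^ r))) (*-identityʳ _) ⟩
    ι (half r choose t) ∎

  vanishing-binomial : ∀ {r} N → r ℕ.≤ h → half r ℕ.< N → N ℕ.< p ℕ.^ r → ι (m choose N) ≈ 0#
  vanishing-binomial N r≤h lo hi = trans (low-digits h N r≤h hi) (reflexive (≡.cong ι (k>n⇒nCk≡0 lo)))

  binomial-half : ∀ {l} → l ℕ.≤ h → ¬ (ι (m choose half l) ≈ 0#)
  binomial-half {l} l≤h e = 1≉0 (trans (sym (trans (low-digits h (half l) l≤h (half< l)) (reflexive (≡.cong ι (nCn≡1 (half l)))))) e)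

  binomial-digit : ∀ H i → 1 ℕ.≤ H → i ℕ.≤ c → ¬ (ι (half H choose i) ≈ 0#)
  binomial-digit H i 1≤H i≤c e = ι-nonzero (prime∤binomial pr c i c<p i≤c)
    (trans (reflexive (≡.cong (λ x → ι (x choose i)) (≡.sym (≡.trans (≡.cong (c ℕ.+_) (ℕₚ.*-zeroʳ p)) (ℕₚ.+-identityʳ c)))))
      (trans (sym (low-digits {1} H i 1≤H (≡.subst (i ℕ.<_) (≡.sym (ℕₚ.*-identityʳ p)) (ℕₚ.≤-<-trans i≤c c<p)))) e))
    where
    c<p : c ℕ.< p
    c<p = s≤s (ℕₚ.m≤m+n c (c ℕ.+ 0))

  binomial-two-digits : ∀ {t} → 1 ℕ.≤ t → t ℕ.< h → ¬ (ι (m choose (c ℕ.+ p ℕ.^ t ℕ.* c)) ≈ 0#)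
  binomial-two-digits {t} 1≤t t<h e = *-≉0 (binomial-digit t c 1≤t ℕₚ.≤-refl)
    (^-≉0 (p ℕ.^ t) (binomial-digit (h ∸ t) c (ℕₚ.m<n⇒0<n∸m t<h) ℕₚ.≤-refl))
    (trans (sym (lucas t (h ∸ t) c c (ℕₚ.≤-<-trans (1≤half t 1≤t) (half< t))))
      (trans (reflexive (≡.cong (λ x → ι (half x choose (c ℕ.+ p ℕ.^ t ℕ.* c))) (ℕₚ.m+[n∸m]≡n (ℕₚ.<⇒≤ t<h)))) e))

  -- A function whose difference quotients all lie in one coset of the squares.
  module Carlitz (ε : Carrier) (ε≉0 : ¬ (ε ≈ 0#)) where

    Coset : (Carrier → Carrier) → Set
    Coset a = ∀ x y → (a x + - a y) ^ m ≈ ε * (x + - y) ^ m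

    coset-injective : ∀ {a} → Coset a → ∀ x y → a x ≈ a y → x ≈ y
    coset-injective {a} coset x y e = ≈-from-sub (≈-stable λ ne → *-≉0 ε≉0 (^-≉0 m ne)
      (trans (sym (coset x y)) (trans (^-congˡ m (trans (+-congʳ e) (-‿inverseʳ (a y)))) (0^ m 1≤m))))

    module Moments (D : ℕ) (A : PS) (degA : Deg D A) (coset : Coset (ev D A)) where

      a b : Carrier → Carrier
      a = ev D A
      b y = - a y

      b-injective : ∀ x y → b x ≈ b y → x ≈ y
      b-injective x y e = coset-injective coset x y (trans (sym (-‿involutive (a x))) (trans (-‿cong e) (-‿involutive (a y))))

      index-injective : ∀ {i j} → ix (b (el i)) ≡ ix (b (el j)) → i ≡ j
      index-injective {i} {j} e = el-injective (≈⇒≡ (b-injective (el i) (el j)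
        (reflexive (≡.trans (≡.sym (el-ix _)) (≡.trans (≡.cong el e) (el-ix _))))))

      inverse-b : Carrier → Carrier
      inverse-b z = el (proj₁ (endo-surjective (ix ∘ b ∘ el) index-injective (ix z)))

      b-inverse : ∀ z → b (inverse-b z) ≈ z
      b-inverse z = reflexive (≡.trans (≡.sym (el-ix _)) (≡.trans (≡.cong el (proj₂ (endo-surjective (ix ∘ b ∘ el) index-injective (ix z)))) (el-ix z)))

      total-b : ∀ E → total (λ y → b y ^ E) ≈ total (_^ E)
      total-b E = total-permute b inverse-b b-inverse (λ y → b-injective _ y (b-inverse (b y))) (_^ E) (^-congˡ E)

      module _ (j : ℕ) (j≤m : j ℕ.≤ m) where

        -- Chosen so that the exponent `m - i + r` of `b y` equals `q - 1` exactly for `i = j`.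
        r : ℕ
        r = 2 ℕ.* m ∸ (m ∸ j)

        m-j≤2m : m ∸ j ℕ.≤ 2 ℕ.* m
        m-j≤2m = ℕₚ.≤-trans (ℕₚ.m∸n≤m m j) (ℕₚ.m≤m+n m (m ℕ.+ 0))

        m≤r : m ℕ.≤ r
        m≤r = ≡.subst (ℕ._≤ r) (≡.trans (ℕₚ.m+n∸m≡n m (m ℕ.+ 0)) (ℕₚ.+-identityʳ m)) (ℕₚ.∸-monoʳ-≤ (2 ℕ.* m) (ℕₚ.m∸n≤m m j))

        -- Expanding `(a x + b y)^m` isolates `a x ^ j`. By the coset identity the same sum is a
        -- combination of the terms of `(x - y)^m`, where only exponents `N` with `m choose N`
        -- nonzero in the field occur.
        moment : Carrier → Carrier
        moment x = total (λ y → b y ^ r * (a x + b y) ^ m)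

        moment-left : ∀ x → moment x ≈ - ι (m choose j) * a x ^ j
        moment-left x = begin
          moment x ≈⟨ total-cong (λ y → trans (*-congˡ (binomial-theorem m (a x) (b y))) (trans (sym (∑-*ˡ (suc m) (b y ^ r) (λ i → ι (m choose i) * (a x ^ i * b y ^ (m ∸ i)))))
                        (∑-cong (suc m) (λ i _ → summand y i)))) ⟩
          total (λ y → ∑ (suc m) (λ i → ι (m choose i) * a x ^ i * b y ^ (m ∸ i ℕ.+ r)))
            ≈⟨ trans (total-∑ (suc m) (λ i y → ι (m choose i) * a x ^ i * b y ^ (m ∸ i ℕ.+ r)))
                 (∑-cong (suc m) (λ i _ → trans (total-* (ι (m choose i) * a x ^ i) (λ y → b y ^ (m ∸ i ℕ.+ r))) (*-congˡ (total-b (m ∸ i ℕ.+ r))))) ⟩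
          ∑ (suc m) t ≈⟨ ∑-single (suc m) j {t} (s≤s j≤m) (λ { i (s≤s l) ne → off i l ne }) ⟩
          t j ≈⟨ *-congˡ (trans (reflexive (≡.cong (λ e → total (_^ e)) (ℕₚ.m+[n∸m]≡n m-j≤2m))) total-2m) ⟩
          ι (m choose j) * a x ^ j * - 1# ≈⟨ solve 2 (λ u v → u :* v :* (:- con (1 , 0)) := (:- u) :* v) refl _ _ ⟩
          - ι (m choose j) * a x ^ j ∎
          where
          t : ℕ → Carrier
          t i = ι (m choose i) * a x ^ i * total (_^ (m ∸ i ℕ.+ r))
          summand : ∀ y i → b y ^ r * (ι (m choose i) * (a x ^ i * b y ^ (m ∸ i))) ≈ ι (m choose i) * a x ^ i * b y ^ (m ∸ i ℕ.+ r)
          summand y i = trans (solve 4 (λ q u v w → q :* (u :* (v :* w)) := u :* v :* (w :* q)) refl (b y ^ r) _ (a x ^ i) (b y ^ (m ∸ i)))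
            (*-congˡ (sym (^-homo-* (b y) (m ∸ i) r)))
          off : ∀ i → i ℕ.≤ m → i ≢ j → t i ≈ 0#
          off i i≤m ne = zero-mulʳ (total-other (m ∸ i ℕ.+ r) (ℕₚ.<-≤-trans (ℕₚ.<-≤-trans 1≤m m≤r) (ℕₚ.m≤n+m r (m ∸ i))) resonant)
            where
            resonant : ∀ n → m ∸ i ℕ.+ r ≢ suc n ℕ.* (2 ℕ.* m)
            resonant zero e = ne (ℕₚ.∸-cancelˡ-≡ i≤m j≤m (ℕₚ.+-cancelʳ-≡ r (m ∸ i) (m ∸ j)
              (≡.trans e (≡.trans (ℕₚ.+-identityʳ (2 ℕ.* m)) (≡.sym (ℕₚ.m+[n∸m]≡n m-j≤2m))))))
            resonant (suc n) e = ℕₚ.<⇒≱ (ℕₚ.≤-<-trans (ℕₚ.+-mono-≤ (ℕₚ.m∸n≤m m i) (ℕₚ.m∸n≤m (2 ℕ.* m) (m ∸ j))) (ℕₚ.+-monoˡ-< (2 ℕ.* m) m<2m))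
              (≡.subst (2 ℕ.* m ℕ.+ 2 ℕ.* m ℕ.≤_) (≡.sym e) (ℕₚ.≤-trans (ℕₚ.≤-reflexive (≡.cong (2 ℕ.* m ℕ.+_) (≡.sym (ℕₚ.+-identityʳ (2 ℕ.* m))))) (ℕₚ.*-monoˡ-≤ (2 ℕ.* m) {2} {suc (suc n)} (s≤s (s≤s z≤n)))))

        kernel : ℕ → Carrier
        kernel N = ε * total (λ y → b y ^ r * (- y) ^ (m ∸ N))

        right : PS
        right N = ι (m choose N) * kernel N

        Deg-right : Deg m right
        Deg-right N l = zero-mulˡ (reflexive (≡.cong ι (k>n⇒nCk≡0 l)))

        moment-right : ∀ x → moment x ≈ ev m right x
        moment-right x = begin
          moment x ≈⟨ total-cong (λ y → trans (*-congˡ (trans (coset x y) (*-congˡ (binomial-theorem m x (- y)))))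
               (trans (sym (trans (*-assoc (b y ^ r) ε _) refl))
                 (trans (sym (∑-*ˡ (suc m) (b y ^ r * ε) (λ N → ι (m choose N) * (x ^ N * (- y) ^ (m ∸ N)))))
                   (∑-cong (suc m) (λ N _ → solve 5 (λ q e u v w → q :* e :* (u :* (v :* w)) := u :* v :* e :* (q :* w)) refl (b y ^ r) ε (ι (m choose N)) (x ^ N) ((- y) ^ (m ∸ N))))))) ⟩
          total (λ y → ∑ (suc m) (λ N → ι (m choose N) * x ^ N * ε * (b y ^ r * (- y) ^ (m ∸ N))))
            ≈⟨ trans (total-∑ (suc m) (λ N y → ι (m choose N) * x ^ N * ε * (b y ^ r * (- y) ^ (m ∸ N))))
                 (∑-cong (suc m) (λ N _ → trans (total-* (ι (m choose N) * x ^ N * ε) (λ y → b y ^ r * (- y) ^ (m ∸ N)))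
                   (solve 4 (λ u v e t → u :* v :* e :* t := u :* (e :* t) :* v) refl (ι (m choose N)) (x ^ N) ε (total (λ y → b y ^ r * (- y) ^ (m ∸ N)))))) ⟩
          ∑ (suc m) (λ N → right N * x ^ N) ≈⟨ ev-∑ m right x ⟨
          ev m right x ∎

        power-coefficients : j ℕ.* D ℕ.< size → ¬ (ι (m choose j) ≈ 0#) → ∀ N → ι (m choose N) ≈ 0# → (A 𝔹.^ j) N ≈ 0#
        power-coefficients jD<q nz N zN = domain (begin
            - ι (m choose j) * (A 𝔹.^ j) N ≈⟨ at (coefficients-unique M left right M<q (Deg-mono {f = left} (ℕₚ.m≤n⊔m m (j ℕ.* D)) Deg-left)
                (Deg-mono {f = right} (ℕₚ.m≤m⊔n m (j ℕ.* D)) Deg-right) same) N ⟩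
            right N ≈⟨ zero-mulˡ zN ⟩
            0# ∎) (λ e → nz (trans (sym (-‿involutive _)) (trans (-‿cong e) -0#≈0#)))
          where
          M = m ⊔ (j ℕ.* D)
          left : PS
          left N = - ι (m choose j) * (A 𝔹.^ j) N
          Deg-left : Deg (j ℕ.* D) left
          Deg-left N l = zero-mulʳ (Deg-^ D j degA N l)
          M<q : M ℕ.< size
          M<q = ℕₚ.⊔-lub (≡.subst (suc m ℕ.≤_) (≡.sym size-m) (s≤s (ℕₚ.<⇒≤ m<2m))) jD<q
          same : ∀ x → ev M left x ≈ ev M right x
          same x = begin
            ev M left x ≈⟨ ev-mono (j ℕ.* D) M x (ℕₚ.m≤n⊔m m (j ℕ.* D)) Deg-left ⟨
            ev (j ℕ.* D) left x ≈⟨ ev-scale (j ℕ.* D) (- ι (m choose j)) (A 𝔹.^ j) x ⟩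
            - ι (m choose j) * ev (j ℕ.* D) (A 𝔹.^ j) x ≈⟨ *-congˡ (ev-^ D j A x degA) ⟩
            - ι (m choose j) * a x ^ j ≈⟨ trans (sym (moment-left x)) (moment-right x) ⟩
            ev m right x ≈⟨ ev-mono m M x (ℕₚ.m≤m⊔n m (j ℕ.* D)) Deg-right ⟩
            ev M right x ∎

      powers : ∀ j N → j ℕ.* D ℕ.< size → ¬ (ι (m choose j) ≈ 0#) → ι (m choose N) ≈ 0# → (A 𝔹.^ j) N ≈ 0#
      powers j N jD<q nz zN with j ℕ.≤? m
      ... | yes j≤m = power-coefficients j j≤m jD<q nz N zN
      ... | no nl = ⊥-elim (nz (reflexive (≡.cong ι (k>n⇒nCk≡0 (ℕₚ.≰⇒> nl)))))

      -- The leading exponent `j D` of the `j`-th power of `A` must have a nonzero binomial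
      -- coefficient, so it cannot lie strictly between `half r` and `p^r`.
      doubling : ¬ (A D ≈ 0#) → ∀ j r → r ℕ.≤ h → ¬ (ι (m choose j) ≈ 0#) → j ℕ.* D ℕ.< p ℕ.^ r → 2 ℕ.* (j ℕ.* D) ℕ.< p ℕ.^ r
      doubling lead j r r≤h nz lt with j ℕ.* D ℕ.≤? half r
      ... | yes le = ≡.subst (2 ℕ.* (j ℕ.* D) ℕ.<_) (half-spec r) (s≤s (ℕₚ.*-monoʳ-≤ 2 le))
      ... | no nl = ⊥-elim (^-≉0 j lead (trans (sym (top-^ D j degA))
              (powers j (j ℕ.* D) (ℕₚ.<-≤-trans lt (≡.subst (p ℕ.^ r ℕ.≤_) (≡.sym size≡) (ℕₚ.^-monoʳ-≤ p r≤h))) nz (vanishing-binomial (j ℕ.* D) r≤h (ℕₚ.≰⇒> nl) lt))))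

-- Odd characteristic: only monomials survive.

logarithm : ∀ p → 1 ℕ.< p → ∀ δ → 1 ℕ.≤ δ → Σ ℕ λ r → p ℕ.^ r ℕ.≤ δ × δ ℕ.< p ℕ.^ suc r
logarithm p 1<p (suc zero) _ = 0 , ℕₚ.≤-refl , ≡.subst (1 ℕ.<_) (≡.sym (ℕₚ.*-identityʳ p)) 1<p
logarithm p 1<p (suc (suc δ)) _ with logarithm p 1<p (suc δ) (s≤s z≤n)
... | r , lo , hi with suc (suc δ) ℕ.<? p ℕ.^ suc r
... | yes lt = r , ℕₚ.m≤n⇒m≤1+n lo , lt
... | no nl = suc r , ℕₚ.≤-reflexive (≡.sym e) , ≡.subst (ℕ._< p ℕ.* p ℕ.^ suc r) (≡.sym e)
        (ℕₚ.<-≤-trans (ℕₚ.m<n+m (p ℕ.^ suc r) {p ℕ.^ suc r} (≡.subst (0 ℕ.<_) e (s≤s z≤n))) (≡.subst (ℕ._≤ p ℕ.* p ℕ.^ suc r) (≡.cong (p ℕ.^ suc r ℕ.+_) (ℕₚ.+-identityʳ _)) (ℕₚ.*-monoˡ-≤ (p ℕ.^ suc r) 1<p)))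
  where
  e : suc (suc δ) ≡ p ℕ.^ suc r
  e = ℕₚ.≤-antisym hi (ℕₚ.≮⇒≥ nl)

module DigitBounds where
  open ℕₚ.≤-Reasoning
  open +-*-Solver

  next-digit : ∀ c p .{{_ : ℕ.NonZero p}} a δ r l → 2 ℕ.* (c ℕ.* δ) ℕ.< p ℕ.^ suc r → 2 ℕ.* (a ℕ.* δ) ℕ.< p ℕ.^ (r ℕ.+ l) →
    (c ℕ.+ p ℕ.* a) ℕ.* δ ℕ.< p ℕ.^ (r ℕ.+ suc l)
  next-digit c p a δ r l lt lt′ = ℕₚ.*-cancelˡ-< 2 _ _ (begin-strict
    2 ℕ.* ((c ℕ.+ p ℕ.* a) ℕ.* δ)
      ≡⟨ solve 4 (λ c p a d → con 2 :* ((c :+ p :* a) :* d) := con 2 :* (c :* d) :+ p :* (con 2 :* (a :* d))) ≡.refl c p a δ ⟩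
    2 ℕ.* (c ℕ.* δ) ℕ.+ p ℕ.* (2 ℕ.* (a ℕ.* δ)) <⟨ ℕₚ.+-mono-<-≤ lt (ℕₚ.*-monoʳ-≤ p (ℕₚ.<⇒≤ lt′)) ⟩
    p ℕ.^ suc r ℕ.+ p ℕ.^ suc (r ℕ.+ l) ≤⟨ ℕₚ.+-monoˡ-≤ (p ℕ.^ suc (r ℕ.+ l)) (ℕₚ.^-monoʳ-≤ p (s≤s (ℕₚ.m≤m+n r l))) ⟩
    p ℕ.^ suc (r ℕ.+ l) ℕ.+ p ℕ.^ suc (r ℕ.+ l) ≡⟨ ≡.cong (λ e → p ℕ.^ e ℕ.+ p ℕ.^ e) (ℕₚ.+-suc r l) ⟨
    p ℕ.^ (r ℕ.+ suc l) ℕ.+ p ℕ.^ (r ℕ.+ suc l) ≡⟨ ≡.cong (p ℕ.^ (r ℕ.+ suc l) ℕ.+_) (ℕₚ.+-identityʳ _) ⟨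
    2 ℕ.* p ℕ.^ (r ℕ.+ suc l) ∎)

  -- The inequality behind this is `(p Q - 1)(Q + 1) ≥ p Q^2` for `Q = p^r`.
  digit-overflow : ∀ p r H δ → suc H ≡ p ℕ.^ suc r → p ℕ.^ r ℕ.< δ → δ ℕ.< p ℕ.^ suc r → ¬ (H ℕ.* δ ℕ.< p ℕ.^ (r ℕ.+ suc r))
  digit-overflow p r H δ e q<δ hi lt = ℕₚ.<-irrefl ≡.refl (begin-strict
    p ℕ.^ (r ℕ.+ suc r) ≡⟨ ≡.trans (ℕₚ.^-distribˡ-+-* p r (suc r)) (ℕₚ.*-comm q (p ℕ.^ suc r)) ⟩
    p ℕ.^ suc r ℕ.* q ≡⟨ ≡.cong (ℕ._* q) e ⟨
    q ℕ.+ H ℕ.* q ≤⟨ ℕₚ.+-monoˡ-≤ (H ℕ.* q) (ℕₚ.≤-pred (≡.subst (q ℕ.<_) (≡.sym e) (ℕₚ.<-trans q<δ hi))) ⟩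
    H ℕ.+ H ℕ.* q ≡⟨ ℕₚ.*-suc H q ⟨
    H ℕ.* suc q ≤⟨ ℕₚ.*-monoʳ-≤ H q<δ ⟩
    H ℕ.* δ <⟨ lt ⟩
    p ℕ.^ (r ℕ.+ suc r) ∎)
    where q = p ℕ.^ r

module DerivativeOfTranslate (R : Ring₀) where
  open RingLemmas R
  open Series R
  open Translation R

  translate-at-0 : ∀ y m f → translate y m f 0 ≈ ev m f y
  translate-at-0 y zero f = refl
  translate-at-0 y (suc m) f = +-congˡ (trans (shift-at-0 y (translate y m (f ∘ suc))) (*-congˡ (translate-at-0 y m (f ∘ suc))))

  translate-at-1 : ∀ y m f → translate y (suc m) f 1 ≈ ev m (λ n → ι (suc n) * f (suc n)) y
  translate-at-1 y m f = trans (trans (+-identityˡ _) (shift-at-suc y (translate y m (f ∘ suc)) 0)) (go m)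
    where
    go : ∀ m → y * translate y m (f ∘ suc) 1 + translate y m (f ∘ suc) 0 ≈ ev m (λ n → ι (suc n) * f (suc n)) y
    go zero = solve 2 (λ y a → y :* con (0 , 0) :+ a := con (1 , 0) :* a) refl y (f 1)
    go (suc m) = begin
      y * translate y (suc m) (f ∘ suc) 1 + translate y (suc m) (f ∘ suc) 0
        ≈⟨ +-cong (*-congˡ (translate-at-1 y m (f ∘ suc))) (translate-at-0 y (suc m) (f ∘ suc)) ⟩
      y * ev m g y + (f 1 + y * ev m (f ∘ suc ∘ suc) y)
        ≈⟨ solve 4 (λ y s a t → y :* s :+ (a :+ y :* t) := con (1 , 0) :* a :+ y :* (t :+ s)) refl y (ev m g y) (f 1) (ev m (f ∘ suc ∘ suc) y) ⟩
      1# * f 1 + y * (ev m (f ∘ suc ∘ suc) y + ev m g y)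
        ≈⟨ +-congˡ (*-congˡ (trans (sym (ev-+ m (f ∘ suc ∘ suc) g y)) (ev-cong m (pt λ n →
             solve 2 (λ a i → a :+ i :* a := (con (1 , 0) :+ i) :* a) refl (f (suc (suc n))) (ι (suc n))) refl))) ⟩
      ev (suc m) (λ n → ι (suc n) * f (suc n)) y ∎
      where
      g : ℕ → Carrier
      g n = ι (suc n) * f (suc (suc n))

module SmallDegree (F : FiniteField) (c : ℕ) (1≤c : 1 ℕ.≤ c) (pr : Prime (suc (2 ℕ.* c))) (h : ℕ) (1≤h : 1 ℕ.≤ h)
  (size≡ : FiniteField.size F ≡ suc (2 ℕ.* c) ℕ.^ h) where
  open Field F
  open Odd F c 1≤c pr h 1≤h size≡
  open Translation k
  open TopOfTranslate k
  open DerivativeOfTranslate k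
  open Frobenius k pr (char p h size≡)
  open FrobeniusSeries k pr (char p h size≡) using (mul-power-coefficient)
  open +-*-Solver using () renaming (solve to ℕ-solve; _:=_ to _≐_; _:+_ to _⊞_; _:*_ to _⊠_; con to #)

  1<p : 1 ℕ.< p
  1<p = 1<pr pr

  exponent< : ∀ {r s} → p ℕ.^ r ℕ.< p ℕ.^ s → r ℕ.< s
  exponent< {r} {s} l = ℕₚ.≰⇒> λ s≤r → ℕₚ.<⇒≱ l (ℕₚ.^-monoʳ-≤ p s≤r)

  at-0-^ : ∀ n f → (f 𝔹.^ n) 0 ≈ f 0 ^ n
  at-0-^ zero f = refl
  at-0-^ (suc n) f = *-congˡ (at-0-^ n f)

  module _ {f : PS} (f0≈0 : f 0 ≈ 0#) (n : ℕ) where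
    private
      factored : f 𝔹.^ n ≋ (X 𝔹.^ n) 𝔹.* ((f ∘ suc) 𝔹.^ n)
      factored = 𝔹.trans (𝔹.^-congˡ n (𝔹.trans (head-tail f) (𝔹.trans (𝔹.+-congʳ (𝔹.trans (C-cong f0≈0) C-0)) (𝔹.+-identityˡ (X 𝔹.* (f ∘ suc))))))
        (𝔹.^-distrib-* X (f ∘ suc) n)

    power-low : Ord n (f 𝔹.^ n)
    power-low i l = trans (at factored i) (X^*-low n ((f ∘ suc) 𝔹.^ n) i l)

    power-lowest : (f 𝔹.^ n) n ≈ f 1 ^ n
    power-lowest = trans (at factored n) (trans (reflexive (≡.cong ((X 𝔹.^ n) 𝔹.* ((f ∘ suc) 𝔹.^ n)) (≡.sym (ℕₚ.+-identityʳ n))))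
      (trans (X^*-high n ((f ∘ suc) 𝔹.^ n) 0) (at-0-^ n (f ∘ suc))))

  module _ (ε : Carrier) (ε≉0 : ¬ (ε ≈ 0#)) where
    open Carlitz ε ε≉0

    -- Starting from `p^r ≤ δ < p^(r+1)`, `doubling` bounds `2 i δ` for single digits `i ≤ c`, and
    -- then gives `2 (half l) δ < p^(r + l)` one digit at a time. At `l = r + 1` this reads
    -- `(p^(r+1) - 1) δ < p^(2r+1)`, which fails for `δ > p^r`.
    degree-is-power : ∀ δ A → Deg δ A → ¬ (A δ ≈ 0#) → 1 ℕ.≤ δ → δ ℕ.* δ ℕ.* δ ℕ.< size → Coset (ev δ A) →
      Σ ℕ λ t → δ ≡ p ℕ.^ t × t ℕ.< h
    degree-is-power δ A degA lead 1≤δ δ³<size coset with logarithm p 1<p δ 1≤δ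
    ... | r , lo , hi = r , ℕₚ.≤-antisym (ℕₚ.≮⇒≥ not-larger) lo , r<h
      where
      open Moments δ A degA coset using (doubling)
      open DigitBounds

      size-lower : ∀ {x} → x ℕ.≤ δ ℕ.* δ ℕ.* δ → x ℕ.< p ℕ.^ h
      size-lower l = ≡.subst (_ ℕ.<_) size≡ (ℕₚ.≤-<-trans l δ³<size)

      instance
        δ-nonZero : ℕ.NonZero δ
        δ-nonZero = ℕ.>-nonZero 1≤δ

      r<h : r ℕ.< h
      r<h = exponent< (size-lower (ℕₚ.≤-trans lo (ℕₚ.≤-trans (ℕₚ.m≤m*n δ δ) (ℕₚ.m≤m*n (δ ℕ.* δ) δ))))

      -- From `p^(3 r) ≤ δ^3 < q` comes `3 r < h`, which leaves room for `2 r + 1` digits when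
      -- `r ≥ 1`.
      double-r : ∀ r → p ℕ.^ r ℕ.≤ δ → r ℕ.+ suc r ℕ.≤ h
      double-r zero _ = 1≤h
      double-r (suc r) l = ℕₚ.<⇒≤ (ℕₚ.≤-<-trans (ℕₚ.≤-reflexive (ℕ-solve 1 (λ r → # 1 ⊞ r ⊞ (# 2 ⊞ r) ≐ # 3 ⊞ # 2 ⊠ r) ≡.refl r))
        (ℕₚ.≤-<-trans (ℕₚ.+-monoʳ-≤ 3 (ℕₚ.*-monoˡ-≤ r {2} {3} (s≤s (s≤s z≤n))))
          (exponent< (size-lower (ℕₚ.≤-trans (ℕₚ.≤-reflexive cube) (ℕₚ.*-mono-≤ (ℕₚ.*-mono-≤ l l) l))))))
        where
        cube : p ℕ.^ (3 ℕ.+ 3 ℕ.* r) ≡ p ℕ.^ suc r ℕ.* p ℕ.^ suc r ℕ.* p ℕ.^ suc r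
        cube = ≡.trans (≡.cong (p ℕ.^_) (ℕ-solve 1 (λ r → # 3 ⊞ # 3 ⊠ r ≐ (# 1 ⊞ r) ⊞ (# 1 ⊞ r) ⊞ (# 1 ⊞ r)) ≡.refl r))
          (≡.trans (ℕₚ.^-distribˡ-+-* p (suc r ℕ.+ suc r) (suc r)) (≡.cong (ℕ._* p ℕ.^ suc r) (ℕₚ.^-distribˡ-+-* p (suc r) (suc r))))

      digit : ∀ i → i ℕ.≤ c → 2 ℕ.* (i ℕ.* δ) ℕ.< p ℕ.^ suc r
      digit zero _ = 0<p^ (suc r)
      digit (suc i) l = doubling lead (suc i) (suc r) r<h (binomial-digit h (suc i) 1≤h l) (below i (digit i (ℕₚ.<⇒≤ l)))
        where
        -- For `i ≥ 1` one has `(i + 1) δ ≤ 2 i δ`, so each doubling also bounds the next multiple.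
        below : ∀ i → 2 ℕ.* (i ℕ.* δ) ℕ.< p ℕ.^ suc r → suc i ℕ.* δ ℕ.< p ℕ.^ suc r
        below zero _ = ≡.subst (ℕ._< p ℕ.^ suc r) (≡.sym (ℕₚ.*-identityˡ δ)) hi
        below (suc i) lt = ℕₚ.≤-<-trans (ℕₚ.≤-trans (ℕₚ.+-monoˡ-≤ (suc i ℕ.* δ) (ℕₚ.m≤m+n δ (i ℕ.* δ)))
          (ℕₚ.≤-reflexive (≡.cong (suc i ℕ.* δ ℕ.+_) (≡.sym (ℕₚ.+-identityʳ _))))) lt

      all-digits : ∀ l → r ℕ.+ l ℕ.≤ h → 2 ℕ.* (half l ℕ.* δ) ℕ.< p ℕ.^ (r ℕ.+ l)
      all-digits zero _ = 0<p^ (r ℕ.+ 0)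
      all-digits (suc l) le = doubling lead (half (suc l)) (r ℕ.+ suc l) le (binomial-half (ℕₚ.≤-trans (ℕₚ.m≤n+m (suc l) r) le))
        (next-digit c p (half l) δ r l (digit c ℕₚ.≤-refl) (all-digits l (ℕₚ.≤-trans (ℕₚ.+-monoʳ-≤ r (ℕₚ.n≤1+n l)) le)))

      not-larger : ¬ (p ℕ.^ r ℕ.< δ)
      not-larger q<δ = digit-overflow p r (2 ℕ.* half (suc r)) δ (half-spec (suc r)) q<δ hi
        (≡.subst (ℕ._< p ℕ.^ (r ℕ.+ suc r)) (≡.sym (ℕₚ.*-assoc 2 (half (suc r)) δ)) (all-digits (suc r) (double-r r lo)))

    -- With `P = p^T`, the coefficient of `A^(c + P c) = A^c * (A^c)^P` at `2 c P` is a sum over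
    -- `i ≤ 2 c`. The missing constant term of `A` excludes `i < c`, the exponent restriction on
    -- `A^c` excludes `c < i < p`, and `i = c` contributes a product of powers of `A P` and `A 1`.
    -- The whole coefficient vanishes since `2 c P` lies between `half (T + 1)` and `p^(T + 1)`.
    no-linear-term : ∀ T (A : PS) → 1 ℕ.≤ T → T ℕ.< h → p ℕ.^ T ℕ.* p ℕ.^ T ℕ.* p ℕ.^ T ℕ.< size →
      Deg (p ℕ.^ T) A → ¬ (A (p ℕ.^ T) ≈ 0#) → A 0 ≈ 0# → Coset (ev (p ℕ.^ T) A) → A 1 ≈ 0#
    no-linear-term T A 1≤T T<h P³<size degA lead A0≈0 coset = ≈-stable λ A1≉0 →
      *-≉0 (^-≉0 c lead) (^-≉0 P (^-≉0 c A1≉0)) (begin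
        A P ^ c * (A 1 ^ c) ^ P ≈⟨ *-cong (sym (top-^ P c degA)) (^-congˡ P (sym (power-lowest A0≈0 c))) ⟩
        (A 𝔹.^ c) (c ℕ.* P) * (A 𝔹.^ c) c ^ P ≈⟨ *-congʳ (reflexive (≡.cong (A 𝔹.^ c) index)) ⟩
        u c ≈⟨ ∑-single (suc (2 ℕ.* c)) c {u} c<p off ⟨
        ∑ (suc (2 ℕ.* c)) u ≈⟨ mul-power-coefficient T (A 𝔹.^ c) (A 𝔹.^ c) 0 (2 ℕ.* c) (0<p^ T) ⟨
        ((A 𝔹.^ c) 𝔹.* ((A 𝔹.^ c) 𝔹.^ P)) N ≈⟨ at split N ⟨
        (A 𝔹.^ j) N ≈⟨ powers j N jP<size (binomial-two-digits 1≤T T<h) (vanishing-binomial N T<h low high) ⟩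
        0# ∎)
      where
      open Moments (p ℕ.^ T) A degA coset using (powers)
      P = p ℕ.^ T
      N = P ℕ.* (2 ℕ.* c)
      j = c ℕ.+ P ℕ.* c
      u : ℕ → Carrier
      u i = (A 𝔹.^ c) (P ℕ.* (2 ℕ.* c ∸ i)) * (A 𝔹.^ c) i ^ P
      c<p : c ℕ.< p
      c<p = s≤s (ℕₚ.m≤m+n c (c ℕ.+ 0))
      2c≤P : 2 ℕ.* c ℕ.≤ P
      2c≤P = ℕₚ.≤-trans (ℕₚ.n≤1+n (2 ℕ.* c)) (≡.subst (ℕ._≤ P) (ℕₚ.*-identityʳ p) (ℕₚ.^-monoʳ-≤ p 1≤T))
      1≤P : 1 ℕ.≤ P
      1≤P = 0<p^ T
      jP<size : j ℕ.* P ℕ.< size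
      jP<size = ℕₚ.≤-<-trans (ℕₚ.*-monoˡ-≤ P (ℕₚ.≤-trans (ℕₚ.+-monoˡ-≤ (P ℕ.* c) (ℕₚ.≤-trans (ℕₚ.≤-reflexive (≡.sym (ℕₚ.*-identityˡ c))) (ℕₚ.*-monoˡ-≤ c 1≤P)))
        (ℕₚ.≤-trans (ℕₚ.≤-reflexive (ℕ-solve 2 (λ P c → P ⊠ c ⊞ P ⊠ c ≐ P ⊠ (# 2 ⊠ c)) ≡.refl P c)) (ℕₚ.*-monoʳ-≤ P 2c≤P)))) P³<size
      cP<size : c ℕ.* P ℕ.< size
      cP<size = ℕₚ.≤-<-trans (ℕₚ.*-monoˡ-≤ P (ℕₚ.m≤m+n c (P ℕ.* c))) jP<size
      index : c ℕ.* P ≡ P ℕ.* (2 ℕ.* c ∸ c)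
      index = ≡.trans (ℕₚ.*-comm c P) (≡.cong (P ℕ.*_) (≡.sym (≡.trans (ℕₚ.m+n∸m≡n c (c ℕ.+ 0)) (ℕₚ.+-identityʳ c))))
      split : A 𝔹.^ j ≋ (A 𝔹.^ c) 𝔹.* ((A 𝔹.^ c) 𝔹.^ P)
      split = 𝔹.trans (𝔹.^-homo-* A c (P ℕ.* c)) (𝔹.*-congˡ (𝔹.trans (𝔹.reflexive (≡.cong (A 𝔹.^_) (ℕₚ.*-comm P c))) (𝔹.sym (𝔹.^-assocʳ A c P))))
      off : ∀ i → i ℕ.< suc (2 ℕ.* c) → i ≢ c → u i ≈ 0#
      off i i<p ne with i ℕ.<? c
      ... | yes i<c = zero-mulʳ (trans (^-congˡ P (power-low A0≈0 c i i<c)) (0^ P 1≤P))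
      ... | no nl = zero-mulʳ (trans (^-congˡ P (powers c i cP<size (binomial-digit h c 1≤h ℕₚ.≤-refl)
              (vanishing-binomial {1} i 1≤h (≡.subst (ℕ._< i) (≡.sym (≡.trans (≡.cong (c ℕ.+_) (ℕₚ.*-zeroʳ p)) (ℕₚ.+-identityʳ c))) (ℕₚ.≤∧≢⇒< (ℕₚ.≮⇒≥ nl) (ne ∘ ≡.sym)))
                (≡.subst (i ℕ.<_) (≡.sym (ℕₚ.*-identityʳ p)) i<p)))) (0^ P 1≤P))
      low : half (suc T) ℕ.< N
      low = ℕₚ.<-≤-trans (≡.subst (ℕ._< P ℕ.+ c ℕ.* P) (≡.sym halves) (ℕₚ.+-monoˡ-< (c ℕ.* P) (half< T)))
        (ℕₚ.≤-trans (ℕₚ.+-monoˡ-≤ (c ℕ.* P) (ℕₚ.≤-trans (ℕₚ.≤-reflexive (≡.sym (ℕₚ.*-identityˡ P))) (ℕₚ.*-monoˡ-≤ P 1≤c)))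
          (ℕₚ.≤-reflexive (ℕ-solve 2 (λ P c → c ⊠ P ⊞ c ⊠ P ≐ P ⊠ (# 2 ⊠ c)) ≡.refl P c)))
        where
        halves : half (suc T) ≡ half T ℕ.+ c ℕ.* P
        halves = ≡.trans (≡.cong half (ℕₚ.+-comm 1 T)) (≡.trans (half-+ T 1) (≡.cong (λ x → half T ℕ.+ x ℕ.* P) (≡.trans (≡.cong (c ℕ.+_) (ℕₚ.*-zeroʳ p)) (ℕₚ.+-identityʳ c))))
      high : N ℕ.< p ℕ.^ suc T
      high = ≡.subst (ℕ._< p ℕ.* P) (ℕₚ.*-comm (2 ℕ.* c) P) (ℕₚ.m<n+m (2 ℕ.* c ℕ.* P) 1≤P)

    -- Every translate of A is again subject to no-linear-term, so the derivative of A vanishes.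
    derivative-zero : ∀ T (A : PS) → 1 ℕ.≤ T → T ℕ.< h → p ℕ.^ T ℕ.* p ℕ.^ T ℕ.* p ℕ.^ T ℕ.< size →
      Deg (p ℕ.^ T) A → ¬ (A (p ℕ.^ T) ≈ 0#) → Coset (ev (p ℕ.^ T) A) → ∀ N → p ∤ N → A N ≈ 0#
    derivative-zero T A 1≤T T<h P³<size degA lead coset zero p∤N = ⊥-elim (p∤N (p ∣.∣0))
    derivative-zero T A 1≤T T<h P³<size degA lead coset (suc n) p∤N =
      domain (at (vanishing P′ A′ P′<size degA′ derivative) n) (ι-nonzero p∤N)
      where
      P P′ : ℕ
      P = p ℕ.^ T
      P′ = P ∸ 1
      P≡ : suc P′ ≡ P
      P≡ = ℕₚ.m+[n∸m]≡n (0<p^ T)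
      A′ : PS
      A′ n = ι (suc n) * A (suc n)
      P′<size : P′ ℕ.< size
      P′<size = ℕₚ.≤-<-trans (ℕₚ.≤-trans (ℕₚ.m∸n≤m P 1) (ℕₚ.≤-trans (ℕₚ.m≤m*n P P) (ℕₚ.m≤m*n (P ℕ.* P) P))) P³<size
        where
        instance
          P-nonZero : ℕ.NonZero P
          P-nonZero = ℕ.>-nonZero (0<p^ T)
      degA′ : Deg P′ A′
      degA′ i l = zero-mulʳ (degA (suc i) (≡.subst (ℕ._< suc i) P≡ (s≤s l)))
      derivative : ∀ y → ev P′ A′ y ≈ 0#
      derivative y = begin
        ev P′ A′ y ≈⟨ translate-at-1 y P′ A ⟨
        translate y (suc P′) A 1 ≡⟨ ≡.cong (λ r → translate y r A 1) P≡ ⟩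
        t 1 ≈⟨ +-identityʳ (t 1) ⟨
        t 1 + 0# ≈⟨ +-congˡ -0#≈0# ⟨
        B 1 ≈⟨ no-linear-term T B 1≤T T<h P³<size degB leadB (-‿inverseʳ (t 0)) cosetB ⟩
        0# ∎
        where
        t B : PS
        t = translate y P A
        B = t 𝔹.+ 𝔹.- C (t 0)
        degB : Deg P B
        degB = Deg-+ {f = t} {𝔹.- C (t 0)} (Deg-translate y P A) (Deg-neg {f = C (t 0)} (Deg-C (t 0)))
        leadB : ¬ (B P ≈ 0#)
        leadB z = lead (trans (sym (translate-top y P A)) (trans (sym (trans (+-congˡ (trans (-‿cong (high P (0<p^ T))) -0#≈0#)) (+-identityʳ (t P)))) z))
          where
          high : ∀ n → 0 ℕ.< n → C (t 0) n ≈ 0#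
          high (suc n) _ = refl
        value : ∀ x → ev P B x ≈ ev P A (y + x) + - t 0
        value x = trans (ev-+ P t (𝔹.- C (t 0)) x) (+-cong (ev-translate y P A x) (trans (ev-neg P (C (t 0)) x) (-‿cong (ev-C P (t 0) x))))
        cosetB : Coset (ev P B)
        cosetB x z = trans (^-congˡ m (trans (+-cong (value x) (-‿cong (value z)))
            (solve 3 (λ a b s → a :- s :- (b :- s) := a :- b) refl (ev P A (y + x)) (ev P A (y + z)) (t 0))))
          (trans (coset (y + x) (y + z)) (*-congˡ (^-congˡ m (solve 3 (λ y x z → (y :+ x) :- (y :+ z) := x :- z) refl y x z))))

    ∑-sparse : ∀ D (f : ℕ → Carrier) → (∀ N → p ∤ N → f N ≈ 0#) → ∑ (suc (p ℕ.* D)) f ≈ ∑ (suc D) (λ i → f (p ℕ.* i))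
    ∑-sparse zero f z = reflexive (≡.trans (≡.cong (λ r → ∑ (suc r) f) (ℕₚ.*-zeroʳ p)) (≡.cong (λ r → f r + 0#) (≡.sym (ℕₚ.*-zeroʳ p))))
    ∑-sparse (suc D) f z = begin
      ∑ (suc (p ℕ.* suc D)) f ≡⟨ ≡.cong (λ r → ∑ r f) (ℕ-solve 2 (λ p D → # 1 ⊞ p ⊠ (# 1 ⊞ D) ≐ # 1 ⊞ p ⊠ D ⊞ p) ≡.refl p D) ⟩
      ∑ (suc (p ℕ.* D) ℕ.+ p) f ≈⟨ ∑-split (suc (p ℕ.* D)) p f ⟩
      ∑ (suc (p ℕ.* D)) f + ∑ p (λ i → f (suc (p ℕ.* D) ℕ.+ i))
        ≈⟨ +-cong (∑-sparse D f z) (∑-single p (2 ℕ.* c) (ℕₚ.n<1+n (2 ℕ.* c)) off) ⟩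
      ∑ (suc D) (λ i → f (p ℕ.* i)) + f (suc (p ℕ.* D) ℕ.+ 2 ℕ.* c)
        ≡⟨ ≡.cong (λ r → ∑ (suc D) (λ i → f (p ℕ.* i)) + f r) (ℕ-solve 2 (λ c D → # 1 ⊞ (# 1 ⊞ # 2 ⊠ c) ⊠ D ⊞ # 2 ⊠ c ≐ (# 1 ⊞ # 2 ⊠ c) ⊠ (# 1 ⊞ D)) ≡.refl c D) ⟩
      ∑ (suc D) (λ i → f (p ℕ.* i)) + f (p ℕ.* suc D) ≈⟨ ∑-last (suc D) (λ i → f (p ℕ.* i)) ⟨
      ∑ (suc (suc D)) (λ i → f (p ℕ.* i)) ∎
      where
      off : ∀ i → i ℕ.< p → i ≢ 2 ℕ.* c → f (suc (p ℕ.* D) ℕ.+ i) ≈ 0#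
      off i (s≤s l) ne = z (suc (p ℕ.* D) ℕ.+ i) λ d → ℕₚ.<⇒≱ (s≤s (ℕₚ.≤∧≢⇒< l ne))
        (∣.∣⇒≤ (∣.∣m+n∣m⇒∣n (≡.subst (p ∣_) (≡.sym (ℕₚ.+-suc (p ℕ.* D) i)) d) (∣.m∣m*n D)))

    ev-sparse : ∀ D A x → (∀ N → p ∤ N → A N ≈ 0#) → ev (p ℕ.* D) A x ≈ ev D (λ i → A (p ℕ.* i)) (x ^ p)
    ev-sparse D A x z = begin
      ev (p ℕ.* D) A x ≈⟨ ev-∑ (p ℕ.* D) A x ⟩
      ∑ (suc (p ℕ.* D)) (λ N → A N * x ^ N) ≈⟨ ∑-sparse D (λ N → A N * x ^ N) (λ N p∤N → zero-mulˡ (z N p∤N)) ⟩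
      ∑ (suc D) (λ i → A (p ℕ.* i) * x ^ (p ℕ.* i)) ≈⟨ ∑-cong (suc D) (λ i _ → *-congˡ {A (p ℕ.* i)} (sym (^-assocʳ x p i))) ⟩
      ∑ (suc D) (λ i → A (p ℕ.* i) * (x ^ p) ^ i) ≈⟨ ev-∑ D (λ i → A (p ℕ.* i)) (x ^ p) ⟨
      ev D (λ i → A (p ℕ.* i)) (x ^ p) ∎

    -- The inverse of the Frobenius map.
    root : Carrier → Carrier
    root x = x ^ (p ℕ.^ (h ∸ 1))

    root-^p : ∀ x → root x ^ p ≈ x
    root-^p x = trans (^-assocʳ x (p ℕ.^ (h ∸ 1)) p) (trans (reflexive (≡.cong (x ^_)
      (≡.trans (ℕₚ.*-comm (p ℕ.^ (h ∸ 1)) p) (≡.trans (≡.cong (p ℕ.^_) (ℕₚ.m+[n∸m]≡n 1≤h)) (≡.sym size≡))))) (fermat x))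

    -- The `p`-th power preserves the quadratic character, as `p m = m + 2 m c` and `z^(2 m) = 1`
    -- for `z ≠ 0`.
    ^p-^m : ∀ z → (z ^ p) ^ m ≈ z ^ m
    ^p-^m z = go (z ≟ 0#)
      where
      go : Dec (z ≈ 0#) → (z ^ p) ^ m ≈ z ^ m
      go (yes e) = trans (^-congˡ m (trans (^-congˡ p e) (0^ p (s≤s z≤n)))) (sym (^-congˡ m e))
      go (no ne) = begin
        (z ^ p) ^ m ≈⟨ ^-assocʳ z p m ⟩
        z ^ (p ℕ.* m) ≡⟨ ≡.cong (z ^_) (ℕ-solve 2 (λ c m → (# 1 ⊞ # 2 ⊠ c) ⊠ m ≐ m ⊞ (# 2 ⊠ m) ⊠ c) ≡.refl c m) ⟩
        z ^ (m ℕ.+ 2 ℕ.* m ℕ.* c) ≈⟨ ^-homo-* z m (2 ℕ.* m ℕ.* c) ⟩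
        z ^ m * z ^ (2 ℕ.* m ℕ.* c) ≈⟨ *-congˡ (trans (sym (^-assocʳ z (2 ℕ.* m) c)) (trans (^-congˡ c (fermat-2m z ne)) (1^ c))) ⟩
        z ^ m * 1# ≈⟨ *-identityʳ _ ⟩
        z ^ m ∎

    -- A vanishing derivative makes `A` a polynomial `B` in `X^p`; substituting `p`-th roots carries
    -- the coset identity over to `B`, whose degree is smaller by the factor `p`.
    monomial : ∀ t (A : PS) → t ℕ.< h → p ℕ.^ t ℕ.* p ℕ.^ t ℕ.* p ℕ.^ t ℕ.< size →
      Deg (p ℕ.^ t) A → ¬ (A (p ℕ.^ t) ≈ 0#) → A 0 ≈ 0# → Coset (ev (p ℕ.^ t) A) → ∀ N → N ≢ p ℕ.^ t → A N ≈ 0#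
    monomial zero A _ _ degA lead A0≈0 coset zero ne = A0≈0
    monomial zero A _ _ degA lead A0≈0 coset (suc zero) ne = ⊥-elim (ne ≡.refl)
    monomial zero A _ _ degA lead A0≈0 coset (suc (suc N)) ne = degA (suc (suc N)) (s≤s (s≤s z≤n))
    monomial (suc t) A t<h P³<size degA lead A0≈0 coset N ne with p ∣.∣? N
    ... | no p∤N = derivative-zero (suc t) A (s≤s z≤n) t<h P³<size degA lead coset N p∤N
    ... | yes (divides q e) = trans (reflexive (≡.cong A (≡.trans e (ℕₚ.*-comm q p))))
            (monomial t B (ℕₚ.<-trans (ℕₚ.n<1+n t) t<h) D³<size degB lead (trans (reflexive (≡.cong A (ℕₚ.*-zeroʳ p))) A0≈0) cosetB q
              (λ q≡D → ne (≡.trans e (≡.trans (ℕₚ.*-comm q p) (≡.cong (p ℕ.*_) q≡D)))))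
      where
      D = p ℕ.^ t
      B : PS
      B i = A (p ℕ.* i)
      D≤P : D ℕ.≤ p ℕ.* D
      D≤P = ℕₚ.m≤n*m D p
      D³<size : D ℕ.* D ℕ.* D ℕ.< size
      D³<size = ℕₚ.≤-<-trans (ℕₚ.*-mono-≤ (ℕₚ.*-mono-≤ D≤P D≤P) D≤P) P³<size
      degB : Deg D B
      degB i l = degA (p ℕ.* i) (ℕₚ.*-monoʳ-< p l)
      value : ∀ x → ev D B x ≈ ev (p ℕ.* D) A (root x)
      value x = trans (ev-cong D 𝔹.refl (sym (root-^p x))) (sym (ev-sparse D A (root x) (derivative-zero (suc t) A (s≤s z≤n) t<h P³<size degA lead coset)))
      cosetB : Coset (ev D B)
      cosetB x y = begin
        (ev D B x + - ev D B y) ^ m ≈⟨ ^-congˡ m (+-cong (value x) (-‿cong (value y))) ⟩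
        (ev (p ℕ.* D) A (root x) + - ev (p ℕ.* D) A (root y)) ^ m ≈⟨ coset (root x) (root y) ⟩
        ε * (root x + - root y) ^ m ≈⟨ *-congˡ (^p-^m (root x + - root y)) ⟨
        ε * ((root x + - root y) ^ p) ^ m ≈⟨ *-congˡ (^-congˡ m (trans (frobenius (root x) (- root y)) (+-cong (root-^p x) (trans minus (-‿cong (root-^p y)))))) ⟩
        ε * (x + - y) ^ m ∎
        where
        minus : (- root y) ^ p ≈ - (root y ^ p)
        minus = ≡.subst (λ r → (- root y) ^ r ≈ - (root y ^ r)) (ℕₚ.*-identityʳ p) (frobenius^-neg 1 (root y))

  -- Cancelling `middle` in `nonsquare` shows that the `m`-th power of `u (A (x + u) - A x)` is one
  -- constant for all `x` and all `u ≠ 0`; as `u^(2 m) = 1`, the factor `u^m` can be moved to the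
  -- other side.
  ovoid-monomial : ∀ δ A → Deg δ A → ¬ (A δ ≈ 0#) → A 0 ≈ 0# → 1 ℕ.≤ δ → δ ℕ.* δ ℕ.* δ ℕ.< size →
    (∀ x u v → ¬ (u ≈ 0# × v ≈ 0#) → ¬ (v * v + u * (ev δ A (x + u) + - ev δ A x) ≈ 0#)) →
    Σ ℕ λ t → δ ≡ p ℕ.^ t × (∀ N → N ≢ δ → A N ≈ 0#)
  ovoid-monomial δ A degA lead A0≈0 1≤δ δ³<size ovoid = conclude (degree-is-power ε ε≉0 δ A degA lead 1≤δ δ³<size coset)
    where
    a : Carrier → Carrier
    a = ev δ A
    ε : Carrier
    -- Any pair of distinct points would give the same constant; 0 and 1 serve here.
    ε = (1# * (a (0# + 1#) + - a 0#)) ^ m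
    key : ∀ x u → ¬ (u ≈ 0#) → middle * (u * (a (x + u) + - a x)) ^ m ≈ - 1#
    key x u ne = nonsquare (u * (a (x + u) + - a x)) (λ v → ovoid x u v (ne ∘ proj₁))
    product≉0 : ∀ {s} → middle * s ≈ - 1# → ¬ (middle * s ≈ 0#)
    product≉0 e z = 1≉0 (trans (sym (-‿involutive 1#)) (trans (-‿cong (trans (sym e) z)) -0#≈0#))
    ε≉0 : ¬ (ε ≈ 0#)
    ε≉0 z = product≉0 (key 0# 1# 1≉0) (zero-mulʳ z)
    middle≉0 : ¬ (middle ≈ 0#)
    middle≉0 z = product≉0 (key 0# 1# 1≉0) (zero-mulˡ z)
    in-coset : ∀ x u → ¬ (u ≈ 0#) → (u * (a (x + u) + - a x)) ^ m ≈ ε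
    in-coset x u ne = ≈-from-sub (domain (trans (solve 3 (λ c s e → c :* (s :- e) := c :* s :- c :* e) refl middle ((u * (a (x + u) + - a x)) ^ m) ε)
      (trans (+-cong (key x u ne) (-‿cong (key 0# 1# 1≉0))) (-‿inverseʳ (- 1#)))) middle≉0)
    open Carlitz ε ε≉0 using (Coset)
    coset : Coset a
    coset x y = go ((x + - y) ≟ 0#)
      where
      u = x + - y
      go : Dec (u ≈ 0#) → (a x + - a y) ^ m ≈ ε * u ^ m
      go (yes e) = trans (trans (^-congˡ m (trans (+-congʳ (ev-cong δ 𝔹.refl (≈-from-sub e))) (-‿inverseʳ (a y)))) (0^ m 1≤m))
        (sym (zero-mulʳ (trans (^-congˡ m e) (0^ m 1≤m))))
      go (no ne) = begin
        Δ ^ m ≈⟨ trans (sym (*-identityˡ _)) (*-congʳ (sym (square-^m u ne))) ⟩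
        u ^ m * u ^ m * Δ ^ m ≈⟨ solve 2 (λ s t → s :* s :* t := (s :* t) :* s) refl (u ^ m) (Δ ^ m) ⟩
        u ^ m * Δ ^ m * u ^ m ≈⟨ *-congʳ (trans (sym (^-distrib-* u Δ m)) (^-congˡ m (*-congˡ (+-congʳ (ev-cong δ 𝔹.refl (solve 2 (λ x y → x := y :+ (x :- y)) refl x y)))))) ⟩
        (u * (a (y + u) + - a y)) ^ m * u ^ m ≈⟨ *-congʳ (in-coset y u ne) ⟩
        ε * u ^ m ∎
        where Δ = a x + - a y
    conclude : (Σ ℕ λ t → δ ≡ p ℕ.^ t × t ℕ.< h) → Σ ℕ λ t → δ ≡ p ℕ.^ t × (∀ N → N ≢ δ → A N ≈ 0#)
    conclude (t , ≡.refl , t<h) = t , ≡.refl , monomial ε ε≉0 t A t<h δ³<size degA lead A0≈0 coset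

-- The size hypothesis and the final case distinction.

-- Cubing avoids the exponent `13/3`: of `N^13`, twelve factors are the cube of `N^4`, and the spare
-- one, at least `e`, pays for the constants.
cube-root-bound : ∀ s t c e N q → s ℕ.* c ℕ.^ 3 ℕ.≤ t ℕ.* e → e ℕ.≤ N → t ℕ.* N ℕ.^ 13 ℕ.< s ℕ.* q ℕ.^ 3 → c ℕ.* N ℕ.^ 4 ℕ.< q
cube-root-bound s t c e N q constants e≤N lt = ℕₚ.≰⇒> λ q≤ → ℕₚ.<⇒≱ lt (begin
  s ℕ.* q ℕ.^ 3 ≤⟨ ℕₚ.*-monoʳ-≤ s (ℕₚ.^-monoˡ-≤ 3 q≤) ⟩
  s ℕ.* (c ℕ.* N ℕ.^ 4) ℕ.^ 3 ≡⟨ ≡.cong (s ℕ.*_) (≡.trans (cube-* c (N ℕ.^ 4)) (≡.cong (c ℕ.^ 3 ℕ.*_) (ℕₚ.^-*-assoc N 4 3))) ⟩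
  s ℕ.* (c ℕ.^ 3 ℕ.* N ℕ.^ 12) ≡⟨ ℕₚ.*-assoc s (c ℕ.^ 3) (N ℕ.^ 12) ⟨
  s ℕ.* c ℕ.^ 3 ℕ.* N ℕ.^ 12 ≤⟨ ℕₚ.*-monoˡ-≤ (N ℕ.^ 12) constants ⟩
  t ℕ.* e ℕ.* N ℕ.^ 12 ≤⟨ ℕₚ.*-monoˡ-≤ (N ℕ.^ 12) (ℕₚ.*-monoʳ-≤ t e≤N) ⟩
  t ℕ.* N ℕ.* N ℕ.^ 12 ≡⟨ ℕₚ.*-assoc t N (N ℕ.^ 12) ⟩
  t ℕ.* N ℕ.^ 13 ∎)
  where
  open ℕₚ.≤-Reasoning
  cube-* : ∀ x y → (x ℕ.* y) ℕ.^ 3 ≡ x ℕ.^ 3 ℕ.* y ℕ.^ 3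
  cube-* = +-*-Solver.solve 2 (λ x y → (x ⊠ y) ⊠ ((x ⊠ y) ⊠ ((x ⊠ y) ⊠ # 1)) +-*-Solver.:= (x ⊠ (x ⊠ (x ⊠ # 1))) ⊠ (y ⊠ (y ⊠ (y ⊠ # 1)))) ≡.refl
    where open +-*-Solver using () renaming (_:*_ to _⊠_; con to #)

odd-prime : ∀ {p} → Prime p → p ≢ 2 → Σ ℕ λ c → 1 ℕ.≤ c × p ≡ suc (2 ℕ.* c)
odd-prime {p} pr p≢2 = go (p DivMod.% 2) (p DivMod./ 2) (DivMod.m≡m%n+[m/n]*n p 2) (DivMod.m%n<n p 2)
  where
  go : ∀ r c → p ≡ r ℕ.+ c ℕ.* 2 → r ℕ.< 2 → Σ ℕ λ c → 1 ℕ.≤ c × p ≡ suc (2 ℕ.* c)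
  go zero c e _ with prime⇒irreducible pr (divides c e)
  ... | inj₂ 2≡p = ⊥-elim (p≢2 (≡.sym 2≡p))
  go (suc zero) zero e _ = ⊥-elim (ℕₚ.<-irrefl (≡.sym e) (1<pr pr))
  go (suc zero) (suc c) e _ = suc c , s≤s z≤n , ≡.trans e (≡.cong suc (ℕₚ.*-comm (suc c) 2))
  go (suc (suc r)) c e (s≤s (s≤s ()))

-- The constants of the hypothesis on the size stay variables, since unification would
-- unfold products with the literal 250047.
module PolynomialOvoid (F : FiniteField) (d : ℕ) (a : ℕ → ℕ → FiniteField.Carrier F) (s t : ℕ)
  (10³s≤4t : s ℕ.* 10 ℕ.^ 3 ℕ.≤ t ℕ.* 4) (7³s≤2t : s ℕ.* 7 ℕ.^ 3 ℕ.≤ t ℕ.* 2) where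
  open Field F

  f : Carrier → Carrier → Carrier
  f x y = ∑ (suc d) (λ i → ∑ (suc (d ∸ i)) (λ j → a i j * (x ^ i * y ^ j)))

  pow≈^ : ∀ x n → pow F x n ≈ x ^ n
  pow≈^ x zero = refl
  pow≈^ x (suc n) = *-congˡ (pow≈^ x n)

  sumTo≈∑ : ∀ n {g g′ : ℕ → Carrier} → (∀ i → g i ≈ g′ i) → sumTo F n g ≈ ∑ (suc n) g′
  sumTo≈∑ zero e = trans (e 0) (sym (+-identityʳ _))
  sumTo≈∑ (suc n) {g} {g′} e = trans (+-cong (sumTo≈∑ n e) (e (suc n))) (sym (∑-last (suc n) g′))

  eval≈f : ∀ x y → eval F d a x y ≈ f x y
  eval≈f x y = sumTo≈∑ d (λ i → sumTo≈∑ (d ∸ i) (λ j → *-congˡ (*-cong (pow≈^ x i) (pow≈^ y j))))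

  -- On the span of the two points the quadratic form equals `- (λ′ μ)` times the expression in
  -- question, so a zero puts the whole line into the quadric.
  secant : IsOvoid F (O4 F d a) → ∀ x y u v → ¬ (u ≈ 0# × v ≈ 0#) → ¬ (v * v + u * (f (x + u) (y + v) + - f x y) ≈ 0#)
  secant ovoid x y u v ne e = IsOvoid.noLine ovoid (just (x + u , y + v)) (just (x , y)) distinct line
    where
    cancel-left : ∀ {x u} → x + u ≡ x → u ≈ 0#
    cancel-left {x} {u} e = trans (solve 2 (λ x u → u := (x :+ u) :- x) refl x u) (trans (+-congʳ (reflexive e)) (-‿inverseʳ x))
    distinct : just (x + u , y + v) ≢ just (x , y)
    distinct e = let (e₁ , e₂) = ,-injective (just-injective e) in ne (cancel-left e₁ , cancel-left e₂)
    g g′ : Carrier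
    g = eval F d a (x + u) (y + v)
    g′ = eval F d a x y
    line : LineInQ F (O4 F d a (just (x + u , y + v))) (O4 F d a (just (x , y)))
    line λ′ μ = ≈⇒≡ (trans
      (solve 8 (λ l μ x y u v g g′ →
        (l :* con (1 , 0) :+ μ :* con (1 , 0)) :* (l :* (:- ((y :+ v) :* (y :+ v)) :+ :- ((x :+ u) :* g)) :+ μ :* (:- (y :* y) :+ :- (x :* g′)))
          :+ (l :* (x :+ u) :+ μ :* x) :* (l :* g :+ μ :* g′) :+ (l :* (y :+ v) :+ μ :* y) :* (l :* (y :+ v) :+ μ :* y)
        := :- (l :* μ) :* (v :* v :+ u :* (g :- g′))) refl λ′ μ x y u v g g′)
      (zero-mulʳ (trans (+-congˡ (*-congˡ (+-cong (eval≈f (x + u) (y + v)) (-‿cong (eval≈f x y))))) e)))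

  row : ℕ → PS
  row j i = a i j

  ∑-support : ∀ n m (t : ℕ → Carrier) → (∀ j → n ℕ.≤ j → t j ≈ 0#) → (∀ j → m ℕ.≤ j → t j ≈ 0#) → ∑ n t ≈ ∑ m t
  ∑-support zero m t z _ = sym (∑-zero m (λ j _ → z j z≤n))
  ∑-support (suc n) zero t _ z = ∑-zero (suc n) (λ j _ → z j z≤n)
  ∑-support (suc n) (suc m) t z z′ = +-congˡ (∑-support n m (t ∘ suc) (λ j l → z (suc j) (s≤s l)) (λ j l → z′ (suc j) (s≤s l)))

  quadratic-form : (∀ i j → d ℕ.< i ℕ.+ j → a i j ≈ 0#) → (∀ i j → 3 ℕ.≤ j → a i j ≈ 0#) → ∀ x y →
    f x y ≈ ev d (row 0) x + ev d (row 1) x * y + ev d (row 2) x * (y * y)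
  quadratic-form degree high x y = begin
    f x y ≈⟨ ∑-cong (suc d) (λ i i≤d → ∑-support (suc (d ∸ i)) 3 (term i)
               (λ j l → zero-mulˡ (degree i j (ℕₚ.≤-trans (ℕₚ.≤-reflexive (≡.trans (≡.cong suc (≡.sym (ℕₚ.m+[n∸m]≡n (ℕₚ.≤-pred i≤d)))) (≡.sym (ℕₚ.+-suc i (d ∸ i))))) (ℕₚ.+-monoʳ-≤ i l))))
               (λ j l → zero-mulˡ (high i j l))) ⟩
    ∑ (suc d) (λ i → ∑ 3 (term i)) ≈⟨ ∑-swap (suc d) 3 term ⟩
    ∑ 3 (λ j → ∑ (suc d) (λ i → term i j)) ≈⟨ ∑-cong 3 (λ j _ → column j) ⟩
    ∑ 3 (λ j → ev d (row j) x * y ^ j)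
      ≈⟨ solve 4 (λ p q r y → p :* con (1 , 0) :+ (q :* (y :* con (1 , 0)) :+ (r :* (y :* (y :* con (1 , 0))) :+ con (0 , 0))) := p :+ q :* y :+ r :* (y :* y))
           refl (ev d (row 0) x) (ev d (row 1) x) (ev d (row 2) x) y ⟩
    ev d (row 0) x + ev d (row 1) x * y + ev d (row 2) x * (y * y) ∎
    where
    term : ℕ → ℕ → Carrier
    term i j = a i j * (x ^ i * y ^ j)
    column : ∀ j → ∑ (suc d) (λ i → term i j) ≈ ev d (row j) x * y ^ j
    column j = begin
      ∑ (suc d) (λ i → term i j) ≈⟨ ∑-cong (suc d) (λ i _ → sym (*-assoc (a i j) (x ^ i) (y ^ j))) ⟩
      ∑ (suc d) (λ i → a i j * x ^ i * y ^ j) ≈⟨ ∑-*ʳ (suc d) (y ^ j) (λ i → a i j * x ^ i) ⟩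
      ∑ (suc d) (λ i → a i j * x ^ i) * y ^ j ≈⟨ *-congʳ (ev-∑ d (row j) x) ⟨
      ev d (row j) x * y ^ j ∎

  module _ {p} (pr : Prime p) (h : ℕ) (size≡ : size ≡ p ℕ.^ h)
    (degree : HasDegree F d a) (a₀₀ : a 0 0 ≡ 0#)
    (large : t ℕ.* (d ℕ.+ 1) ℕ.^ 13 ℕ.< s ℕ.* size ℕ.^ 3)
    (ovoid : IsOvoid F (O4 F d a)) where

    vanishes : ∀ i j → d ℕ.< i ℕ.+ j → a i j ≈ 0#
    vanishes i j l = reflexive (proj₁ degree i j l)

    top : Σ ℕ λ i → Σ ℕ λ j → i ℕ.+ j ≡ d × ¬ (a i j ≈ 0#)
    top = let (i , j , e , ne) = proj₂ degree in i , j , e , ne ∘ ≈⇒≡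

    N : ℕ
    N = suc d

    lower-bound : ∀ c e → s ℕ.* c ℕ.^ 3 ℕ.≤ t ℕ.* e → e ℕ.≤ N → c ℕ.* (N ℕ.* N ℕ.* N ℕ.* N) ℕ.< size
    lower-bound c e constants e≤N = ≡.subst (λ x → c ℕ.* x ℕ.< size)
      (+-*-Solver.solve 1 (λ n → n +-*-Solver.:* (n +-*-Solver.:* (n +-*-Solver.:* (n +-*-Solver.:* +-*-Solver.con 1))) +-*-Solver.:= n +-*-Solver.:* n +-*-Solver.:* n +-*-Solver.:* n) ≡.refl N)
      (cube-root-bound s t c e N size constants e≤N (≡.subst (λ n → t ℕ.* n ℕ.^ 13 ℕ.< s ℕ.* size ℕ.^ 3) (ℕₚ.+-comm d 1) large))

    1≤d : 1 ℕ.≤ d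
    1≤d = ℕₚ.n≢0⇒n>0 (λ e → constant e top)
      where
      constant : d ≡ 0 → (Σ ℕ λ i → Σ ℕ λ j → i ℕ.+ j ≡ d × ¬ (a i j ≈ 0#)) → ⊥
      constant d≡0 (zero , zero , _ , ne) = ne (reflexive a₀₀)
      constant ≡.refl (suc i , j , () , _)
      constant ≡.refl (zero , suc j , () , _)

    7N⁴<size : 7 ℕ.* (N ℕ.* N ℕ.* N ℕ.* N) ℕ.< size
    7N⁴<size = lower-bound 7 2 7³s≤2t (s≤s 1≤d)

    -- Downward induction on `j` from above `d`, so that at each stage `j` is an upper bound for the
    -- `Y`-degree of `f`.
    no-high-Y-degree : ∀ i j → 3 ℕ.≤ j → a i j ≈ 0#
    no-high-Y-degree i j = descend d j (ℕₚ.≤-trans (s≤s (ℕₚ.m≤m+n d j)) (ℕₚ.≤-reflexive ≡.refl)) i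
      where
      descend : ∀ n j → d ℕ.< suc n ℕ.+ j → ∀ i → 3 ℕ.≤ j → a i j ≈ 0#
      descend n j l i 3≤j with j ℕ.≤? d
      ... | no j≰d = vanishes i j (ℕₚ.≤-trans (ℕₚ.≰⇒> j≰d) (ℕₚ.m≤n+m j i))
      ... | yes j≤d = ≈-stable λ ne → HighDegree.impossible F pr h size≡ d j a vanishes 3≤j j≤d (above n l) large-N
              (λ x u v uv e → secant ovoid x 0# u v uv (trans (+-congˡ (*-congˡ (+-congʳ (reflexive (≡.cong (f (x + u)) (≈⇒≡ (+-identityˡ v))))))) e)) top (i , ne)
        where
        -- The inequalities `3 ≤ j ≤ d` give `N ≥ 4`, which the constant 10 relies on.
        large-N : 10 ℕ.* (N ℕ.* N ℕ.* N ℕ.* N) ℕ.≤ size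
        large-N = ℕₚ.<⇒≤ (lower-bound 10 4 10³s≤4t (s≤s (ℕₚ.≤-trans 3≤j j≤d)))
        above : ∀ n → d ℕ.< suc n ℕ.+ j → ∀ i j′ → j ℕ.< j′ → a i j′ ≈ 0#
        above zero l i j′ j<j′ = vanishes i j′ (ℕₚ.<-≤-trans l (ℕₚ.≤-trans j<j′ (ℕₚ.m≤n+m j′ i)))
        above (suc n) l i j′ j<j′ = descend n j′ (ℕₚ.<-≤-trans l (≡.subst (ℕ._≤ suc n ℕ.+ j′) (ℕₚ.+-suc (suc n) j) (ℕₚ.+-monoʳ-≤ (suc n) j<j′))) i (ℕₚ.≤-trans 3≤j (ℕₚ.<⇒≤ j<j′))

    N≤N⁴ : N ℕ.≤ N ℕ.* N ℕ.* N ℕ.* N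
    N≤N⁴ = ℕₚ.m≤n*m N (N ℕ.* N ℕ.* N)

    N³≤N⁴ : N ℕ.* N ℕ.* N ℕ.≤ N ℕ.* N ℕ.* N ℕ.* N
    N³≤N⁴ = ℕₚ.m≤m*n (N ℕ.* N ℕ.* N) N

    N⁴<size : N ℕ.* N ℕ.* N ℕ.* N ℕ.< size
    N⁴<size = ℕₚ.≤-<-trans (ℕₚ.m≤n*m (N ℕ.* N ℕ.* N ℕ.* N) 7) 7N⁴<size

    d<size : d ℕ.< size
    d<size = ℕₚ.≤-<-trans (ℕₚ.≤-trans (ℕₚ.n≤1+n d) N≤N⁴) N⁴<size

    2<size : 2 ℕ.< size
    2<size = ℕₚ.≤-<-trans (ℕₚ.≤-trans (s≤s 1≤d) N≤N⁴) N⁴<size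

    d³<size : d ℕ.* d ℕ.* d ℕ.< size
    d³<size = ℕₚ.≤-<-trans (ℕₚ.≤-trans (ℕₚ.*-mono-≤ (ℕₚ.*-mono-≤ (ℕₚ.n≤1+n d) (ℕₚ.n≤1+n d)) (ℕₚ.n≤1+n d)) N³≤N⁴) N⁴<size

    -- By way of `16 d^2 ≤ 28 N^2 ≤ 7 N^4`, since `N ≥ 2`.
    16d²≤size : 4 ℕ.* d ℕ.* (4 ℕ.* d) ℕ.≤ size
    16d²≤size = ℕₚ.<⇒≤ (ℕₚ.≤-<-trans (ℕₚ.≤-trans (ℕₚ.≤-reflexive (ℕ-solve 1 (λ d → # 4 ⊠ d ⊠ (# 4 ⊠ d) ≐ # 16 ⊠ (d ⊠ d)) ≡.refl d))
      (ℕₚ.≤-trans (ℕₚ.*-mono-≤ {16} {28} (toWitness {a? = 16 ℕ.≤? 28} _) (ℕₚ.*-mono-≤ (ℕₚ.n≤1+n d) (ℕₚ.n≤1+n d)))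
        (ℕₚ.≤-trans (ℕₚ.≤-reflexive (ℕ-solve 1 (λ n → # 28 ⊠ (n ⊠ n) ≐ # 7 ⊠ (n ⊠ n ⊠ # 2 ⊠ # 2)) ≡.refl N))
          (ℕₚ.*-monoʳ-≤ 7 (ℕₚ.*-mono-≤ (ℕₚ.*-monoʳ-≤ (N ℕ.* N) (s≤s 1≤d)) (s≤s 1≤d)))))) 7N⁴<size)
      where open +-*-Solver using () renaming (solve to ℕ-solve; _:=_ to _≐_; _:*_ to _⊠_; con to #)

    deg-row : ∀ j → Deg d (row j)
    deg-row j i l = vanishes i j (ℕₚ.<-≤-trans l (ℕₚ.m≤m+n i j))

    module _ (sqrt : 1# + 1# ≈ 0# → ∀ w → Σ Carrier λ y → y * y ≈ w) where

      private
        module Q = Quadratic F 2<size (ev d (row 0)) (ev d (row 1)) (ev d (row 2))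

        quadratic-ovoid : ∀ x y u v → ¬ (u ≈ 0# × v ≈ 0#) →
          ¬ (v * v + u * ((ev d (row 0) (x + u) + ev d (row 1) (x + u) * (y + v) + ev d (row 2) (x + u) * ((y + v) * (y + v))) +
             - (ev d (row 0) x + ev d (row 1) x * y + ev d (row 2) x * (y * y))) ≈ 0#)
        quadratic-ovoid x y u v ne e = secant ovoid x y u v ne (trans (+-congˡ (*-congˡ (+-cong
          (quadratic-form vanishes no-high-Y-degree (x + u) (y + v)) (-‿cong (quadratic-form vanishes no-high-Y-degree x y))))) e)

      row-2 : ∀ i → a i 2 ≈ 0#
      row-2 = at (vanishing d (row 2) d<size (deg-row 2) (Q.C≈0 sqrt quadratic-ovoid))

      row-1≋ : row 1 ≋ C (ev d (row 1) 0#)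
      row-1≋ = coefficients-unique d (row 1) (C (ev d (row 1) 0#)) d<size (deg-row 1) (Deg-C _)
        (λ x → trans (Q.B-constant sqrt quadratic-ovoid x) (sym (ev-C d (ev d (row 1) 0#) x)))

      row-1 : ∀ i → a (suc i) 1 ≈ 0#
      row-1 i = at row-1≋ (suc i)

      row-0-ovoid : ∀ x u v → ¬ (u ≈ 0# × v ≈ 0#) → ¬ (v * v + u * ((ev d (row 0) (x + u) + - ev d (row 0) x) + a 0 1 * v) ≈ 0#)
      row-0-ovoid x u v ne e = Q.additive-ovoid sqrt quadratic-ovoid x u v ne (trans (+-congˡ (*-congˡ (+-congˡ (*-congʳ (sym (at row-1≋ 0)))))) e)

      a₀₁≉0 : 1# + 1# ≈ 0# → ¬ (a 0 1 ≈ 0#)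
      a₀₁≉0 two≈0 z = Q.B≉0 sqrt quadratic-ovoid two≈0 (trans (sym (at row-1≋ 0)) z)

      off-axis : a 0 1 ≈ 0# → ∀ i j → a i (suc j) ≈ 0#
      off-axis z zero zero = z
      off-axis z (suc i) zero = row-1 i
      off-axis z i (suc zero) = row-2 i
      off-axis z i (suc (suc j)) = no-high-Y-degree i (suc (suc (suc j))) (s≤s (s≤s (s≤s z≤n)))

      -- The earlier steps leave `a d 0` and, for `d = 1`, also `a 0 1` as possible nonzero
      -- coefficients of top degree.
      leading : (d ≡ 1 → a 0 1 ≈ 0#) → ¬ (a d 0 ≈ 0#)
      leading z = go top
        where
        go : (Σ ℕ λ i → Σ ℕ λ j → i ℕ.+ j ≡ d × ¬ (a i j ≈ 0#)) → ¬ (a d 0 ≈ 0#)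
        go (i , zero , e , ne) z′ = ne (trans (reflexive (≡.cong (λ r → a r 0) (≡.trans (≡.sym (ℕₚ.+-identityʳ i)) e))) z′)
        go (zero , suc zero , e , ne) z′ = ne (z (≡.sym e))
        go (suc i , suc zero , e , ne) z′ = ne (row-1 i)
        go (i , suc (suc zero) , e , ne) z′ = ne (row-2 i)
        go (i , suc (suc (suc j)) , e , ne) z′ = ne (no-high-Y-degree i (suc (suc (suc j))) (s≤s (s≤s (s≤s z≤n))))

  linear-in-characteristic-2 : Prime 2 → ∀ h → size ≡ 2 ℕ.^ h → HasDegree F d a → a 0 0 ≡ 0# →
    t ℕ.* (d ℕ.+ 1) ℕ.^ 13 ℕ.< s ℕ.* size ℕ.^ 3 → IsOvoid F (O4 F d a) →
    ∀ i j → ¬ (i ≡ 1 × j ≡ 0) → ¬ (i ≡ 0 × j ≡ 1) → a i j ≡ 0#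
  linear-in-characteristic-2 pr h size≡ degree a₀₀ large ovoid = go h size≡
    where
    go : ∀ h → size ≡ 2 ℕ.^ h → ∀ i j → ¬ (i ≡ 1 × j ≡ 0) → ¬ (i ≡ 0 × j ≡ 1) → a i j ≡ 0#
    -- The trace argument is set up for `q ≥ 4`; the smaller exponents contradict `2<size`.
    go zero size≡ = ⊥-elim (ℕₚ.<⇒≱ (≡.subst (2 ℕ.<_) size≡ (2<size pr zero size≡ degree a₀₀ large ovoid)) (s≤s z≤n))
    go (suc zero) size≡ = ⊥-elim (ℕₚ.<-irrefl (≡.sym size≡) (2<size pr 1 size≡ degree a₀₀ large ovoid))
    go (suc (suc h)) size≡ = coefficients
      where
      module E = Even F h size≡ pr
      d≤1 : d ℕ.≤ 1
      d≤1 = ℕₚ.≮⇒≥ λ 2≤d → leading pr (suc (suc h)) size≡ degree a₀₀ large ovoid (λ _ → E.sqrt) (λ d≡1 → ⊥-elim (ℕₚ.<-irrefl (≡.sym d≡1) 2≤d))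
        (E.Conclusion.leading-zero d (row 0) (deg-row pr (suc (suc h)) size≡ degree a₀₀ large ovoid 0) 2≤d (a 0 1)
          (a₀₁≉0 pr (suc (suc h)) size≡ degree a₀₀ large ovoid (λ _ → E.sqrt) E.1+1≈0)
          (16d²≤size pr (suc (suc h)) size≡ degree a₀₀ large ovoid) (row-0-ovoid pr (suc (suc h)) size≡ degree a₀₀ large ovoid (λ _ → E.sqrt)))
      coefficients : ∀ i j → ¬ (i ≡ 1 × j ≡ 0) → ¬ (i ≡ 0 × j ≡ 1) → a i j ≡ 0#
      coefficients zero zero _ _ = a₀₀
      coefficients zero (suc zero) _ ne = ⊥-elim (ne (≡.refl , ≡.refl))
      coefficients (suc zero) zero ne _ = ⊥-elim (ne (≡.refl , ≡.refl))
      coefficients zero (suc (suc j)) _ _ = proj₁ degree zero (suc (suc j)) (ℕₚ.≤-trans (s≤s d≤1) (s≤s (s≤s z≤n)))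
      coefficients (suc zero) (suc j) _ _ = proj₁ degree 1 (suc j) (ℕₚ.≤-trans (s≤s d≤1) (s≤s (s≤s z≤n)))
      coefficients (suc (suc i)) j _ _ = proj₁ degree (suc (suc i)) j (ℕₚ.≤-trans (s≤s d≤1) (s≤s (s≤s z≤n)))

  monomial-in-odd-characteristic : ∀ c → 1 ℕ.≤ c → Prime (suc (2 ℕ.* c)) → ∀ h → 1 ℕ.≤ h → size ≡ suc (2 ℕ.* c) ℕ.^ h →
    HasDegree F d a → a 0 0 ≡ 0# → a 0 1 ≡ 0# →
    t ℕ.* (d ℕ.+ 1) ℕ.^ 13 ℕ.< s ℕ.* size ℕ.^ 3 → IsOvoid F (O4 F d a) →
    Σ ℕ λ t → ∀ i j → ¬ (i ≡ suc (2 ℕ.* c) ℕ.^ t × j ≡ 0) → a i j ≡ 0#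
  monomial-in-odd-characteristic c 1≤c pr h 1≤h size≡ degree a₀₀ a₀₁ large ovoid = conclude
    (SmallDegree.ovoid-monomial F c 1≤c pr h 1≤h size≡ d (row 0) (deg-row pr h size≡ degree a₀₀ large ovoid 0)
      (leading pr h size≡ degree a₀₀ large ovoid sqrt (λ _ → reflexive a₀₁)) (reflexive a₀₀)
      (1≤d pr h size≡ degree a₀₀ large ovoid) (d³<size pr h size≡ degree a₀₀ large ovoid)
      (λ x u v ne e → row-0-ovoid pr h size≡ degree a₀₀ large ovoid sqrt x u v ne
        (trans (+-congˡ (*-congˡ (trans (+-congˡ (zero-mulˡ (reflexive a₀₁))) (+-identityʳ _)))) e)))
    where
    2<p : 2 ℕ.< suc (2 ℕ.* c)
    2<p = s≤s (ℕₚ.*-monoʳ-≤ 2 1≤c)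
    -- Vacuous, because 2 is nonzero in odd characteristic.
    sqrt : 1# + 1# ≈ 0# → ∀ w → Σ Carrier λ y → y * y ≈ w
    sqrt two≈0 = ⊥-elim (Odd.ι-nonzero F c 1≤c pr h 1≤h size≡ {2} (λ p∣2 → ℕₚ.<⇒≱ 2<p (∣.∣⇒≤ p∣2)) two≈0)
    conclude : (Σ ℕ λ t → d ≡ suc (2 ℕ.* c) ℕ.^ t × (∀ N → N ≢ d → a N 0 ≈ 0#)) →
      Σ ℕ λ t → ∀ i j → ¬ (i ≡ suc (2 ℕ.* c) ℕ.^ t × j ≡ 0) → a i j ≡ 0#
    conclude (r , d≡ , zeros) = r , λ where
      i zero ne → ≈⇒≡ (zeros i (λ i≡d → ne (≡.trans i≡d d≡ , ≡.refl)))
      i (suc j) _ → ≈⇒≡ (off-axis pr h size≡ degree a₀₀ large ovoid sqrt (reflexive a₀₁) i j)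

  classification : ∀ p h → Prime p → h ℕ.≥ 1 → size ≡ p ℕ.^ h → HasDegree F d a → a 0 0 ≡ 0# → (2 ℕ.< p → a 0 1 ≡ 0#) →
    t ℕ.* (d ℕ.+ 1) ℕ.^ 13 ℕ.< s ℕ.* size ℕ.^ 3 → IsOvoid F (O4 F d a) →
    (p ≡ 2 × (∀ i j → ¬ (i ≡ 1 × j ≡ 0) → ¬ (i ≡ 0 × j ≡ 1) → a i j ≡ 0#))
    ⊎ (2 ℕ.< p × Σ ℕ λ k → ∀ i j → ¬ (i ≡ p ℕ.^ k × j ≡ 0) → a i j ≡ 0#)
  classification p h pr 1≤h size≡ degree a₀₀ a₀₁ large ovoid with p ℕ.≟ 2
  ... | yes ≡.refl = inj₁ (≡.refl , linear-in-characteristic-2 pr h size≡ degree a₀₀ large ovoid)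
  ... | no p≢2 with odd-prime pr p≢2
  ... | c , 1≤c , ≡.refl = inj₂ (2<p , monomial-in-odd-characteristic c 1≤c pr h 1≤h size≡ degree a₀₀ (a₀₁ 2<p) large ovoid)
    where
    2<p : 2 ℕ.< suc (2 ℕ.* c)
    2<p = s≤s (ℕₚ.*-monoʳ-≤ 2 1≤c)

-- The numerical hypothesis is `q > 6.3 (d + 1)^(13/3)` cubed, with `6.3^3 = 250047 / 1000`.
theorem2p10 : (F : FiniteField) (p h : ℕ) → Prime p → h ℕ.≥ 1 →
  FiniteField.size F ≡ p ℕ.^ h →
  (d : ℕ) (a : ℕ → ℕ → FiniteField.Carrier F) →
  HasDegree F d a →
  a 0 0 ≡ FiniteField.0# F →
  (2 ℕ.< p → a 0 1 ≡ FiniteField.0# F) →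
  250047 ℕ.* (d ℕ.+ 1) ℕ.^ 13 ℕ.< 1000 ℕ.* FiniteField.size F ℕ.^ 3 →
  IsOvoid F (O4 F d a) →
  (p ≡ 2 × (∀ i j → ¬ (i ≡ 1 × j ≡ 0) → ¬ (i ≡ 0 × j ≡ 1) → a i j ≡ FiniteField.0# F))
  ⊎ (2 ℕ.< p × Σ ℕ λ k → ∀ i j → ¬ (i ≡ p ℕ.^ k × j ≡ 0) → a i j ≡ FiniteField.0# F)
theorem2p10 F p h pr 1≤h size≡ d a = PolynomialOvoid.classification F d a 1000 250047
  -- These are `1000000 ≤ 1000188` and `343000 ≤ 500094`; the first is nearly sharp, so 10 is the
  -- largest integer constant available for `N ≥ 4`.
  (toWitness {a? = 1000 ℕ.* 10 ℕ.^ 3 ℕ.≤? 250047 ℕ.* 4} _) (toWitness {a? = 1000 ℕ.* 7 ℕ.^ 3 ℕ.≤? 250047 ℕ.* 2} _) p h pr 1≤h size≡
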